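{- Let $n\ge 1$ be an integer and $\alpha=n+\frac{m}{2}$ with $m$ a real number. There exists a $2$-dimensional polyomino consisting of $n$ cells whose convex hull has area $\alpha$ if and only if $m\in\mathbb{N}_0$, $0\le m\le \left\lfloor\frac{n-1}{2}\right\rfloor\left\lfloor\frac{n}{2}\right\rfloor$, and $m\neq 1$ if $n+1$ is a prime.
   Context: A $2$-dimensional polyomino with $n$ cells is an edge-to-edge connected system of $n$ distinct unit squares of the integer grid in $\mathbb{R}^2$: any two of its squares are joined by a chain of squares of the system in which consecutive squares share a full edge. Its convex hull is the convex hull in $\mathbb{R}^2$ of the union of its (closed) squares. $\mathbb{N}_0$ denotes the non-negative integers. -}

module Defs where

open import Data.Fin.Base using (Fin)
open import Data.Integer.Base as ℤ using (ℤ; +_)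
open import Data.List.Base using (List; foldr; length)
open import Data.List.Membership.Propositional using (_∈_)
open import Data.List.Relation.Unary.All using (All)
open import Data.List.Relation.Unary.AllPairs using (AllPairs)
open import Data.List.Relation.Unary.Any using (Any)
open import Data.List.Relation.Unary.Unique.Propositional using (Unique)
open import Data.Nat.Base as ℕ using (ℕ)
import Data.Nat.Properties as ℕ
open import Data.Product.Base using (Σ-syntax; ∃-syntax; _×_; _,_; proj₁; proj₂)
open import Data.Rational.Base as ℚ using (ℚ; 0ℚ; 1ℚ; ½; ∣_∣; _÷_)
import Data.Rational.Properties as ℚ
open import Data.Rational.Solver using (module +-*-Solver)
open import Data.Sum.Base using (_⊎_)
import Data.Vec.Functional as Vector
open import Level using (0ℓ)
open import Relation.Binary.Construct.Closure.ReflexiveTransitive using (Star)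
open import Relation.Binary.PropositionalEquality using (_≡_; refl; sym; trans; cong; cong₂; subst)
open import Relation.Unary using (Pred; _⊆_)

-- ℝ consists of Cauchy sequences of rationals, with equality the setoid
-- relation _≃_.

Eventually : Pred ℕ 0ℓ → Set
Eventually P = ∃[ N ] (∀ n → N ℕ.≤ n → P n)

record ℝ : Set where
  constructor mkℝ
  field
    seq    : ℕ → ℚ
    cauchy : ∀ ε → 0ℚ ℚ.< ε →
             ∃[ N ] (∀ m n → N ℕ.≤ m → N ℕ.≤ n → ∣ seq m ℚ.- seq n ∣ ℚ.< ε)

open ℝ public

infix 4 _≃_ _≤_

_≃_ : ℝ → ℝ → Set
x ≃ y = ∀ ε → 0ℚ ℚ.< ε → Eventually λ n → ∣ seq x n ℚ.- seq y n ∣ ℚ.< ε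

_≤_ : ℝ → ℝ → Set
x ≤ y = ∀ ε → 0ℚ ℚ.< ε → Eventually λ n → seq x n ℚ.< seq y n ℚ.+ ε

private
  half-pos : ∀ ε → 0ℚ ℚ.< ε → 0ℚ ℚ.< ½ ℚ.* ε
  half-pos ε 0<ε = subst (ℚ._< ½ ℚ.* ε) (ℚ.*-zeroʳ ½) (ℚ.*-monoʳ-<-pos ½ 0<ε)

  half+half : ∀ ε → ½ ℚ.* ε ℚ.+ ½ ℚ.* ε ≡ ε
  half+half ε = trans (sym (ℚ.*-distribʳ-+ ε ½ ½)) (ℚ.*-identityˡ ε)

  0<1 : 0ℚ ℚ.< 1ℚ
  0<1 = ℚ.positive⁻¹ 1ℚ

  -- An explicit eventual bound on ∣ x ∣.
  boundIndex : ℝ → ℕ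
  boundIndex x = proj₁ (cauchy x 1ℚ 0<1)

  bound : ℝ → ℚ
  bound x = ∣ seq x (boundIndex x) ∣ ℚ.+ 1ℚ

  0<bound : ∀ x → 0ℚ ℚ.< bound x
  0<bound x = ℚ.+-mono-≤-< (ℚ.0≤∣p∣ (seq x (boundIndex x))) 0<1

  bounded : ∀ x n → boundIndex x ℕ.≤ n → ∣ seq x n ∣ ℚ.≤ bound x
  bounded x n N≤n = begin
    ∣ a ∣                  ≡⟨ cong ∣_∣ (solve 2 (λ s t → s := t :+ (s :- t)) refl a b) ⟩
    ∣ b ℚ.+ (a ℚ.- b) ∣     ≤⟨ ℚ.∣p+q∣≤∣p∣+∣q∣ b (a ℚ.- b) ⟩
    ∣ b ∣ ℚ.+ ∣ a ℚ.- b ∣   ≤⟨ ℚ.+-monoʳ-≤ ∣ b ∣ (ℚ.<⇒≤ (proj₂ (cauchy x 1ℚ 0<1) n N N≤n ℕ.≤-refl)) ⟩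
    ∣ b ∣ ℚ.+ 1ℚ           ∎
    where
    open ℚ.≤-Reasoning
    open +-*-Solver
    N = boundIndex x
    a = seq x n
    b = seq x N

  module Quotient (c ε : ℚ) (0<c : 0ℚ ℚ.< c) (0<ε : 0ℚ ℚ.< ε) where
    private
      instance
        c-pos : ℚ.Positive c
        c-pos = ℚ.positive 0<c
        c-nonZero : ℚ.NonZero c
        c-nonZero = ℚ.pos⇒nonZero c

    δ : ℚ
    δ = ε ÷ c

    0<δ : 0ℚ ℚ.< δ
    0<δ = ℚ.positive⁻¹ δ
      {{ℚ.pos*pos⇒pos ε {{ℚ.positive 0<ε}} (ℚ.1/ c) {{ℚ.1/pos⇒pos c}}}}

    δ*c≡ε : δ ℚ.* c ≡ ε
    δ*c≡ε = trans (ℚ.*-assoc ε (ℚ.1/ c) c)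
                  (trans (cong (ε ℚ.*_) (ℚ.*-inverseˡ c)) (ℚ.*-identityʳ ε))

    small*bounded : ∀ p q → ∣ p ∣ ℚ.< δ → ∣ q ∣ ℚ.≤ c → ∣ p ℚ.* q ∣ ℚ.< ε
    small*bounded p q p<δ q≤c = begin-strict
      ∣ p ℚ.* q ∣      ≡⟨ ℚ.∣p*q∣≡∣p∣*∣q∣ p q ⟩
      ∣ p ∣ ℚ.* ∣ q ∣  ≤⟨ ℚ.*-monoˡ-≤-nonNeg ∣ p ∣ {{ℚ.nonNegative (ℚ.0≤∣p∣ p)}} q≤c ⟩
      ∣ p ∣ ℚ.* c      <⟨ ℚ.*-monoˡ-<-pos c p<δ ⟩
      δ ℚ.* c          ≡⟨ δ*c≡ε ⟩
      ε                ∎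
      where open ℚ.≤-Reasoning

  sum-small : ∀ p q ε → ∣ p ∣ ℚ.< ½ ℚ.* ε → ∣ q ∣ ℚ.< ½ ℚ.* ε → ∣ p ℚ.+ q ∣ ℚ.< ε
  sum-small p q ε p< q< = begin-strict
    ∣ p ℚ.+ q ∣            ≤⟨ ℚ.∣p+q∣≤∣p∣+∣q∣ p q ⟩
    ∣ p ∣ ℚ.+ ∣ q ∣        <⟨ ℚ.+-mono-< p< q< ⟩
    ½ ℚ.* ε ℚ.+ ½ ℚ.* ε    ≡⟨ half+half ε ⟩
    ε                      ∎
    where open ℚ.≤-Reasoning

fromℚ : ℚ → ℝ
fromℚ q = mkℝ (λ _ → q) λ ε 0<ε →
  0 , λ _ _ _ _ → subst (λ d → ∣ d ∣ ℚ.< ε) (sym (ℚ.+-inverseʳ q)) 0<ε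

fromℤ : ℤ → ℝ
fromℤ i = fromℚ (i ℚ./ 1)

fromℕ : ℕ → ℝ
fromℕ n = fromℤ (+ n)

0ℝ 1ℝ : ℝ
0ℝ = fromℚ 0ℚ
1ℝ = fromℚ 1ℚ

infixl 6 _+_
infixl 7 _*_
infixl 7 _/2

_+_ : ℝ → ℝ → ℝ
x + y = mkℝ (λ n → seq x n ℚ.+ seq y n) λ ε 0<ε →
  let Nx , hx = cauchy x (½ ℚ.* ε) (half-pos ε 0<ε)
      Ny , hy = cauchy y (½ ℚ.* ε) (half-pos ε 0<ε)
  in Nx ℕ.⊔ Ny , λ m n N≤m N≤n →
    subst (λ d → ∣ d ∣ ℚ.< ε) (regroup (seq x m) (seq x n) (seq y m) (seq y n))
      (sum-small (seq x m ℚ.- seq x n) (seq y m ℚ.- seq y n) ε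
        (hx m n (ℕ.m⊔n≤o⇒m≤o Nx Ny N≤m) (ℕ.m⊔n≤o⇒m≤o Nx Ny N≤n))
        (hy m n (ℕ.m⊔n≤o⇒n≤o Nx Ny N≤m) (ℕ.m⊔n≤o⇒n≤o Nx Ny N≤n)))
  where
  open +-*-Solver
  regroup : ∀ a b c d → (a ℚ.- b) ℚ.+ (c ℚ.- d) ≡ (a ℚ.+ c) ℚ.- (b ℚ.+ d)
  regroup = solve 4 (λ a b c d → (a :- b) :+ (c :- d) := (a :+ c) :- (b :+ d)) refl

_*_ : ℝ → ℝ → ℝ
x * y = mkℝ (λ n → seq x n ℚ.* seq y n) λ ε 0<ε →
  let module X = Quotient (bound y) (½ ℚ.* ε) (0<bound y) (half-pos ε 0<ε)
      module Y = Quotient (bound x) (½ ℚ.* ε) (0<bound x) (half-pos ε 0<ε)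
      Nx , hx = cauchy x X.δ X.0<δ
      Ny , hy = cauchy y Y.δ Y.0<δ
      Bx = boundIndex x
      By = boundIndex y
  in (Nx ℕ.⊔ Ny) ℕ.⊔ (Bx ℕ.⊔ By) , λ m n N≤m N≤n →
    let M≤m = ℕ.m⊔n≤o⇒m≤o (Nx ℕ.⊔ Ny) (Bx ℕ.⊔ By) N≤m
        M≤n = ℕ.m⊔n≤o⇒m≤o (Nx ℕ.⊔ Ny) (Bx ℕ.⊔ By) N≤n
        B≤m = ℕ.m⊔n≤o⇒n≤o (Nx ℕ.⊔ Ny) (Bx ℕ.⊔ By) N≤m
        B≤n = ℕ.m⊔n≤o⇒n≤o (Nx ℕ.⊔ Ny) (Bx ℕ.⊔ By) N≤n
        dx = seq x m ℚ.- seq x n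
        dy = seq y m ℚ.- seq y n
    in subst (λ d → ∣ d ∣ ℚ.< ε) (regroup (seq x m) (seq x n) (seq y m) (seq y n))
      (sum-small (dx ℚ.* seq y n) (dy ℚ.* seq x m) ε
        (X.small*bounded dx (seq y n)
          (hx m n (ℕ.m⊔n≤o⇒m≤o Nx Ny M≤m) (ℕ.m⊔n≤o⇒m≤o Nx Ny M≤n))
          (bounded y n (ℕ.m⊔n≤o⇒n≤o Bx By B≤n)))
        (Y.small*bounded dy (seq x m)
          (hy m n (ℕ.m⊔n≤o⇒n≤o Nx Ny M≤m) (ℕ.m⊔n≤o⇒n≤o Nx Ny M≤n))
          (bounded x m (ℕ.m⊔n≤o⇒m≤o Bx By B≤m))))
  where
  open +-*-Solver
  regroup : ∀ a b c d → (a ℚ.- b) ℚ.* d ℚ.+ (c ℚ.- d) ℚ.* a ≡ a ℚ.* c ℚ.- b ℚ.* d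
  regroup = solve 4 (λ a b c d → (a :- b) :* d :+ (c :- d) :* a := a :* c :- b :* d) refl

_/2 : ℝ → ℝ
x /2 = fromℚ ½ * x

sum : ∀ {k} → (Fin k → ℝ) → ℝ
sum = Vector.foldr _+_ 0ℝ

ℝ² : Set
ℝ² = ℝ × ℝ

Region : Set₁
Region = Pred ℝ² 0ℓ

convexHull : Region → Region
convexHull S (x , y) =
  ∃[ k ] Σ[ w ∈ (Fin k → ℝ) ] Σ[ p ∈ (Fin k → ℝ²) ]
    (∀ i → 0ℝ ≤ w i) × sum w ≃ 1ℝ × (∀ i → S (p i)) ×
    x ≃ sum (λ i → w i * proj₁ (p i)) × y ≃ sum (λ i → w i * proj₂ (p i))

record Box : Set where
  field
    left right bottom top : ℚ
    left<right            : left ℚ.< right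
    bottom<top            : bottom ℚ.< top

open Box public

boxRegion : Box → Region
boxRegion b (x , y) =
  fromℚ (left b)   ≤ x × x ≤ fromℚ (right b) ×
  fromℚ (bottom b) ≤ y × y ≤ fromℚ (top b)

boxArea : Box → ℚ
boxArea b = (right b ℚ.- left b) ℚ.* (top b ℚ.- bottom b)

totalArea : List Box → ℚ
totalArea = foldr (λ b s → boxArea b ℚ.+ s) 0ℚ

-- Boxes are nondegenerate, so this says that the interiors are disjoint.
NonOverlapping : Box → Box → Set
NonOverlapping b c =
  right b ℚ.≤ left c ⊎ right c ℚ.≤ left b ⊎ top b ℚ.≤ bottom c ⊎ top c ℚ.≤ bottom b

-- Area as Jordan content: α is the area of S when finite unions of boxes
-- inscribed in S and finite unions of boxes covering S have areas arbitrarily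
-- close to α, from inside and outside respectively. Shrinking or enlarging
-- boxes slightly shows that rational box coordinates give the same notion as
-- real ones.
HasArea : Region → ℝ → Set
HasArea S α = ∀ ε → 0ℚ ℚ.< ε →
  (∃[ bs ] AllPairs NonOverlapping bs × All (λ b → boxRegion b ⊆ S) bs ×
           α ≤ fromℚ (totalArea bs ℚ.+ ε)) ×
  (∃[ bs ] S ⊆ (λ p → Any (λ b → boxRegion b p) bs) ×
           fromℚ (totalArea bs) ≤ α + fromℚ ε)

-- The unit square [a, a + 1] × [b, b + 1] is represented by (a , b).
Cell : Set
Cell = ℤ × ℤ

square : Cell → Region
square (a , b) (x , y) =
  fromℤ a ≤ x × x ≤ fromℤ (ℤ.suc a) × fromℤ b ≤ y × y ≤ fromℤ (ℤ.suc b)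

ShareEdge : Cell → Cell → Set
ShareEdge (a , b) (c , d) =
  (a ≡ c × ℤ.∣ b ℤ.- d ∣ ≡ 1) ⊎ (b ≡ d × ℤ.∣ a ℤ.- c ∣ ≡ 1)

record Polyomino (n : ℕ) : Set where
  field
    cells     : List Cell
    size      : length cells ≡ n
    distinct  : Unique cells
    connected : ∀ {c d} → c ∈ cells → d ∈ cells →
                Star (λ e f → e ∈ cells × f ∈ cells × ShareEdge e f) c d

open Polyomino public

union : ∀ {n} → Polyomino n → Region
union P p = Any (λ c → square c p) (cells P)

{-# OPTIONS --safe #-}
-- The boundary of the hull consists of an upper and a lower chain of lattice
-- points, so twice the area is an integer 2 n + m, and m ≥ 0 because the n
-- squares lie in the hull.
--
-- Build the polyomino cell by cell. A cell placed above or below an old one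
-- raises one boundary of a hull of width a by at most a tent function of height
-- 1 that vanishes at both ends, so m grows by at most a - 1, which is at most
-- the number of horizontal steps made so far; horizontal steps are symmetric.
-- With h horizontal and v vertical steps this gives m ≤ h v, where
-- h + v = n - 1.
--
-- If m = 1, every column is filled up to the boundary except for an excess of
-- one half, which forces one boundary to be level and the other one to be level
-- up to an end column that is lower by 1. So the polyomino is a rectangle
-- without a corner cell, and n + 1 is composite.
--
-- Conversely, such rectangles give m = 1, two rows give 2 ≤ m ≤ n - 2, and a
-- hook with legs h and v gives m = h v. Each further cell inside the hull of the
-- hook lowers m by 2, and the values skipped in this way are reached by removing
-- the corner cell of the hook or by a bump beside its vertical leg.
module Submission where

open import Defs hiding (_+_; _*_; _≤_)
open import Defs using () renaming (_+_ to _+ʳ_; _*_ to _*ʳ_; _≤_ to _≤ʳ_)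
open import Data.Empty using (⊥; ⊥-elim)
open import Data.Fin.Base as Fin using (Fin)
open import Data.Integer.Base as ℤ using (ℤ; +_; -[1+_])
import Data.Integer.Properties as ℤ
open import Data.Integer.Solver using () renaming (module +-*-Solver to ℤSolver)
open import Data.Integer.Tactic.RingSolver using (solve-∀)
open import Data.List.Base using (List; []; _∷_; _++_; length; map; foldr)
open import Data.List.Membership.Propositional using (_∈_; _∉_; find; lose)
open import Data.List.Membership.Propositional.Properties using (∈-++⁺ˡ; ∈-++⁺ʳ; ∈-++⁻; ∈-map⁺; ∈-map⁻; ∈-∃++)
open import Data.List.Relation.Binary.Permutation.Propositional as Perm using (_↭_; ↭-sym; ↭-trans)
import Data.List.Relation.Binary.Permutation.Propositional.Properties as Perm
open import Data.List.Relation.Unary.All as All using (All; []; _∷_)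
import Data.List.Relation.Unary.All.Properties as All
open import Data.List.Relation.Unary.AllPairs as AllPairs using (AllPairs; []; _∷_)
import Data.List.Relation.Unary.AllPairs.Properties as AllPairs
open import Data.List.Relation.Unary.Any as Any using (Any; here; there)
import Data.List.Relation.Unary.Any.Properties as Any
open import Data.List.Relation.Unary.Unique.Propositional using (Unique)
open import Data.Nat.Base as ℕ using (ℕ; zero; suc; _∸_)
open import Data.Nat.Divisibility using (divides; hasNonTrivialDivisor)
open import Data.Nat.DivMod using (_/_; _%_; m%n<n; m≡m%n+[m/n]*n; m<n*o⇒m/o<n; m*n/n≡m; /-monoˡ-≤)
open import Data.Nat.Primality using (Prime; prime; Composite; composite?)
import Data.Nat.Properties as ℕ
open import Data.Nat.Tactic.RingSolver using () renaming (solve-∀ to ℕsolve-∀)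
open import Data.Product.Base using (Σ-syntax; ∃-syntax; _×_; _,_; proj₁; proj₂)
open import Data.Rational.Base as ℚ using (ℚ; 0ℚ; 1ℚ; ½; ∣_∣; _+_; _*_; _-_; -_; _≤_; _<_; _⊔_; _⊓_)
import Data.Rational.Properties as ℚ
open import Data.Rational.Solver using (module +-*-Solver)
import Data.Rational.Unnormalised.Base as ℚᵘ
import Data.Rational.Unnormalised.Properties as ℚᵘ
open import Data.Sum.Base using (_⊎_; inj₁; inj₂; [_,_]′)
open import Function.Base using (_∘_; id; case_of_)
open import Function.Bundles using (_⇔_; mk⇔)
open import Relation.Binary.Construct.Closure.ReflexiveTransitive as Star using (Star; _◅_; _◅◅_)
open import Relation.Binary.Definitions using (tri<; tri≈; tri>)
open import Relation.Binary.PropositionalEquality using (_≡_; _≢_; refl; sym; trans; cong; cong₂; subst; subst₂; module ≡-Reasoning)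
open import Relation.Nullary.Decidable.Core using (Dec; yes; no)
open import Relation.Nullary.Negation using (¬_; contradiction)
open import Relation.Unary using (_⊆_)
open +-*-Solver using (solve; _:=_; _:+_; _:*_; _:-_; :-_; con)
open ℤSolver using () renaming (solve to solveᶻ; _:=_ to _:=ᶻ_; _:+_ to _:+ᶻ_; _:*_ to _:*ᶻ_; _:-_ to _:-ᶻ_; :-_ to :-ᶻ_; con to conᶻ)

-- Area is the Jordan content of a set given by real convex combinations, while the theorem is about
-- lattice corners. The link is `Cap`. All vertices of the hull are lattice points, so each boundary
-- is affine on every unit column and one line per column describes it completely. Such a line lies
-- above all corners, which bounds the hull from outside by half planes, and it is attained at both
-- ends of its column, which puts points into the hull. Together these facts give the area by thin
-- boxes. Later, two hulls are compared by evaluating a line of one at points attained by the other,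
-- without locating the vertices of either.
--
-- The bound h v with h + v = n - 1 is largest for the most equal split; this is the product of
-- floors in the theorem. In the constructions n is fixed, so a cell spent on filling the hull of a
-- hook is missing from one of its legs. This double cost is the modulus that governs which values
-- are skipped by the hooks.

infixr 6 _⊕_
infixr 7 _⊗_

_⊕_ : ∀ {p q} → 0ℚ ≤ p → 0ℚ ≤ q → 0ℚ ≤ p + q
_⊕_ = ℚ.+-mono-≤

_⊗_ : ∀ {p q} → 0ℚ ≤ p → 0ℚ ≤ q → 0ℚ ≤ p * q
_⊗_ {p} {q} 0≤p 0≤q =
  ℚ.nonNegative⁻¹ (p * q) {{ℚ.nonNeg*nonNeg⇒nonNeg p {{ℚ.nonNegative 0≤p}} q {{ℚ.nonNegative 0≤q}}}}

*-pos : ∀ {p q} → 0ℚ < p → 0ℚ < q → 0ℚ < p * q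
*-pos {p} {q} 0<p 0<q =
  ℚ.positive⁻¹ (p * q) {{ℚ.pos*pos⇒pos p {{ℚ.positive 0<p}} q {{ℚ.positive 0<q}}}}

diff : ∀ {p q} → p ≤ q → 0ℚ ≤ q - p
diff {p} {q} p≤q = subst (_≤ q - p) (ℚ.+-inverseʳ p) (ℚ.+-monoˡ-≤ (- p) p≤q)

diff< : ∀ {p q} → p < q → 0ℚ < q - p
diff< {p} {q} p<q = subst (_< q - p) (ℚ.+-inverseʳ p) (ℚ.+-monoˡ-< (- p) p<q)

-- Inequalities are proved by exhibiting the difference of the two sides as a
-- nonnegative expression d.
lin : ∀ {p q d} → 0ℚ ≤ d → q - p ≡ d → p ≤ q
lin {p} {q} 0≤d eq = subst₂ _≤_ (ℚ.+-identityˡ p) (solve 2 (λ p q → q :- p :+ p := q) refl p q)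
  (ℚ.+-monoˡ-≤ p (subst (0ℚ ≤_) (sym eq) 0≤d))

lin< : ∀ {p q d} → 0ℚ < d → q - p ≡ d → p < q
lin< {p} {q} 0<d eq = subst₂ _<_ (ℚ.+-identityˡ p) (solve 2 (λ p q → q :- p :+ p := q) refl p q)
  (ℚ.+-monoˡ-< p (subst (0ℚ <_) (sym eq) 0<d))

0≤½ : 0ℚ ≤ ½
0≤½ = ℚ.nonNegative⁻¹ ½

0<½ : 0ℚ < ½
0<½ = ℚ.positive⁻¹ ½

0≤1 : 0ℚ ≤ 1ℚ
0≤1 = ℚ.nonNegative⁻¹ 1ℚ

0<1 : 0ℚ < 1ℚ
0<1 = ℚ.positive⁻¹ 1ℚ

half-pos : ∀ {ε} → 0ℚ < ε → 0ℚ < ½ * ε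
half-pos = *-pos 0<½

inverse : ∀ c → 0ℚ < c → Σ[ d ∈ ℚ ] 0ℚ < d × d * c ≡ 1ℚ
inverse c 0<c = ℚ.1/ c , ℚ.positive⁻¹ (ℚ.1/ c) {{ℚ.1/pos⇒pos c}} , ℚ.*-inverseˡ c
  where
  instance
    c-pos : ℚ.Positive c
    c-pos = ℚ.positive 0<c
    c-nonZero : ℚ.NonZero c
    c-nonZero = ℚ.pos⇒nonZero c

cancel-≤ : ∀ {c p q} → 0ℚ < c → c * p ≤ c * q → p ≤ q
cancel-≤ {c} 0<c = ℚ.*-cancelˡ-≤-pos c {{ℚ.positive 0<c}}

abs-< : ∀ {p ε} → - ε < p → p < ε → ∣ p ∣ < ε
abs-< {p} {ε} lo hi with ℚ.∣p∣≡p∨∣p∣≡-p p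
... | inj₁ eq = subst (_< ε) (sym eq) hi
... | inj₂ eq = subst (_< ε) (sym eq)
  (lin< (diff< lo) (solve 2 (λ p ε → ε :- (:- p) := p :- (:- ε)) refl p ε))

p≤∣p∣ : ∀ p → p ≤ ∣ p ∣
p≤∣p∣ p with ℚ.≤-total 0ℚ p
... | inj₁ 0≤p = ℚ.≤-reflexive (sym (ℚ.0≤p⇒∣p∣≡p 0≤p))
... | inj₂ p≤0 = ℚ.≤-trans p≤0 (ℚ.0≤∣p∣ p)

-p≤∣p∣ : ∀ p → - p ≤ ∣ p ∣
-p≤∣p∣ p = subst (- p ≤_) (ℚ.∣-p∣≡∣p∣ p) (p≤∣p∣ (- p))

abs-<⁻ : ∀ {p ε} → ∣ p ∣ < ε → - ε < p × p < ε
abs-<⁻ {p} {ε} h =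
  lin< (diff< (ℚ.≤-<-trans (-p≤∣p∣ p) h)) (solve 2 (λ p ε → p :- (:- ε) := ε :- (:- p)) refl p ε) ,
  ℚ.≤-<-trans (p≤∣p∣ p) h

-- Nonnegative and null sequences of rationals

eventually₂ : ∀ {P Q R : ℕ → Set} → (∀ n → P n → Q n → R n) →
              Eventually P → Eventually Q → Eventually R
eventually₂ f (M , p) (N , q) = M ℕ.⊔ N , λ n le →
  f n (p n (ℕ.m⊔n≤o⇒m≤o M N le)) (q n (ℕ.m⊔n≤o⇒n≤o M N le))

eventually₁ : ∀ {P Q : ℕ → Set} → (∀ n → P n → Q n) → Eventually P → Eventually Q
eventually₁ f (N , p) = N , λ n le → f n (p n le)

-- For reals, x ≤ y means NonNeg (λ n → seq y n - seq x n); the intermediate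
-- sequences of a proof then need no Cauchy moduli.
NonNeg : (ℕ → ℚ) → Set
NonNeg s = ∀ ε → 0ℚ < ε → Eventually λ n → - ε < s n

Null : (ℕ → ℚ) → Set
Null s = ∀ ε → 0ℚ < ε → Eventually λ n → ∣ s n ∣ < ε

nonNeg-resp : ∀ {s t} → (∀ n → s n ≡ t n) → NonNeg s → NonNeg t
nonNeg-resp eq h ε 0<ε = eventually₁ (λ n → subst (- ε <_) (eq n)) (h ε 0<ε)

null-resp : ∀ {s t} → (∀ n → s n ≡ t n) → Null s → Null t
null-resp eq h ε 0<ε = eventually₁ (λ n → subst (λ x → ∣ x ∣ < ε) (eq n)) (h ε 0<ε)

neg-< : ∀ {ε} → 0ℚ < ε → - ε < 0ℚ
neg-< {ε} 0<ε = lin< 0<ε (solve 1 (λ ε → con 0ℚ :- (:- ε) := ε) refl ε)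

nonNeg-const : ∀ {q} → 0ℚ ≤ q → NonNeg (λ _ → q)
nonNeg-const 0≤q ε 0<ε = 0 , λ _ _ → ℚ.<-≤-trans (neg-< 0<ε) 0≤q

-- With the tolerance `- q`, a negative `q` would satisfy q < q.
nonNeg-const⁻ : ∀ {q} → NonNeg (λ _ → q) → 0ℚ ≤ q
nonNeg-const⁻ {q} h with ℚ._≤?_ 0ℚ q
... | yes 0≤q = 0≤q
... | no  0≰q = contradiction (proj₂ (h (- q) 0<-q) _ ℕ.≤-refl)
      (λ lt → ℚ.<-irrefl refl (subst (_< q) (solve 1 (λ q → :- (:- q) := q) refl q) lt))
  where
  0<-q : 0ℚ < - q
  0<-q = lin< (diff< (ℚ.≰⇒> 0≰q)) (solve 1 (λ q → :- q :- con 0ℚ := con 0ℚ :- q) refl q)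

nonNeg-+ : ∀ {s t} → NonNeg s → NonNeg t → NonNeg (λ n → s n + t n)
nonNeg-+ {s} {t} hs ht ε 0<ε = eventually₂
  (λ n p q → lin< (ℚ.+-mono-< (diff< p) (diff< q))
    (solve 3 (λ x y ε → x :+ y :- (:- ε) := (x :- (:- (con ½ :* ε))) :+ (y :- (:- (con ½ :* ε)))) refl (s n) (t n) ε))
  (hs (½ * ε) (half-pos 0<ε)) (ht (½ * ε) (half-pos 0<ε))

nonNeg-scale : ∀ {c s} → 0ℚ ≤ c → NonNeg s → NonNeg (λ n → c * s n)
nonNeg-scale {c} {s} 0≤c hs ε 0<ε with ℚ._≤?_ c 0ℚ
-- For positive `c` the tolerance handed to `s` is ε / c, which leaves c = 0 as a separate case.
... | yes c≤0 = 0 , λ n _ → subst (- ε <_)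
      (trans (sym (ℚ.*-zeroˡ (s n))) (cong (_* s n) (ℚ.≤-antisym 0≤c c≤0))) (neg-< 0<ε)
... | no  c≰0 with inverse c (ℚ.≰⇒> c≰0)
...   | d , 0<d , dc≡1 = eventually₁
  (λ n p → lin< (*-pos (ℚ.≰⇒> c≰0) (diff< p)) (begin
    c * s n - (- ε)              ≡⟨ solve 2 (λ x ε → x :- (:- ε) := x :+ con 1ℚ :* ε) refl (c * s n) ε ⟩
    c * s n + 1ℚ * ε             ≡⟨ cong (λ u → c * s n + u * ε) (sym dc≡1) ⟩
    c * s n + (d * c) * ε        ≡⟨ solve 4 (λ c x d ε → c :* x :+ (d :* c) :* ε := c :* (x :- (:- (d :* ε))))
      refl c (s n) d ε ⟩
    c * (s n - (- (d * ε)))      ∎))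
  (hs (d * ε) (*-pos 0<d 0<ε))
  where open ≡-Reasoning

≤⇒nonNeg : ∀ {x y} → x ≤ʳ y → NonNeg (λ n → seq y n - seq x n)
≤⇒nonNeg {x} {y} h ε 0<ε = eventually₁
  (λ n p → lin< (diff< p) (solve 3 (λ x y ε → y :- x :- (:- ε) := y :+ ε :- x) refl (seq x n) (seq y n) ε))
  (h ε 0<ε)

nonNeg⇒≤ : ∀ {x y} → NonNeg (λ n → seq y n - seq x n) → x ≤ʳ y
nonNeg⇒≤ {x} {y} h ε 0<ε = eventually₁
  (λ n p → lin< (diff< p) (solve 3 (λ x y ε → y :+ ε :- x := y :- x :- (:- ε)) refl (seq x n) (seq y n) ε))
  (h ε 0<ε)

fromℚ-≤⁻ : ∀ {p q} → fromℚ p ≤ʳ fromℚ q → p ≤ q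
fromℚ-≤⁻ {p} {q} h = lin (nonNeg-const⁻ {q - p} (≤⇒nonNeg {fromℚ p} {fromℚ q} h)) refl

fromℚ-≤ : ∀ {p q} → p ≤ q → fromℚ p ≤ʳ fromℚ q
fromℚ-≤ {p} {q} h = nonNeg⇒≤ {fromℚ p} {fromℚ q} (nonNeg-const (diff h))

null⇒nonNeg : ∀ {s} → Null s → NonNeg s
null⇒nonNeg h ε 0<ε = eventually₁ (λ n p → proj₁ (abs-<⁻ p)) (h ε 0<ε)

null-neg : ∀ {s} → Null s → Null (λ n → - s n)
null-neg {s} h ε 0<ε = eventually₁ (λ n → subst (_< ε) (sym (ℚ.∣-p∣≡∣p∣ (s n)))) (h ε 0<ε)

nonNeg⇒null : ∀ {s} → NonNeg s → NonNeg (λ n → - s n) → Null s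
nonNeg⇒null {s} h₁ h₂ ε 0<ε = eventually₂
  (λ n p q → abs-< p (lin< (diff< q) (solve 2 (λ x ε → ε :- x := :- x :- (:- ε)) refl (s n) ε)))
  (h₁ ε 0<ε) (h₂ ε 0<ε)

null-+ : ∀ {s t} → Null s → Null t → Null (λ n → s n + t n)
null-+ {s} {t} hs ht = nonNeg⇒null (nonNeg-+ (null⇒nonNeg hs) (null⇒nonNeg ht))
  (nonNeg-resp (λ n → sym (ℚ.neg-distrib-+ (s n) (t n)))
    (nonNeg-+ (null⇒nonNeg (null-neg hs)) (null⇒nonNeg (null-neg ht))))

null-const : ∀ {q} → q ≡ 0ℚ → Null (λ _ → q)
null-const refl ε 0<ε = 0 , λ _ _ → 0<ε

≃-refl : ∀ {x} → x ≃ x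
≃-refl {x} = null-resp (λ n → sym (ℚ.+-inverseʳ (seq x n))) (null-const refl)

≃-sym : ∀ {x y} → x ≃ y → y ≃ x
≃-sym {x} {y} h = null-resp
  (λ n → solve 2 (λ x y → :- (x :- y) := y :- x) refl (seq x n) (seq y n)) (null-neg h)

≃-trans : ∀ {x y z} → x ≃ y → y ≃ z → x ≃ z
≃-trans {x} {y} {z} h₁ h₂ = null-resp
  (λ n → solve 3 (λ x y z → (x :- y) :+ (y :- z) := x :- z) refl (seq x n) (seq y n) (seq z n))
  (null-+ h₁ h₂)

≡⇒≃ : ∀ {x y} → (∀ n → seq x n ≡ seq y n) → x ≃ y
≡⇒≃ {x} {y} h = null-resp
  (λ n → sym (trans (cong (_- seq y n) (h n)) (ℚ.+-inverseʳ (seq y n)))) (null-const refl)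

≃⇒≤ : ∀ {x y} → x ≃ y → x ≤ʳ y
≃⇒≤ {x} {y} h = nonNeg⇒≤ {x} {y} (null⇒nonNeg (≃-sym {x} {y} h))

≤-antisymʳ : ∀ {x y} → x ≤ʳ y → y ≤ʳ x → x ≃ y
≤-antisymʳ {x} {y} h₁ h₂ = nonNeg⇒null (≤⇒nonNeg {y} {x} h₂)
  (nonNeg-resp (λ n → solve 2 (λ x y → y :- x := :- (x :- y)) refl (seq x n) (seq y n)) (≤⇒nonNeg {x} {y} h₁))

≤-transʳ : ∀ {x y z} → x ≤ʳ y → y ≤ʳ z → x ≤ʳ z
≤-transʳ {x} {y} {z} h₁ h₂ = nonNeg⇒≤ {x} {z} (nonNeg-resp
  (λ n → solve 3 (λ x y z → (y :- x) :+ (z :- y) := z :- x) refl (seq x n) (seq y n) (seq z n))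
  (nonNeg-+ (≤⇒nonNeg {x} {y} h₁) (≤⇒nonNeg {y} {z} h₂)))

fromℚ-≃⁻ : ∀ {p q} → fromℚ p ≃ fromℚ q → p ≡ q
fromℚ-≃⁻ {p} {q} h = ℚ.≤-antisym (fromℚ-≤⁻ (≃⇒≤ {fromℚ p} {fromℚ q} h))
  (fromℚ-≤⁻ (≃⇒≤ {fromℚ q} {fromℚ p} (≃-sym {fromℚ p} {fromℚ q} h)))

-- The bound is kept as data because the tolerance for one factor of a product is computed from the
-- bound of the other.
Bounded : (ℕ → ℚ) → Set
Bounded s = Σ[ B ∈ ℚ ] 0ℚ < B × Eventually λ n → ∣ s n ∣ ≤ B

real-bounded : ∀ x → Bounded (seq x)
real-bounded x = ∣ b ∣ + 1ℚ , ℚ.+-mono-≤-< (ℚ.0≤∣p∣ b) 0<1 , N , λ n N≤n → begin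
  ∣ seq x n ∣              ≡⟨ cong ∣_∣ (solve 2 (λ s t → s := t :+ (s :- t)) refl (seq x n) b) ⟩
  ∣ b + (seq x n - b) ∣    ≤⟨ ℚ.∣p+q∣≤∣p∣+∣q∣ b (seq x n - b) ⟩
  ∣ b ∣ + ∣ seq x n - b ∣  ≤⟨ ℚ.+-monoʳ-≤ ∣ b ∣ (ℚ.<⇒≤ (proj₂ (cauchy x 1ℚ 0<1) n N N≤n ℕ.≤-refl)) ⟩
  ∣ b ∣ + 1ℚ               ∎
  where
  open ℚ.≤-Reasoning
  N = proj₁ (cauchy x 1ℚ 0<1)
  b = seq x N

null-* : ∀ {s t} → Null s → Bounded t → Null (λ n → s n * t n)
null-* {s} {t} hs (B , 0<B , ht) ε 0<ε with inverse B 0<B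
... | d , 0<d , dB≡1 = eventually₂ step (hs (ε * d) (*-pos 0<ε 0<d)) ht
  where
  open ℚ.≤-Reasoning
  step : ∀ n → ∣ s n ∣ < ε * d → ∣ t n ∣ ≤ B → ∣ s n * t n ∣ < ε
  step n p q = begin-strict
    ∣ s n * t n ∣      ≡⟨ ℚ.∣p*q∣≡∣p∣*∣q∣ (s n) (t n) ⟩
    ∣ s n ∣ * ∣ t n ∣  ≤⟨ ℚ.*-monoˡ-≤-nonNeg ∣ s n ∣ {{ℚ.nonNegative (ℚ.0≤∣p∣ (s n))}} q ⟩
    ∣ s n ∣ * B        <⟨ ℚ.*-monoˡ-<-pos B {{ℚ.positive 0<B}} p ⟩
    ε * d * B          ≡⟨ trans (ℚ.*-assoc ε d B) (trans (cong (ε *_) dB≡1) (ℚ.*-identityʳ ε)) ⟩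
    ε                  ∎

nonNeg-* : ∀ {s t} → NonNeg s → NonNeg t → Bounded s → Bounded t → NonNeg (λ n → s n * t n)
nonNeg-* {s} {t} hs ht (A , 0<A , as) (B , 0<B , bt) ε 0<ε with inverse (A + B) (ℚ.+-mono-< 0<A 0<B)
... | d , 0<d , dC≡1 = eventually₂ (λ n f g → f (proj₁ g) (proj₂ g))
    (eventually₂ (λ n p q → step n p q) (hs (d * ε) 0<δ) (ht (d * ε) 0<δ))
    (eventually₂ (λ n → _,_) as bt)
  where
  0<δ = *-pos 0<d 0<ε
  below-abs : ∀ {x b} → ∣ x ∣ ≤ b → x ≤ b
  below-abs {x} h = ℚ.≤-trans (p≤∣p∣ x) h
  -- If both factors are nonnegative so is the product; otherwise a factor in
  -- (-δ, 0) costs at most δ (A + B).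
  negative-case : ∀ x y b → - (d * ε) < x → x ≤ 0ℚ → 0ℚ ≤ y → y ≤ b → b < A + B → - ε < x * y
  negative-case x y b lo x≤0 0≤y y≤b b<C = lin<
    (ℚ.+-mono-<-≤ (*-pos 0<δ (diff< b<C))
      ((0≤δ ⊗ diff y≤b) ⊕ (diff (ℚ.<⇒≤ lo) ⊗ 0≤y)))
    (begin
      x * y - (- ε)                   ≡⟨ solve 2 (λ u ε → u :- (:- ε) := u :+ con 1ℚ :* ε) refl (x * y) ε ⟩
      x * y + 1ℚ * ε                  ≡⟨ cong (λ u → x * y + u * ε) (sym dC≡1) ⟩
      x * y + (d * (A + B)) * ε       ≡⟨ solve 6 (λ x y b d ε C → x :* y :+ (d :* C) :* ε := (d :* ε) :* (C :- b)
        :+ ((d :* ε) :* (b :- y) :+ (x :- (:- (d :* ε))) :* y)) refl x y b d ε (A + B) ⟩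
      (d * ε) * (A + B - b) + ((d * ε) * (b - y) + (x - (- (d * ε))) * y) ∎)
    where
    open ≡-Reasoning
    0≤δ = ℚ.<⇒≤ 0<δ
  step : ∀ n → - (d * ε) < s n → - (d * ε) < t n → ∣ s n ∣ ≤ A → ∣ t n ∣ ≤ B → - ε < s n * t n
  step n p q a b with ℚ.≤-total 0ℚ (s n) | ℚ.≤-total 0ℚ (t n)
  ... | inj₁ 0≤s | inj₁ 0≤t = ℚ.<-≤-trans (neg-< 0<ε) (0≤s ⊗ 0≤t)
  ... | inj₂ s≤0 | inj₁ 0≤t = negative-case (s n) (t n) B p s≤0 0≤t (below-abs b)
        (lin< 0<A (solve 2 (λ A B → A :+ B :- B := A) refl A B))
  ... | inj₁ 0≤s | inj₂ t≤0 = subst (- ε <_) (ℚ.*-comm (t n) (s n))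
        (negative-case (t n) (s n) A q t≤0 0≤s (below-abs a)
          (lin< 0<B (solve 2 (λ A B → A :+ B :- A := B) refl A B)))
  ... | inj₂ s≤0 | inj₂ t≤0 = ℚ.<-≤-trans (neg-< 0<ε)
        (lin (diff s≤0 ⊗ diff t≤0) (solve 2 (λ s t → s :* t :- con 0ℚ := (con 0ℚ :- s) :* (con 0ℚ :- t)) refl
          (s n) (t n)))

-- Comparing the area of inscribed and of covering boxes

-- Retraction onto [p, q]. The part of [l, r] inside the window [p, q] has length
-- `clamp p q r - clamp p q l`, and this is 0 for disjoint intervals without a case distinction.
clamp : ℚ → ℚ → ℚ → ℚ
clamp p q t = p ⊔ (t ⊓ q)

clamp-low : ∀ {p q t} → t ≤ p → clamp p q t ≡ p
clamp-low {p} {q} {t} t≤p = ℚ.p≥q⇒p⊔q≡p (ℚ.≤-trans (ℚ.p⊓q≤p t q) t≤p)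

clamp-high : ∀ {p q t} → p ≤ q → q ≤ t → clamp p q t ≡ q
clamp-high {p} {q} {t} p≤q q≤t = trans (cong (p ⊔_) (ℚ.p≥q⇒p⊓q≡q q≤t)) (ℚ.p≤q⇒p⊔q≡q p≤q)

clamp-inside : ∀ {p q t} → p ≤ t → t ≤ q → clamp p q t ≡ t
clamp-inside {p} {q} {t} p≤t t≤q = trans (cong (p ⊔_) (ℚ.p≤q⇒p⊓q≡p t≤q)) (ℚ.p≤q⇒p⊔q≡q p≤t)

clamp-mono : ∀ p q {t u} → t ≤ u → clamp p q t ≤ clamp p q u
clamp-mono p q t≤u = ℚ.⊔-mono-≤ (ℚ.≤-refl {p}) (ℚ.⊓-mono-≤ t≤u (ℚ.≤-refl {q}))

-- The summand `s` cancels in differences, so the length of an overlap is additive when the window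
-- is cut at `s`.
clamp-split : ∀ {p s q} → p ≤ s → s ≤ q → ∀ t → clamp p s t + clamp s q t ≡ clamp p q t + s
clamp-split {p} {s} {q} p≤s s≤q t with ℚ.≤-total t s
... | inj₁ t≤s = cong₂ _+_
  (cong (p ⊔_) (trans (ℚ.p≤q⇒p⊓q≡p t≤s) (sym (ℚ.p≤q⇒p⊓q≡p (ℚ.≤-trans t≤s s≤q))))) (clamp-low t≤s)
... | inj₂ s≤t = trans (cong₂ _+_ (clamp-high p≤s s≤t) refl) (trans (ℚ.+-comm s (clamp s q t))
  (cong (_+ s) (trans (ℚ.p≤q⇒p⊔q≡q s≤) (sym (ℚ.p≤q⇒p⊔q≡q (ℚ.≤-trans p≤s s≤))))))
  where
  s≤ : s ≤ t ⊓ q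
  s≤ = ℚ.⊓-glb s≤t s≤q

length-split : ∀ {p s q} → p ≤ s → s ≤ q → ∀ r l →
  clamp p q r - clamp p q l ≡ (clamp p s r - clamp p s l) + (clamp s q r - clamp s q l)
length-split {p} {s} {q} p≤s s≤q r l = begin
  clamp p q r - clamp p q l                ≡⟨ solve 3 (λ u v s → u :- v := (u :+ s) :- (v :+ s)) refl
    (clamp p q r) (clamp p q l) s ⟩
  (clamp p q r + s) - (clamp p q l + s)    ≡⟨ sym (cong₂ _-_ (clamp-split p≤s s≤q r) (clamp-split p≤s s≤q l)) ⟩
  (clamp p s r + clamp s q r) - (clamp p s l + clamp s q l)
    ≡⟨ solve 4 (λ a b c d → a :+ b :- (c :+ d) := (a :- c) :+ (b :- d)) refl (clamp p s r) (clamp s q r)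
      (clamp p s l) (clamp s q l) ⟩
  (clamp p s r - clamp p s l) + (clamp s q r - clamp s q l) ∎
  where open ≡-Reasoning

xOverlap yOverlap overlapArea : Box → Box → ℚ
xOverlap w b = clamp (left w) (right w) (right b) - clamp (left w) (right w) (left b)
yOverlap w b = clamp (bottom w) (top w) (top b) - clamp (bottom w) (top w) (bottom b)
overlapArea w b = xOverlap w b * yOverlap w b

totalOverlap : Box → List Box → ℚ
totalOverlap w = foldr (λ b s → overlapArea w b + s) 0ℚ

0≤overlap : ∀ w b → 0ℚ ≤ overlapArea w b
0≤overlap w b = diff (clamp-mono (left w) (right w) (ℚ.<⇒≤ (left<right b))) ⊗
                diff (clamp-mono (bottom w) (top w) (ℚ.<⇒≤ (bottom<top b)))

0≤totalOverlap : ∀ w bs → 0ℚ ≤ totalOverlap w bs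
0≤totalOverlap w []       = ℚ.≤-refl
0≤totalOverlap w (b ∷ bs) = 0≤overlap w b ⊕ 0≤totalOverlap w bs

totalOverlap-split : ∀ {w w₁ w₂} → (∀ b → overlapArea w b ≡ overlapArea w₁ b + overlapArea w₂ b) →
                     ∀ bs → totalOverlap w bs ≡ totalOverlap w₁ bs + totalOverlap w₂ bs
totalOverlap-split h [] = refl
totalOverlap-split {w} {w₁} {w₂} h (b ∷ bs) = trans (cong₂ _+_ (h b) (totalOverlap-split {w} {w₁} {w₂} h bs))
  (solve 4 (λ a b c d → (a :+ b) :+ (c :+ d) := (a :+ c) :+ (b :+ d)) refl
    (overlapArea w₁ b) (overlapArea w₂ b) (totalOverlap w₁ bs) (totalOverlap w₂ bs))

record Contains (b : Box) (x y : ℚ) : Set where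
  constructor contains
  field
    left≤   : left b ≤ x
    ≤right  : x ≤ right b
    bottom≤ : bottom b ≤ y
    ≤top    : y ≤ top b

-- Rational test points suffice, since the only points that will be tested are midpoints of rational
-- windows; comparisons with them are decidable.
Covered : List Box → List Box → Set
Covered bs cs = ∀ {x y} → Any (λ b → Contains b x y) bs → Any (λ c → Contains c x y) cs

Outside : (lo hi t : ℚ) → Set
Outside lo hi t = t ≤ lo ⊎ hi ≤ t

-- No side of `b` runs through the interior of `w`, so `b` either contains `w` or misses its
-- interior.
Aligned : Box → Box → Set
Aligned w b = (Outside (left w) (right w) (left b) × Outside (left w) (right w) (right b)) ×
              (Outside (bottom w) (top w) (bottom b) × Outside (bottom w) (top w) (top b))

Within : Box → Box → Set
Within w b = (left b ≤ left w × right w ≤ right b) × (bottom b ≤ bottom w × top w ≤ top b)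

length-dichotomy : ∀ {lo hi l r} → lo < hi → l < r → Outside lo hi l → Outside lo hi r →
  (l ≤ lo × hi ≤ r) ⊎ clamp lo hi r - clamp lo hi l ≡ 0ℚ
length-dichotomy lo<hi l<r (inj₁ l≤lo) (inj₂ hi≤r) = inj₁ (l≤lo , hi≤r)
length-dichotomy {lo} lo<hi l<r (inj₁ l≤lo) (inj₁ r≤lo) =
  inj₂ (trans (cong₂ _-_ (clamp-low r≤lo) (clamp-low l≤lo)) (ℚ.+-inverseʳ lo))
length-dichotomy {hi = hi} lo<hi l<r (inj₂ hi≤l) _ = inj₂ (trans
  (cong₂ _-_ (clamp-high (ℚ.<⇒≤ lo<hi) (ℚ.≤-trans hi≤l (ℚ.<⇒≤ l<r))) (clamp-high (ℚ.<⇒≤ lo<hi) hi≤l))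
  (ℚ.+-inverseʳ hi))

dichotomy : ∀ w b → Aligned w b → Within w b ⊎ overlapArea w b ≡ 0ℚ
dichotomy w b ((l , r) , (d , u))
  with length-dichotomy (left<right w) (left<right b) l r
     | length-dichotomy (bottom<top w) (bottom<top b) d u
... | inj₁ h  | inj₁ v  = inj₁ (h , v)
... | inj₂ eq | _       = inj₂ (trans (cong (_* yOverlap w b) eq) (ℚ.*-zeroˡ (yOverlap w b)))
... | inj₁ _  | inj₂ eq = inj₂ (trans (cong (xOverlap w b *_) eq) (ℚ.*-zeroʳ (xOverlap w b)))

overlap-within : ∀ w b → Within w b → overlapArea w b ≡ boxArea w
overlap-within w b ((l , r) , (d , u)) = cong₂ _*_
  (cong₂ _-_ (clamp-high (ℚ.<⇒≤ (left<right w)) r) (clamp-low l))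
  (cong₂ _-_ (clamp-high (ℚ.<⇒≤ (bottom<top w)) u) (clamp-low d))

within-overlapping : ∀ w b c → Within w b → Within w c → ¬ NonOverlapping b c
within-overlapping w b c ((l , r) , (d , u)) ((l′ , r′) , (d′ , u′)) =
  λ { (inj₁ h)               → crossed (left<right w) r h l′
    ; (inj₂ (inj₁ h))        → crossed (left<right w) r′ h l
    ; (inj₂ (inj₂ (inj₁ h))) → crossed (bottom<top w) u h d′
    ; (inj₂ (inj₂ (inj₂ h))) → crossed (bottom<top w) u′ h d }
  where
  crossed : ∀ {lo hi s t} → lo < hi → hi ≤ s → s ≤ t → t ≤ lo → ⊥
  crossed lo<hi hi≤s s≤t t≤lo = ℚ.<-irrefl refl (ℚ.<-≤-trans lo<hi (ℚ.≤-trans hi≤s (ℚ.≤-trans s≤t t≤lo)))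

midpoint : ∀ {p q} → p < q → Σ[ m ∈ ℚ ] p < m × m < q
midpoint = ℚ.<-dense

aligned-covers : ∀ w c {x y} → Aligned w c → left w < x → x < right w → bottom w < y → y < top w →
                 Contains c x y → Within w c
aligned-covers w c ((l , r) , (d , u)) lx xr dy yu (contains l≤ ≤r d≤ ≤u) =
  (low l l≤ xr , high r ≤r lx) , (low d d≤ yu , high u ≤u dy)
  where
  low : ∀ {lo hi t x} → Outside lo hi t → t ≤ x → x < hi → t ≤ lo
  low (inj₁ h) _ _ = h
  low (inj₂ h) t≤x x<hi = contradiction (ℚ.<-≤-trans x<hi (ℚ.≤-trans h t≤x)) (ℚ.<-irrefl refl)
  high : ∀ {lo hi t x} → Outside lo hi t → x ≤ t → lo < x → hi ≤ t
  high (inj₂ h) _ _ = h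
  high (inj₁ h) x≤t lo<x = contradiction (ℚ.<-≤-trans lo<x (ℚ.≤-trans x≤t h)) (ℚ.<-irrefl refl)

within-total : ∀ w cs → Any (Within w) cs → boxArea w ≤ totalOverlap w cs
within-total w (c ∷ cs) (here h) = lin (0≤totalOverlap w cs)
  (trans (cong (λ u → u + totalOverlap w cs - boxArea w) (overlap-within w c h))
    (solve 2 (λ a t → a :+ t :- a := t) refl (boxArea w) (totalOverlap w cs)))
within-total w (c ∷ cs) (there h) = ℚ.≤-trans (within-total w cs h)
  (lin (0≤overlap w c) (solve 2 (λ a t → a :+ t :- t := a) refl (overlapArea w c) (totalOverlap w cs)))

disjoint-total : ∀ w b bs → Within w b → All (NonOverlapping b) bs → All (Aligned w) bs → totalOverlap w bs ≡ 0ℚ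
disjoint-total w b [] _ _ _ = refl
disjoint-total w b (c ∷ cs) wb (n ∷ ns) (a ∷ as) with dichotomy w c a
... | inj₁ wc = contradiction n (within-overlapping w b c wb wc)
... | inj₂ eq = trans (cong₂ _+_ eq (disjoint-total w b cs wb ns as)) refl

-- At most one of the non-overlapping boxes contains an aligned window. If one does, the midpoint of
-- the window lies in some box of the covering, and by alignment that box contains the whole window.
aligned-total : ∀ w bs cs → AllPairs NonOverlapping bs → All (Aligned w) bs → All (Aligned w) cs →
                Covered bs cs → totalOverlap w bs ≤ totalOverlap w cs
aligned-total w [] cs _ _ _ _ = 0≤totalOverlap w cs
aligned-total w (b ∷ bs) cs (n ∷ ns) (a ∷ as) as′ cov with dichotomy w b a
... | inj₂ eq = subst (_≤ totalOverlap w cs) (sym (trans (cong (_+ totalOverlap w bs) eq) (ℚ.+-identityˡ _)))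
  (aligned-total w bs cs ns as as′ (cov ∘ there))
... | inj₁ wb@((l , r) , (d , u)) with midpoint (left<right w) | midpoint (bottom<top w)
...   | x , lx , xr | y , dy , yu = subst (_≤ totalOverlap w cs)
  (sym (trans (cong₂ _+_ (overlap-within w b wb) (disjoint-total w b bs wb n as)) (ℚ.+-identityʳ _)))
  (within-total w cs (pick cs as′ (cov (here (contains
    (ℚ.≤-trans l (ℚ.<⇒≤ lx)) (ℚ.≤-trans (ℚ.<⇒≤ xr) r) (ℚ.≤-trans d (ℚ.<⇒≤ dy)) (ℚ.≤-trans (ℚ.<⇒≤ yu) u))))))
  where
  pick : ∀ cs → All (Aligned w) cs → Any (λ c → Contains c x y) cs → Any (Within w) cs
  pick (c ∷ cs) (a ∷ _)  (here h)  = here (aligned-covers w c a lx xr dy yu h)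
  pick (c ∷ cs) (_ ∷ as) (there h) = there (pick cs as h)

-- The list `ts` holds the coordinates at which the window has still to be cut. Once it is empty,
-- every box is aligned with the window.
Pending : List ℚ → (lo hi t : ℚ) → Set
Pending ts lo hi t = t ∈ ts ⊎ Outside lo hi t

shrink : ∀ {ts lo hi lo′ hi′ t} → lo ≤ lo′ → hi′ ≤ hi → Pending ts lo hi t → Pending ts lo′ hi′ t
shrink _ _ (inj₁ h)        = inj₁ h
shrink p _ (inj₂ (inj₁ h)) = inj₂ (inj₁ (ℚ.≤-trans h p))
shrink _ p (inj₂ (inj₂ h)) = inj₂ (inj₂ (ℚ.≤-trans p h))

processed : ∀ {t ts lo hi u} → Outside lo hi t → Pending (t ∷ ts) lo hi u → Pending ts lo hi u
processed o (inj₁ (here refl)) = inj₂ o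
processed _ (inj₁ (there h))   = inj₁ h
processed _ (inj₂ h)           = inj₂ h

settled : ∀ {lo hi t} → Pending [] lo hi t → Outside lo hi t
settled (inj₂ h) = h

PendingX PendingY : List ℚ → Box → Box → Set
PendingX xs w b = Pending xs (left w) (right w) (left b) × Pending xs (left w) (right w) (right b)
PendingY ys w b = Pending ys (bottom w) (top w) (bottom b) × Pending ys (bottom w) (top w) (top b)

both : ∀ {A B : ℚ → Set} {p q} → (∀ {t} → A t → B t) → A p × A q → B p × B q
both f (a , b) = f a , f b

outside? : ∀ lo hi t → Outside lo hi t ⊎ (lo < t × t < hi)
outside? lo hi t with ℚ._≤?_ t lo | ℚ._≤?_ hi t
... | yes p | _     = inj₁ (inj₁ p)
... | no _  | yes q = inj₁ (inj₂ q)
... | no p  | no q  = inj₂ (ℚ.≰⇒> p , ℚ.≰⇒> q)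

-- Induction on the remaining cuts: a coordinate strictly inside the window splits it in two, both
-- totals are additive under the split, and the windows that remain at the end are aligned.
window-total-y : ∀ ys w bs cs → AllPairs NonOverlapping bs → Covered bs cs →
  All (PendingX [] w) (bs ++ cs) → All (PendingY ys w) (bs ++ cs) → totalOverlap w bs ≤ totalOverlap w cs
window-total-y [] w bs cs ns cov hx hy = aligned-total w bs cs ns (All.++⁻ˡ bs as) (All.++⁻ʳ bs as) cov
  where
  as : All (Aligned w) (bs ++ cs)
  as = All.zipWith (λ (h , v) → both {Pending [] _ _} {Outside _ _} settled h , both {Pending [] _ _}
    {Outside _ _} settled v) (hx , hy)
window-total-y (y ∷ ys) w bs cs ns cov hx hy with outside? (bottom w) (top w) y
... | inj₁ o = window-total-y ys w bs cs ns cov hx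
  (All.map (both {Pending (y ∷ ys) _ _} {Pending ys _ _} (processed o)) hy)
... | inj₂ (b<y , y<t) = subst₂ _≤_ (sym (totalOverlap-split {w} {w₁} {w₂} split bs)) (sym (totalOverlap-split {w}
  {w₁} {w₂} split cs))
  (ℚ.+-mono-≤
    (window-total-y ys w₁ bs cs ns cov hx
      (All.map (both {Pending (y ∷ ys) _ _} {Pending ys _ _} (processed (inj₂ ℚ.≤-refl) ∘ shrink ℚ.≤-refl
        (ℚ.<⇒≤ y<t))) hy))
    (window-total-y ys w₂ bs cs ns cov hx
      (All.map (both {Pending (y ∷ ys) _ _} {Pending ys _ _} (processed (inj₁ ℚ.≤-refl) ∘ shrink (ℚ.<⇒≤ b<y)
        ℚ.≤-refl)) hy)))
  where
  w₁ w₂ : Box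
  w₁ = record w { top = y ; bottom<top = b<y }
  w₂ = record w { bottom = y ; bottom<top = y<t }
  split : ∀ b → overlapArea w b ≡ overlapArea w₁ b + overlapArea w₂ b
  split b = trans (cong (xOverlap w b *_) (length-split (ℚ.<⇒≤ b<y) (ℚ.<⇒≤ y<t) (top b) (bottom b)))
    (ℚ.*-distribˡ-+ (xOverlap w b) (yOverlap w₁ b) (yOverlap w₂ b))

window-total : ∀ xs ys w bs cs → AllPairs NonOverlapping bs → Covered bs cs →
  All (PendingX xs w) (bs ++ cs) → All (PendingY ys w) (bs ++ cs) → totalOverlap w bs ≤ totalOverlap w cs
window-total [] ys w bs cs ns cov hx hy = window-total-y ys w bs cs ns cov hx hy
window-total (x ∷ xs) ys w bs cs ns cov hx hy with outside? (left w) (right w) x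
... | inj₁ o = window-total xs ys w bs cs ns cov
  (All.map (both {Pending (x ∷ xs) _ _} {Pending xs _ _} (processed o)) hx) hy
... | inj₂ (l<x , x<r) = subst₂ _≤_ (sym (totalOverlap-split {w} {w₁} {w₂} split bs)) (sym (totalOverlap-split {w}
  {w₁} {w₂} split cs))
  (ℚ.+-mono-≤
    (window-total xs ys w₁ bs cs ns cov
      (All.map (both {Pending (x ∷ xs) _ _} {Pending xs _ _} (processed (inj₂ ℚ.≤-refl) ∘ shrink ℚ.≤-refl
        (ℚ.<⇒≤ x<r))) hx) hy)
    (window-total xs ys w₂ bs cs ns cov
      (All.map (both {Pending (x ∷ xs) _ _} {Pending xs _ _} (processed (inj₁ ℚ.≤-refl) ∘ shrink (ℚ.<⇒≤ l<x)
        ℚ.≤-refl)) hx) hy))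
  where
  w₁ w₂ : Box
  w₁ = record w { right = x ; left<right = l<x }
  w₂ = record w { left = x ; left<right = x<r }
  split : ∀ b → overlapArea w b ≡ overlapArea w₁ b + overlapArea w₂ b
  split b = trans (cong (_* yOverlap w b) (length-split (ℚ.<⇒≤ l<x) (ℚ.<⇒≤ x<r) (right b) (left b)))
    (ℚ.*-distribʳ-+ (yOverlap w b) (xOverlap w₁ b) (xOverlap w₂ b))

InWindow : ℚ → Box → Set
InWindow M b = (- M ≤ left b × right b ≤ M) × (- M ≤ bottom b × top b ≤ M)

window-exists : ∀ bs → Σ[ M ∈ ℚ ] 0ℚ < M × All (InWindow M) bs
window-exists [] = 1ℚ , 0<1 , []
window-exists (b ∷ bs) with window-exists bs
... | M , 0<M , h = M′ , ℚ.+-mono-<-≤ 0<M 0≤e ,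
    ((lower (left b) (0≤∣ right b ∣ ⊕ 0≤∣ bottom b ∣ ⊕ 0≤∣ top b ∣) refl
     , upper (right b) (0≤∣ left b ∣ ⊕ 0≤∣ bottom b ∣ ⊕ 0≤∣ top b ∣) (solve 4 (λ l r d u → r :+ (l :+ (d :+ u)) :=
       l :+ (r :+ (d :+ u))) refl L R D U))
    , (lower (bottom b) (0≤∣ left b ∣ ⊕ 0≤∣ right b ∣ ⊕ 0≤∣ top b ∣) (solve 4 (λ l r d u → d :+ (l :+ (r :+ u)) :=
      l :+ (r :+ (d :+ u))) refl L R D U)
     , upper (top b) (0≤∣ left b ∣ ⊕ 0≤∣ right b ∣ ⊕ 0≤∣ bottom b ∣) (solve 4 (λ l r d u → u :+ (l :+ (r :+ d)) :=
       l :+ (r :+ (d :+ u))) refl L R D U)))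
    ∷ All.map (λ {c} → widen {c}) h
  where
  0≤∣_∣ : ∀ p → 0ℚ ≤ ∣ p ∣
  0≤∣ p ∣ = ℚ.0≤∣p∣ p
  L R D U e : ℚ
  L = ∣ left b ∣
  R = ∣ right b ∣
  D = ∣ bottom b ∣
  U = ∣ top b ∣
  e = L + (R + (D + U))
  0≤e : 0ℚ ≤ e
  0≤e = 0≤∣ left b ∣ ⊕ 0≤∣ right b ∣ ⊕ 0≤∣ bottom b ∣ ⊕ 0≤∣ top b ∣
  M′ = M + e
  lower : ∀ p {s} → 0ℚ ≤ s → ∣ p ∣ + s ≡ e → - M′ ≤ p
  lower p {s} 0≤s eq = lin (ℚ.<⇒≤ 0<M ⊕ 0≤s ⊕ diff (-p≤∣p∣ p))
    (trans (cong (λ e → p - (- (M + e))) (sym eq))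
      (solve 4 (λ p M a s → p :- (:- (M :+ (a :+ s))) := M :+ (s :+ (a :- (:- p)))) refl p M ∣ p ∣ s))
  upper : ∀ p {s} → 0ℚ ≤ s → ∣ p ∣ + s ≡ e → p ≤ M′
  upper p {s} 0≤s eq = lin (ℚ.<⇒≤ 0<M ⊕ 0≤s ⊕ diff (p≤∣p∣ p))
    (trans (cong (λ e → M + e - p) (sym eq))
      (solve 4 (λ p M a s → M :+ (a :+ s) :- p := M :+ (s :+ (a :- p))) refl p M ∣ p ∣ s))
  M≤M′ : M ≤ M′
  M≤M′ = lin 0≤e (solve 2 (λ M e → M :+ e :- M := e) refl M e)
  widen : ∀ {c} → InWindow M c → InWindow M′ c
  widen ((a , b) , (c , d)) =
    (ℚ.≤-trans (ℚ.neg-antimono-≤ M≤M′) a , ℚ.≤-trans b M≤M′) , (ℚ.≤-trans (ℚ.neg-antimono-≤ M≤M′) c , ℚ.≤-trans d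
      M≤M′)

overlap-inWindow : ∀ {M} (M-pos : - M < M) b → InWindow M b →
  overlapArea (record { left<right = M-pos ; bottom<top = M-pos }) b ≡ boxArea b
overlap-inWindow p b ((l , r) , (d , u)) = cong₂ _*_
  (cong₂ _-_ (clamp-inside (ℚ.≤-trans l (ℚ.<⇒≤ (left<right b))) r) (clamp-inside l
    (ℚ.≤-trans (ℚ.<⇒≤ (left<right b)) r)))
  (cong₂ _-_ (clamp-inside (ℚ.≤-trans d (ℚ.<⇒≤ (bottom<top b))) u) (clamp-inside d
    (ℚ.≤-trans (ℚ.<⇒≤ (bottom<top b)) u)))

-- In a window that contains all boxes, overlaps are full areas. Initially the coordinates of all
-- boxes are pending, so nothing has to be assumed about the position of the boxes.
cover-area : ∀ bs cs → AllPairs NonOverlapping bs → Covered bs cs → totalArea bs ≤ totalArea cs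
cover-area bs cs ns cov with window-exists (bs ++ cs)
... | M , 0<M , h = subst₂ _≤_ (total bs (All.++⁻ˡ bs h)) (total cs (All.++⁻ʳ bs h))
  (window-total (coords left right ds) (coords bottom top ds) w bs cs ns cov
    (All.tabulate (λ m → both {_∈ coords left right ds} {Pending _ _ _} inj₁ (coords-∈ left right m)))
    (All.tabulate (λ m → both {_∈ coords bottom top ds} {Pending _ _ _} inj₁ (coords-∈ bottom top m))))
  where
  ds = bs ++ cs
  -M<M : - M < M
  -M<M = ℚ.<-trans (neg-< 0<M) 0<M
  w : Box
  w = record { left<right = -M<M ; bottom<top = -M<M }
  total : ∀ es → All (InWindow M) es → totalOverlap w es ≡ totalArea es
  total [] [] = refl
  total (e ∷ es) (i ∷ is) = cong₂ _+_ (overlap-inWindow -M<M e i) (total es is)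
  coords : (f g : Box → ℚ) → List Box → List ℚ
  coords f g []       = []
  coords f g (b ∷ bs) = f b ∷ g b ∷ coords f g bs
  coords-∈ : ∀ f g {b bs} → b ∈ bs → f b ∈ coords f g bs × g b ∈ coords f g bs
  coords-∈ f g (here refl) = here refl , there (here refl)
  coords-∈ f g (there m)   = let p , q = coords-∈ f g m in there (there p) , there (there q)

inner≤outer : ∀ {S : Region} bs cs → AllPairs NonOverlapping bs → All (λ b → boxRegion b ⊆ S) bs →
              S ⊆ (λ p → Any (λ c → boxRegion c p) cs) → totalArea bs ≤ totalArea cs
inner≤outer {S} bs cs ns ins cov = cover-area bs cs ns λ {x} {y} m →
  Any.map (λ {c} (l , r , d , u) → contains (fromℚ-≤⁻ l) (fromℚ-≤⁻ r) (fromℚ-≤⁻ d) (fromℚ-≤⁻ u))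
    (cov (locate x y ins m))
  where
  locate : ∀ x y {bs} → All (λ b → boxRegion b ⊆ S) bs → Any (λ b → Contains b x y) bs → S (fromℚ x , fromℚ y)
  locate x y (i ∷ _)  (here (contains l r d u)) = i (fromℚ-≤ l , fromℚ-≤ r , fromℚ-≤ d , fromℚ-≤ u)
  locate x y (_ ∷ is) (there m) = locate x y is m

area-mono : ∀ {S T : Region} {α β} → S ⊆ T → HasArea S α → HasArea T β → α ≤ʳ β
area-mono {S} {T} {α} {β} S⊆T hα hβ ε 0<ε
  -- A quarter of ε for each of four errors: the two approximations by boxes and the two
  -- inequalities between real numbers.
  with proj₁ (hα (½ * (½ * ε)) (half-pos (half-pos 0<ε))) | proj₂ (hβ (½ * (½ * ε)) (half-pos (half-pos 0<ε)))
... | bs , ns , ins , α≤ | cs , cov , ≤β = eventually₂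
  (λ n p q → lin< (ℚ.+-mono-<-≤ (ℚ.+-mono-< (diff< p) (diff< q)) (diff bs≤cs))
    (solve 5 (λ a b s t ε → b :+ ε :- a :=
       ((s :+ con ½ :* (con ½ :* ε)) :+ con ½ :* (con ½ :* ε) :- a) :+ (b :+ con ½ :* (con ½ :* ε) :+ con ½ :*
         (con ½ :* ε) :- t) :+ (t :- s))
      refl (seq α n) (seq β n) (totalArea bs) (totalArea cs) ε))
  (α≤ (½ * (½ * ε)) (half-pos (half-pos 0<ε))) (≤β (½ * (½ * ε)) (half-pos (half-pos 0<ε)))
  where
  bs≤cs : totalArea bs ≤ totalArea cs
  bs≤cs = inner≤outer {T} bs cs ns (All.map (λ {b} (i : boxRegion b ⊆ S) {x} p → S⊆T (i p)) ins) cov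

area-unique : ∀ {S : Region} {α β} → HasArea S α → HasArea S β → α ≃ β
area-unique {S} {α} {β} hα hβ = ≤-antisymʳ {α} {β} (area-mono {S} {S} {α} {β} id hα hβ) (area-mono {S} {S} {β} {α}
  id hβ hα)

area-resp : ∀ {S T : Region} {α β} → S ⊆ T → T ⊆ S → α ≃ β → HasArea S α → HasArea T β
area-resp {S} {T} {α} {β} S⊆T T⊆S α≃β h ε 0<ε with h ε 0<ε
... | (bs , ns , ins , α≤) , (cs , cov , ≤α) =
  (bs , ns , All.map (λ {b} (i : boxRegion b ⊆ S) {x} p → S⊆T (i p)) ins ,
    ≤-transʳ {β} {α} {fromℚ (totalArea bs + ε)} (≃⇒≤ {β} {α} (≃-sym {α} {β} α≃β)) α≤) ,
  (cs , cov ∘ T⊆S , nonNeg⇒≤ {fromℚ (totalArea cs)} {β +ʳ fromℚ ε}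
    (nonNeg-resp (λ n → solve 4 (λ a b t e → (a :+ e :- t) :+ (b :- a) := b :+ e :- t) refl (seq α n) (seq β n)
      (totalArea cs) ε)
      (nonNeg-+ (≤⇒nonNeg {fromℚ (totalArea cs)} {α +ʳ fromℚ ε} ≤α) (≤⇒nonNeg {α} {β} (≃⇒≤ {α} {β} α≃β)))))

-- Convex hulls

-- Opaque, so that S and p can be inferred from the type.
opaque
  InHull : Region → ℝ² → Set
  InHull S p = convexHull S p

  inHull : ∀ {S p} → convexHull S p → InHull S p
  inHull h = h

  combination : ∀ {S p} → InHull S p → convexHull S p
  combination h = h

affine : (a b c : ℚ) → ℝ → ℝ → ℝ
affine a b c x y = fromℚ a *ʳ x +ʳ fromℚ b *ʳ y +ʳ fromℚ c

real-bounded-const : ∀ c → Bounded (λ _ → c)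
real-bounded-const c = real-bounded (fromℚ c)

null-scale : ∀ c {s} → Null s → Null (λ n → c * s n)
null-scale c {s} h = null-resp (λ n → ℚ.*-comm (s n) c) (null-* h (real-bounded-const c))

-- The value at a convex combination is the weighted sum of the values at its points, up to null
-- sequences coming from the sum of the weights and from the two coordinates. All outer bounds on
-- the hull are instances of this.
halfplane′ : ∀ {S : Region} a b c → (∀ {x y} → S (x , y) → NonNeg (seq (affine a b c x y))) →
            ∀ {x y} → convexHull S (x , y) → NonNeg (seq (affine a b c x y))
halfplane′ {S} a b c h {x} {y} (k , w , p , w≥0 , Σw≃1 , p∈S , x≃ , y≃) = nonNeg-resp
  (λ n → solve 8 (λ a b c x y w X Y →
     (a :* X :+ b :* Y :+ c :* w) :+ (:- c :* (w :- con 1ℚ) :+ (a :* (x :- X) :+ b :* (y :- Y)))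
     := a :* x :+ b :* y :+ c) refl a b c (seq x n) (seq y n) (seq (sum w) n) (seq X n) (seq Y n))
  (nonNeg-+ (weighted k w p w≥0 p∈S)
    (null⇒nonNeg (null-+ (null-scale (- c) Σw≃1) (null-+ (null-scale a x≃) (null-scale b y≃)))))
  where
  X Y : ℝ
  X = sum (λ i → w i *ʳ proj₁ (p i))
  Y = sum (λ i → w i *ʳ proj₂ (p i))
  weighted : ∀ k (w : Fin k → ℝ) (p : Fin k → ℝ²) → (∀ i → 0ℝ ≤ʳ w i) → (∀ i → S (p i)) →
    NonNeg (λ n → a * seq (sum (λ i → w i *ʳ proj₁ (p i))) n + b * seq (sum (λ i → w i *ʳ proj₂ (p i))) n + c *
      seq (sum w) n)
  weighted zero    w p w≥0 p∈S = nonNeg-resp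
    (λ n → solve 3 (λ a b c → con 0ℚ := a :* con 0ℚ :+ b :* con 0ℚ :+ c :* con 0ℚ) refl a b c) (nonNeg-const ℚ.≤-refl)
  weighted (suc k) w p w≥0 p∈S = nonNeg-resp
    (λ n → solve 9 (λ a b c w x y X Y W →
        w :* (a :* x :+ b :* y :+ c) :+ (a :* X :+ b :* Y :+ c :* W)
        := a :* (w :* x :+ X) :+ b :* (w :* y :+ Y) :+ c :* (w :+ W)) refl
      a b c (seq (w Fin.zero) n) (seq (proj₁ (p Fin.zero)) n) (seq (proj₂ (p Fin.zero)) n)
      (seq (sum (λ i → w (Fin.suc i) *ʳ proj₁ (p (Fin.suc i)))) n)
      (seq (sum (λ i → w (Fin.suc i) *ʳ proj₂ (p (Fin.suc i)))) n) (seq (sum (w ∘ Fin.suc)) n))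
    (nonNeg-+
      (nonNeg-*
        (nonNeg-resp (λ n → solve 1 (λ w → w :- con 0ℚ := w) refl (seq (w Fin.zero) n)) (≤⇒nonNeg {0ℝ}
          {w Fin.zero} (w≥0 Fin.zero)))
        (h (p∈S Fin.zero)) (real-bounded (w Fin.zero)) (real-bounded (affine a b c (proj₁ (p Fin.zero))
          (proj₂ (p Fin.zero)))))
      (weighted k (w ∘ Fin.suc) (p ∘ Fin.suc) (w≥0 ∘ Fin.suc) (p∈S ∘ Fin.suc)))

halfplane : ∀ {S : Region} a b c → (∀ {x y} → S (x , y) → NonNeg (seq (affine a b c x y))) →
            ∀ {x y} → InHull S (x , y) → NonNeg (seq (affine a b c x y))
halfplane {S} a b c h {x} {y} hull = halfplane′ {S} a b c h {x} {y} (combination hull)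

cat : ∀ {A : Set} k {l} → (Fin k → A) → (Fin l → A) → Fin (k ℕ.+ l) → A
cat zero    f g i           = g i
cat (suc k) f g Fin.zero    = f Fin.zero
cat (suc k) f g (Fin.suc i) = cat k (f ∘ Fin.suc) g i

cat-∀ : ∀ {A : Set} (P : A → Set) k {l} (f : Fin k → A) (g : Fin l → A) →
        (∀ i → P (f i)) → (∀ i → P (g i)) → ∀ i → P (cat k f g i)
cat-∀ P zero    f g pf pg i           = pg i
cat-∀ P (suc k) f g pf pg Fin.zero    = pf Fin.zero
cat-∀ P (suc k) f g pf pg (Fin.suc i) = cat-∀ P k (f ∘ Fin.suc) g (pf ∘ Fin.suc) pg i

sumℚ : ∀ k → (Fin k → ℚ) → ℚ
sumℚ zero    f = 0ℚ
sumℚ (suc k) f = f Fin.zero + sumℚ k (f ∘ Fin.suc)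

seq-sum : ∀ k (f : Fin k → ℝ) n → seq (sum f) n ≡ sumℚ k (λ i → seq (f i) n)
seq-sum zero    f n = refl
seq-sum (suc k) f n = cong (λ u → seq (f Fin.zero) n + u) (seq-sum k (λ i → f (Fin.suc i)) n)

sumℚ-cat : ∀ {A : Set} (h : A → ℚ) k {l} (f : Fin k → A) (g : Fin l → A) →
           sumℚ (k ℕ.+ l) (λ i → h (cat k f g i)) ≡ sumℚ k (λ i → h (f i)) + sumℚ l (λ i → h (g i))
sumℚ-cat h zero    {l} f g = sym (ℚ.+-identityˡ (sumℚ l (λ i → h (g i))))
sumℚ-cat h (suc k) {l} f g = trans (cong (λ u → h (f Fin.zero) + u) (sumℚ-cat h k (λ i → f (Fin.suc i)) g))
  (sym (ℚ.+-assoc (h (f Fin.zero)) (sumℚ k (λ i → h (f (Fin.suc i)))) (sumℚ l (λ i → h (g i)))))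

sumℚ-scale : ∀ k s (f g : Fin k → ℚ) → (∀ i → g i ≡ s * f i) → sumℚ k g ≡ s * sumℚ k f
sumℚ-scale zero    s f g h = sym (ℚ.*-zeroʳ s)
sumℚ-scale (suc k) s f g h = trans (cong₂ _+_ (h Fin.zero) (sumℚ-scale k s (λ i → f (Fin.suc i))
  (λ i → g (Fin.suc i)) (λ i → h (Fin.suc i))))
  (sym (ℚ.*-distribˡ-+ s (f Fin.zero) (sumℚ k (λ i → f (Fin.suc i)))))

join : ∀ {k l} → ℝ → (Fin k → ℝ) → (Fin k → ℝ²) → ℝ → (Fin l → ℝ) → (Fin l → ℝ²) → Fin (k ℕ.+ l) → ℝ × ℝ²
join {k} s w p t w′ p′ = cat k (λ i → s *ʳ w i , p i) (λ i → t *ʳ w′ i , p′ i)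

-- With `h` constant this is the sum of the joined weights, with `h` a coordinate it is the
-- corresponding moment.
join-sum : ∀ {k l} (s : ℝ) (w : Fin k → ℝ) p (t : ℝ) (w′ : Fin l → ℝ) p′ n (h : ℝ² → ℚ)
  (u : Fin k → ℝ) (u′ : Fin l → ℝ) (U : Fin (k ℕ.+ l) → ℝ) →
  (∀ i → seq (U i) n ≡ seq (proj₁ (join s w p t w′ p′ i)) n * h (proj₂ (join s w p t w′ p′ i))) →
  (∀ i → seq (w i) n * h (p i) ≡ seq (u i) n) → (∀ i → seq (w′ i) n * h (p′ i) ≡ seq (u′ i) n) →
  seq (sum U) n ≡ seq s n * seq (sum u) n + seq t n * seq (sum u′) n
join-sum {k} {l} s w p t w′ p′ n h u u′ U U≡ u≡ u′≡ = begin
  seq (sum U) n                                            ≡⟨ seq-sum (k ℕ.+ l) U n ⟩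
  sumℚ (k ℕ.+ l) (λ i → seq (U i) n)                        ≡⟨ sumℚ-cong (k ℕ.+ l) U≡ ⟩
  sumℚ (k ℕ.+ l) (λ i → g (join s w p t w′ p′ i))           ≡⟨ sumℚ-cat g k (λ i → s *ʳ w i , p i) (λ i → t *ʳ w′
    i , p′ i) ⟩
  sumℚ k (λ i → (seq s n * seq (w i) n) * h (p i)) + sumℚ l (λ i → (seq t n * seq (w′ i) n) * h (p′ i))
    ≡⟨ cong₂ _+_
        (sumℚ-scale k (seq s n) (λ i → seq (u i) n) _ (λ i → trans (ℚ.*-assoc (seq s n) (seq (w i) n) (h (p i)))
          (cong (seq s n *_) (u≡ i))))
        (sumℚ-scale l (seq t n) (λ i → seq (u′ i) n) _ (λ i → trans (ℚ.*-assoc (seq t n) (seq (w′ i) n)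
          (h (p′ i))) (cong (seq t n *_) (u′≡ i)))) ⟩
  seq s n * sumℚ k (λ i → seq (u i) n) + seq t n * sumℚ l (λ i → seq (u′ i) n)
    ≡⟨ sym (cong₂ (λ a b → seq s n * a + seq t n * b) (seq-sum k u n) (seq-sum l u′ n)) ⟩
  seq s n * seq (sum u) n + seq t n * seq (sum u′) n       ∎
  where
  open ≡-Reasoning
  g : ℝ × ℝ² → ℚ
  g q = seq (proj₁ q) n * h (proj₂ q)
  sumℚ-cong : ∀ k {f g : Fin k → ℚ} → (∀ i → f i ≡ g i) → sumℚ k f ≡ sumℚ k g
  sumℚ-cong zero    h = refl
  sumℚ-cong (suc k) h = cong₂ _+_ (h Fin.zero) (sumℚ-cong k (λ i → h (Fin.suc i)))

join-weight : ∀ {k l} s (w : Fin k → ℝ) p t (w′ : Fin l → ℝ) p′ n →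
  seq (sum (λ i → proj₁ (join s w p t w′ p′ i))) n ≡ seq s n * seq (sum w) n + seq t n * seq (sum w′) n
join-weight s w p t w′ p′ n = join-sum s w p t w′ p′ n (λ _ → 1ℚ) w w′ (λ i → proj₁ (join s w p t w′ p′ i))
  (λ i → sym (ℚ.*-identityʳ (seq (proj₁ (join s w p t w′ p′ i)) n)))
  (λ i → ℚ.*-identityʳ (seq (w i) n)) (λ i → ℚ.*-identityʳ (seq (w′ i) n))

join-moment : ∀ {k l} (c : ℝ² → ℝ) s (w : Fin k → ℝ) p t (w′ : Fin l → ℝ) p′ n →
  seq (sum (λ i → proj₁ (join s w p t w′ p′ i) *ʳ c (proj₂ (join s w p t w′ p′ i)))) n ≡
  seq s n * seq (sum (λ i → w i *ʳ c (p i))) n + seq t n * seq (sum (λ i → w′ i *ʳ c (p′ i))) n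
join-moment c s w p t w′ p′ n = join-sum s w p t w′ p′ n (λ q → seq (c q) n)
  (λ i → w i *ʳ c (p i)) (λ i → w′ i *ʳ c (p′ i))
  (λ i → proj₁ (join s w p t w′ p′ i) *ʳ c (proj₂ (join s w p t w′ p′ i)))
  (λ _ → refl) (λ _ → refl) (λ _ → refl)

scaled-nonNeg : ∀ s → NonNeg (seq s) → ∀ {k} (w : Fin k → ℝ) → (∀ i → 0ℝ ≤ʳ w i) → ∀ i → 0ℝ ≤ʳ s *ʳ w i
scaled-nonNeg s s≥0 w w≥0 i = nonNeg⇒≤ {0ℝ} {s *ʳ w i} (nonNeg-resp
  (λ n → solve 2 (λ s w → s :* (w :- con 0ℚ) := s :* w :- con 0ℚ) refl (seq s n) (seq (w i) n))
  (nonNeg-* s≥0 (≤⇒nonNeg {0ℝ} {w i} (w≥0 i)) (real-bounded s) (real-bounded (w i +ʳ fromℚ (- 0ℚ)))))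

join-≃ : ∀ {x x′ X} {s t u v W : ℝ} → (∀ n → seq W n ≡ seq s n * seq u n + seq t n * seq v n) →
  x ≃ u → x′ ≃ v → Null (λ n → seq X n - (seq s n * seq x n + seq t n * seq x′ n)) → X ≃ W
join-≃ {x} {x′} {X} {s} {t} {u} {v} {W} W≡ x≃ x′≃ X≃ = null-resp (λ n → trans
    (solve 7 (λ X s t x x′ u v → (X :- (s :* x :+ t :* x′)) :+ ((x :- u) :* s :+ (x′ :- v) :* t) := X :-
      (s :* u :+ t :* v)) refl
      (seq X n) (seq s n) (seq t n) (seq x n) (seq x′ n) (seq u n) (seq v n))
    (cong (λ u → seq X n - u) (sym (W≡ n))))
  (null-+ X≃ (null-+ (null-* x≃ (real-bounded s)) (null-* x′≃ (real-bounded t))))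

-- The weights are real and the equations hold up to null sequences, because arbitrary real points
-- of a box have to be reached, not only rational ones.
hull-convex′ : ∀ {S : Region} {x y x′ y′ X Y} (s t : ℝ) → NonNeg (seq s) → NonNeg (seq t) →
  Null (λ n → seq s n + seq t n - 1ℚ) → convexHull S (x , y) → convexHull S (x′ , y′) →
  Null (λ n → seq X n - (seq s n * seq x n + seq t n * seq x′ n)) →
  Null (λ n → seq Y n - (seq s n * seq y n + seq t n * seq y′ n)) → convexHull S (X , Y)
hull-convex′ {S} {x} {y} {x′} {y′} {X} {Y} s t s≥0 t≥0 s+t (k , w , p , w≥0 , Σw , p∈S , x≃ , y≃)
    (k′ , w′ , p′ , w′≥0 , Σw′ , p′∈S , x′≃ , y′≃) X≃ Y≃ =
  k ℕ.+ k′ , (λ i → proj₁ (join s w p t w′ p′ i)) , (λ i → proj₂ (join s w p t w′ p′ i)) ,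
  cat-∀ (λ q → 0ℝ ≤ʳ proj₁ q) k (λ i → s *ʳ w i , p i) (λ i → t *ʳ w′ i , p′ i)
    (scaled-nonNeg s s≥0 w w≥0) (scaled-nonNeg t t≥0 w′ w′≥0) ,
  null-resp (λ n → trans
      (solve 4 (λ s t u v → (u :- con 1ℚ) :* s :+ ((v :- con 1ℚ) :* t :+ (s :+ t :- con 1ℚ)) := s :* u :+ t :* v
        :- con 1ℚ) refl
        (seq s n) (seq t n) (seq (sum w) n) (seq (sum w′) n))
      (cong (_- 1ℚ) (sym (join-weight s w p t w′ p′ n))))
    (null-+ (null-* Σw (real-bounded s)) (null-+ (null-* Σw′ (real-bounded t)) s+t)) ,
  cat-∀ (λ q → S (proj₂ q)) k (λ i → s *ʳ w i , p i) (λ i → t *ʳ w′ i , p′ i) p∈S p′∈S ,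
  join-≃ {x} {x′} {X} {s} {t} {sum (λ i → w i *ʳ proj₁ (p i))} {sum (λ i → w′ i *ʳ proj₁ (p′ i))}
    {sum (λ i → proj₁ (join s w p t w′ p′ i) *ʳ proj₁ (proj₂ (join s w p t w′ p′ i)))} (join-moment proj₁ s w p t
      w′ p′) x≃ x′≃ X≃ ,
  join-≃ {y} {y′} {Y} {s} {t} {sum (λ i → w i *ʳ proj₂ (p i))} {sum (λ i → w′ i *ʳ proj₂ (p′ i))}
    {sum (λ i → proj₁ (join s w p t w′ p′ i) *ʳ proj₂ (proj₂ (join s w p t w′ p′ i)))} (join-moment proj₂ s w p t
      w′ p′) y≃ y′≃ Y≃

hull-convex : ∀ {S : Region} {x y x′ y′ X Y} (s t : ℝ) → NonNeg (seq s) → NonNeg (seq t) →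
  Null (λ n → seq s n + seq t n - 1ℚ) → InHull S (x , y) → InHull S (x′ , y′) →
  Null (λ n → seq X n - (seq s n * seq x n + seq t n * seq x′ n)) →
  Null (λ n → seq Y n - (seq s n * seq y n + seq t n * seq y′ n)) → InHull S (X , Y)
hull-convex {S} {x} {y} {x′} {y′} {X} {Y} s t s≥0 t≥0 s+t h h′ X≃ Y≃ =
  inHull (hull-convex′ {S} {x} {y} {x′} {y′} {X} {Y} s t s≥0 t≥0 s+t (combination h) (combination h′) X≃ Y≃)

hull-⊇ : ∀ {S : Region} → S ⊆ InHull S
hull-⊇ {S} {x , y} h = inHull (1 , (λ _ → 1ℝ) , (λ _ → x , y) , (λ _ → fromℚ-≤ 0≤1) , ≃-refl {1ℝ} ,
  (λ _ → h) , single x , single y)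
  where
  single : ∀ x → x ≃ 1ℝ *ʳ x +ʳ 0ℝ
  single x = ≡⇒≃ {x} {1ℝ *ʳ x +ʳ 0ℝ} λ n → solve 1 (λ x → x := con 1ℚ :* x :+ con 0ℚ) refl (seq x n)

hull-mono : ∀ {S T : Region} → S ⊆ T → InHull S ⊆ InHull T
hull-mono S⊆T h = let k , w , p , w≥0 , Σw , p∈S , eqs = combination h in inHull (k , w , p , w≥0 , Σw , (λ i → S⊆T (p∈S i)) , eqs)

HullQ : Region → ℚ → ℚ → Set
HullQ S x y = InHull S (fromℚ x , fromℚ y)

hullQ-convex : ∀ {S x y x′ y′ X Y} τ → 0ℚ ≤ τ → τ ≤ 1ℚ → HullQ S x y → HullQ S x′ y′ →
  X ≡ (1ℚ - τ) * x + τ * x′ → Y ≡ (1ℚ - τ) * y + τ * y′ → HullQ S X Y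
hullQ-convex {S} {x} {y} {x′} {y′} {X} {Y} τ 0≤τ τ≤1 p q refl refl =
  hull-convex {S} {fromℚ x} {fromℚ y} {fromℚ x′} {fromℚ y′} {fromℚ X} {fromℚ Y} (fromℚ (1ℚ - τ)) (fromℚ τ)
    (nonNeg-const (diff τ≤1)) (nonNeg-const 0≤τ)
    (null-const (solve 1 (λ τ → con 1ℚ :- τ :+ τ :- con 1ℚ := con 0ℚ) refl τ)) p q
    (null-const (ℚ.+-inverseʳ X)) (null-const (ℚ.+-inverseʳ Y))

-- The end points get the weights (r - U) / (r - l) and (U - l) / (r - l). The reciprocal `d` enters
-- the hypotheses only through its defining equation.
hull-segment : ∀ {S : Region} {x y x′ y′ X Y} l r (U : ℝ) → l < r → fromℚ l ≤ʳ U → U ≤ʳ fromℚ r →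
  InHull S (x , y) → InHull S (x′ , y′) →
  (∀ d → d * (r - l) ≡ 1ℚ → ∀ n → seq X n ≡ d * (r - seq U n) * seq x n + d * (seq U n - l) * seq x′ n) →
  (∀ d → d * (r - l) ≡ 1ℚ → ∀ n → seq Y n ≡ d * (r - seq U n) * seq y n + d * (seq U n - l) * seq y′ n) →
  InHull S (X , Y)
hull-segment {S} {x} {y} {x′} {y′} {X} {Y} l r U l<r l≤U U≤r p q X≡ Y≡ with inverse (r - l) (diff< l<r)
... | d , 0<d , d≡ = hull-convex {S} {x} {y} {x′} {y′} {X} {Y} (fromℚ d *ʳ (fromℚ r +ʳ (fromℚ (- 1ℚ) *ʳ U)))
  (fromℚ d *ʳ (U +ʳ fromℚ (- l)))
    (nonNeg-scale (ℚ.<⇒≤ 0<d) (nonNeg-resp (λ n → solve 2 (λ r u → r :- u := r :+ con (- 1ℚ) :* u) refl r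
      (seq U n)) (≤⇒nonNeg {U} {fromℚ r} U≤r)))
    (nonNeg-scale (ℚ.<⇒≤ 0<d) (≤⇒nonNeg {fromℚ l} {U} l≤U))
    (null-resp (λ n → trans (cong (_- 1ℚ) (sym d≡))
        (solve 4 (λ d r l u → d :* (r :- l) :- con 1ℚ := d :* (r :+ con (- 1ℚ) :* u) :+ d :* (u :- l) :- con 1ℚ)
          refl d r l (seq U n)))
      (null-const refl))
    p q (exact {X} {x} {x′} X≡) (exact {Y} {y} {y′} Y≡)
  where
  exact : ∀ {X x x′ : ℝ} → (∀ d → d * (r - l) ≡ 1ℚ → ∀ n → seq X n ≡ d * (r - seq U n) * seq x n + d *
    (seq U n - l) * seq x′ n) →
    Null (λ n → seq X n - (d * (r + (- 1ℚ) * seq U n) * seq x n + d * (seq U n - l) * seq x′ n))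
  exact {X} {x} {x′} h = null-resp (λ n → trans (sym (ℚ.+-inverseʳ (seq X n))) (cong (λ u → seq X n - u)
    (trans (h d d≡ n)
    (solve 6 (λ d r l u x x′ → d :* (r :- u) :* x :+ d :* (u :- l) :* x′ := d :* (r :+ con (- 1ℚ) :* u) :* x :+ d
      :* (u :- l) :* x′) refl
      d r l (seq U n) (seq x n) (seq x′ n))))) (null-const refl)

-- The abscissa `X` is reached by interpolating along the bottom and the top side, and the point
-- itself on the vertical segment between the two.
box-in-hull : ∀ {S : Region} b → HullQ S (left b) (bottom b) → HullQ S (right b) (bottom b) →
  HullQ S (left b) (top b) → HullQ S (right b) (top b) → boxRegion b ⊆ InHull S
box-in-hull {S} b p₁ p₂ p₃ p₄ {X , Y} (l≤X , X≤r , b≤Y , Y≤t) =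
  hull-segment {S} {X} {fromℚ (bottom b)} {X} {fromℚ (top b)} {X} {Y} (bottom b) (top b) Y (bottom<top b) b≤Y Y≤t
    (side (bottom b) p₁ p₂) (side (top b) p₃ p₄)
    (λ d d≡ n → unit (top b) (bottom b) d d≡ (seq X n) (seq Y n)) (λ d d≡ n → moving (top b) (bottom b) d d≡
      (seq Y n))
  where
  unit : ∀ r l d → d * (r - l) ≡ 1ℚ → ∀ x u → x ≡ d * (r - u) * x + d * (u - l) * x
  unit r l d d≡ x u = trans (sym (ℚ.*-identityˡ x)) (trans (cong (_* x) (sym d≡))
    (solve 5 (λ d r l u x → d :* (r :- l) :* x := d :* (r :- u) :* x :+ d :* (u :- l) :* x) refl d r l u x))
  moving : ∀ r l d → d * (r - l) ≡ 1ℚ → ∀ u → u ≡ d * (r - u) * l + d * (u - l) * r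
  moving r l d d≡ u = trans (sym (ℚ.*-identityˡ u)) (trans (cong (_* u) (sym d≡))
    (solve 4 (λ d r l u → d :* (r :- l) :* u := d :* (r :- u) :* l :+ d :* (u :- l) :* r) refl d r l u))
  side : ∀ y → HullQ S (left b) y → HullQ S (right b) y → InHull S (X , fromℚ y)
  side y p q = hull-segment {S} {fromℚ (left b)} {fromℚ y} {fromℚ (right b)} {fromℚ y} {X} {fromℚ y} (left b)
    (right b) X (left<right b) l≤X X≤r p q
    (λ d d≡ n → moving (right b) (left b) d d≡ (seq X n)) (λ d d≡ n → unit (right b) (left b) d d≡ y (seq X n))

-- Integers as rationals, and finite sums

ι : ℤ → ℚ
ι z = z ℚ./ 1

ιℕ : ℕ → ℚ
ιℕ n = ι (+ n)

private
  ιᵘ : ∀ z → ℚ.toℚᵘ (ι z) ℚᵘ.≃ ℚᵘ.mkℚᵘ z 0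
  ιᵘ z = ℚ.toℚᵘ-fromℚᵘ (ℚᵘ.mkℚᵘ z 0)

ι-+ : ∀ a b → ι (a ℤ.+ b) ≡ ι a + ι b
ι-+ a b = ℚ.toℚᵘ-injective (begin
  ℚ.toℚᵘ (ι (a ℤ.+ b))                      ≈⟨ ιᵘ (a ℤ.+ b) ⟩
  ℚᵘ.mkℚᵘ (a ℤ.+ b) 0                       ≈⟨ ℚᵘ.*≡* (arith a b) ⟩
  ℚᵘ.mkℚᵘ a 0 ℚᵘ.+ ℚᵘ.mkℚᵘ b 0              ≈⟨ ℚᵘ.+-cong (ℚᵘ.≃-sym (ιᵘ a)) (ℚᵘ.≃-sym (ιᵘ b)) ⟩
  ℚ.toℚᵘ (ι a) ℚᵘ.+ ℚ.toℚᵘ (ι b)            ≈⟨ ℚᵘ.≃-sym (ℚ.toℚᵘ-homo-+ (ι a) (ι b)) ⟩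
  ℚ.toℚᵘ (ι a + ι b)                        ∎)
  where
  open ℚᵘ.≃-Reasoning
  arith : ∀ a b → (a ℤ.+ b) ℤ.* (+ 1) ≡ (a ℤ.* (+ 1) ℤ.+ b ℤ.* (+ 1)) ℤ.* (+ 1)
  arith = solve-∀

ι-* : ∀ a b → ι (a ℤ.* b) ≡ ι a * ι b
ι-* a b = ℚ.toℚᵘ-injective (begin
  ℚ.toℚᵘ (ι (a ℤ.* b))                      ≈⟨ ιᵘ (a ℤ.* b) ⟩
  ℚᵘ.mkℚᵘ (a ℤ.* b) 0                       ≈⟨ ℚᵘ.*≡* refl ⟩
  ℚᵘ.mkℚᵘ a 0 ℚᵘ.* ℚᵘ.mkℚᵘ b 0              ≈⟨ ℚᵘ.*-cong (ℚᵘ.≃-sym (ιᵘ a)) (ℚᵘ.≃-sym (ιᵘ b)) ⟩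
  ℚ.toℚᵘ (ι a) ℚᵘ.* ℚ.toℚᵘ (ι b)            ≈⟨ ℚᵘ.≃-sym (ℚ.toℚᵘ-homo-* (ι a) (ι b)) ⟩
  ℚ.toℚᵘ (ι a * ι b)                        ∎)
  where open ℚᵘ.≃-Reasoning

ι-neg : ∀ a → ι (ℤ.- a) ≡ - ι a
ι-neg a = begin
  ι (ℤ.- a)                    ≡⟨ solve 2 (λ a b → b := (a :+ b) :- a) refl (ι a) (ι (ℤ.- a)) ⟩
  (ι a + ι (ℤ.- a)) - ι a      ≡⟨ cong (_- ι a) (sym (ι-+ a (ℤ.- a))) ⟩
  ι (a ℤ.+ ℤ.- a) - ι a        ≡⟨ cong (λ z → ι z - ι a) (ℤ.+-inverseʳ a) ⟩
  0ℚ - ι a                     ≡⟨ ℚ.+-identityˡ (- ι a) ⟩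
  - ι a                        ∎
  where open ≡-Reasoning

ι-minus : ∀ a b → ι (a ℤ.- b) ≡ ι a - ι b
ι-minus a b = trans (ι-+ a (ℤ.- b)) (cong (λ u → ι a + u) (ι-neg b))

ι-suc : ∀ a → ι (ℤ.suc a) ≡ ι a + 1ℚ
ι-suc a = trans (ι-+ (+ 1) a) (ℚ.+-comm 1ℚ (ι a))

ιℕ-suc : ∀ n → ιℕ (suc n) ≡ ιℕ n + 1ℚ
ιℕ-suc n = ι-suc (+ n)

ι-≤ : ∀ {a b} → a ℤ.≤ b → ι a ≤ ι b
ι-≤ {a} {b} a≤b = ℚ.toℚᵘ-cancel-≤ (ℚᵘ.≤-respˡ-≃ (ℚᵘ.≃-sym (ιᵘ a)) (ℚᵘ.≤-respʳ-≃ (ℚᵘ.≃-sym (ιᵘ b))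
  (ℚᵘ.*≤* (subst₂ ℤ._≤_ (sym (ℤ.*-identityʳ a)) (sym (ℤ.*-identityʳ b)) a≤b))))

ι-≤⁻ : ∀ {a b} → ι a ≤ ι b → a ℤ.≤ b
ι-≤⁻ {a} {b} h with ℚᵘ.≤-respˡ-≃ (ιᵘ a) (ℚᵘ.≤-respʳ-≃ (ιᵘ b) (ℚ.toℚᵘ-mono-≤ h))
... | ℚᵘ.*≤* a≤b = subst₂ ℤ._≤_ (ℤ.*-identityʳ a) (ℤ.*-identityʳ b) a≤b

ι-injective : ∀ {a b} → ι a ≡ ι b → a ≡ b
ι-injective eq = ℤ.≤-antisym (ι-≤⁻ (ℚ.≤-reflexive eq)) (ι-≤⁻ (ℚ.≤-reflexive (sym eq)))

ι-< : ∀ {a b} → a ℤ.< b → ι a < ι b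
ι-< {a} {b} a<b = ℚ.≰⇒> (λ h → ℤ.<-irrefl refl (ℤ.<-≤-trans a<b (ι-≤⁻ {b} {a} h)))

0≤ιℕ : ∀ n → 0ℚ ≤ ιℕ n
0≤ιℕ n = ι-≤ {+ 0} {+ n} (ℤ.+≤+ ℕ.z≤n)

Σ< : ℕ → (ℕ → ℚ) → ℚ
Σ< zero    f = 0ℚ
Σ< (suc n) f = f 0 + Σ< n (λ i → f (suc i))

Σ<-cong : ∀ n {f g} → (∀ i → i ℕ.< n → f i ≡ g i) → Σ< n f ≡ Σ< n g
Σ<-cong zero    h = refl
Σ<-cong (suc n) h = cong₂ _+_ (h 0 (ℕ.s≤s ℕ.z≤n)) (Σ<-cong n (λ i i<n → h (suc i) (ℕ.s≤s i<n)))

Σ<-mono : ∀ n {f g} → (∀ i → i ℕ.< n → f i ≤ g i) → Σ< n f ≤ Σ< n g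
Σ<-mono zero    h = ℚ.≤-refl
Σ<-mono (suc n) h = ℚ.+-mono-≤ (h 0 (ℕ.s≤s ℕ.z≤n)) (Σ<-mono n (λ i i<n → h (suc i) (ℕ.s≤s i<n)))

Σ<-+ : ∀ n f g → Σ< n (λ i → f i + g i) ≡ Σ< n f + Σ< n g
Σ<-+ zero    f g = refl
Σ<-+ (suc n) f g = trans (cong (λ u → f 0 + g 0 + u) (Σ<-+ n (λ i → f (suc i)) (λ i → g (suc i))))
  (solve 4 (λ a b c d → a :+ b :+ (c :+ d) := (a :+ c) :+ (b :+ d)) refl (f 0) (g 0) (Σ< n (λ i → f (suc i)))
    (Σ< n (λ i → g (suc i))))

Σ<-affine : ∀ n p f q → Σ< n (λ i → p * f i + q) ≡ p * Σ< n f + ιℕ n * q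
Σ<-affine zero    p f q = solve 2 (λ p q → con 0ℚ := p :* con 0ℚ :+ con 0ℚ :* q) refl p q
Σ<-affine (suc n) p f q = trans (cong (λ u → p * f 0 + q + u) (Σ<-affine n p (λ i → f (suc i)) q))
  (trans (solve 5 (λ p a q s n → p :* a :+ q :+ (p :* s :+ n :* q) := p :* (a :+ s) :+ (n :+ con 1ℚ) :* q) refl p
    (f 0) q (Σ< n (λ i → f (suc i))) (ιℕ n))
    (cong (λ u → p * (f 0 + Σ< n (λ i → f (suc i))) + u * q) (sym (ιℕ-suc n))))

Σ<-arithmetic : ∀ n p q → Σ< n (λ i → p + ιℕ i * q) ≡ ιℕ n * p + ½ * (ιℕ n * (ιℕ n - 1ℚ)) * q
Σ<-arithmetic zero    p q = solve 2 (λ p q → con 0ℚ := con 0ℚ :* p :+ con ½ :* (con 0ℚ :* (con 0ℚ :- con 1ℚ)) :*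
  q) refl p q
Σ<-arithmetic (suc n) p q = begin
  p + 0ℚ * q + Σ< n (λ i → p + ιℕ (suc i) * q)
    ≡⟨ cong (λ u → p + 0ℚ * q + u) (Σ<-cong n (λ i _ → trans (cong (λ u → p + u * q) (ιℕ-suc i))
         (solve 3 (λ p i q → p :+ (i :+ con 1ℚ) :* q := (p :+ q) :+ i :* q) refl p (ιℕ i) q))) ⟩
  p + 0ℚ * q + Σ< n (λ i → (p + q) + ιℕ i * q)
    ≡⟨ cong (λ u → p + 0ℚ * q + u) (Σ<-arithmetic n (p + q) q) ⟩
  p + 0ℚ * q + (ιℕ n * (p + q) + ½ * (ιℕ n * (ιℕ n - 1ℚ)) * q)
    ≡⟨ solve 3 (λ p q n → p :+ con 0ℚ :* q :+ (n :* (p :+ q) :+ con ½ :* (n :* (n :- con 1ℚ)) :* q)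
         := (n :+ con 1ℚ) :* p :+ con ½ :* ((n :+ con 1ℚ) :* ((n :+ con 1ℚ) :- con 1ℚ)) :* q) refl p q (ιℕ n) ⟩
  (ιℕ n + 1ℚ) * p + ½ * ((ιℕ n + 1ℚ) * ((ιℕ n + 1ℚ) - 1ℚ)) * q
    ≡⟨ cong (λ u → u * p + ½ * (u * (u - 1ℚ)) * q) (sym (ιℕ-suc n)) ⟩
  ιℕ (suc n) * p + ½ * (ιℕ (suc n) * (ιℕ (suc n) - 1ℚ)) * q ∎
  where open ≡-Reasoning

small-reciprocal : ∀ C ε → 0ℚ ≤ C → 0ℚ < ε → Σ[ N ∈ ℕ ] Σ[ w ∈ ℚ ] 0ℚ < w × w ≤ 1ℚ × ιℕ (suc N) * w ≡ 1ℚ × w * C ≤ ε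
small-reciprocal C ε 0≤C 0<ε with inverse ε 0<ε
... | e , 0<e , eε≡1 = N , w , 0<w , w≤1 , trans (ℚ.*-comm (ιℕ (suc N)) w) wN≡1 ,
    cancel-≤ {ιℕ (suc N)} 0<N (lin (diff bound ⊗ ℚ.<⇒≤ 0<ε)
      (begin
        ιℕ (suc N) * ε - ιℕ (suc N) * (w * C)   ≡⟨ solve 4 (λ n ε w C → n :* ε :- n :* (w :* C) := n :* ε :-
          (w :* n) :* C) refl (ιℕ (suc N)) ε w C ⟩
        ιℕ (suc N) * ε - (w * ιℕ (suc N)) * C   ≡⟨ cong (λ u → ιℕ (suc N) * ε - u * C) (trans wN≡1 (sym eε≡1)) ⟩
        ιℕ (suc N) * ε - (e * ε) * C            ≡⟨ solve 4 (λ n ε e C → n :* ε :- (e :* ε) :* C := (n :- C :* e)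
          :* ε) refl (ιℕ (suc N)) ε e C ⟩
        (ιℕ (suc N) - C * e) * ε                ∎))
  where
  open ≡-Reasoning
  -- A rational does not exceed the absolute value of its numerator, so this is an integer bound for
  -- C / ε.
  N = ℤ.∣ ℚ.numerator (C * e) ∣
  numerator-bound : ∀ q → q ≤ ιℕ ℤ.∣ ℚ.numerator q ∣
  numerator-bound q@(ℚ.mkℚ z d _) = ℚ.toℚᵘ-cancel-≤ (ℚᵘ.≤-respʳ-≃ (ℚᵘ.≃-sym (ιᵘ (+ ℤ.∣ z ∣)))
    (ℚᵘ.*≤* (ℤ.≤-trans (ℤ.≤-reflexive (ℤ.*-identityʳ z)) (ℤ.≤-trans (z≤ z) (grow ℤ.∣ z ∣)))))
    where
    z≤ : ∀ z → z ℤ.≤ + ℤ.∣ z ∣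
    z≤ (+ n)    = ℤ.≤-refl
    z≤ -[1+ n ] = ℤ.-≤+
    grow : ∀ n → + n ℤ.≤ + n ℤ.* + suc d
    grow n = subst (+ n ℤ.≤_) (ℤ.pos-* n (suc d)) (ℤ.+≤+ (ℕ.m≤m*n n (suc d)))
  1≤N : 1ℚ ≤ ιℕ (suc N)
  1≤N = ι-≤ {+ 1} {+ suc N} (ℤ.+≤+ (ℕ.s≤s ℕ.z≤n))
  0<N : 0ℚ < ιℕ (suc N)
  0<N = ℚ.<-≤-trans 0<1 1≤N
  bound : C * e ≤ ιℕ (suc N)
  bound = ℚ.≤-trans (numerator-bound (C * e)) (ι-≤ {+ N} {+ suc N} (ℤ.+≤+ (ℕ.n≤1+n N)))
  w = proj₁ (inverse (ιℕ (suc N)) 0<N)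
  0<w = proj₁ (proj₂ (inverse (ιℕ (suc N)) 0<N))
  wN≡1 = proj₂ (proj₂ (inverse (ιℕ (suc N)) 0<N))
  w≤1 : w ≤ 1ℚ
  w≤1 = lin (ℚ.<⇒≤ 0<w ⊗ diff 1≤N) (trans (cong (_- w) (sym wN≡1))
    (solve 2 (λ w n → w :* n :- w := w :* (n :- con 1ℚ)) refl w (ιℕ (suc N))))

-- Upper and lower boundary of the hull

record Line : Set where
  constructor mkLine
  field
    intercept slope : ℚ

open Line

at : Line → ℚ → ℚ
at l x = intercept l + slope l * x

unionOf : List Cell → Region
unionOf cs p = Any (λ c → square c p) cs

-- The lower boundary of cs is treated as the upper boundary of map flip cs.
flip : Cell → Cell
flip (x , y) = x , ℤ.- (ℤ.suc y)

data TopCorner (cs : List Cell) : ℤ → ℤ → Set where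
  topLeft  : ∀ {x y} → (x , y) ∈ cs → TopCorner cs x (ℤ.suc y)
  topRight : ∀ {x y} → (x , y) ∈ cs → TopCorner cs (ℤ.suc x) (ℤ.suc y)

Above : List Cell → Line → Set
Above cs l = ∀ {x y} → TopCorner cs x y → ι y ≤ at l (ι x)

-- A point on a segment between two top corners. It belongs to the hull, and every affine inequality
-- valid at the corners carries over to it.
record Attained (cs : List Cell) (X Y : ℚ) : Set where
  field
    {x₀ y₀ x₁ y₁} : ℤ
    first  : TopCorner cs x₀ y₀
    second : TopCorner cs x₁ y₁
    τ      : ℚ
    0≤τ    : 0ℚ ≤ τ
    τ≤1    : τ ≤ 1ℚ
    X≡     : X ≡ (1ℚ - τ) * ι x₀ + τ * ι x₁
    Y≡     : Y ≡ (1ℚ - τ) * ι y₀ + τ * ι y₁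

attained-≤ : ∀ {cs X Y} l → Attained cs X Y → Above cs l → Y ≤ at l X
attained-≤ (mkLine c σ) record { first = p ; second = q ; τ = τ ; 0≤τ = 0≤τ ; τ≤1 = τ≤1 ; X≡ = refl ; Y≡ = refl } h =
  lin ((diff τ≤1 ⊗ diff (h p)) ⊕ (0≤τ ⊗ diff (h q)))
    (solve 7 (λ c σ τ x y x′ y′ → c :+ σ :* ((con 1ℚ :- τ) :* x :+ τ :* x′) :- ((con 1ℚ :- τ) :* y :+ τ :* y′)
      := (con 1ℚ :- τ) :* (c :+ σ :* x :- y) :+ τ :* (c :+ σ :* x′ :- y′)) refl c σ τ _ _ _ _)

attained-≥ : ∀ {cs X Y} l → Attained cs X Y → (∀ {x y} → TopCorner cs x y → at l (ι x) ≤ ι y) → at l X ≤ Y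
attained-≥ (mkLine c σ) record { first = p ; second = q ; τ = τ ; 0≤τ = 0≤τ ; τ≤1 = τ≤1 ; X≡ = refl ; Y≡ = refl } h =
  lin ((diff τ≤1 ⊗ diff (h p)) ⊕ (0≤τ ⊗ diff (h q)))
    (solve 7 (λ c σ τ x y x′ y′ → ((con 1ℚ :- τ) :* y :+ τ :* y′) :- (c :+ σ :* ((con 1ℚ :- τ) :* x :+ τ :* x′))
      := (con 1ℚ :- τ) :* (y :- (c :+ σ :* x)) :+ τ :* (y′ :- (c :+ σ :* x′))) refl c σ τ _ _ _ _)

corner-hull : ∀ {cs x y} → TopCorner cs x y → HullQ (unionOf cs) (ι x) (ι y)
corner-hull (topLeft {x} {y} m) = hull-⊇ (lose m
  (fromℚ-≤ (ℚ.≤-refl {ι x}) , fromℚ-≤ (ι-≤ (ℤ.i≤suc[i] x)) , fromℚ-≤ (ι-≤ (ℤ.i≤suc[i] y)) , fromℚ-≤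
    (ℚ.≤-refl {ι (ℤ.suc y)})))
corner-hull (topRight {x} {y} m) = hull-⊇ (lose m
  (fromℚ-≤ (ι-≤ (ℤ.i≤suc[i] x)) , fromℚ-≤ (ℚ.≤-refl {ι (ℤ.suc x)}) , fromℚ-≤ (ι-≤ (ℤ.i≤suc[i] y)) , fromℚ-≤
    (ℚ.≤-refl {ι (ℤ.suc y)})))

suc-flip : ∀ y → ℤ.suc (ℤ.- (ℤ.suc y)) ≡ ℤ.- y
suc-flip = arith
  where
  arith : ∀ y → + 1 ℤ.+ (ℤ.- (+ 1 ℤ.+ y)) ≡ ℤ.- y
  arith = solve-∀

ι-suc-flip : ∀ y → ι y ≡ - ι (ℤ.suc (ℤ.- (ℤ.suc y)))
ι-suc-flip y = sym (trans (cong (λ z → - ι z) (suc-flip y)) (trans (cong -_ (ι-neg y))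
  (solve 1 (λ y → :- (:- y) := y) refl (ι y))))

corner-hull-flip : ∀ {cs x y} → TopCorner (map flip cs) x y → HullQ (unionOf cs) (ι x) (- ι y)
corner-hull-flip (topLeft m) with ∈-map⁻ flip m
... | (x , y) , m′ , refl = subst (HullQ _ (ι x)) (ι-suc-flip y) (hull-⊇ (lose m′
  (fromℚ-≤ (ℚ.≤-refl {ι x}) , fromℚ-≤ (ι-≤ (ℤ.i≤suc[i] x)) , fromℚ-≤ (ℚ.≤-refl {ι y}) , fromℚ-≤
    (ι-≤ (ℤ.i≤suc[i] y)))))
corner-hull-flip (topRight m) with ∈-map⁻ flip m
... | (x , y) , m′ , refl = subst (HullQ _ (ι (ℤ.suc x))) (ι-suc-flip y) (hull-⊇ (lose m′
  (fromℚ-≤ (ι-≤ (ℤ.i≤suc[i] x)) , fromℚ-≤ (ℚ.≤-refl {ι (ℤ.suc x)}) , fromℚ-≤ (ℚ.≤-refl {ι y}) , fromℚ-≤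
    (ι-≤ (ℤ.i≤suc[i] y)))))

attained-hull : ∀ {cs X Y} → Attained cs X Y → HullQ (unionOf cs) X Y
attained-hull a = hullQ-convex τ 0≤τ τ≤1 (corner-hull first) (corner-hull second) X≡ Y≡
  where open Attained a

attained-hull-flip : ∀ {cs X Y} → Attained (map flip cs) X Y → HullQ (unionOf cs) X (- Y)
attained-hull-flip a = hullQ-convex τ 0≤τ τ≤1 (corner-hull-flip first) (corner-hull-flip second) X≡
  (trans (cong -_ Y≡) (solve 3 (λ τ y y′ → :- ((con 1ℚ :- τ) :* y :+ τ :* y′) := (con 1ℚ :- τ) :* (:- y) :+ τ :*
    (:- y′)) refl τ (ι y₀) (ι y₁)))
  where open Attained a

-- By `halfplane` a single square suffices. There the line is interpolated between the two top
-- corners of the square with weights p + 1 - x and x - p.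
hull-below : ∀ {cs x y} l → Above cs l → InHull (unionOf cs) (x , y) → NonNeg (λ n → at l (seq x n) - seq y n)
hull-below {cs} {x} {y} l@(mkLine c σ) above h = nonNeg-resp
  (λ n → solve 4 (λ c σ x y → σ :* x :+ con (- 1ℚ) :* y :+ c := c :+ σ :* x :- y) refl c σ (seq x n) (seq y n))
  (halfplane σ (- 1ℚ) c (λ {x} {y} → on-square x y) h)
  where
  on-square : ∀ x y → unionOf cs (x , y) → NonNeg (seq (affine σ (- 1ℚ) c x y))
  on-square x y m with find m
  ... | (p , q) , c∈ , (p≤x , x≤p′ , _ , y≤q′) = nonNeg-resp
    (λ n → begin
      (ι (ℤ.suc q) - seq y n) + ((at l (ι p) - ι (ℤ.suc q)) * (ι (ℤ.suc p) - seq x n) + (at l (ι (ℤ.suc p)) - ι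
        (ℤ.suc q)) * (seq x n - ι p))
        ≡⟨ cong (λ p′ → (ι (ℤ.suc q) - seq y n) + ((at l (ι p) - ι (ℤ.suc q)) * (p′ - seq x n) +
          (at l p′ - ι (ℤ.suc q)) * (seq x n - ι p))) (ι-suc p) ⟩
      _ ≡⟨ solve 6 (λ c σ x y p q → (q :- y) :+ ((c :+ σ :* p :- q) :* (p :+ con 1ℚ :- x) :+
        (c :+ σ :* (p :+ con 1ℚ) :- q) :* (x :- p))
             := σ :* x :+ con (- 1ℚ) :* y :+ c) refl c σ (seq x n) (seq y n) (ι p) (ι (ℤ.suc q)) ⟩
      σ * seq x n + (- 1ℚ) * seq y n + c ∎)
    (nonNeg-+ (≤⇒nonNeg {y} {fromℤ (ℤ.suc q)} y≤q′)
      (nonNeg-+ (nonNeg-scale (diff (above (topLeft c∈))) (≤⇒nonNeg {x} {fromℤ (ℤ.suc p)} x≤p′))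
                (nonNeg-scale (diff (above (topRight c∈))) (≤⇒nonNeg {fromℤ p} {x} p≤x))))
    where open ≡-Reasoning

hull-above : ∀ {cs x y} l → Above (map flip cs) l → InHull (unionOf cs) (x , y) → NonNeg (λ n → at l (seq x n) +
  seq y n)
hull-above {cs} {x} {y} l@(mkLine c σ) above h = nonNeg-resp
  (λ n → solve 4 (λ c σ x y → σ :* x :+ con 1ℚ :* y :+ c := c :+ σ :* x :+ y) refl c σ (seq x n) (seq y n))
  (halfplane σ 1ℚ c (λ {x} {y} → on-square x y) h)
  where
  on-square : ∀ x y → unionOf cs (x , y) → NonNeg (seq (affine σ 1ℚ c x y))
  on-square x y m with find m
  ... | (p , q) , c∈ , (p≤x , x≤p′ , q≤y , _) = nonNeg-resp
    (λ n → begin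
      (seq y n - ι q) + ((at l (ι p) - q′) * (ι (ℤ.suc p) - seq x n) + (at l (ι (ℤ.suc p)) - q′) * (seq x n - ι p))
        ≡⟨ cong₂ (λ p′ q′ → (seq y n - ι q) + ((at l (ι p) - q′) * (p′ - seq x n) + (at l p′ - q′) *
          (seq x n - ι p))) (ι-suc p) q′≡ ⟩
      _ ≡⟨ solve 6 (λ c σ x y p q → (y :- q) :+ ((c :+ σ :* p :- (:- q)) :* (p :+ con 1ℚ :- x) :+
        (c :+ σ :* (p :+ con 1ℚ) :- (:- q)) :* (x :- p))
             := σ :* x :+ con 1ℚ :* y :+ c) refl c σ (seq x n) (seq y n) (ι p) (ι q) ⟩
      σ * seq x n + 1ℚ * seq y n + c ∎)
    (nonNeg-+ (≤⇒nonNeg {fromℤ q} {y} q≤y)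
      (nonNeg-+ (nonNeg-scale (diff (above (topLeft (∈-map⁺ flip c∈)))) (≤⇒nonNeg {x} {fromℤ (ℤ.suc p)} x≤p′))
                (nonNeg-scale (diff (above (topRight (∈-map⁺ flip c∈)))) (≤⇒nonNeg {fromℤ p} {x} p≤x))))
    where
    open ≡-Reasoning
    q′ = ι (ℤ.suc (ℤ.- (ℤ.suc q)))
    q′≡ : q′ ≡ - ι q
    q′≡ = trans (cong ι (suc-flip q)) (ι-neg q)

hull-right-of : ∀ {cs x y} X → (∀ {p q} → (p , q) ∈ cs → X ≤ ι p) → InHull (unionOf cs) (x , y) → NonNeg
  (λ n → seq x n - X)
hull-right-of {cs} {x} {y} X bound h = nonNeg-resp
  (λ n → solve 3 (λ x y X → con 1ℚ :* x :+ con 0ℚ :* y :+ :- X := x :- X) refl (seq x n) (seq y n) X)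
  (halfplane 1ℚ 0ℚ (- X) (λ {x} {y} → on-square x y) h)
  where
  on-square : ∀ x y → unionOf cs (x , y) → NonNeg (seq (affine 1ℚ 0ℚ (- X) x y))
  on-square x y m with find m
  ... | (p , q) , c∈ , (p≤x , _) = nonNeg-resp
    (λ n → solve 4 (λ x y X p → (x :- p) :+ (p :- X) := con 1ℚ :* x :+ con 0ℚ :* y :+ :- X) refl (seq x n)
      (seq y n) X (ι p))
    (nonNeg-+ (≤⇒nonNeg {fromℤ p} {x} p≤x) (nonNeg-const (diff (bound c∈))))

hull-left-of : ∀ {cs x y} X → (∀ {p q} → (p , q) ∈ cs → ι (ℤ.suc p) ≤ X) → InHull (unionOf cs) (x , y) → NonNeg
  (λ n → X - seq x n)
hull-left-of {cs} {x} {y} X bound h = nonNeg-resp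
  (λ n → solve 3 (λ x y X → con (- 1ℚ) :* x :+ con 0ℚ :* y :+ X := X :- x) refl (seq x n) (seq y n) X)
  (halfplane (- 1ℚ) 0ℚ X (λ {x} {y} → on-square x y) h)
  where
  on-square : ∀ x y → unionOf cs (x , y) → NonNeg (seq (affine (- 1ℚ) 0ℚ X x y))
  on-square x y m with find m
  ... | (p , q) , c∈ , (_ , x≤p , _) = nonNeg-resp
    (λ n → solve 4 (λ x y X p → (p :- x) :+ (X :- p) := con (- 1ℚ) :* x :+ con 0ℚ :* y :+ X) refl (seq x n)
      (seq y n) X (ι (ℤ.suc p)))
    (nonNeg-+ (≤⇒nonNeg {x} {fromℤ (ℤ.suc p)} x≤p) (nonNeg-const (diff (bound c∈))))

-- The upper boundary over `a` unit columns from `X` on. Being above all corners and attained at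
-- both ends of its column, `line i` is the boundary there. By the trapezoid rule `total` is twice
-- the signed area under the boundary.
record Cap (cs : List Cell) (X : ℚ) (a : ℕ) (z : ℤ) : Set where
  field
    line     : ℕ → Line
    above    : ∀ i → i ℕ.< a → Above cs (line i)
    leftEnd  : ∀ i → i ℕ.< a → Attained cs (X + ιℕ i) (at (line i) (X + ιℕ i))
    rightEnd : ∀ i → i ℕ.< a → Attained cs (X + ιℕ (suc i)) (at (line i) (X + ιℕ (suc i)))
    total    : Σ< a (λ i → at (line i) (X + ιℕ i) + at (line i) (X + ιℕ (suc i))) ≡ ι z

-- The area between the two boundaries

totalArea-++ : ∀ bs cs → totalArea (bs ++ cs) ≡ totalArea bs + totalArea cs
totalArea-++ []       cs = sym (ℚ.+-identityˡ (totalArea cs))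
totalArea-++ (b ∷ bs) cs = trans (cong (λ u → boxArea b + u) (totalArea-++ bs cs))
  (sym (ℚ.+-assoc (boxArea b) (totalArea bs) (totalArea cs)))

-- Since the boxes stay between `l` and `r`, boxes of different strips do not overlap when strips
-- are put side by side.
Inscribed : Region → (l r t : ℚ) → Set
Inscribed S l r t = ∃[ bs ] AllPairs NonOverlapping bs ×
  All (λ b → boxRegion b ⊆ InHull S × l ≤ left b × right b ≤ r) bs × t ≤ totalArea bs

-- It is undecidable on which side of l a real abscissa x lies, so the covered
-- strips overlap by δ and a rational q near x selects the strip.
Covering : Region → (δ l r t : ℚ) → Set
Covering S δ l r t = ∃[ bs ]
  (∀ x y → InHull S (x , y) → ∀ q → l ≤ q → q ≤ r → NonNeg (λ n → seq x n - (q - δ)) → NonNeg (λ n → q + δ - seq x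
    n) →
    Any (λ b → boxRegion b (x , y)) bs) ×
  totalArea bs ≤ t

stack-inner : ∀ {S} (pos : ℕ → ℚ) → (∀ i → pos i ≤ pos (suc i)) → ∀ n v →
  (∀ i → i ℕ.< n → Inscribed S (pos i) (pos (suc i)) (v i)) → Inscribed S (pos 0) (pos n) (Σ< n v)
stack-inner pos mono zero    v h = [] , [] , [] , ℚ.≤-refl
stack-inner {S} pos mono (suc n) v h with h 0 (ℕ.s≤s ℕ.z≤n) | stack-inner {S} (pos ∘ suc) (mono ∘ suc) n (v ∘ suc)
  (λ i i<n → h (suc i) (ℕ.s≤s i<n))
... | bs , ns , as , t≤ | bs′ , ns′ , as′ , t′≤ = bs ++ bs′ ,
  AllPairs.++⁺ ns ns′ (All.map (λ (_ , _ , r≤) → All.map (λ (_ , ≤l , _) → inj₁ (ℚ.≤-trans r≤ ≤l)) as′) as) ,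
  All.++⁺ (All.map (λ (i , ≤l , r≤) → (λ {p} → i {p}) , ≤l , ℚ.≤-trans r≤ (increasing (pos ∘ suc) (mono ∘ suc) n)) as)
          (All.map (λ (i , ≤l , r≤) → (λ {p} → i {p}) , ℚ.≤-trans (mono 0) ≤l , r≤) as′) ,
  subst (v 0 + Σ< n (v ∘ suc) ≤_) (sym (totalArea-++ bs bs′)) (ℚ.+-mono-≤ t≤ t′≤)
  where
  increasing : ∀ (pos : ℕ → ℚ) → (∀ i → pos i ≤ pos (suc i)) → ∀ n → pos 0 ≤ pos n
  increasing pos mono zero    = ℚ.≤-refl
  increasing pos mono (suc n) = ℚ.≤-trans (mono 0) (increasing (pos ∘ suc) (mono ∘ suc) n)

stack-outer : ∀ {S δ} (pos : ℕ → ℚ) → ∀ n v →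
  (∀ i → i ℕ.< suc n → Covering S δ (pos i) (pos (suc i)) (v i)) → Covering S δ (pos 0) (pos (suc n)) (Σ< (suc n) v)
stack-outer pos zero v h with h 0 (ℕ.s≤s ℕ.z≤n)
... | bs , cov , ≤t = bs , cov , subst (totalArea bs ≤_) (sym (ℚ.+-identityʳ (v 0))) ≤t
stack-outer {S} {δ} pos (suc n) v h with h 0 (ℕ.s≤s ℕ.z≤n) | stack-outer {S} {δ} (pos ∘ suc) n (v ∘ suc)
  (λ i i<n → h (suc i) (ℕ.s≤s i<n))
... | bs , cov , ≤t | bs′ , cov′ , ≤t′ = bs ++ bs′ , cover ,
  subst (_≤ v 0 + Σ< (suc n) (v ∘ suc)) (sym (totalArea-++ bs bs′)) (ℚ.+-mono-≤ ≤t ≤t′)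
  where
  cover : ∀ x y → InHull S (x , y) → ∀ q → pos 0 ≤ q → q ≤ pos (suc (suc n)) →
    NonNeg (λ n → seq x n - (q - δ)) → NonNeg (λ n → q + δ - seq x n) → Any (λ b → boxRegion b (x , y)) (bs ++ bs′)
  cover x y hull q ≤q q≤ near₁ near₂ with ℚ.≤-total q (pos 1)
  ... | inj₁ q≤₁ = Any.++⁺ˡ (cov x y hull q ≤q q≤₁ near₁ near₂)
  ... | inj₂ ₁≤q = Any.++⁺ʳ bs (cov′ x y hull q ₁≤q q≤ near₁ near₂)

SlopeBound : ℚ → Line → Set
SlopeBound s l = - s ≤ slope l × slope l ≤ s

gap : Line → Line → Line
gap u l = mkLine (intercept u - intercept l) (slope u - slope l)

hull-line : ∀ {S} l {x x′ t} → x < x′ → x ≤ t → t ≤ x′ → HullQ S x (at l x) → HullQ S x′ (at l x′) → HullQ S t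
  (at l t)
hull-line {S} l@(mkLine c σ) {x} {x′} {t} x<x′ x≤t t≤x′ p q with inverse (x′ - x) (diff< x<x′)
... | d , 0<d , d≡ = hullQ-convex (d * (t - x)) (ℚ.<⇒≤ 0<d ⊗ diff x≤t)
  (lin (ℚ.<⇒≤ 0<d ⊗ diff t≤x′) (trans (cong (_- d * (t - x)) (sym d≡))
    (solve 4 (λ d x x′ t → d :* (x′ :- x) :- d :* (t :- x) := d :* (x′ :- t)) refl d x x′ t)))
  p q t≡ (trans (cong (λ t → c + σ * t) t≡)
    (solve 5 (λ c σ τ x x′ → c :+ σ :* ((con 1ℚ :- τ) :* x :+ τ :* x′) := (con 1ℚ :- τ) :* (c :+ σ :* x) :+ τ :*
      (c :+ σ :* x′)) refl c σ (d * (t - x)) x x′))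
  where
  t≡ : t ≡ (1ℚ - d * (t - x)) * x + d * (t - x) * x′
  t≡ = trans (trans (solve 2 (λ x t → t := x :+ con 1ℚ :* (t :- x)) refl x t) (cong (λ u → x + u * (t - x)) (sym d≡)))
    (solve 4 (λ d x x′ t → x :+ d :* (x′ :- x) :* (t :- x) := (con 1ℚ :- d :* (t :- x)) :* x :+ d :* (t :- x) :*
      x′) refl d x x′ t)

hull-vertical : ∀ {S x y y′ t} → y ≤ t → t ≤ y′ → HullQ S x y → HullQ S x y′ → HullQ S x t
hull-vertical {S} {x} {y} {y′} {t} y≤t t≤y′ p q with ℚ._<?_ y y′
... | no y≮y′ = subst (HullQ S x) (ℚ.≤-antisym y≤t (ℚ.≤-trans t≤y′ (ℚ.≮⇒≥ y≮y′))) p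
... | yes y<y′ with inverse (y′ - y) (diff< y<y′)
...   | d , 0<d , d≡ = hullQ-convex (d * (t - y)) (ℚ.<⇒≤ 0<d ⊗ diff y≤t)
  (lin (ℚ.<⇒≤ 0<d ⊗ diff t≤y′) (trans (cong (_- d * (t - y)) (sym d≡))
    (solve 4 (λ d y y′ t → d :* (y′ :- y) :- d :* (t :- y) := d :* (y′ :- t)) refl d y y′ t)))
  p q (solve 2 (λ x τ → x := (con 1ℚ :- τ) :* x :+ τ :* x) refl x (d * (t - y)))
  (trans (trans (solve 2 (λ y t → t := y :+ con 1ℚ :* (t :- y)) refl y t) (cong (λ u → y + u * (t - y)) (sym d≡)))
    (solve 4 (λ d y y′ t → y :+ d :* (y′ :- y) :* (t :- y) := (con 1ℚ :- d :* (t :- y)) :* y :+ d :* (t :- y) :*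
      y′) refl d y y′ t))

-- The area of a trapezoid of width `w` minus an error. Each of the two boundaries has slope at most
-- `s` and deviates from its mean by at most s w / 2.
innerValue : Line → (s w x : ℚ) → ℚ
innerValue d s w x = w * (½ * (at d x + at d (x + w)) - s * w)

-- Here `ω` is the width of the strip including its overlap with the neighbours; over it each
-- boundary exceeds its mean by at most s ω / 2.
outerValue : Line → (s w ω x : ℚ) → ℚ
outerValue d s w ω x = ω * (½ * (at d x + at d (x + w)) + s * ω)

inner-cell : ∀ {S} u l s x w → 0ℚ < w → SlopeBound s u → SlopeBound s l →
  HullQ S x (at u x) → HullQ S (x + w) (at u (x + w)) → HullQ S x (at l x) → HullQ S (x + w) (at l (x + w)) →
  Inscribed S x (x + w) (innerValue (gap u l) s w x)
inner-cell {S} u@(mkLine c σ) l@(mkLine c′ σ′) s x w 0<w (-s≤σ , σ≤s) (-s≤σ′ , σ′≤s) p₁ p₂ q₁ q₂ = choose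
  (ℚ._<?_ bot tp)
  where
  tp bot : ℚ
  tp = at u x ⊓ at u (x + w)
  bot = at l x ⊔ at l (x + w)
  mean⁻ mean⁺ : ℚ
  mean⁻ = ½ * (at u x + at u (x + w)) - ½ * (s * w)
  mean⁺ = ½ * (at l x + at l (x + w)) + ½ * (s * w)
  tp≥₁ : mean⁻ ≤ at u x
  tp≥₁ = lin (0≤½ ⊗ diff σ≤s ⊗ ℚ.<⇒≤ 0<w) (solve 5 (λ c σ s x w → (c :+ σ :* x) :-
    (con ½ :* ((c :+ σ :* x) :+ (c :+ σ :* (x :+ w))) :- con ½ :* (s :* w)) := con ½ :* ((s :- σ) :* w)) refl c σ
    s x w)
  tp≥₂ : mean⁻ ≤ at u (x + w)
  tp≥₂ = lin (0≤½ ⊗ diff -s≤σ ⊗ ℚ.<⇒≤ 0<w) (solve 5 (λ c σ s x w → (c :+ σ :* (x :+ w)) :-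
    (con ½ :* ((c :+ σ :* x) :+ (c :+ σ :* (x :+ w))) :- con ½ :* (s :* w)) := con ½ :* ((σ :- (:- s)) :* w)) refl
    c σ s x w)
  tp≥ : mean⁻ ≤ tp
  tp≥ = ℚ.⊓-glb tp≥₁ tp≥₂
  bot≤₁ : at l x ≤ mean⁺
  bot≤₁ = lin (0≤½ ⊗ diff -s≤σ′ ⊗ ℚ.<⇒≤ 0<w)
    (solve 5 (λ c σ s x w → (con ½ :* ((c :+ σ :* x) :+ (c :+ σ :* (x :+ w))) :+ con ½ :* (s :* w)) :-
    (c :+ σ :* x) := con ½ :* ((σ :- (:- s)) :* w)) refl c′ σ′ s x w)
  bot≤₂ : at l (x + w) ≤ mean⁺
  bot≤₂ = lin (0≤½ ⊗ diff σ′≤s ⊗ ℚ.<⇒≤ 0<w)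
    (solve 5 (λ c σ s x w → (con ½ :* ((c :+ σ :* x) :+ (c :+ σ :* (x :+ w))) :+ con ½ :* (s :* w)) :-
    (c :+ σ :* (x :+ w)) := con ½ :* ((s :- σ) :* w)) refl c′ σ′ s x w)
  bot≤ : bot ≤ mean⁺
  bot≤ = ℚ.⊔-lub bot≤₁ bot≤₂
  choose : Dec (bot < tp) → Inscribed S x (x + w) (innerValue (gap u l) s w x)
  -- The lower boundary reaches the upper one within the error, so the required area is at most 0
  -- and the empty list does it.
  choose (no b≮t) = [] , [] , [] , lin (ℚ.<⇒≤ 0<w ⊗ (diff (ℚ.≮⇒≥ b≮t) ⊕ diff tp≥ ⊕ diff bot≤))
    (solve 9 (λ c σ c′ σ′ s x w t b → con 0ℚ :- w :* (con ½ :* ((c :- c′) :+ (σ :- σ′) :* x :+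
      ((c :- c′) :+ (σ :- σ′) :* (x :+ w))) :- s :* w)
      := w :* ((b :- t) :+ ((t :- (con ½ :* ((c :+ σ :* x) :+ (c :+ σ :* (x :+ w))) :- con ½ :* (s :* w)))
         :+ ((con ½ :* ((c′ :+ σ′ :* x) :+ (c′ :+ σ′ :* (x :+ w))) :+ con ½ :* (s :* w)) :- b)))) refl c σ c′ σ′ s
           x w tp bot)
  choose (yes b<t) = box ∷ [] , [] ∷ [] ,
    ((λ {p} → box-in-hull box
        (hull-vertical (ℚ.p≤p⊔q (at l x) (at l (x + w))) (ℚ.≤-trans (ℚ.<⇒≤ b<t) (ℚ.p⊓q≤p (at u x) (at u (x + w))))
          q₁ p₁)
        (hull-vertical (ℚ.p≤q⊔p (at l x) (at l (x + w))) (ℚ.≤-trans (ℚ.<⇒≤ b<t) (ℚ.p⊓q≤q (at u x) (at u (x + w))))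
          q₂ p₂)
        (hull-vertical (ℚ.≤-trans (ℚ.p≤p⊔q (at l x) (at l (x + w))) (ℚ.<⇒≤ b<t)) (ℚ.p⊓q≤p (at u x) (at u (x + w)))
          q₁ p₁)
        (hull-vertical (ℚ.≤-trans (ℚ.p≤q⊔p (at l x) (at l (x + w))) (ℚ.<⇒≤ b<t)) (ℚ.p⊓q≤q (at u x) (at u (x + w)))
          q₂ p₂) {p}) ,
      ℚ.≤-refl , ℚ.≤-refl) ∷ [] ,
    lin (ℚ.<⇒≤ 0<w ⊗ (diff tp≥ ⊕ diff bot≤))
      (solve 9 (λ c σ c′ σ′ s x w t b → (x :+ w :- x) :* (t :- b) :+ con 0ℚ :- w :*
        (con ½ :* ((c :- c′) :+ (σ :- σ′) :* x :+ ((c :- c′) :+ (σ :- σ′) :* (x :+ w))) :- s :* w)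
        := w :* ((t :- (con ½ :* ((c :+ σ :* x) :+ (c :+ σ :* (x :+ w))) :- con ½ :* (s :* w)))
           :+ ((con ½ :* ((c′ :+ σ′ :* x) :+ (c′ :+ σ′ :* (x :+ w))) :+ con ½ :* (s :* w)) :- b))) refl c σ c′ σ′
             s x w tp bot)
    where
    box : Box
    box = record { left = x ; right = x + w ; bottom = bot ; top = tp
                 ; left<right = lin< 0<w (solve 2 (λ x w → x :+ w :- x := w) refl x w) ; bottom<top = b<t }

outer-cell : ∀ {S} u l s x w δ → 0ℚ < w → 0ℚ < δ → 0ℚ < s → SlopeBound s u → SlopeBound s l →
  0ℚ ≤ at (gap u l) x → 0ℚ ≤ at (gap u l) (x + w) →
  (∀ x y → InHull S (x , y) → NonNeg (λ n → at u (seq x n) - seq y n)) →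
  (∀ x y → InHull S (x , y) → NonNeg (λ n → seq y n - at l (seq x n))) →
  Covering S δ x (x + w) (outerValue (gap u l) s w (w + (δ + δ)) x)
outer-cell {S} u@(mkLine c σ) l@(mkLine c′ σ′) s x w δ 0<w 0<δ 0<s (-s≤σ , σ≤s) (-s≤σ′ , σ′≤s) g₁ g₂ below above =
  box ∷ [] , (λ X Y hull q x≤q q≤x′ near₁ near₂ → here (cover X Y hull q x≤q q≤x′ near₁ near₂)) ,
  ℚ.≤-reflexive (solve 8 (λ c σ c′ σ′ s x w δ →
      (x :+ w :+ δ :- (x :- δ)) :* (con ½ :* ((c :+ σ :* x) :+ (c :+ σ :* (x :+ w))) :+ s :*
        (con ½ :* (w :+ (δ :+ δ)))
         :- (con ½ :* ((c′ :+ σ′ :* x) :+ (c′ :+ σ′ :* (x :+ w))) :- s :* (con ½ :* (w :+ (δ :+ δ))))) :+ con 0ℚ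
      := (w :+ (δ :+ δ)) :* (con ½ :* ((c :- c′) :+ (σ :- σ′) :* x :+ ((c :- c′) :+ (σ :- σ′) :* (x :+ w))) :+ s
        :* (w :+ (δ :+ δ)))) refl c σ c′ σ′ s x w δ)
  where
  ω tp bot : ℚ
  ω = w + (δ + δ)
  tp = ½ * (at u x + at u (x + w)) + s * (½ * ω)
  bot = ½ * (at l x + at l (x + w)) - s * (½ * ω)
  0<ω : 0ℚ < ω
  0<ω = ℚ.+-mono-< 0<w (ℚ.+-mono-< 0<δ 0<δ)
  box : Box
  box = record
    { left = x - δ ; right = x + w + δ ; bottom = bot ; top = tp
    ; left<right = lin< 0<ω (solve 3 (λ x w δ → x :+ w :+ δ :- (x :- δ) := w :+ (δ :+ δ)) refl x w δ)
    -- The positive term s ω keeps the box nondegenerate even where the two boundaries meet.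
    ; bottom<top = lin< (ℚ.+-mono-≤-< (0≤½ ⊗ (g₁ ⊕ g₂)) (*-pos 0<s 0<ω))
        (solve 7 (λ a b a′ b′ s x ω → con ½ :* (a :+ b) :+ s :* (con ½ :* ω) :- (con ½ :* (a′ :+ b′) :- s :*
          (con ½ :* ω))
          := con ½ :* ((a :- a′) :+ (b :- b′)) :+ s :* ω) refl (at u x) (at u (x + w)) (at l x) (at l (x + w)) s x ω
         ∙ cong₂ (λ a b → ½ * (a + b) + s * ω) (gap≡ x) (gap≡ (x + w))) }
    where
    infixr 5 _∙_
    _∙_ : ∀ {a b c : ℚ} → a ≡ b → b ≡ c → a ≡ c
    _∙_ = trans
    gap≡ : ∀ x → at u x - at l x ≡ at (gap u l) x
    gap≡ x = solve 5 (λ c σ c′ σ′ x → c :+ σ :* x :- (c′ :+ σ′ :* x) := (c :- c′) :+ (σ :- σ′) :* x) refl c σ c′ σ′ x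
  cover : ∀ X Y → InHull S (X , Y) → ∀ q → x ≤ q → q ≤ x + w →
    NonNeg (λ n → seq X n - (q - δ)) → NonNeg (λ n → q + δ - seq X n) → boxRegion box (X , Y)
  cover X Y hull q x≤q q≤x′ near₁ near₂ =
    nonNeg⇒≤ {fromℚ (x - δ)} {X} ≥left , nonNeg⇒≤ {X} {fromℚ (x + w + δ)} ≤right ,
    nonNeg⇒≤ {fromℚ bot} {Y} (nonNeg-resp
      (λ n → solve 8 (λ c σ s x w δ X Y → (Y :- (c :+ σ :* X)) :+ ((con ½ :* (s :- σ)) :* (x :+ w :+ δ :- X) :+
        (con ½ :* (σ :- (:- s))) :* (X :- (x :- δ)))
        := Y :- (con ½ :* ((c :+ σ :* x) :+ (c :+ σ :* (x :+ w))) :- s :* (con ½ :* (w :+ (δ :+ δ))))) refl c′ σ′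
          s x w δ (seq X n) (seq Y n))
      (nonNeg-+ (above X Y hull) (nonNeg-+ (nonNeg-scale (0≤½ ⊗ diff σ′≤s) ≤right)
        (nonNeg-scale (0≤½ ⊗ diff -s≤σ′) ≥left)))) ,
    nonNeg⇒≤ {Y} {fromℚ tp} (nonNeg-resp
      (λ n → solve 8 (λ c σ s x w δ X Y → ((c :+ σ :* X) :- Y) :+ ((con ½ :* (σ :- (:- s))) :* (x :+ w :+ δ :- X)
        :+ (con ½ :* (s :- σ)) :* (X :- (x :- δ)))
        := con ½ :* ((c :+ σ :* x) :+ (c :+ σ :* (x :+ w))) :+ s :* (con ½ :* (w :+ (δ :+ δ))) :- Y) refl c σ s x
          w δ (seq X n) (seq Y n))
      (nonNeg-+ (below X Y hull) (nonNeg-+ (nonNeg-scale (0≤½ ⊗ diff -s≤σ) ≤right) (nonNeg-scale (0≤½ ⊗ diff σ≤s)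
        ≥left))))
    where
    ≥left : NonNeg (λ n → seq X n - (x - δ))
    ≥left = nonNeg-resp (λ n → solve 4 (λ x q δ X → (X :- (q :- δ)) :+ (q :- x) := X :- (x :- δ)) refl x q δ
      (seq X n))
      (nonNeg-+ near₁ (nonNeg-const (diff x≤q)))
    ≤right : NonNeg (λ n → x + w + δ - seq X n)
    ≤right = nonNeg-resp (λ n → solve 5 (λ x w q δ X → (q :+ δ :- X) :+ (x :+ w :- q) := x :+ w :+ δ :- X) refl x
      w q δ (seq X n))
      (nonNeg-+ near₂ (nonNeg-const (diff q≤x′)))

module Grid (N : ℕ) (w : ℚ) (0<w : 0ℚ < w) (Nw≡1 : ιℕ N * w ≡ 1ℚ) (X : ℚ) where

  gridPoint : ℕ → ℚ
  gridPoint k = X + ιℕ k * w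

  gridPoint-suc : ∀ k → gridPoint (suc k) ≡ gridPoint k + w
  gridPoint-suc k = trans (cong (λ u → X + u * w) (ιℕ-suc k))
    (solve 3 (λ X k w → X :+ (k :+ con 1ℚ) :* w := X :+ k :* w :+ w) refl X (ιℕ k) w)

  gridPoint-first : gridPoint 0 ≡ X
  gridPoint-first = solve 2 (λ X w → X :+ con 0ℚ :* w := X) refl X w

  gridPoint-last : gridPoint N ≡ X + 1ℚ
  gridPoint-last = cong (λ u → X + u) Nw≡1

  gridPoint-lower : ∀ k → X ≤ gridPoint k
  gridPoint-lower k = lin (0≤ιℕ k ⊗ ℚ.<⇒≤ 0<w) (solve 3 (λ X k w → X :+ k :* w :- X := k :* w) refl X (ιℕ k) w)

  gridPoint-upper : ∀ {k} → k ℕ.≤ N → gridPoint k ≤ X + 1ℚ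
  gridPoint-upper {k} k≤N = subst (gridPoint k ≤_) gridPoint-last
    (lin (diff (ι-≤ {+ k} {+ N} (ℤ.+≤+ k≤N)) ⊗ ℚ.<⇒≤ 0<w)
      (solve 4 (λ X k N w → X :+ N :* w :- (X :+ k :* w) := (N :- k) :* w) refl X (ιℕ k) (ιℕ N) w))

  -- The trapezoid rule is exact for an affine gap; what is lost is the error s w, taken over a
  -- total width of 1.
  sum-inner : ∀ d s → Σ< N (λ k → innerValue d s w (gridPoint k)) ≡ ½ * (at d X + at d (X + 1ℚ)) - s * w
  sum-inner d@(mkLine c σ) s = begin
    Σ< N (λ k → innerValue d s w (gridPoint k))
      ≡⟨ Σ<-cong N (λ k _ → solve 6 (λ c σ s w X k →
           w :* (con ½ :* (c :+ σ :* (X :+ k :* w) :+ (c :+ σ :* (X :+ k :* w :+ w))) :- s :* w)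
           := w :* (con ½ :* (c :+ σ :* X :+ (c :+ σ :* (X :+ w))) :- s :* w) :+ k :* (w :* w :* σ)) refl c σ s w
             X (ιℕ k)) ⟩
    Σ< N (λ k → w * P + ιℕ k * (w * w * σ))
      ≡⟨ Σ<-arithmetic N (w * P) (w * w * σ) ⟩
    ιℕ N * (w * P) + ½ * (ιℕ N * (ιℕ N - 1ℚ)) * (w * w * σ)
      ≡⟨ solve 4 (λ N w P σ → N :* (w :* P) :+ con ½ :* (N :* (N :- con 1ℚ)) :* (w :* w :* σ)
           := N :* w :* P :+ con ½ :* (N :* w :* (N :* w) :- N :* w :* w) :* σ) refl (ιℕ N) w P σ ⟩
    ιℕ N * w * P + ½ * (ιℕ N * w * (ιℕ N * w) - ιℕ N * w * w) * σ
      ≡⟨ cong (λ u → u * P + ½ * (u * u - u * w) * σ) Nw≡1 ⟩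
    1ℚ * P + ½ * (1ℚ * 1ℚ - 1ℚ * w) * σ
      ≡⟨ solve 5 (λ c σ s w X → con 1ℚ :* (con ½ :* (c :+ σ :* X :+ (c :+ σ :* (X :+ w))) :- s :* w) :+ con ½ :*
        (con 1ℚ :* con 1ℚ :- con 1ℚ :* w) :* σ
           := con ½ :* (c :+ σ :* X :+ (c :+ σ :* (X :+ con 1ℚ))) :- s :* w) refl c σ s w X ⟩
    ½ * (at d X + at d (X + 1ℚ)) - s * w ∎
    where
    open ≡-Reasoning
    P = ½ * (at d X + at d (X + w)) - s * w

  -- The overlap δ = w² / 2 on both sides gives strips of width w (1 + w), so that N strips have
  -- total width 1 + w. An overlap of order w would not vanish in the limit.
  sum-outer : ∀ d s → Σ< N (λ k → outerValue d s w (w + (½ * (w * w) + ½ * (w * w))) (gridPoint k)) ≡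
    (1ℚ + w) * (½ * (at d X + at d (X + 1ℚ)) + s * (w + w * w))
  sum-outer d@(mkLine c σ) s = begin
    Σ< N (λ k → outerValue d s w (w + (½ * (w * w) + ½ * (w * w))) (gridPoint k))
      ≡⟨ Σ<-cong N (λ k _ → solve 6 (λ c σ s w X k →
           (w :+ (con ½ :* (w :* w) :+ con ½ :* (w :* w))) :* (con ½ :* (c :+ σ :* (X :+ k :* w) :+
             (c :+ σ :* (X :+ k :* w :+ w))) :+ s :* (w :+ (con ½ :* (w :* w) :+ con ½ :* (w :* w))))
           := w :* ((con 1ℚ :+ w) :* (con ½ :* (c :+ σ :* X :+ (c :+ σ :* (X :+ w))) :+ s :* (w :+ w :* w))) :+ k
             :* (w :* w :* ((con 1ℚ :+ w) :* σ))) refl c σ s w X (ιℕ k)) ⟩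
    Σ< N (λ k → w * P + ιℕ k * (w * w * ((1ℚ + w) * σ)))
      ≡⟨ Σ<-arithmetic N (w * P) (w * w * ((1ℚ + w) * σ)) ⟩
    ιℕ N * (w * P) + ½ * (ιℕ N * (ιℕ N - 1ℚ)) * (w * w * ((1ℚ + w) * σ))
      ≡⟨ solve 4 (λ N w P σ → N :* (w :* P) :+ con ½ :* (N :* (N :- con 1ℚ)) :* (w :* w :* σ)
           := N :* w :* P :+ con ½ :* (N :* w :* (N :* w) :- N :* w :* w) :* σ) refl (ιℕ N) w P ((1ℚ + w) * σ) ⟩
    ιℕ N * w * P + ½ * (ιℕ N * w * (ιℕ N * w) - ιℕ N * w * w) * ((1ℚ + w) * σ)
      ≡⟨ cong (λ u → u * P + ½ * (u * u - u * w) * ((1ℚ + w) * σ)) Nw≡1 ⟩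
    1ℚ * P + ½ * (1ℚ * 1ℚ - 1ℚ * w) * ((1ℚ + w) * σ)
      ≡⟨ solve 5 (λ c σ s w X → con 1ℚ :* ((con 1ℚ :+ w) :* (con ½ :* (c :+ σ :* X :+ (c :+ σ :* (X :+ w))) :+ s
        :* (w :+ w :* w)))
             :+ con ½ :* (con 1ℚ :* con 1ℚ :- con 1ℚ :* w) :* ((con 1ℚ :+ w) :* σ)
           := (con 1ℚ :+ w) :* (con ½ :* (c :+ σ :* X :+ (c :+ σ :* (X :+ con 1ℚ))) :+ s :* (w :+ w :* w))) refl c
             σ s w X ⟩
    (1ℚ + w) * (½ * (at d X + at d (X + 1ℚ)) + s * (w + w * w)) ∎
    where
    open ≡-Reasoning
    P = (1ℚ + w) * (½ * (at d X + at d (X + w)) + s * (w + w * w))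

  private
    X<X+1 : X < X + 1ℚ
    X<X+1 = lin< 0<1 (solve 1 (λ X → X :+ con 1ℚ :- X := con 1ℚ) refl X)

    mono : ∀ k → gridPoint k ≤ gridPoint (suc k)
    mono k = subst (gridPoint k ≤_) (sym (gridPoint-suc k))
      (lin (ℚ.<⇒≤ 0<w) (solve 2 (λ x w → x :+ w :- x := w) refl (gridPoint k) w))

  unit-inner : ∀ {S} u l s → SlopeBound s u → SlopeBound s l →
    HullQ S X (at u X) → HullQ S (X + 1ℚ) (at u (X + 1ℚ)) → HullQ S X (at l X) → HullQ S (X + 1ℚ) (at l (X + 1ℚ)) →
    Inscribed S X (X + 1ℚ) (½ * (at (gap u l) X + at (gap u l) (X + 1ℚ)) - s * w)
  unit-inner {S} u l s hu hl p₁ p₂ q₁ q₂ =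
    subst (Inscribed S X (X + 1ℚ)) (sum-inner (gap u l) s)
      (subst₂ (λ a b → Inscribed S a b (Σ< N v)) gridPoint-first gridPoint-last
        (stack-inner {S} gridPoint mono N v cell))
    where
    v : ℕ → ℚ
    v k = innerValue (gap u l) s w (gridPoint k)
    on : ∀ l → HullQ S X (at l X) → HullQ S (X + 1ℚ) (at l (X + 1ℚ)) → ∀ {k} → k ℕ.≤ N → HullQ S (gridPoint k)
      (at l (gridPoint k))
    on l p q {k} k≤N = hull-line l X<X+1 (gridPoint-lower k) (gridPoint-upper k≤N) p q
    cell : ∀ k → k ℕ.< N → Inscribed S (gridPoint k) (gridPoint (suc k)) (v k)
    cell k k<N = subst (λ b → Inscribed S (gridPoint k) b (v k)) (sym (gridPoint-suc k))
      (inner-cell u l s (gridPoint k) w 0<w hu hl (on u p₁ p₂ (ℕ.<⇒≤ k<N)) (next u (on u p₁ p₂ k<N))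
        (on l q₁ q₂ (ℕ.<⇒≤ k<N)) (next l (on l q₁ q₂ k<N)))
      where
      next : ∀ l → HullQ S (gridPoint (suc k)) (at l (gridPoint (suc k))) → HullQ S (gridPoint k + w)
        (at l (gridPoint k + w))
      next l = subst (λ x → HullQ S x (at l x)) (gridPoint-suc k)

  at-between : ∀ l → 0ℚ ≤ at l X → 0ℚ ≤ at l (X + 1ℚ) → ∀ {x} → X ≤ x → x ≤ X + 1ℚ → 0ℚ ≤ at l x
  at-between (mkLine c σ) p q {x} X≤x x≤ = lin ((diff x≤ ⊗ p) ⊕ (diff X≤x ⊗ q))
    (solve 4 (λ c σ X x → c :+ σ :* x :- con 0ℚ := (X :+ con 1ℚ :- x) :* (c :+ σ :* X) :+ (x :- X) :*
      (c :+ σ :* (X :+ con 1ℚ))) refl c σ X x)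

unit-outer : ∀ {S} N w (0<w : 0ℚ < w) → ιℕ (suc N) * w ≡ 1ℚ → ∀ X u l s → 0ℚ < s → SlopeBound s u → SlopeBound s l →
  0ℚ ≤ at (gap u l) X → 0ℚ ≤ at (gap u l) (X + 1ℚ) →
  (∀ x y → InHull S (x , y) → NonNeg (λ n → at u (seq x n) - seq y n)) →
  (∀ x y → InHull S (x , y) → NonNeg (λ n → seq y n - at l (seq x n))) →
  Covering S (½ * (w * w)) X (X + 1ℚ) ((1ℚ + w) * (½ * (at (gap u l) X + at (gap u l) (X + 1ℚ)) + s * (w + w * w)))
unit-outer {S} N w 0<w Nw≡1 X u l s 0<s hu hl g₁ g₂ below above =
  subst (Covering S (½ * (w * w)) X (X + 1ℚ)) (sum-outer (gap u l) s)
    (subst₂ (λ a b → Covering S (½ * (w * w)) a b (Σ< (suc N) v)) gridPoint-first gridPoint-last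
      (stack-outer {S} {½ * (w * w)} gridPoint N v cell))
  where
  open Grid (suc N) w 0<w Nw≡1 X
  v : ℕ → ℚ
  v k = outerValue (gap u l) s w (w + (½ * (w * w) + ½ * (w * w))) (gridPoint k)
  cell : ∀ k → k ℕ.< suc N → Covering S (½ * (w * w)) (gridPoint k) (gridPoint (suc k)) (v k)
  cell k k<N = subst (λ b → Covering S (½ * (w * w)) (gridPoint k) b (v k)) (sym (gridPoint-suc k))
    (outer-cell u l s (gridPoint k) w (½ * (w * w)) 0<w (half-pos (*-pos 0<w 0<w)) 0<s hu hl
      (at-between (gap u l) g₁ g₂ (gridPoint-lower k) (gridPoint-upper (ℕ.<⇒≤ k<N)))
      (subst (λ x → 0ℚ ≤ at (gap u l) x) (gridPoint-suc k)
        (at-between (gap u l) g₁ g₂ (gridPoint-lower (suc k)) (gridPoint-upper k<N)))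
      below above)

neg : Line → Line
neg l = mkLine (- intercept l) (- slope l)

at-neg : ∀ l x → at (neg l) x ≡ - at l x
at-neg (mkLine c σ) x = solve 3 (λ c σ x → :- c :+ :- σ :* x := :- (c :+ σ :* x)) refl c σ x

-- Stated for all `t` above `s`, so that the upper and the lower boundary can share the sum of their
-- bounds.
slopeBound : ∀ (f : ℕ → Line) n → Σ[ s ∈ ℚ ] 0ℚ < s × (∀ i → i ℕ.< n → ∀ {t} → s ≤ t → SlopeBound t (f i) ×
  SlopeBound t (neg (f i)))
slopeBound f zero    = 1ℚ , 0<1 , λ _ ()
slopeBound f (suc n) with slopeBound (f ∘ suc) n
... | s , 0<s , h = s + ∣ σ ∣ , ℚ.+-mono-<-≤ 0<s (ℚ.0≤∣p∣ σ) , bound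
  where
  σ = slope (f 0)
  bound : ∀ i → i ℕ.< suc n → ∀ {t} → s + ∣ σ ∣ ≤ t → SlopeBound t (f i) × SlopeBound t (neg (f i))
  bound (suc i) (ℕ.s≤s i<n) s≤t = h i i<n (ℚ.≤-trans (lin (ℚ.0≤∣p∣ σ) (solve 2 (λ s a → s :+ a :- s := a) refl s ∣
    σ ∣)) s≤t)
  bound zero _ {t} s≤t = (lower , upper) , (ℚ.neg-antimono-≤ upper , subst (- σ ≤_) (solve 1 (λ t → :- (:- t) :=
    t) refl t) (ℚ.neg-antimono-≤ lower))
    where
    0≤s = ℚ.<⇒≤ 0<s
    upper : σ ≤ t
    upper = lin (0≤s ⊕ diff (p≤∣p∣ σ) ⊕ diff s≤t) (solve 4 (λ s a σ t → t :- σ := s :+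
      ((a :- σ) :+ (t :- (s :+ a)))) refl s ∣ σ ∣ σ t)
    lower : - t ≤ σ
    lower = lin (0≤s ⊕ diff (-p≤∣p∣ σ) ⊕ diff s≤t) (solve 4 (λ s a σ t → σ :- (:- t) := s :+ ((a :- (:- σ)) :+
      (t :- (s :+ a)))) refl s ∣ σ ∣ σ t)

InRange : List Cell → ℚ → ℕ → Set
InRange cs X a = ∀ {p q} → (p , q) ∈ cs → X ≤ ι p × ι (ℤ.suc p) ≤ X + ιℕ a

-- The lower line passes below the bottom corner that lies one unit under each top corner. This
-- makes the gap between the boundaries nonnegative at attained points.
below-corner : ∀ {cs} l → Above (map flip cs) l → ∀ {x y} → TopCorner cs x y → at (neg l) (ι x) ≤ ι y
below-corner {cs} l above p = corner p
  where
  bound : ∀ x q → ι (ℤ.suc (ℤ.- (ℤ.suc q))) ≤ at l (ι x) → at (neg l) (ι x) ≤ ι (ℤ.suc q)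
  bound x q h = lin (diff h ⊕ 0≤1) (begin
    ι (ℤ.suc q) - at (neg l) (ι x)      ≡⟨ cong₂ _-_ (ι-suc q) (at-neg l (ι x)) ⟩
    ι q + 1ℚ - (- at l (ι x))           ≡⟨ cong (λ u → u + 1ℚ - (- at l (ι x))) (ι-suc-flip q) ⟩
    - q′ + 1ℚ - (- at l (ι x))          ≡⟨ solve 2 (λ q a → :- q :+ con 1ℚ :- (:- a) := (a :- q) :+ con 1ℚ) refl
      q′ (at l (ι x)) ⟩
    (at l (ι x) - q′) + 1ℚ              ∎)
    where
    open ≡-Reasoning
    q′ = ι (ℤ.suc (ℤ.- (ℤ.suc q)))
  corner : ∀ {x y} → TopCorner cs x y → at (neg l) (ι x) ≤ ι y
  corner (topLeft {x} {q} m)  = bound x q (above (topLeft (∈-map⁺ flip m)))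
  corner (topRight {x} {q} m) = bound (ℤ.suc x) q (above (topRight (∈-map⁺ flip m)))

eventually-nonNeg : ∀ {s} → Eventually (λ n → 0ℚ ≤ s n) → NonNeg s
eventually-nonNeg h ε 0<ε = eventually₁ (λ n → ℚ.<-≤-trans (neg-< 0<ε)) h

-- A late term of the sequence is within δ of `x`. If it falls outside [l, r], the nearer end is
-- used instead, which is no farther from `x` because `x` itself lies in [l, r].
approximate : ∀ x l r δ → 0ℚ < δ → l ≤ r → NonNeg (λ n → seq x n - l) → NonNeg (λ n → r - seq x n) →
  Σ[ q ∈ ℚ ] l ≤ q × q ≤ r × NonNeg (λ n → seq x n - (q - δ)) × NonNeg (λ n → q + δ - seq x n)
approximate x l r δ 0<δ l≤r l≤x x≤r with cauchy x δ 0<δ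
... | M , h = choose (ℚ._≤?_ l q) (ℚ._≤?_ q r)
  where
  q = seq x M
  near₁ : NonNeg (λ n → seq x n - (q - δ))
  near₁ = eventually-nonNeg (M , λ n M≤n → subst (0ℚ ≤_)
    (solve 3 (λ x q δ → x :- q :- (:- δ) := x :- (q :- δ)) refl (seq x n) q δ)
      (diff (ℚ.<⇒≤ (proj₁ (abs-<⁻ (h n M M≤n ℕ.≤-refl))))))
  near₂ : NonNeg (λ n → q + δ - seq x n)
  near₂ = eventually-nonNeg (M , λ n M≤n → subst (0ℚ ≤_)
    (solve 3 (λ x q δ → δ :- (x :- q) := q :+ δ :- x) refl (seq x n) q δ)
      (diff (ℚ.<⇒≤ (proj₂ (abs-<⁻ (h n M M≤n ℕ.≤-refl))))))
  choose : Dec (l ≤ q) → Dec (q ≤ r) → Σ[ q ∈ ℚ ] l ≤ q × q ≤ r × NonNeg (λ n → seq x n - (q - δ)) × NonNeg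
    (λ n → q + δ - seq x n)
  choose (yes l≤q) (yes q≤r) = q , l≤q , q≤r , near₁ , near₂
  choose (no l≰q) _ = l , ℚ.≤-refl , l≤r ,
    nonNeg-resp (λ n → solve 3 (λ x l δ → (x :- l) :+ δ := x :- (l :- δ)) refl (seq x n) l δ)
      (nonNeg-+ l≤x (nonNeg-const (ℚ.<⇒≤ 0<δ))) ,
    nonNeg-resp (λ n → solve 4 (λ x l q δ → (q :+ δ :- x) :+ (l :- q) := l :+ δ :- x) refl (seq x n) l q δ)
      (nonNeg-+ near₂ (nonNeg-const (diff (ℚ.<⇒≤ (ℚ.≰⇒> l≰q)))))
  choose (yes _) (no q≰r) = r , l≤r , ℚ.≤-refl ,
    nonNeg-resp (λ n → solve 4 (λ x r q δ → (x :- (q :- δ)) :+ (q :- r) := x :- (r :- δ)) refl (seq x n) r q δ)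
      (nonNeg-+ near₁ (nonNeg-const (diff (ℚ.<⇒≤ (ℚ.≰⇒> q≰r))))) ,
    nonNeg-resp (λ n → solve 3 (λ x r δ → (r :- x) :+ δ := r :+ δ :- x) refl (seq x n) r δ)
      (nonNeg-+ x≤r (nonNeg-const (ℚ.<⇒≤ 0<δ)))

HullArea : List Cell → ℤ → Set
HullArea cs z = HasArea (convexHull (unionOf cs)) (fromℤ z /2)

module CapArea {cs X b z z′} (U : Cap cs X (suc b) z) (L : Cap (map flip cs) X (suc b) z′) (range : InRange cs X (suc b)) where

  private
    a = suc b
    S = unionOf cs
    module U = Cap U
    module L = Cap L

    lower : ℕ → Line
    lower i = neg (L.line i)

    gapLine : ℕ → Line
    gapLine i = gap (U.line i) (lower i)

    mean : ℕ → ℚ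
    mean i = ½ * (at (gapLine i) (X + ιℕ i) + at (gapLine i) (X + ιℕ (suc i)))

    A : ℚ
    A = ½ * (ι z + ι z′)

    sum-mean : Σ< a mean ≡ A
    sum-mean = begin
      Σ< a mean
        ≡⟨ Σ<-cong a (λ i _ → mean≡ (U.line i) (L.line i) (X + ιℕ i) (X + ιℕ (suc i))) ⟩
      Σ< a (λ i → ½ * (f i + g i) + 0ℚ)       ≡⟨ Σ<-affine a ½ (λ i → f i + g i) 0ℚ ⟩
      ½ * Σ< a (λ i → f i + g i) + ιℕ a * 0ℚ  ≡⟨ cong (λ u → ½ * u + ιℕ a * 0ℚ) (trans (Σ<-+ a f g)
        (cong₂ _+_ U.total L.total)) ⟩
      ½ * (ι z + ι z′) + ιℕ a * 0ℚ            ≡⟨ solve 2 (λ u a → u :+ a :* con 0ℚ := u) refl (½ * (ι z + ι z′))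
        (ιℕ a) ⟩
      ½ * (ι z + ι z′)                        ∎
      where
      open ≡-Reasoning
      f g : ℕ → ℚ
      f i = at (U.line i) (X + ιℕ i) + at (U.line i) (X + ιℕ (suc i))
      g i = at (L.line i) (X + ιℕ i) + at (L.line i) (X + ιℕ (suc i))
      mean≡ : ∀ u l x y → ½ * (at (gap u (neg l)) x + at (gap u (neg l)) y) ≡ ½ * ((at u x + at u y) +
        (at l x + at l y)) + 0ℚ
      mean≡ (mkLine c σ) (mkLine c′ σ′) x y = solve 6 (λ c σ c′ σ′ x y →
        con ½ :* ((c :- (:- c′)) :+ (σ :- (:- σ′)) :* x :+ ((c :- (:- c′)) :+ (σ :- (:- σ′)) :* y))
        := con ½ :* ((c :+ σ :* x :+ (c :+ σ :* y)) :+ (c′ :+ σ′ :* x :+ (c′ :+ σ′ :* y))) :+ con 0ℚ) refl c σ c′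
          σ′ x y

    step : ∀ i → X + ιℕ (suc i) ≡ X + ιℕ i + 1ℚ
    step i = trans (cong (λ u → X + u) (ιℕ-suc i)) (sym (ℚ.+-assoc X (ιℕ i) 1ℚ))

    gap-nonNeg : ∀ u l {x} → at l x ≤ at u x → 0ℚ ≤ at (gap u l) x
    gap-nonNeg (mkLine c σ) (mkLine c′ σ′) {x} h = lin (diff h)
      (solve 5 (λ c σ c′ σ′ x → (c :- c′) :+ (σ :- σ′) :* x :- con 0ℚ := (c :+ σ :* x) :- (c′ :+ σ′ :* x)) refl c
        σ c′ σ′ x)

    gapLeft : ∀ i → i ℕ.< a → 0ℚ ≤ at (gapLine i) (X + ιℕ i)
    gapLeft i i<a = gap-nonNeg (U.line i) (lower i) (attained-≥ (lower i) (U.leftEnd i i<a)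
      (below-corner (L.line i) (L.above i i<a)))

    gapRight : ∀ i → i ℕ.< a → 0ℚ ≤ at (gapLine i) (X + ιℕ (suc i))
    gapRight i i<a = gap-nonNeg (U.line i) (lower i) (attained-≥ (lower i) (U.rightEnd i i<a)
      (below-corner (L.line i) (L.above i i<a)))

    lowerHull : ∀ l {x} → Attained (map flip cs) x (at l x) → HullQ S x (at (neg l) x)
    lowerHull l {x} h = subst (HullQ S x) (sym (at-neg l x)) (attained-hull-flip h)

    sU = slopeBound U.line a
    sL = slopeBound L.line a

    s : ℚ
    s = proj₁ sU + proj₁ sL

    0<s : 0ℚ < s
    0<s = ℚ.+-mono-< (proj₁ (proj₂ sU)) (proj₁ (proj₂ sL))

    boundU : ∀ i → i ℕ.< a → SlopeBound s (U.line i)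
    boundU i i<a = proj₁ (proj₂ (proj₂ sU) i i<a
      (lin (ℚ.<⇒≤ (proj₁ (proj₂ sL))) (solve 2 (λ a b → a :+ b :- a := b) refl (proj₁ sU) (proj₁ sL))))

    boundL : ∀ i → i ℕ.< a → SlopeBound s (lower i)
    boundL i i<a = proj₂ (proj₂ (proj₂ sL) i i<a
      (lin (ℚ.<⇒≤ (proj₁ (proj₂ sU))) (solve 2 (λ a b → a :+ b :- b := a) refl (proj₁ sU) (proj₁ sL))))

    column-inner : ∀ {N w} → 0ℚ < w → ιℕ N * w ≡ 1ℚ → ∀ i → i ℕ.< a → Inscribed S (X + ιℕ i) (X + ιℕ (suc i))
      (mean i - s * w)
    column-inner {N} {w} 0<w Nw≡1 i i<a = subst (λ x → Inscribed S (X + ιℕ i) x (½ * (at (gapLine i) (X + ιℕ i) +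
      at (gapLine i) x) - s * w)) (sym (step i))
      (Grid.unit-inner N w 0<w Nw≡1 (X + ιℕ i) {S} (U.line i) (lower i) s (boundU i i<a) (boundL i i<a)
        (attained-hull (U.leftEnd i i<a))
        (subst (λ x → HullQ S x (at (U.line i) x)) (step i) (attained-hull (U.rightEnd i i<a)))
        (lowerHull (L.line i) (L.leftEnd i i<a))
        (subst (λ x → HullQ S x (at (lower i) x)) (step i) (lowerHull (L.line i) (L.rightEnd i i<a))))

    column-outer : ∀ {N w} → 0ℚ < w → ιℕ (suc N) * w ≡ 1ℚ → ∀ i → i ℕ.< a →
      Covering S (½ * (w * w)) (X + ιℕ i) (X + ιℕ (suc i)) ((1ℚ + w) * (mean i + s * (w + w * w)))
    column-outer {N} {w} 0<w Nw≡1 i i<a = subst (λ x → Covering S (½ * (w * w)) (X + ιℕ i) x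
      ((1ℚ + w) * (½ * (at (gapLine i) (X + ιℕ i) + at (gapLine i) x) + s * (w + w * w)))) (sym (step i))
      (unit-outer N w 0<w Nw≡1 (X + ιℕ i) (U.line i) (lower i) s 0<s (boundU i i<a) (boundL i i<a) (gapLeft i i<a)
        (subst (λ x → 0ℚ ≤ at (gapLine i) x) (step i) (gapRight i i<a))
        (λ x y → hull-below {y = y} (U.line i) (U.above i i<a))
        (λ x y h → nonNeg-resp (λ n → trans (solve 2 (λ a y → a :+ y := y :- (:- a)) refl (at (L.line i)
          (seq x n)) (seq y n))
            (cong (λ u → seq y n - u) (sym (at-neg (L.line i) (seq x n)))))
          (hull-above {y = y} (L.line i) (L.above i i<a) h)))

    α≡ : ∀ n → seq (fromℤ (z ℤ.+ z′) /2) n ≡ A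
    α≡ n = cong (½ *_) (ι-+ z z′)

    -- The inscribed boxes lose a s w. The covering boxes gain w A + a s w (1 + w)², which is at
    -- most w (∣A∣ + 4 a s) for w ≤ 1. So `w * C` bounds both errors.
    C : ℚ
    C = ∣ A ∣ + (1ℚ + 1ℚ + 1ℚ + 1ℚ) * (ιℕ a * s)

    0≤as : 0ℚ ≤ ιℕ a * s
    0≤as = 0≤ιℕ a ⊗ ℚ.<⇒≤ 0<s

    innerTotal : ∀ w → Σ< a (λ i → mean i - s * w) ≡ A + ιℕ a * (- (s * w))
    innerTotal w = trans (Σ<-cong a (λ i _ → solve 2 (λ m u → m :- u := con 1ℚ :* m :+ (:- u)) refl (mean i) (s * w)))
      (trans (Σ<-affine a 1ℚ mean (- (s * w))) (cong (λ u → u + ιℕ a * (- (s * w)))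
        (trans (ℚ.*-identityˡ (Σ< a mean)) sum-mean)))

    inner-bound : ∀ ε w t → 0ℚ < w → w * C ≤ ε → Σ< a (λ i → mean i - s * w) ≤ t → A ≤ t + ε
    inner-bound ε w t 0<w small t≤ =
      lin (diff (subst (_≤ t) (innerTotal w) t≤) ⊕ diff small ⊕ (ℚ.<⇒≤ 0<w ⊗ (ℚ.0≤∣p∣ A ⊕ ((0≤1 ⊕ 0≤1 ⊕ 0≤1) ⊗
        0≤as))))
        (solve 7 (λ A t ε a s w B → t :+ ε :- A := (t :- (A :+ a :* (:- (s :* w)))) :+
           ((ε :- w :* (B :+ (con 1ℚ :+ con 1ℚ :+ con 1ℚ :+ con 1ℚ) :* (a :* s))) :+ w :*
             (B :+ (con 1ℚ :+ (con 1ℚ :+ con 1ℚ)) :* (a :* s)))) refl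
           A t ε (ιℕ a) s w ∣ A ∣)

    outerTotal : ∀ w → Σ< a (λ i → (1ℚ + w) * (mean i + s * (w + w * w))) ≡ (1ℚ + w) * A + ιℕ a *
      ((1ℚ + w) * (s * (w + w * w)))
    outerTotal w = trans (Σ<-cong a (λ i _ → ℚ.*-distribˡ-+ (1ℚ + w) (mean i) (s * (w + w * w))))
      (trans (Σ<-affine a (1ℚ + w) mean ((1ℚ + w) * (s * (w + w * w)))) (cong (λ u → (1ℚ + w) * u + ιℕ a *
        ((1ℚ + w) * (s * (w + w * w)))) sum-mean))

    outer-bound : ∀ ε w t → 0ℚ < w → w ≤ 1ℚ → w * C ≤ ε → t ≤ Σ< a (λ i → (1ℚ + w) * (mean i + s * (w + w * w))) →
      t ≤ A + ε
    outer-bound ε w t 0<w w≤1 small ≤t =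
      lin (diff (subst (t ≤_) (outerTotal w) ≤t) ⊕ diff small ⊕ (0≤w ⊗ diff (p≤∣p∣ A)) ⊕
          (0≤w ⊗ 0≤as ⊗ diff w≤1 ⊗ ((0≤1 ⊕ 0≤1 ⊕ 0≤1) ⊕ 0≤w)))
        (solve 7 (λ A t ε a s w B → A :+ ε :- t :=
           ((con 1ℚ :+ w) :* A :+ a :* ((con 1ℚ :+ w) :* (s :* (w :+ w :* w))) :- t) :+
           ((ε :- w :* (B :+ (con 1ℚ :+ con 1ℚ :+ con 1ℚ :+ con 1ℚ) :* (a :* s))) :+
           (w :* (B :- A) :+ w :* ((a :* s) :* ((con 1ℚ :- w) :* ((con 1ℚ :+ (con 1ℚ :+ con 1ℚ)) :+ w)))))) refl
           A t ε (ιℕ a) s w ∣ A ∣)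
      where 0≤w = ℚ.<⇒≤ 0<w

    inner : ∀ ε w → 0ℚ < w → w * C ≤ ε → Inscribed S (X + ιℕ 0) (X + ιℕ a) (Σ< a (λ i → mean i - s * w)) →
      ∃[ bs ] AllPairs NonOverlapping bs × All (λ b → boxRegion b ⊆ convexHull S) bs ×
              (fromℤ (z ℤ.+ z′) /2) ≤ʳ fromℚ (totalArea bs + ε)
    inner ε w 0<w small (bs , ns , as , t≤) = bs , ns , All.map (λ (i , _) {p} q → combination (i {p} q)) as ,
      nonNeg⇒≤ {fromℤ (z ℤ.+ z′) /2} {fromℚ (totalArea bs + ε)} (nonNeg-resp
        (λ n → cong (λ u → totalArea bs + ε - u) (sym (α≡ n)))
        (nonNeg-const (diff (inner-bound ε w (totalArea bs) 0<w small t≤))))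

    outer : ∀ ε w → 0ℚ < w → w ≤ 1ℚ → w * C ≤ ε →
      Covering S (½ * (w * w)) (X + ιℕ 0) (X + ιℕ a) (Σ< a (λ i → (1ℚ + w) * (mean i + s * (w + w * w)))) →
      ∃[ bs ] (convexHull S ⊆ (λ p → Any (λ b → boxRegion b p) bs)) × fromℚ (totalArea bs) ≤ʳ (fromℤ (z ℤ.+ z′)
        /2) +ʳ fromℚ ε
    outer ε w 0<w w≤1 small (bs , cov , ≤t) = bs , (λ {p} h → cover (proj₁ p) (proj₂ p) h) ,
      nonNeg⇒≤ {fromℚ (totalArea bs)} {(fromℤ (z ℤ.+ z′) /2) +ʳ fromℚ ε} (nonNeg-resp
        (λ n → cong (λ u → u + ε - totalArea bs) (sym (α≡ n)))
        (nonNeg-const (diff (outer-bound ε w (totalArea bs) 0<w w≤1 small ≤t))))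
      where
      cover : ∀ x y → convexHull S (x , y) → Any (λ b → boxRegion b (x , y)) bs
      cover x y h = finish (approximate x (X + ιℕ 0) (X + ιℕ a) (½ * (w * w)) (half-pos (*-pos 0<w 0<w))
          (lin (0≤ιℕ a) (solve 2 (λ X a → X :+ a :- (X :+ con 0ℚ) := a) refl X (ιℕ a)))
          (hull-right-of {x = x} {y} (X + ιℕ 0) (λ {p} m → subst (_≤ ι p) (sym (ℚ.+-identityʳ X))
            (proj₁ (range m))) (inHull h))
          (hull-left-of {x = x} {y} (X + ιℕ a) (λ m → proj₂ (range m)) (inHull h)))
        where
        finish : (Σ[ q ∈ ℚ ] X + ιℕ 0 ≤ q × q ≤ X + ιℕ a × NonNeg (λ n → seq x n - (q - ½ * (w * w))) × NonNeg
          (λ n → q + ½ * (w * w) - seq x n)) →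
                 Any (λ b → boxRegion b (x , y)) bs
        finish (q , l≤q , q≤r , near₁ , near₂) = cov x y (inHull h) q l≤q q≤r near₁ near₂

    mono : ∀ i → X + ιℕ i ≤ X + ιℕ (suc i)
    mono i = subst (X + ιℕ i ≤_) (sym (step i)) (lin 0≤1 (solve 1 (λ x → x :+ con 1ℚ :- x := con 1ℚ) refl (X + ιℕ i)))

  hullArea : HullArea cs (z ℤ.+ z′)
  hullArea ε 0<ε = squeeze (small-reciprocal C ε (ℚ.0≤∣p∣ A ⊕ ((0≤1 ⊕ 0≤1 ⊕ 0≤1 ⊕ 0≤1) ⊗ 0≤as)) 0<ε)
    where
    squeeze : (Σ[ N ∈ ℕ ] Σ[ w ∈ ℚ ] 0ℚ < w × w ≤ 1ℚ × ιℕ (suc N) * w ≡ 1ℚ × w * C ≤ ε) →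
      (∃[ bs ] AllPairs NonOverlapping bs × All (λ b → boxRegion b ⊆ convexHull S) bs ×
        (fromℤ (z ℤ.+ z′) /2) ≤ʳ fromℚ (totalArea bs + ε)) ×
      (∃[ bs ] (convexHull S ⊆ (λ p → Any (λ b → boxRegion b p) bs)) × fromℚ (totalArea bs) ≤ʳ (fromℤ (z ℤ.+ z′)
        /2) +ʳ fromℚ ε)
    squeeze (N , w , 0<w , w≤1 , Nw≡1 , small) =
      inner ε w 0<w small (stack-inner {S} (λ i → X + ιℕ i) mono a (λ i → mean i - s * w) (column-inner {suc N}
        0<w Nw≡1)) ,
      outer ε w 0<w w≤1 small (stack-outer {S} {½ * (w * w)} (λ i → X + ιℕ i) b (λ i → (1ℚ + w) *
        (mean i + s * (w + w * w))) (column-outer {N} 0<w Nw≡1))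

-- Lattice chains and gift wrapping

infixr 6 _⊕ᶻ_
infixr 7 _⊗ᶻ_

_⊕ᶻ_ : ∀ {i j} → + 0 ℤ.≤ i → + 0 ℤ.≤ j → + 0 ℤ.≤ i ℤ.+ j
_⊕ᶻ_ = ℤ.+-mono-≤

_⊗ᶻ_ : ∀ {i j} → + 0 ℤ.≤ i → + 0 ℤ.≤ j → + 0 ℤ.≤ i ℤ.* j
_⊗ᶻ_ {i} {+ j} 0≤i (ℤ.+≤+ _) = ℤ.*-monoʳ-≤-nonNeg (+ j) 0≤i

diffᶻ : ∀ {i j} → i ℤ.≤ j → + 0 ℤ.≤ j ℤ.- i
diffᶻ = ℤ.i≤j⇒0≤j-i

linᶻ : ∀ {i j d} → + 0 ℤ.≤ d → j ℤ.- i ≡ d → i ℤ.≤ j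
linᶻ 0≤d eq = ℤ.0≤i-j⇒j≤i (subst (+ 0 ℤ.≤_) (sym eq) 0≤d)

above-difference : ∀ {x z} → x ℤ.< z → Σ[ d ∈ ℕ ] z ≡ x ℤ.+ + suc d
above-difference {x} {z} x<z = ℤ.∣ z ℤ.- ℤ.suc x ∣ , (begin
  z                                             ≡⟨ solveᶻ 2 (λ x z → z :=ᶻ x :+ᶻ (conᶻ (+ 1) :+ᶻ
    (z :-ᶻ (conᶻ (+ 1) :+ᶻ x)))) refl x z ⟩
  x ℤ.+ (+ 1 ℤ.+ (z ℤ.- ℤ.suc x))               ≡⟨ cong (λ u → x ℤ.+ (+ 1 ℤ.+ u))
    (sym (ℤ.0≤i⇒+∣i∣≡i (diffᶻ (ℤ.i<j⇒suc[i]≤j x<z)))) ⟩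
  x ℤ.+ + suc ℤ.∣ z ℤ.- ℤ.suc x ∣               ∎)
  where open ≡-Reasoning

catℕ : ∀ {A : Set} → ℕ → (ℕ → A) → (ℕ → A) → ℕ → A
catℕ zero    f g i       = g i
catℕ (suc d) f g zero    = f zero
catℕ (suc d) f g (suc i) = catℕ d (f ∘ suc) g i

catℕ-∀ : ∀ {A : Set} (P : ℕ → A → Set) d {a f g} → (∀ i → i ℕ.< d → P i (f i)) → (∀ i → i ℕ.< a → P (d ℕ.+ i) (g i)) →
         ∀ i → i ℕ.< d ℕ.+ a → P i (catℕ d f g i)
catℕ-∀ P zero    pf pg i       i<             = pg i i<
catℕ-∀ P (suc d) pf pg zero    i<             = pf zero (ℕ.s≤s ℕ.z≤n)
catℕ-∀ P (suc d) pf pg (suc i) (ℕ.s≤s i<) = catℕ-∀ (P ∘ suc) d (λ i i<d → pf (suc i) (ℕ.s≤s i<d)) pg i i<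

Σ<-cat : ∀ {A : Set} (h : ℕ → A → ℚ) d a f g →
         Σ< (d ℕ.+ a) (λ i → h i (catℕ d f g i)) ≡ Σ< d (λ i → h i (f i)) + Σ< a (λ i → h (d ℕ.+ i) (g i))
Σ<-cat h zero    a f g = sym (ℚ.+-identityˡ (Σ< a (λ i → h i (g i))))
Σ<-cat h (suc d) a f g = trans (cong (λ u → h 0 (f 0) + u) (Σ<-cat (h ∘ suc) d a (f ∘ suc) g))
  (sym (ℚ.+-assoc (h 0 (f 0)) (Σ< d (λ i → h (suc i) (f (suc i)))) (Σ< a (λ i → h (suc (d ℕ.+ i)) (g i)))))

ιℕ-+ : ∀ m n → ιℕ (m ℕ.+ n) ≡ ιℕ m + ιℕ n
ιℕ-+ m n = trans (cong ι (ℤ.pos-+ m n)) (ι-+ (+ m) (+ n))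

cap-++ : ∀ {cs X d a z z′} → Cap cs X d z → Cap cs (X + ιℕ d) a z′ → Cap cs X (d ℕ.+ a) (z ℤ.+ z′)
cap-++ {cs} {X} {d} {a} {z} {z′} C D = record
  { line     = catℕ d C.line D.line
  ; above    = λ i i< → proj₁ (fits i i<)
  ; leftEnd  = λ i i< → proj₁ (proj₂ (fits i i<))
  ; rightEnd = λ i i< → proj₂ (proj₂ (fits i i<))
  ; total    = begin
      Σ< (d ℕ.+ a) (λ i → h i (catℕ d C.line D.line i))                ≡⟨ Σ<-cat h d a C.line D.line ⟩
      Σ< d (λ i → h i (C.line i)) + Σ< a (λ i → h (d ℕ.+ i) (D.line i))
        ≡⟨ cong₂ _+_ C.total (trans (Σ<-cong a (λ i _ → cong₂ (λ x y → at (D.line i) x + at (D.line i) y)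
          (shift i) (shift′ i))) D.total) ⟩
      ι z + ι z′                                                        ≡⟨ sym (ι-+ z z′) ⟩
      ι (z ℤ.+ z′)                                                      ∎ }
  where
  open ≡-Reasoning
  module C = Cap C
  module D = Cap D
  h : ℕ → Line → ℚ
  h i l = at l (X + ιℕ i) + at l (X + ιℕ (suc i))
  shift : ∀ i → X + ιℕ (d ℕ.+ i) ≡ X + ιℕ d + ιℕ i
  shift i = trans (cong (λ u → X + u) (ιℕ-+ d i)) (sym (ℚ.+-assoc X (ιℕ d) (ιℕ i)))
  shift′ : ∀ i → X + ιℕ (suc (d ℕ.+ i)) ≡ X + ιℕ d + ιℕ (suc i)
  shift′ i = trans (cong (λ k → X + ιℕ k) (sym (ℕ.+-suc d i))) (shift (suc i))
  P : ℕ → Line → Set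
  P i l = Above cs l × Attained cs (X + ιℕ i) (at l (X + ιℕ i)) × Attained cs (X + ιℕ (suc i)) (at l (X + ιℕ (suc i)))
  fits : ∀ i → i ℕ.< d ℕ.+ a → P i (catℕ d C.line D.line i)
  fits = catℕ-∀ P d (λ i i< → C.above i i< , C.leftEnd i i< , C.rightEnd i i<)
    (λ i i< → D.above i i< , subst (λ x → Attained cs x (at (D.line i) x)) (sym (shift i)) (D.leftEnd i i<) ,
      subst (λ x → Attained cs x (at (D.line i) x)) (sym (shift′ i)) (D.rightEnd i i<))

-- All columns below one edge share its line. Summing over the whole edge turns the slope e / (d +
-- 1) into the integer `e`, which is why the total is an integer although single columns need not
-- be.
segment-cap : ∀ {cs x y} d e → TopCorner cs x y → TopCorner cs (x ℤ.+ + suc d) (y ℤ.+ e) →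
  (∀ {p q} → TopCorner cs p q → + suc d ℤ.* (q ℤ.- y) ℤ.≤ e ℤ.* (p ℤ.- x)) →
  Cap cs (ι x) (suc d) (+ suc d ℤ.* (y ℤ.+ (y ℤ.+ e)))
segment-cap {cs} {x} {y} d e from to support = record
  { line = λ _ → l ; above = λ _ _ → above
  ; leftEnd = λ i i< → attained i (ℕ.<⇒≤ i<) ; rightEnd = λ i i< → attained (suc i) i<
  ; total = begin
      Σ< n (λ i → at l (ι x + ιℕ i) + at l (ι x + ιℕ (suc i)))
        ≡⟨ Σ<-cong n (λ i _ → trans (cong (λ u → at l (ι x + ιℕ i) + at l (ι x + u)) (ιℕ-suc i))
             (solve 4 (λ X Y σ i → (Y :- σ :* X) :+ σ :* (X :+ i) :+ ((Y :- σ :* X) :+ σ :* (X :+ (i :+ con 1ℚ)))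
               := (Y :+ Y :+ σ) :+ i :* (σ :+ σ)) refl (ι x) (ι y) σ (ιℕ i))) ⟩
      Σ< n (λ i → (ι y + ι y + σ) + ιℕ i * (σ + σ))
        ≡⟨ Σ<-arithmetic n (ι y + ι y + σ) (σ + σ) ⟩
      ιℕ n * (ι y + ι y + σ) + ½ * (ιℕ n * (ιℕ n - 1ℚ)) * (σ + σ)
        ≡⟨ solve 4 (λ n y E r → n :* (y :+ y :+ E :* r) :+ con ½ :* (n :* (n :- con 1ℚ)) :* (E :* r :+ E :* r)
             := n :* (y :+ (y :+ E :* (r :* n)))) refl (ιℕ n) (ι y) (ι e) r ⟩
      ιℕ n * (ι y + (ι y + ι e * (r * ιℕ n)))
        ≡⟨ cong (λ u → ιℕ n * (ι y + (ι y + u))) (trans (cong (ι e *_) rn≡1) (ℚ.*-identityʳ (ι e))) ⟩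
      ιℕ n * (ι y + (ι y + ι e))
        ≡⟨ cong (λ u → ιℕ n * u) (trans (cong (λ u → ι y + u) (sym (ι-+ y e))) (sym (ι-+ y (y ℤ.+ e)))) ⟩
      ιℕ n * ι (y ℤ.+ (y ℤ.+ e))
        ≡⟨ sym (ι-* (+ n) (y ℤ.+ (y ℤ.+ e))) ⟩
      ι (+ n ℤ.* (y ℤ.+ (y ℤ.+ e))) ∎ }
  where
  open ≡-Reasoning
  n = suc d
  0<n : 0ℚ < ιℕ n
  0<n = ι-< {+ 0} {+ n} (ℤ.+<+ (ℕ.s≤s ℕ.z≤n))
  r = proj₁ (inverse (ιℕ n) 0<n)
  0≤r = ℚ.<⇒≤ (proj₁ (proj₂ (inverse (ιℕ n) 0<n)))
  rn≡1 = proj₂ (proj₂ (inverse (ιℕ n) 0<n))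
  σ = ι e * r
  l = mkLine (ι y - σ * ι x) σ
  above : Above cs l
  above {p} {q} c = lin (0≤r ⊗ diff (ι-≤ (support c))) (sym (begin
    r * (ι (e ℤ.* (p ℤ.- x)) - ι (+ n ℤ.* (q ℤ.- y)))
      ≡⟨ cong₂ (λ u v → r * (u - v)) (trans (ι-* e (p ℤ.- x)) (cong (ι e *_) (ι-minus p x)))
           (trans (ι-* (+ n) (q ℤ.- y)) (cong (ιℕ n *_) (ι-minus q y))) ⟩
    r * (ι e * (ι p - ι x) - ιℕ n * (ι q - ι y))
      ≡⟨ solve 7 (λ r n E p x q y → r :* (E :* (p :- x) :- n :* (q :- y)) := (E :* r) :* (p :- x) :- (r :* n) :*
        (q :- y)) refl r (ιℕ n) (ι e) (ι p) (ι x) (ι q) (ι y) ⟩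
    σ * (ι p - ι x) - (r * ιℕ n) * (ι q - ι y)
      ≡⟨ cong (λ u → σ * (ι p - ι x) - u * (ι q - ι y)) rn≡1 ⟩
    σ * (ι p - ι x) - 1ℚ * (ι q - ι y)
      ≡⟨ solve 5 (λ σ p x q y → σ :* (p :- x) :- con 1ℚ :* (q :- y) := (y :- σ :* x) :+ σ :* p :- q) refl σ (ι p)
        (ι x) (ι q) (ι y) ⟩
    at l (ι p) - ι q ∎))
  attained : ∀ i → i ℕ.≤ n → Attained cs (ι x + ιℕ i) (at l (ι x + ιℕ i))
  attained i i≤n = record
    { first = from ; second = to ; τ = ιℕ i * r
    ; 0≤τ = 0≤ιℕ i ⊗ 0≤r
    ; τ≤1 = lin (diff (ι-≤ {+ i} {+ n} (ℤ.+≤+ i≤n)) ⊗ 0≤r) (trans (cong (_- ιℕ i * r) (sym rn≡1))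
        (solve 3 (λ r n i → r :* n :- i :* r := (n :- i) :* r) refl r (ιℕ n) (ιℕ i)))
    ; X≡ = begin
        ι x + ιℕ i                                      ≡⟨ cong (λ u → ι x + u) (sym (ℚ.*-identityʳ (ιℕ i))) ⟩
        ι x + ιℕ i * 1ℚ                                 ≡⟨ cong (λ u → ι x + ιℕ i * u) (sym rn≡1) ⟩
        ι x + ιℕ i * (r * ιℕ n)                         ≡⟨ solve 4 (λ x i r n → x :+ i :* (r :* n) :=
          (con 1ℚ :- i :* r) :* x :+ i :* r :* (x :+ n)) refl (ι x) (ιℕ i) r (ιℕ n) ⟩
        (1ℚ - ιℕ i * r) * ι x + ιℕ i * r * (ι x + ιℕ n) ≡⟨ cong (λ u → (1ℚ - ιℕ i * r) * ι x + ιℕ i * r * u)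
          (sym (ι-+ x (+ n))) ⟩
        (1ℚ - ιℕ i * r) * ι x + ιℕ i * r * ι (x ℤ.+ + n) ∎
    ; Y≡ = begin
        at l (ι x + ιℕ i)                               ≡⟨ solve 5 (λ x y E r i → (y :- E :* r :* x) :+ E :* r :*
          (x :+ i) := (con 1ℚ :- i :* r) :* y :+ i :* r :* (y :+ E)) refl (ι x) (ι y) (ι e) r (ιℕ i) ⟩
        (1ℚ - ιℕ i * r) * ι y + ιℕ i * r * (ι y + ι e)  ≡⟨ cong (λ u → (1ℚ - ιℕ i * r) * ι y + ιℕ i * r * u)
          (sym (ι-+ y e)) ⟩
        (1ℚ - ιℕ i * r) * ι y + ιℕ i * r * ι (y ℤ.+ e) ∎ }

-- The edges of the boundary from left to right, starting at (x, y). Each edge has positive width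
-- and supports all corners, in cross-multiplied form; its summand is twice the signed area of the
-- trapezoid under it.
data Chain (cs : List Cell) : (x y : ℤ) → ℕ → ℤ → Set where
  stop : ∀ {x y} → Chain cs x y 0 (+ 0)
  edge : ∀ {x y a t} d e → TopCorner cs x y → TopCorner cs (x ℤ.+ + suc d) (y ℤ.+ e) →
         (∀ {p q} → TopCorner cs p q → + suc d ℤ.* (q ℤ.- y) ℤ.≤ e ℤ.* (p ℤ.- x)) →
         Chain cs (x ℤ.+ + suc d) (y ℤ.+ e) a t →
         Chain cs x y (suc d ℕ.+ a) (+ suc d ℤ.* (y ℤ.+ (y ℤ.+ e)) ℤ.+ t)

chain⇒cap : ∀ {cs x y a t} → Chain cs x y a t → Cap cs (ι x) a t
chain⇒cap stop = record { line = λ _ → mkLine 0ℚ 0ℚ ; above = λ _ () ; leftEnd = λ _ () ; rightEnd = λ _ () ;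
  total = refl }
chain⇒cap {cs} {x} (edge {a = a} {t} d e from to support chain) = cap-++ (segment-cap d e from to support)
  (subst (λ X → Cap cs X a t) (ι-+ x (+ suc d)) (chain⇒cap chain))

topCorners : List Cell → List (ℤ × ℤ)
topCorners []             = []
topCorners ((x , y) ∷ cs) = (x , ℤ.suc y) ∷ (ℤ.suc x , ℤ.suc y) ∷ topCorners cs

weaken : ∀ {c cs x y} → TopCorner cs x y → TopCorner (c ∷ cs) x y
weaken (topLeft m)  = topLeft (there m)
weaken (topRight m) = topRight (there m)

∈⇒topCorner : ∀ {cs x y} → (x , y) ∈ topCorners cs → TopCorner cs x y
∈⇒topCorner {_ ∷ _} (here refl)         = topLeft (here refl)
∈⇒topCorner {_ ∷ _} (there (here refl)) = topRight (here refl)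
∈⇒topCorner {_ ∷ _} (there (there m))   = weaken (∈⇒topCorner m)

topCorner⇒∈ : ∀ {cs x y} → TopCorner cs x y → (x , y) ∈ topCorners cs
topCorner⇒∈ (topLeft (here refl))  = here refl
topCorner⇒∈ (topLeft (there m))    = there (there (topCorner⇒∈ (topLeft m)))
topCorner⇒∈ (topRight (here refl)) = there (here refl)
topCorner⇒∈ (topRight (there m))   = there (there (topCorner⇒∈ (topRight m)))

cancelᶻ : ∀ {d i j} → + 0 ℤ.< d → d ℤ.* i ℤ.≤ d ℤ.* j → i ℤ.≤ j
cancelᶻ {d} {i} {j} 0<d = ℤ.*-cancelˡ-≤-pos i j d {{ℤ.positive 0<d}}

0<diffᶻ : ∀ {i j} → i ℤ.< j → + 0 ℤ.< j ℤ.- i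
0<diffᶻ {i} {j} i<j = subst (ℤ._< j ℤ.- i) (ℤ.+-inverseʳ i) (ℤ.+-monoˡ-< (ℤ.- i) i<j)

Steepest : (x y u v : ℤ) → List (ℤ × ℤ) → Set
Steepest x y u v ps = ∀ {p q} → (p , q) ∈ ps → x ℤ.< p → (q ℤ.- y) ℤ.* (u ℤ.- x) ℤ.≤ (v ℤ.- y) ℤ.* (p ℤ.- x)

-- The next vertex is a corner of maximal slope among those further right. Slopes are compared by
-- cross multiplication with the positive horizontal distances.
steepest : ∀ x y ps → (∀ {p q} → (p , q) ∈ ps → p ℤ.≤ x) ⊎
  (Σ[ u ∈ ℤ ] Σ[ v ∈ ℤ ] (u , v) ∈ ps × x ℤ.< u × Steepest x y u v ps)
steepest x y [] = inj₁ (λ ())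
steepest x y ((p , q) ∷ ps) with p ℤ.≤? x | steepest x y ps
... | yes p≤x | inj₁ h = inj₁ λ { (here refl) → p≤x ; (there m) → h m }
... | yes p≤x | inj₂ (u , v , m , x<u , h) = inj₂ (u , v , there m , x<u ,
      λ { (here refl) x<p → contradiction p≤x (ℤ.<⇒≱ x<p) ; (there m) → h m })
... | no p≰x | inj₁ h = inj₂ (p , q , here refl , ℤ.≰⇒> p≰x ,
      λ { (here refl) _ → ℤ.≤-refl ; (there m) x<p → contradiction (h m) (ℤ.<⇒≱ x<p) })
... | no p≰x | inj₂ (u , v , m , x<u , h) with (q ℤ.- y) ℤ.* (u ℤ.- x) ℤ.≤? (v ℤ.- y) ℤ.* (p ℤ.- x)
...   | yes le = inj₂ (u , v , there m , x<u , λ { (here refl) _ → le ; (there m) → h m })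
...   | no  gt = inj₂ (p , q , here refl , ℤ.≰⇒> p≰x , λ { (here refl) _ → ℤ.≤-refl ; (there m) → better m })
  where
  better : Steepest x y p q ps
  -- Transitivity of the comparison of slopes, obtained after multiplication by the positive
  -- distance u - x.
  better {r} {s} m x<r = cancelᶻ (0<diffᶻ x<u) (linᶻ
    ((diffᶻ (h m x<r) ⊗ᶻ ℤ.<⇒≤ (0<diffᶻ (ℤ.≰⇒> p≰x))) ⊕ᶻ (diffᶻ (ℤ.<⇒≤ (ℤ.≰⇒> gt)) ⊗ᶻ ℤ.<⇒≤ (0<diffᶻ x<r)))
    (solveᶻ 6 (λ s r v u q p → u :*ᶻ (q :*ᶻ r) :-ᶻ u :*ᶻ (s :*ᶻ p) :=ᶻ (v :*ᶻ r :-ᶻ s :*ᶻ u) :*ᶻ p :+ᶻ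
      (q :*ᶻ u :-ᶻ v :*ᶻ p) :*ᶻ r) refl
      (s ℤ.- y) (r ℤ.- x) (v ℤ.- y) (u ℤ.- x) (q ℤ.- y) (p ℤ.- x)))

-- Slopes towards corners on the right do not exceed those from corners on the
-- left, with denominators cleared.
IsVertex : List Cell → (x y : ℤ) → Set
IsVertex cs x y = ∀ {p q r s} → TopCorner cs p q → TopCorner cs r s → p ℤ.< x → x ℤ.< r →
  (q ℤ.- y) ℤ.* (r ℤ.- x) ℤ.+ (s ℤ.- y) ℤ.* (x ℤ.- p) ℤ.≤ + 0

-- An edge may use up several columns at once; `fuel` makes the recursion structural. The edge of
-- maximal slope supports the corners to its right by maximality, those on the current vertical by
-- `top`, and those to the left by `vertex`.
wrap : ∀ {cs} fuel k → k ℕ.≤ fuel → ∀ x y → TopCorner cs x y → (∀ {q} → TopCorner cs x q → q ℤ.≤ y) → IsVertex cs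
  x y →
  (∀ {p q} → TopCorner cs p q → p ℤ.≤ x ℤ.+ + k) → Σ[ q ∈ ℤ ] TopCorner cs (x ℤ.+ + k) q → Σ[ t ∈ ℤ ] Chain cs x y k t
wrap fuel zero _ x y v top vertex bound last = + 0 , stop
wrap {cs} (suc fuel) (suc k) (ℕ.s≤s k≤) x y v top vertex bound (z , last) with steepest x y (topCorners cs)
... | inj₁ h = contradiction (h (topCorner⇒∈ last)) (ℤ.<⇒≱ (subst (ℤ._< x ℤ.+ + suc k) (ℤ.+-identityʳ x)
  (ℤ.+-monoʳ-< x (ℤ.+<+ (ℕ.s≤s ℕ.z≤n)))))
... | inj₂ (u , v′ , m , x<u , h) with above-difference x<u
...   | d , refl = go (v′ ℤ.- y) (solveᶻ 2 (λ y v → v :=ᶻ y :+ᶻ (v :-ᶻ y)) refl y v′)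
  where
  go : ∀ e → v′ ≡ y ℤ.+ e → Σ[ t ∈ ℤ ] Chain cs x y (suc k) t
  go e refl = + D ℤ.* (y ℤ.+ (y ℤ.+ e)) ℤ.+ proj₁ rest ,
      subst (λ n → Chain cs x y n (+ D ℤ.* (y ℤ.+ (y ℤ.+ e)) ℤ.+ proj₁ rest)) (ℕ.m+[n∸m]≡n D≤)
        (edge d e v w support (proj₂ rest))
    where
    D = suc d
    D⁺ : + 0 ℤ.< + D
    D⁺ = ℤ.+<+ (ℕ.s≤s ℕ.z≤n)
    D≥0 : + 0 ℤ.≤ + D
    D≥0 = ℤ.<⇒≤ D⁺
    x′ = x ℤ.+ + D
    y′ = y ℤ.+ e
    w : TopCorner cs x′ y′
    w = ∈⇒topCorner m
    D≤ : D ℕ.≤ suc k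
    D≤ = ℤ.drop‿+≤+ (linᶻ (diffᶻ (bound w)) (solveᶻ 3 (λ x D k → k :-ᶻ D :=ᶻ x :+ᶻ k :-ᶻ (x :+ᶻ D)) refl x (+ D)
      (+ suc k)))
    support : ∀ {p q} → TopCorner cs p q → + D ℤ.* (q ℤ.- y) ℤ.≤ e ℤ.* (p ℤ.- x)
    support {p} {q} c with ℤ.<-cmp p x
    ... | tri< p<x _ _ = linᶻ (diffᶻ (vertex c w p<x x<u))
          (solveᶻ 6 (λ x y p q D e → e :*ᶻ (p :-ᶻ x) :-ᶻ D :*ᶻ (q :-ᶻ y)
            :=ᶻ conᶻ (+ 0) :-ᶻ ((q :-ᶻ y) :*ᶻ (x :+ᶻ D :-ᶻ x) :+ᶻ (y :+ᶻ e :-ᶻ y) :*ᶻ (x :-ᶻ p))) refl x y p q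
              (+ D) e)
    ... | tri≈ _ refl _ = linᶻ (D≥0 ⊗ᶻ diffᶻ (top c))
          (solveᶻ 5 (λ p y q D e → e :*ᶻ (p :-ᶻ p) :-ᶻ D :*ᶻ (q :-ᶻ y) :=ᶻ D :*ᶻ (y :-ᶻ q)) refl p y q (+ D) e)
    ... | tri> _ _ x<p = linᶻ (diffᶻ (h (topCorner⇒∈ c) x<p))
          (solveᶻ 6 (λ x y p q D e → e :*ᶻ (p :-ᶻ x) :-ᶻ D :*ᶻ (q :-ᶻ y)
            :=ᶻ (y :+ᶻ e :-ᶻ y) :*ᶻ (p :-ᶻ x) :-ᶻ (q :-ᶻ y) :*ᶻ (x :+ᶻ D :-ᶻ x)) refl x y p q (+ D) e)
    top′ : ∀ {q} → TopCorner cs x′ q → q ℤ.≤ y′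
    top′ {q} c = cancelᶻ D⁺ (linᶻ (diffᶻ (support c))
      (solveᶻ 5 (λ x y q D e → D :*ᶻ (y :+ᶻ e) :-ᶻ D :*ᶻ q :=ᶻ e :*ᶻ (x :+ᶻ D :-ᶻ x) :-ᶻ D :*ᶻ (q :-ᶻ y)) refl x y
        q (+ D) e))
    -- Corners on either side of the new vertex lie below the edge that ends there, so slopes do not
    -- increase from left to right.
    vertex′ : IsVertex cs x′ y′
    vertex′ {p} {q} {r} {s} a b p<x′ x′<r = cancelᶻ D⁺ (linᶻ
      ((ℤ.<⇒≤ (0<diffᶻ x′<r) ⊗ᶻ diffᶻ (support a)) ⊕ᶻ (ℤ.<⇒≤ (0<diffᶻ p<x′) ⊗ᶻ diffᶻ (support b)))
      (solveᶻ 8 (λ x y p q r s D e → D :*ᶻ conᶻ (+ 0) :-ᶻ D :*ᶻ ((q :-ᶻ (y :+ᶻ e)) :*ᶻ (r :-ᶻ (x :+ᶻ D)) :+ᶻ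
        (s :-ᶻ (y :+ᶻ e)) :*ᶻ (x :+ᶻ D :-ᶻ p))
        :=ᶻ (r :-ᶻ (x :+ᶻ D)) :*ᶻ (e :*ᶻ (p :-ᶻ x) :-ᶻ D :*ᶻ (q :-ᶻ y)) :+ᶻ (x :+ᶻ D :-ᶻ p) :*ᶻ (e :*ᶻ (r :-ᶻ x)
          :-ᶻ D :*ᶻ (s :-ᶻ y)))
        refl x y p q r s (+ D) e))
    end≡ : x ℤ.+ + suc k ≡ x′ ℤ.+ + (suc k ∸ D)
    end≡ = trans (cong (λ n → x ℤ.+ + n) (sym (ℕ.m+[n∸m]≡n D≤)))
      (trans (cong (λ u → x ℤ.+ u) (ℤ.pos-+ D (suc k ∸ D))) (sym (ℤ.+-assoc x (+ D) (+ (suc k ∸ D)))))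
    rest : Σ[ t ∈ ℤ ] Chain cs x′ y′ (suc k ∸ D) t
    rest = wrap fuel (suc k ∸ D) (ℕ.≤-trans (ℕ.m∸n≤m k d) k≤) x′ y′ w top′ vertex′
      (λ {p} c → subst (p ℤ.≤_) end≡ (bound c)) (z , subst (λ x → TopCorner cs x z) end≡ last)

record Span (cs : List Cell) (x : ℤ) (b : ℕ) : Set where
  field
    lower     : ∀ {p q} → (p , q) ∈ cs → x ℤ.≤ p
    upper     : ∀ {p q} → (p , q) ∈ cs → ℤ.suc p ℤ.≤ x ℤ.+ + suc b
    leftmost  : Σ[ q ∈ ℤ ] (x , q) ∈ cs
    rightmost : Σ[ p ∈ ℤ ] Σ[ q ∈ ℤ ] (p , q) ∈ cs × ℤ.suc p ≡ x ℤ.+ + suc b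

Topmost : ℤ → List (ℤ × ℤ) → Set
Topmost x ps = Σ[ t ∈ ℤ ] (x , t) ∈ ps × (∀ {q} → (x , q) ∈ ps → q ℤ.≤ t)

topmost? : ∀ x ps → Topmost x ps ⊎ (∀ {q} → (x , q) ∉ ps)
topmost? x [] = inj₂ λ ()
topmost? x ((a , b) ∷ ps) with a ℤ.≟ x | topmost? x ps
... | no a≢x | inj₁ (t , m , h) = inj₁ (t , there m , λ { (here refl) → contradiction refl a≢x ; (there m) → h m })
... | no a≢x | inj₂ h = inj₂ λ { (here refl) → a≢x refl ; (there m) → h m }
... | yes refl | inj₂ h = inj₁ (b , here refl , λ { (here refl) → ℤ.≤-refl ; (there m) → contradiction m h })
... | yes refl | inj₁ (t , m , h) with b ℤ.≤? t
...   | yes b≤t = inj₁ (t , there m , λ { (here refl) → b≤t ; (there m) → h m })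
...   | no  b≰t = inj₁ (b , here refl , λ { (here refl) → ℤ.≤-refl ; (there m) → ℤ.≤-trans (h m)
  (ℤ.<⇒≤ (ℤ.≰⇒> b≰t)) })

topmost : ∀ {x y ps} → (x , y) ∈ ps → Topmost x ps
topmost {x} {y} {ps} m with topmost? x ps
... | inj₁ t = t
... | inj₂ h = contradiction m h

corner-column : ∀ {cs x b p q} → Span cs x b → TopCorner cs p q → x ℤ.≤ p × p ℤ.≤ x ℤ.+ + suc b
corner-column S (topLeft m)      = Span.lower S m , ℤ.≤-trans (ℤ.i≤suc[i] _) (Span.upper S m)
corner-column S (topRight {x} m) = ℤ.≤-trans (Span.lower S m) (ℤ.i≤suc[i] x) , Span.upper S m

span⇒cap : ∀ {cs x b} → Span cs x b → Σ[ z ∈ ℤ ] Cap cs (ι x) (suc b) z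
span⇒cap {cs} {x} {b} S with topmost (topCorner⇒∈ {cs} (topLeft (proj₂ (Span.leftmost S))))
... | y , m , h = let t , chain = wrap (suc b) (suc b) ℕ.≤-refl x y (∈⇒topCorner m) (λ c → h (topCorner⇒∈ c))
                        -- Wrapping starts in the leftmost column, where the vertex condition is
                        -- vacuous.
                        (λ a _ p<x _ → contradiction (proj₁ (corner-column S a)) (ℤ.<⇒≱ p<x))
                          (λ c → proj₂ (corner-column S c)) last
                  in t , chain⇒cap chain
  where
  last : Σ[ q ∈ ℤ ] TopCorner cs (x ℤ.+ + suc b) q
  last = let p , q , m , eq = Span.rightmost S in ℤ.suc q , subst (λ p → TopCorner cs p (ℤ.suc q)) eq (topRight m)

span-flip : ∀ {cs x b} → Span cs x b → Span (map flip cs) x b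
span-flip {cs} S = record
  { lower     = λ m → let _ , m′ , eq = ∈-map⁻ flip m in subst (_ ℤ.≤_) (sym (cong proj₁ eq)) (Span.lower S m′)
  ; upper     = λ m → let _ , m′ , eq = ∈-map⁻ flip m in subst (λ p → ℤ.suc p ℤ.≤ _) (sym (cong proj₁ eq)) (Span.upper S m′)
  ; leftmost  = let q , m = Span.leftmost S in _ , ∈-map⁺ flip m
  ; rightmost = let p , q , m , eq = Span.rightmost S in p , _ , ∈-map⁺ flip m , eq }

span⇒range : ∀ {cs x b} → Span cs x b → InRange cs (ι x) (suc b)
span⇒range {x = x} {b} S {p} m = ι-≤ (Span.lower S m) , subst (ι (ℤ.suc p) ≤_) (ι-+ x (+ suc b))
  (ι-≤ (Span.upper S m))

caps⇒area : ∀ {cs x b z z′} → Span cs x b → Cap cs (ι x) (suc b) z → Cap (map flip cs) (ι x) (suc b) z′ → HullArea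
  cs (z ℤ.+ z′)
caps⇒area S U L = CapArea.hullArea U L (span⇒range S)

minimum : ∀ (f : Cell → ℤ) c cs → Σ[ d ∈ Cell ] d ∈ c ∷ cs × (∀ {e} → e ∈ c ∷ cs → f d ℤ.≤ f e)
minimum f c [] = c , here refl , λ { (here refl) → ℤ.≤-refl }
minimum f c (c′ ∷ cs) with minimum f c′ cs
... | d , m , h with f c ℤ.≤? f d
...   | yes le = c , here refl , λ { (here refl) → ℤ.≤-refl ; (there m) → ℤ.≤-trans le (h m) }
...   | no  gt = d , there m , λ { (here refl) → ℤ.<⇒≤ (ℤ.≰⇒> gt) ; (there m) → h m }

span-exists : ∀ c cs → Σ[ x ∈ ℤ ] Σ[ b ∈ ℕ ] Span (c ∷ cs) x b
span-exists c cs with minimum proj₁ c cs | minimum (λ d → ℤ.- proj₁ d) c cs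
... | (x , y) , m , h | (p , q) , m′ , h′ with above-difference (ℤ.≤-<-trans (h m′) (ℤ.suc[i]≤j⇒i<j
  (ℤ.≤-refl {ℤ.suc p})))
...   | b , eq = x , b , record
  { lower = h ; upper = λ {r} m → subst (ℤ.suc r ℤ.≤_) eq (ℤ.suc-mono (ℤ.neg-cancel-≤ (h′ m)))
  ; leftmost = y , m ; rightmost = p , q , m′ , eq }

-- Adding one cell

-- The boundary of `cs′` is attained on segments between its corners, and the old line plus `g i` is
-- an affine bound at these corners. Hence the bound holds at both ends of the column.
cap-compare : ∀ {cs cs′ X a z z′} (U : Cap cs X a z) → Cap cs′ X a z′ → (g : ℕ → Line) →
  (∀ i → i ℕ.< a → ∀ {p q} → TopCorner cs′ p q → ι q ≤ at (Cap.line U i) (ι p) + at (g i) (ι p)) →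
  ι z′ ≤ ι z + Σ< a (λ i → at (g i) (X + ιℕ i) + at (g i) (X + ιℕ (suc i)))
cap-compare {cs} {cs′} {X} {a} {z} {z′} U U′ g h = subst₂ _≤_ U′.total
  (trans (Σ<-+ a (λ i → at (U.line i) (X + ιℕ i) + at (U.line i) (X + ιℕ (suc i))) (λ i → at (g i) (X + ιℕ i) + at
    (g i) (X + ιℕ (suc i))))
    (cong (λ u → u + Σ< a (λ i → at (g i) (X + ιℕ i) + at (g i) (X + ιℕ (suc i)))) U.total))
  (Σ<-mono a λ i i<a → lin
    (diff (attained-≤ (sumLine i) (U′.leftEnd i i<a) (above′ i i<a)) ⊕ diff (attained-≤ (sumLine i) (U′.rightEnd i
      i<a) (above′ i i<a)))
    (regroup (U.line i) (g i) (X + ιℕ i) (X + ιℕ (suc i)) (at (U′.line i) (X + ιℕ i)) (at (U′.line i)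
      (X + ιℕ (suc i)))))
  where
  module U = Cap U
  module U′ = Cap U′
  sumLine : ℕ → Line
  sumLine i = mkLine (intercept (U.line i) + intercept (g i)) (slope (U.line i) + slope (g i))
  above′ : ∀ i → i ℕ.< a → Above cs′ (sumLine i)
  above′ i i<a {p} {q} c = subst (ι q ≤_) (solve 5 (λ c σ c′ σ′ x → c :+ σ :* x :+ (c′ :+ σ′ :* x) := c :+ c′ :+
    (σ :+ σ′) :* x) refl
    (intercept (U.line i)) (slope (U.line i)) (intercept (g i)) (slope (g i)) (ι p)) (h i i<a c)
  regroup : ∀ l g x y a b → at l x + at l y + (at g x + at g y) - (a + b) ≡
    (at (mkLine (intercept l + intercept g) (slope l + slope g)) x - a) + (at (mkLine (intercept l + intercept g)
      (slope l + slope g)) y - b)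
  regroup (mkLine c σ) (mkLine c′ σ′) x y a b = solve 8 (λ c σ c′ σ′ x y a b →
    c :+ σ :* x :+ (c :+ σ :* y) :+ (c′ :+ σ′ :* x :+ (c′ :+ σ′ :* y)) :- (a :+ b)
    := (c :+ c′ :+ (σ :+ σ′) :* x :- a) :+ (c :+ c′ :+ (σ :+ σ′) :* y :- b)) refl c σ c′ σ′ x y a b

cap-mono : ∀ {cs cs′ X a z z′} → Cap cs X a z → Cap cs′ X a z′ → (∀ l → Above cs l → Above cs′ l) → z′ ℤ.≤ z
cap-mono {cs} {cs′} {X} {a} {z} {z′} U U′ h = ι-≤⁻ (subst (ι z′ ≤_)
  (trans (cong (λ u → ι z + u) (vanish a (λ i → at (mkLine 0ℚ 0ℚ) (X + ιℕ i) + at (mkLine 0ℚ 0ℚ) (X + ιℕ (suc i)))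
      (λ i → solve 2 (λ x y → con 0ℚ :+ con 0ℚ :* x :+ (con 0ℚ :+ con 0ℚ :* y) := con 0ℚ) refl (X + ιℕ i)
        (X + ιℕ (suc i)))))
    (ℚ.+-identityʳ (ι z)))
  (cap-compare U U′ (λ _ → mkLine 0ℚ 0ℚ) λ i i<a {p} c → subst (_ ≤_)
    (solve 2 (λ a x → a := a :+ (con 0ℚ :+ con 0ℚ :* x)) refl (at (Cap.line U i) (ι p)) (ι p)) (h (Cap.line U i)
      (Cap.above U i i<a) c)))
  where
  vanish : ∀ n f → (∀ i → f i ≡ 0ℚ) → Σ< n f ≡ 0ℚ
  vanish zero    f h = refl
  vanish (suc n) f h = cong₂ _+_ (h 0) (vanish n (f ∘ suc) (h ∘ suc))

-- The default 0 makes the rising or falling part of a tent contribute 0 when it is empty.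
recip : ℕ → ℚ
recip zero      = 0ℚ
recip n@(suc _) = proj₁ (inverse (ιℕ n) (ι-< {+ 0} {+ n} (ℤ.+<+ (ℕ.s≤s ℕ.z≤n))))

0≤recip : ∀ n → 0ℚ ≤ recip n
0≤recip zero      = ℚ.≤-refl
0≤recip n@(suc _) = ℚ.<⇒≤ (proj₁ (proj₂ (inverse (ιℕ n) (ι-< {+ 0} {+ n} (ℤ.+<+ (ℕ.s≤s ℕ.z≤n))))))

recip-inverse : ∀ {j n} → j ℕ.< n → recip n * ιℕ n ≡ 1ℚ
recip-inverse {n = n@(suc _)} _ = proj₂ (proj₂ (inverse (ιℕ n) (ι-< {+ 0} {+ n} (ℤ.+<+ (ℕ.s≤s ℕ.z≤n)))))

recip-square : ∀ n → recip n * (ιℕ n * ιℕ n) ≡ ιℕ n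
recip-square zero    = refl
recip-square (suc n) = trans (sym (ℚ.*-assoc (recip (suc n)) (ιℕ (suc n)) (ιℕ (suc n))))
  (trans (cong (_* ιℕ (suc n)) (recip-inverse (ℕ.n<1+n n))) (ℚ.*-identityˡ (ιℕ (suc n))))

-- The tent function on [X, X + i + 1 + r] that is 1 on [X + i, X + i + 1] and
-- 0 at both ends; adding it keeps a boundary concave.
module Tent (X : ℚ) (i r : ℕ) where

  a : ℚ
  a = ιℕ i + (1ℚ + ιℕ r)

  rising falling : Line
  rising  = mkLine (- (recip i * X)) (recip i)
  falling = mkLine (recip r * (X + a)) (- recip r)

  tent : ℕ → Line
  tent = catℕ i (λ _ → rising) (catℕ 1 (λ _ → mkLine 1ℚ 0ℚ) (λ _ → falling))

  -- Required of each piece over the whole interval and not only over its own column, because the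
  -- line of one column is compared with all corners. This is where concavity of the tent enters.
  record Good (l : Line) : Set where
    field
      nonNegative : ∀ t → X ≤ t → t ≤ X + a → 0ℚ ≤ at l t
      left≥1      : 1ℚ ≤ at l (X + ιℕ i)
      right≥1     : 1ℚ ≤ at l (X + ιℕ i + 1ℚ)

  tent-good : ∀ j → j ℕ.< i ℕ.+ suc r → Good (tent j)
  tent-good = catℕ-∀ (λ _ → Good) i rise (catℕ-∀ (λ _ → Good) 1 (λ _ _ → flat) fall)
    where
    flat : Good (mkLine 1ℚ 0ℚ)
    flat = record
      { nonNegative = λ t _ _ → lin 0≤1 (solve 1 (λ t → con 1ℚ :+ con 0ℚ :* t :- con 0ℚ := con 1ℚ) refl t)
      ; left≥1  = lin ℚ.≤-refl (solve 1 (λ t → con 1ℚ :+ con 0ℚ :* t :- con 1ℚ := con 0ℚ) refl (X + ιℕ i))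
      ; right≥1 = lin ℚ.≤-refl (solve 1 (λ t → con 1ℚ :+ con 0ℚ :* t :- con 1ℚ := con 0ℚ) refl (X + ιℕ i + 1ℚ)) }
    ρ = recip i
    ρ′ = recip r
    rise : ∀ j → j ℕ.< i → Good rising
    rise j j<i = record
      { nonNegative = λ t X≤t _ → lin (0≤recip i ⊗ diff X≤t) (solve 3 (λ ρ X t → :- (ρ :* X) :+ ρ :* t :- con 0ℚ
        := ρ :* (t :- X)) refl ρ X t)
      ; left≥1  = lin ℚ.≤-refl (trans (solve 3 (λ ρ X i → :- (ρ :* X) :+ ρ :* (X :+ i) :- con 1ℚ := ρ :* i :- con
        1ℚ) refl ρ X (ιℕ i)) (cong (_- 1ℚ) (recip-inverse j<i)))
      ; right≥1 = lin (0≤recip i) (trans (solve 3 (λ ρ X i → :- (ρ :* X) :+ ρ :* (X :+ i :+ con 1ℚ) :- con 1ℚ := ρ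
        :* i :- con 1ℚ :+ ρ) refl ρ X (ιℕ i))
          (trans (cong (λ u → u - 1ℚ + ρ) (recip-inverse j<i)) (solve 1 (λ ρ → con 1ℚ :- con 1ℚ :+ ρ := ρ) refl ρ))) }
    fall : ∀ j → j ℕ.< r → Good falling
    fall j j<r = record
      { nonNegative = λ t _ t≤ → lin (0≤recip r ⊗ diff t≤) (solve 3 (λ ρ Y t → ρ :* Y :+ :- ρ :* t :- con 0ℚ := ρ
        :* (Y :- t)) refl ρ′ (X + a) t)
      ; left≥1  = lin (0≤recip r) (trans (solve 4 (λ ρ X i r → ρ :* (X :+ (i :+ (con 1ℚ :+ r))) :+ :- ρ :*
        (X :+ i) :- con 1ℚ := ρ :* r :- con 1ℚ :+ ρ) refl ρ′ X (ιℕ i) (ιℕ r))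
          (trans (cong (λ u → u - 1ℚ + ρ′) (recip-inverse j<r)) (solve 1 (λ ρ → con 1ℚ :- con 1ℚ :+ ρ := ρ) refl ρ′)))
      ; right≥1 = lin ℚ.≤-refl (trans (solve 4 (λ ρ X i r → ρ :* (X :+ (i :+ (con 1ℚ :+ r))) :+ :- ρ :*
        (X :+ i :+ con 1ℚ) :- con 1ℚ := ρ :* r :- con 1ℚ) refl ρ′ X (ιℕ i) (ιℕ r))
          (cong (_- 1ℚ) (recip-inverse j<r))) }

  -- The two triangles count i and r, the plateau counts 2.
  tent-sum : Σ< (i ℕ.+ suc r) (λ j → at (tent j) (X + ιℕ j) + at (tent j) (X + ιℕ (suc j))) ≡ a + 1ℚ
  tent-sum = begin
    Σ< (i ℕ.+ suc r) (λ j → h j (tent j))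
      ≡⟨ Σ<-cat h i (suc r) (λ _ → rising) (catℕ 1 (λ _ → mkLine 1ℚ 0ℚ) (λ _ → falling)) ⟩
    Σ< i (λ j → h j rising) + (h (i ℕ.+ 0) (mkLine 1ℚ 0ℚ) + Σ< r (λ j → h (i ℕ.+ suc j) falling))
      ≡⟨ cong₂ _+_ left-part (cong₂ _+_ (solve 2 (λ x y → con 1ℚ :+ con 0ℚ :* x :+ (con 1ℚ :+ con 0ℚ :* y) := con
        1ℚ :+ con 1ℚ) refl (X + ιℕ (i ℕ.+ 0)) (X + ιℕ (suc (i ℕ.+ 0)))) right-part) ⟩
    ιℕ i + (1ℚ + 1ℚ + ιℕ r)
      ≡⟨ solve 2 (λ i r → i :+ (con 1ℚ :+ con 1ℚ :+ r) := i :+ (con 1ℚ :+ r) :+ con 1ℚ) refl (ιℕ i) (ιℕ r) ⟩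
    a + 1ℚ ∎
    where
    open ≡-Reasoning
    h : ℕ → Line → ℚ
    h j l = at l (X + ιℕ j) + at l (X + ιℕ (suc j))
    ρ = recip i
    ρ′ = recip r
    left-part : Σ< i (λ j → h j rising) ≡ ιℕ i
    left-part = begin
      Σ< i (λ j → h j rising)
        ≡⟨ Σ<-cong i (λ j _ → trans (cong (λ u → at rising (X + ιℕ j) + at rising (X + u)) (ιℕ-suc j))
             (solve 3 (λ ρ X j → :- (ρ :* X) :+ ρ :* (X :+ j) :+ (:- (ρ :* X) :+ ρ :* (X :+ (j :+ con 1ℚ))) := ρ
               :+ j :* (ρ :+ ρ)) refl ρ X (ιℕ j))) ⟩
      Σ< i (λ j → ρ + ιℕ j * (ρ + ρ))
        ≡⟨ Σ<-arithmetic i ρ (ρ + ρ) ⟩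
      ιℕ i * ρ + ½ * (ιℕ i * (ιℕ i - 1ℚ)) * (ρ + ρ)
        ≡⟨ solve 2 (λ i ρ → i :* ρ :+ con ½ :* (i :* (i :- con 1ℚ)) :* (ρ :+ ρ) := ρ :* (i :* i)) refl (ιℕ i) ρ ⟩
      ρ * (ιℕ i * ιℕ i) ≡⟨ recip-square i ⟩
      ιℕ i ∎
    right-part : Σ< r (λ j → h (i ℕ.+ suc j) falling) ≡ ιℕ r
    right-part = begin
      Σ< r (λ j → h (i ℕ.+ suc j) falling)
        ≡⟨ Σ<-cong r (λ j _ → trans (cong₂ (λ u v → at falling (X + u) + at falling (X + v)) (index j)
          (trans (ιℕ-suc (i ℕ.+ suc j)) (cong (_+ 1ℚ) (index j))))
             (solve 5 (λ ρ X i r j → ρ :* (X :+ (i :+ (con 1ℚ :+ r))) :+ :- ρ :* (X :+ (i :+ (j :+ con 1ℚ))) :+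
               (ρ :* (X :+ (i :+ (con 1ℚ :+ r))) :+ :- ρ :* (X :+ (i :+ (j :+ con 1ℚ) :+ con 1ℚ)))
               := (r :+ r :- con 1ℚ) :* ρ :+ j :* (:- (ρ :+ ρ))) refl ρ′ X (ιℕ i) (ιℕ r) (ιℕ j))) ⟩
      Σ< r (λ j → (ιℕ r + ιℕ r - 1ℚ) * ρ′ + ιℕ j * (- (ρ′ + ρ′)))
        ≡⟨ Σ<-arithmetic r ((ιℕ r + ιℕ r - 1ℚ) * ρ′) (- (ρ′ + ρ′)) ⟩
      ιℕ r * ((ιℕ r + ιℕ r - 1ℚ) * ρ′) + ½ * (ιℕ r * (ιℕ r - 1ℚ)) * (- (ρ′ + ρ′))
        ≡⟨ solve 2 (λ r ρ → r :* ((r :+ r :- con 1ℚ) :* ρ) :+ con ½ :* (r :* (r :- con 1ℚ)) :* (:- (ρ :+ ρ)) := ρ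
          :* (r :* r)) refl (ιℕ r) ρ′ ⟩
      ρ′ * (ιℕ r * ιℕ r) ≡⟨ recip-square r ⟩
      ιℕ r ∎
      where
      index : ∀ j → ιℕ (i ℕ.+ suc j) ≡ ιℕ i + (ιℕ j + 1ℚ)
      index j = trans (ιℕ-+ i (suc j)) (cong (λ u → ιℕ i + u) (ιℕ-suc j))

corner-cases : ∀ {cs c} (P : ℤ → ℤ → Set) → (∀ {p q} → TopCorner cs p q → P p q) →
  P (proj₁ c) (ℤ.suc (proj₂ c)) → P (ℤ.suc (proj₁ c)) (ℤ.suc (proj₂ c)) → ∀ {p q} → TopCorner (c ∷ cs) p q → P p q
corner-cases P old l r (topLeft (here refl))  = l
corner-cases P old l r (topLeft (there m))    = old (topLeft m)
corner-cases P old l r (topRight (here refl)) = r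
corner-cases P old l r (topRight (there m))   = old (topRight m)

-- The tent is at least 1 at both corners of the new cell, whose counterparts one unit below were
-- under the old lines, and it is nonnegative at all other corners.
cap-raise : ∀ {cs x y i r z z′} → (∀ {p q} → TopCorner cs p q → x ℤ.≤ p × p ℤ.≤ x ℤ.+ + (i ℕ.+ suc r)) →
  (x ℤ.+ + i , y) ∈ cs → Cap cs (ι x) (i ℕ.+ suc r) z → Cap ((x ℤ.+ + i , ℤ.suc y) ∷ cs) (ι x) (i ℕ.+ suc r) z′ →
  z′ ℤ.≤ z ℤ.+ + suc (i ℕ.+ suc r)
cap-raise {cs} {x} {y} {i} {r} {z} {z′} range m U U′ = ι-≤⁻ (subst (ι z′ ≤_)
  (begin
    ι z + Σ< n (λ j → at (tent j) (ι x + ιℕ j) + at (tent j) (ι x + ιℕ (suc j)))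
      ≡⟨ cong (λ u → ι z + u) tent-sum ⟩
    ι z + (ιℕ i + (1ℚ + ιℕ r) + 1ℚ)
      ≡⟨ cong (λ u → ι z + u) (sym (trans (ιℕ-suc n) (cong (_+ 1ℚ) n≡))) ⟩
    ι z + ιℕ (suc n)
      ≡⟨ sym (ι-+ z (+ suc n)) ⟩
    ι (z ℤ.+ + suc n) ∎)
  (cap-compare U U′ tent λ j j<n → corner-cases (λ p q → ι q ≤ at (Cap.line U j) (ι p) + at (tent j) (ι p))
    (λ {p} {q} c → ℚ.≤-trans (Cap.above U j j<n c) (lin (Good.nonNegative (tent-good j j<n) (ι p)
      (ι-≤ (proj₁ (range c)))
        (subst (ι p ≤_) (trans (ι-+ x (+ n)) (cong (λ u → ι x + u) n≡)) (ι-≤ (proj₂ (range c)))))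
      (solve 2 (λ a b → a :+ b :- a := b) refl (at (Cap.line U j) (ι p)) (at (tent j) (ι p)))))
    (raise (Cap.above U j j<n (topLeft m)) (subst (λ t → 1ℚ ≤ at (tent j) t) (sym (ι-+ x (+ i)))
      (Good.left≥1 (tent-good j j<n))))
    (raise (Cap.above U j j<n (topRight m)) (subst (λ t → 1ℚ ≤ at (tent j) t)
      (trans (cong (_+ 1ℚ) (sym (ι-+ x (+ i)))) (sym (ι-suc (x ℤ.+ + i)))) (Good.right≥1 (tent-good j j<n))))))
  where
  open Tent (ι x) i r
  open ≡-Reasoning
  n = i ℕ.+ suc r
  n≡ : ιℕ n ≡ ιℕ i + (1ℚ + ιℕ r)
  n≡ = trans (ιℕ-+ i (suc r)) (cong (λ u → ιℕ i + u) (trans (ιℕ-suc r) (ℚ.+-comm (ιℕ r) 1ℚ)))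
  raise : ∀ {u v} → ι (ℤ.suc y) ≤ u → 1ℚ ≤ v → ι (ℤ.suc (ℤ.suc y)) ≤ u + v
  raise {u} {v} p q = subst (_≤ u + v) (sym (ι-suc (ℤ.suc y))) (ℚ.+-mono-≤ p q)

-- The corners of the new cell lie one unit below those of the old cell, hence under every line that
-- bounds the old corners.
cap-lower : ∀ {cs x y X a z z′} → (x , ℤ.suc y) ∈ cs → Cap cs X a z → Cap ((x , y) ∷ cs) X a z′ → z′ ℤ.≤ z
cap-lower {y = y} m U U′ = cap-mono U U′ λ l above → corner-cases (λ p q → ι q ≤ at l (ι p)) above
  (ℚ.≤-trans (ι-≤ (ℤ.i≤suc[i] (ℤ.suc y))) (above (topLeft m))) (ℚ.≤-trans (ι-≤ (ℤ.i≤suc[i] (ℤ.suc y)))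
    (above (topRight m)))

-- Transposition

transpose : Cell → Cell
transpose (x , y) = y , x

transposeBox : Box → Box
transposeBox b = record { left<right = bottom<top b ; bottom<top = left<right b }

transposeRegion : Region → Region
transposeRegion S (x , y) = S (y , x)

totalArea-transpose : ∀ bs → totalArea (map transposeBox bs) ≡ totalArea bs
totalArea-transpose []       = refl
totalArea-transpose (b ∷ bs) = cong₂ _+_ (ℚ.*-comm (top b - bottom b) (right b - left b)) (totalArea-transpose bs)

nonOverlapping-transpose : ∀ {b c} → NonOverlapping b c → NonOverlapping (transposeBox b) (transposeBox c)
nonOverlapping-transpose (inj₁ h)               = inj₂ (inj₂ (inj₁ h))
nonOverlapping-transpose (inj₂ (inj₁ h))        = inj₂ (inj₂ (inj₂ h))
nonOverlapping-transpose (inj₂ (inj₂ (inj₁ h))) = inj₁ h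
nonOverlapping-transpose (inj₂ (inj₂ (inj₂ h))) = inj₂ (inj₁ h)

-- Reflection in the diagonal maps boxes to boxes of the same area. It serves to treat horizontal
-- steps as vertical ones.
area-transpose : ∀ {S T : Region} {α} → S ⊆ transposeRegion T → T ⊆ transposeRegion S → HasArea S α → HasArea T α
area-transpose {S} {T} {α} S→T T→S h ε 0<ε = flipInner (proj₁ (h ε 0<ε)) , flipOuter (proj₂ (h ε 0<ε))
  where
  flipInner : ∃[ bs ] AllPairs NonOverlapping bs × All (λ b → boxRegion b ⊆ S) bs × α ≤ʳ fromℚ (totalArea bs + ε) →
              ∃[ bs ] AllPairs NonOverlapping bs × All (λ b → boxRegion b ⊆ T) bs × α ≤ʳ fromℚ (totalArea bs + ε)
  flipInner (bs , ns , is , α≤) = map transposeBox bs ,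
    AllPairs.map⁺ (AllPairs.map (λ {b} {c} → nonOverlapping-transpose {b} {c}) ns) ,
    All.map⁺ (All.map (λ {b} (i : boxRegion b ⊆ S) {p} (l , r , d , u) → S→T (i {proj₂ p , proj₁ p}
      (d , u , l , r))) is) ,
    subst (λ t → α ≤ʳ fromℚ (t + ε)) (sym (totalArea-transpose bs)) α≤
  flipOuter : ∃[ bs ] (S ⊆ (λ p → Any (λ b → boxRegion b p) bs)) × fromℚ (totalArea bs) ≤ʳ α +ʳ fromℚ ε →
              ∃[ bs ] (T ⊆ (λ p → Any (λ b → boxRegion b p) bs)) × fromℚ (totalArea bs) ≤ʳ α +ʳ fromℚ ε
  flipOuter (bs , cov , ≤α) = map transposeBox bs ,
    (λ {p} t → Any.map⁺ (Any.map (λ {b} (l , r , d , u) → d , u , l , r) (cov {proj₂ p , proj₁ p} (T→S {p} t)))) ,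
    subst (λ t → fromℚ t ≤ʳ α +ʳ fromℚ ε) (sym (totalArea-transpose bs)) ≤α

hull-transpose : ∀ {S T : Region} → S ⊆ transposeRegion T → convexHull S ⊆ transposeRegion (convexHull T)
hull-transpose S→T (k , w , p , w≥0 , Σw , p∈S , x≃ , y≃) =
  k , w , (λ i → proj₂ (p i) , proj₁ (p i)) , w≥0 , Σw , (λ i → S→T (p∈S i)) , y≃ , x≃

hullArea-transpose : ∀ {cs z} → HullArea cs z → HullArea (map transpose cs) z
hullArea-transpose {cs} {z} = area-transpose {α = fromℤ z /2}
  (λ {p} → hull-transpose {unionOf cs} {unionOf (map transpose cs)} (λ {q} → to {q}) {p})
  (λ {p} → hull-transpose {unionOf (map transpose cs)} {unionOf cs} (λ {q} → from {q}) {p})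
  where
  to : unionOf cs ⊆ transposeRegion (unionOf (map transpose cs))
  to h = Any.map⁺ (Any.map (λ (l , r , d , u) → d , u , l , r) h)
  from : unionOf (map transpose cs) ⊆ transposeRegion (unionOf cs)
  from h = Any.map (λ (l , r , d , u) → d , u , l , r) (Any.map⁻ h)

hullArea-transpose⁻ : ∀ {cs z} → HullArea (map transpose cs) z → HullArea cs z
hullArea-transpose⁻ {cs} {z} h = subst (λ cs → HullArea cs z) (involutive cs) (hullArea-transpose {map transpose
  cs} {z} h)
  where
  involutive : ∀ cs → map transpose (map transpose cs) ≡ cs
  involutive []       = refl
  involutive (c ∷ cs) = cong (c ∷_) (involutive cs)

null-const⁻ : ∀ {q} → Null (λ _ → q) → q ≡ 0ℚ
null-const⁻ {q} h = ℚ.≤-antisym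
  (lin (nonNeg-const⁻ (null⇒nonNeg (null-neg h))) (ℚ.+-identityˡ (- q))) (nonNeg-const⁻ (null⇒nonNeg h))

half-injective : ∀ {p q} → ½ * p - ½ * q ≡ 0ℚ → p ≡ q
half-injective {p} {q} eq = begin
  p                                 ≡⟨ solve 2 (λ p q → p := q :+ (con ½ :* p :- con ½ :* q :+ (con ½ :* p :- con
    ½ :* q))) refl p q ⟩
  q + (½ * p - ½ * q + (½ * p - ½ * q)) ≡⟨ cong (λ u → q + (u + u)) eq ⟩
  q + (0ℚ + 0ℚ)                     ≡⟨ ℚ.+-identityʳ q ⟩
  q                                 ∎
  where open ≡-Reasoning

-- Identifies an area found through transposition with the one computed from the caps of the same
-- cells.
hullArea-unique : ∀ {cs z z′} → HullArea cs z → HullArea cs z′ → z ≡ z′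
hullArea-unique {cs} {z} {z′} h h′ = ι-injective (half-injective
  (null-const⁻ (area-unique {convexHull (unionOf cs)} {fromℤ z /2} {fromℤ z′ /2} h h′)))

-- Growing polyominoes

StepX StepY : Cell → Cell → Set
StepX c d = proj₂ c ≡ proj₂ d × (proj₁ c ≡ ℤ.suc (proj₁ d) ⊎ proj₁ d ≡ ℤ.suc (proj₁ c))
StepY c d = proj₁ c ≡ proj₁ d × (proj₂ c ≡ ℤ.suc (proj₂ d) ⊎ proj₂ d ≡ ℤ.suc (proj₂ c))

-- A cell with several older neighbours is attached to one of them only, so every cell after the
-- first counts either in `h` or in `v`.
data Grow : List Cell → (h v : ℕ) → Set where
  seed  : ∀ c → Grow (c ∷ []) 0 0
  growX : ∀ {cs h v c d} → Grow cs h v → d ∈ cs → c ∉ cs → StepX c d → Grow (c ∷ cs) (suc h) v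
  growY : ∀ {cs h v c d} → Grow cs h v → d ∈ cs → c ∉ cs → StepY c d → Grow (c ∷ cs) h (suc v)

grow-length : ∀ {cs h v} → Grow cs h v → length cs ≡ suc (h ℕ.+ v)
grow-length (seed c)                       = refl
grow-length (growX g _ _ _)                = cong suc (grow-length g)
grow-length (growY {h = h} {v} g _ _ _)    = cong suc (trans (grow-length g) (sym (ℕ.+-suc h v)))

span-cons : ∀ {cs x b c d} → Span cs x b → d ∈ cs → proj₁ c ≡ proj₁ d → Span (c ∷ cs) x b
span-cons {x = x} {b} S m eq = record
  { lower     = λ { (here refl) → subst (x ℤ.≤_) (sym eq) (Span.lower S m) ; (there m) → Span.lower S m }
  ; upper     = λ { (here refl) → subst (λ p → ℤ.suc p ℤ.≤ x ℤ.+ + suc b) (sym eq) (Span.upper S m) ; (there m) →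
    Span.upper S m }
  ; leftmost  = let q , m = Span.leftmost S in q , there m
  ; rightmost = let p , q , m , eq = Span.rightmost S in p , q , there m , eq }

column-index : ∀ {cs x b p q} → Span cs x b → (p , q) ∈ cs → Σ[ i ∈ ℕ ] Σ[ r ∈ ℕ ] p ≡ x ℤ.+ + i × suc b ≡ i ℕ.+ suc r
column-index {x = x} {b} {p} S m with above-difference {x} {ℤ.suc p} (ℤ.≤-<-trans (Span.lower S m) (ℤ.suc[i]≤j⇒i<j
  (ℤ.≤-refl {ℤ.suc p})))
... | i , eq = i , b ∸ i , p≡ , trans (cong suc (sym (ℕ.m+[n∸m]≡n i≤b))) (sym (ℕ.+-suc i (b ∸ i)))
  where
  p≡ : p ≡ x ℤ.+ + i
  p≡ = trans (solveᶻ 1 (λ p → p :=ᶻ conᶻ (+ 1) :+ᶻ p :-ᶻ conᶻ (+ 1)) refl p) (trans (cong (ℤ._- + 1) eq)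
    (solveᶻ 2 (λ x i → x :+ᶻ (conᶻ (+ 1) :+ᶻ i) :-ᶻ conᶻ (+ 1) :=ᶻ x :+ᶻ i) refl x (+ i)))
  i≤b : i ℕ.≤ b
  i≤b = ℕ.s≤s⁻¹ (ℤ.drop‿+≤+ (linᶻ (diffᶻ (subst (ℤ._≤ x ℤ.+ + suc b) eq (Span.upper S m)))
    (solveᶻ 3 (λ x i b → b :-ᶻ i :=ᶻ x :+ᶻ b :-ᶻ (x :+ᶻ i)) refl x (+ suc i) (+ suc b))))

raise-in-span : ∀ {cs x b p y z z′} → Span cs x b → (p , y) ∈ cs → Cap cs (ι x) (suc b) z →
  Cap ((p , ℤ.suc y) ∷ cs) (ι x) (suc b) z′ → z′ ℤ.≤ z ℤ.+ + suc (suc b)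
raise-in-span {cs} {x} {b} {p} {y} {z} {z′} S m U U′ with column-index S m
... | i , r , refl , eq = subst (λ n → z′ ℤ.≤ z ℤ.+ + suc n) (sym eq)
  (cap-raise {cs} {x} {y} {i} {r} (λ {p} {q} c → subst (λ n → x ℤ.≤ p × p ℤ.≤ x ℤ.+ + n) eq (corner-column S c)) m
    (subst (λ n → Cap cs (ι x) n z) eq U) (subst (λ n → Cap ((x ℤ.+ + i , ℤ.suc y) ∷ cs) (ι x) n z′) eq U′))

-- A cell above an old one may raise the upper boundary but not the lower one of the flipped cells;
-- for a cell below an old one the roles are exchanged.
growY-caps : ∀ {cs x b p q q′ u l u′ l′} → Span cs x b → (p , q′) ∈ cs → q ≡ ℤ.suc q′ ⊎ q′ ≡ ℤ.suc q →
  Cap cs (ι x) (suc b) u → Cap (map flip cs) (ι x) (suc b) l →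
  Cap ((p , q) ∷ cs) (ι x) (suc b) u′ → Cap (map flip ((p , q) ∷ cs)) (ι x) (suc b) l′ →
  u′ ℤ.+ l′ ℤ.≤ u ℤ.+ l ℤ.+ + suc (suc b)
growY-caps {cs} {x} {b} {p} {q′ = q′} {u} {l} {u′} {l′} S m (inj₁ refl) U L U′ L′ =
  linᶻ (diffᶻ (raise-in-span S m U U′) ⊕ᶻ
      diffᶻ (cap-lower (subst (λ y → (p , y) ∈ map flip cs) (sym (suc-flip (ℤ.suc q′))) (∈-map⁺ flip m)) L L′))
    (solveᶻ 5 (λ u l u′ l′ k → u :+ᶻ l :+ᶻ k :-ᶻ (u′ :+ᶻ l′) :=ᶻ (u :+ᶻ k :-ᶻ u′) :+ᶻ (l :-ᶻ l′)) refl u l u′ l′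
      (+ suc (suc b)))
growY-caps {cs} {x} {b} {p} {q} {u = u} {l} {u′} {l′} S m (inj₂ refl) U L U′ L′ =
  linᶻ (diffᶻ (cap-lower m U U′) ⊕ᶻ diffᶻ (raise-in-span (span-flip S) (∈-map⁺ flip m) L
      (subst (λ y → Cap ((p , y) ∷ map flip cs) (ι x) (suc b) l′) (sym (suc-flip (ℤ.suc q))) L′)))
    (solveᶻ 5 (λ u l u′ l′ k → u :+ᶻ l :+ᶻ k :-ᶻ (u′ :+ᶻ l′) :=ᶻ (u :-ᶻ u′) :+ᶻ (l :+ᶻ k :-ᶻ l′)) refl u l u′ l′
      (+ suc (suc b)))

growY-area : ∀ {cs x b c d z} → Span cs x b → HullArea cs z → d ∈ cs → StepY c d →
  Σ[ z′ ∈ ℤ ] HullArea (c ∷ cs) z′ × z′ ℤ.≤ z ℤ.+ + suc (suc b)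
growY-area {cs} {x} {b} {p , q} {p′ , q′} {z} S h m (refl , step) =
  compare (span⇒cap S) (span⇒cap (span-flip S)) (span⇒cap S′) (span⇒cap (span-flip S′))
  where
  S′ : Span ((p , q) ∷ cs) x b
  S′ = span-cons S m refl
  compare : Σ[ u ∈ ℤ ] Cap cs (ι x) (suc b) u → Σ[ l ∈ ℤ ] Cap (map flip cs) (ι x) (suc b) l →
    Σ[ u′ ∈ ℤ ] Cap ((p , q) ∷ cs) (ι x) (suc b) u′ → Σ[ l′ ∈ ℤ ] Cap (map flip ((p , q) ∷ cs)) (ι x) (suc b) l′ →
    Σ[ z′ ∈ ℤ ] HullArea ((p , q) ∷ cs) z′ × z′ ℤ.≤ z ℤ.+ + suc (suc b)
  compare (u , U) (l , L) (u′ , U′) (l′ , L′) = u′ ℤ.+ l′ , caps⇒area S′ U′ L′ ,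
    subst (λ z → u′ ℤ.+ l′ ℤ.≤ z ℤ.+ + suc (suc b)) (hullArea-unique {cs} {u ℤ.+ l} {z} (caps⇒area S U L) h)
      (growY-caps S m step U L U′ L′)

-- An upper bound on the extent, not its exact value: a horizontal step may stay within the columns
-- that are already occupied.
Width : List Cell → ℕ → Set
Width cs h = Σ[ x ∈ ℤ ] (∀ {p q} → (p , q) ∈ cs → x ℤ.≤ p × p ℤ.≤ x ℤ.+ + h)

width-same : ∀ {cs h c d} → Width cs h → d ∈ cs → proj₁ c ≡ proj₁ d → Width (c ∷ cs) h
width-same {h = h} (x , bound) m eq = x , λ { (here refl) → subst (λ p → x ℤ.≤ p × p ℤ.≤ x ℤ.+ + h) (sym eq)
  (bound m) ; (there m) → bound m }

width-step : ∀ {cs h c d} → Width cs h → d ∈ cs → proj₁ c ≡ ℤ.suc (proj₁ d) ⊎ proj₁ d ≡ ℤ.suc (proj₁ c) → Width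
  (c ∷ cs) (suc h)
width-step {h = h} (x , bound) m (inj₁ refl) = x , λ
  { (here refl) → ℤ.≤-trans (proj₁ (bound m)) (ℤ.i≤suc[i] _) , linᶻ (diffᶻ (proj₂ (bound m)))
      (solveᶻ 3 (λ x h d → x :+ᶻ (conᶻ (+ 1) :+ᶻ h) :-ᶻ (conᶻ (+ 1) :+ᶻ d) :=ᶻ x :+ᶻ h :-ᶻ d) refl x (+ h) _)
  ; (there m) → proj₁ (bound m) , ℤ.≤-trans (proj₂ (bound m)) (ℤ.+-monoʳ-≤ x (ℤ.+≤+ (ℕ.n≤1+n h))) }
width-step {h = h} {c} (x , bound) m (inj₂ refl) = x ℤ.- + 1 , λ
  { (here refl) → linᶻ (diffᶻ (proj₁ (bound m))) (solveᶻ 2 (λ x p → p :-ᶻ (x :-ᶻ conᶻ (+ 1)) :=ᶻ (conᶻ (+ 1) :+ᶻ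
    p) :-ᶻ x) refl x (proj₁ c)) ,
      linᶻ (diffᶻ (proj₂ (bound m)) ⊕ᶻ ℤ.+≤+ (ℕ.z≤n {1})) (solveᶻ 3 (λ x h p → x :-ᶻ conᶻ (+ 1) :+ᶻ
        (conᶻ (+ 1) :+ᶻ h) :-ᶻ p :=ᶻ (x :+ᶻ h :-ᶻ (conᶻ (+ 1) :+ᶻ p)) :+ᶻ conᶻ (+ 1)) refl x (+ h) (proj₁ c))
  ; {p} (there m) → ℤ.≤-trans (linᶻ (ℤ.+≤+ (ℕ.z≤n {1})) (solveᶻ 1 (λ x → x :-ᶻ (x :-ᶻ conᶻ (+ 1)) :=ᶻ conᶻ (+ 1))
    refl x)) (proj₁ (bound m)) ,
      linᶻ (diffᶻ (proj₂ (bound m))) (solveᶻ 3 (λ x h p → x :-ᶻ conᶻ (+ 1) :+ᶻ (conᶻ (+ 1) :+ᶻ h) :-ᶻ p :=ᶻ x :+ᶻ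
        h :-ᶻ p) refl x (+ h) p) }

width-span : ∀ {cs h x b} → Width cs h → Span cs x b → b ℕ.≤ h
width-span {h = h} {x} {b} (x₀ , bound) S with Span.rightmost S
... | p , q , m , eq = ℤ.drop‿+≤+ (linᶻ (diffᶻ (proj₂ (bound m)) ⊕ᶻ diffᶻ (proj₁ (bound (proj₂ (Span.leftmost S)))))
  (begin
    + h ℤ.- + b                                        ≡⟨ solveᶻ 3 (λ x h b → h :-ᶻ b :=ᶻ h :+ᶻ x :+ᶻ conᶻ (+ 1)
      :-ᶻ (x :+ᶻ (conᶻ (+ 1) :+ᶻ b))) refl x (+ h) (+ b) ⟩
    + h ℤ.+ x ℤ.+ + 1 ℤ.- (x ℤ.+ + suc b)              ≡⟨ cong (λ u → + h ℤ.+ x ℤ.+ + 1 ℤ.- u) (sym eq) ⟩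
    + h ℤ.+ x ℤ.+ + 1 ℤ.- ℤ.suc p                      ≡⟨ solveᶻ 4 (λ x₀ x h p → h :+ᶻ x :+ᶻ conᶻ (+ 1) :-ᶻ
      (conᶻ (+ 1) :+ᶻ p) :=ᶻ (x₀ :+ᶻ h :-ᶻ p) :+ᶻ (x :-ᶻ x₀)) refl x₀ x (+ h) p ⟩
    (x₀ ℤ.+ + h ℤ.- p) ℤ.+ (x ℤ.- x₀)                  ∎))
  where open ≡-Reasoning

span-nonempty : ∀ {cs} {c : Cell} → c ∈ cs → Σ[ x ∈ ℤ ] Σ[ b ∈ ℕ ] Span cs x b
span-nonempty {c ∷ cs} _ = span-exists c cs

cell-area : ∀ c → HullArea (c ∷ []) (+ 2)
cell-area (p , q) = subst (HullArea ((p , q) ∷ [])) (solveᶻ 1 (λ q → (conᶻ (+ 1) :*ᶻ ((conᶻ (+ 1) :+ᶻ q) :+ᶻ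
  ((conᶻ (+ 1) :+ᶻ q) :+ᶻ conᶻ (+ 0))) :+ᶻ conᶻ (+ 0))
    :+ᶻ (conᶻ (+ 1) :*ᶻ ((conᶻ (+ 1) :+ᶻ (:-ᶻ (conᶻ (+ 1) :+ᶻ q))) :+ᶻ ((conᶻ (+ 1) :+ᶻ (:-ᶻ (conᶻ (+ 1) :+ᶻ q)))
      :+ᶻ conᶻ (+ 0))) :+ᶻ conᶻ (+ 0)) :=ᶻ conᶻ (+ 2)) refl q)
  (caps⇒area {(p , q) ∷ []} {p} {0} span (chain⇒cap (flat p q)) (chain⇒cap (flat p (ℤ.- ℤ.suc q))))
  where
  span : Span ((p , q) ∷ []) p 0
  span = record { lower = λ { (here refl) → ℤ.≤-refl } ; upper = λ { (here refl) → ℤ.≤-reflexive (ℤ.+-comm (+ 1) p) }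
                ; leftmost = q , here refl ; rightmost = p , q , here refl , ℤ.+-comm (+ 1) p }
  flat : ∀ p q → Chain ((p , q) ∷ []) p (ℤ.suc q) 1 _
  flat p q = edge 0 (+ 0) (topLeft (here refl))
    (subst₂ (TopCorner ((p , q) ∷ [])) (ℤ.+-comm (+ 1) p) (sym (ℤ.+-identityʳ (ℤ.suc q))) (topRight (here refl)))
    (corner-cases (λ r s → + 1 ℤ.* (s ℤ.- ℤ.suc q) ℤ.≤ + 0 ℤ.* (r ℤ.- p)) (λ { (topLeft ()) ; (topRight ()) })
      (ℤ.≤-reflexive (level p)) (ℤ.≤-reflexive (level (ℤ.suc p)))) stop
    where
    level : ∀ r → + 1 ℤ.* (ℤ.suc q ℤ.- ℤ.suc q) ≡ + 0 ℤ.* (r ℤ.- p)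
    level r = solveᶻ 3 (λ p q r → conᶻ (+ 1) :*ᶻ (q :-ᶻ q) :=ᶻ conᶻ (+ 0) :*ᶻ (r :-ᶻ p)) refl p (ℤ.suc q) r

AreaBound : List Cell → (h v : ℕ) → Set
AreaBound cs h v = Σ[ z ∈ ℤ ] HullArea cs z × z ℤ.≤ + (2 ℕ.* suc (h ℕ.+ v) ℕ.+ h ℕ.* v)

growY-bound : ∀ {cs h v c d} → AreaBound cs h v → Width cs h → d ∈ cs → StepY c d → AreaBound (c ∷ cs) h (suc v)
growY-bound {cs} {h} {v} {c} {d} (z , area , z≤) width m step = extend (span-nonempty m)
  where
  -- The increment width + 1 is at most h + 2: the 2 pays for the new cell, the h for passing from h
  -- v to h (v + 1).
  arith : ∀ h v → 2 ℕ.* suc (h ℕ.+ v) ℕ.+ h ℕ.* v ℕ.+ suc (suc h) ≡ 2 ℕ.* suc (h ℕ.+ suc v) ℕ.+ h ℕ.* suc v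
  arith = ℕsolve-∀
  extend : Σ[ x ∈ ℤ ] Σ[ b ∈ ℕ ] Span cs x b → AreaBound (c ∷ cs) h (suc v)
  extend (x , b , S) = let z′ , area′ , z′≤ = growY-area {cs} {x} {b} {c} {d} {z} S area m step in z′ , area′ ,
    ℤ.≤-trans z′≤ (ℤ.≤-trans (ℤ.+-mono-≤ z≤ (ℤ.+≤+ (ℕ.s≤s (ℕ.s≤s (width-span width S))))) (ℤ.≤-reflexive
      (cong +_ (arith h v))))

areaBound-transpose : ∀ {cs h v} → AreaBound cs h v → AreaBound (map transpose cs) v h
areaBound-transpose {cs} {h} {v} (z , area , z≤) = z , hullArea-transpose {cs} {z} area ,
  subst₂ (λ a b → z ℤ.≤ + (2 ℕ.* suc a ℕ.+ b)) (ℕ.+-comm h v) (ℕ.*-comm h v) z≤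

areaBound-transpose⁻ : ∀ {cs h v} → AreaBound (map transpose cs) v h → AreaBound cs h v
areaBound-transpose⁻ {cs} {h} {v} (z , area , z≤) = z , hullArea-transpose⁻ {cs} {z} area ,
  subst₂ (λ a b → z ℤ.≤ + (2 ℕ.* suc a ℕ.+ b)) (ℕ.+-comm v h) (ℕ.*-comm v h) z≤

-- The height is carried along as the width of the transposed cells, which is what a horizontal step
-- requires after transposition.
grow-bound : ∀ {cs h v} → Grow cs h v → AreaBound cs h v × Width cs h × Width (map transpose cs) v
grow-bound (seed c@(x , y)) = (+ 2 , cell-area c , ℤ.≤-refl) , point c , point (transpose c)
  where
  point : ∀ c → Width (c ∷ []) 0
  point (x , y) = x , λ { (here refl) → ℤ.≤-refl , ℤ.≤-reflexive (sym (ℤ.+-identityʳ x)) }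
grow-bound (growY g m _ step@(same , dir)) = let area , width , height = grow-bound g in
  growY-bound area width m step , width-same width m same , width-step height (∈-map⁺ transpose m) dir
grow-bound (growX {cs} {h} {v} {c} g m _ step@(same , dir)) = let area , width , height = grow-bound g in
  areaBound-transpose⁻ {c ∷ cs} {suc h} {v} (growY-bound (areaBound-transpose {cs} {h} {v} area) height
    (∈-map⁺ transpose m) step) ,
  width-step width m dir , width-same height (∈-map⁺ transpose m) same

adjacent : ∀ i j → ℤ.∣ i ℤ.- j ∣ ≡ 1 → i ≡ ℤ.suc j ⊎ j ≡ ℤ.suc i
adjacent i j eq with i ℤ.- j in d
... | + suc zero = inj₁ (trans (solveᶻ 2 (λ i j → i :=ᶻ (i :-ᶻ j) :+ᶻ j) refl i j) (cong (ℤ._+ j) d))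
... | -[1+ zero ] = inj₂ (trans (solveᶻ 2 (λ i j → j :=ᶻ (:-ᶻ (i :-ᶻ j)) :+ᶻ i) refl i j)
  (cong (λ u → ℤ.- u ℤ.+ i) d))

grow-nonempty : ∀ {cs h v} → Grow cs h v → Σ[ c ∈ Cell ] c ∈ cs
grow-nonempty (seed c)                = c , here refl
grow-nonempty (growX {c = c} _ _ _ _) = c , here refl
grow-nonempty (growY {c = c} _ _ _ _) = c , here refl

unique-↭ : ∀ {xs ys : List Cell} → xs ↭ ys → Unique xs → Unique ys
unique-↭ Perm.refl         u = u
unique-↭ (Perm.prep x p)   (ne ∷ u) = Perm.All-resp-↭ p ne ∷ unique-↭ p u
unique-↭ (Perm.swap x y p) ((x≢y ∷ nx) ∷ (ny ∷ u)) =
  ((λ eq → x≢y (sym eq)) ∷ Perm.All-resp-↭ p ny) ∷ (Perm.All-resp-↭ p nx ∷ unique-↭ p u)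
unique-↭ (Perm.trans p q)  u = unique-↭ q (unique-↭ p u)

swap-⊎ : ∀ {A B : Set} → A ⊎ B → B ⊎ A
swap-⊎ (inj₁ a) = inj₂ a
swap-⊎ (inj₂ b) = inj₁ b

-- On a path from a placed cell to a missing one some edge leaves the set of placed cells; its far
-- end is attached next.
complete : ∀ {cells} → Unique cells →
  (∀ {c d} → c ∈ cells → d ∈ cells → Star (λ e f → e ∈ cells × f ∈ cells × ShareEdge e f) c d) →
  ∀ n {vs h v} rest → length rest ≡ n → Grow vs h v → cells ↭ vs ++ rest →
  Σ[ cs ∈ List Cell ] Σ[ h ∈ ℕ ] Σ[ v ∈ ℕ ] Grow cs h v × cells ↭ cs ++ []
complete unique connected zero    []       _   g perm = _ , _ , _ , g , perm
complete {cells} unique connected (suc n) {vs} (d ∷ ds) len g perm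
  with grow-nonempty g
... | c , c∈vs with cross (connected (Perm.∈-resp-↭ (↭-sym perm) (∈-++⁺ˡ c∈vs)) (Perm.∈-resp-↭ (↭-sym perm)
  (∈-++⁺ʳ vs (here refl)))) c∈vs (here refl)
  where
  cross : ∀ {c e} → Star (λ e f → e ∈ cells × f ∈ cells × ShareEdge e f) c e → c ∈ vs → e ∈ d ∷ ds →
    Σ[ a ∈ Cell ] Σ[ f ∈ Cell ] a ∈ vs × f ∈ d ∷ ds × ShareEdge a f
  cross Star.ε c∈ e∈ = _ , _ , c∈ , e∈ , ⊥-elim (disjoint vs c∈ e∈ (unique-↭ perm unique))
    where
    disjoint : ∀ vs {c ws} → c ∈ vs → c ∈ ws → Unique (vs ++ ws) → ⊥
    disjoint (v ∷ vs) (here refl) c∈ws (ne ∷ _) = All.lookup ne (∈-++⁺ʳ vs c∈ws) refl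
    disjoint (v ∷ vs) (there m) c∈ws (_ ∷ u) = disjoint vs m c∈ws u
  cross (_◅_ {j = f} (_ , f∈ , share) path) c∈ e∈ with ∈-++⁻ vs (Perm.∈-resp-↭ perm f∈)
  ... | inj₁ f∈vs   = cross path f∈vs e∈
  ... | inj₂ f∈rest = _ , _ , c∈ , f∈rest , share
... | a , f , a∈vs , f∈rest , share with ∈-∃++ f∈rest
...   | as , bs , eq = extend share
  where
  perm′ : cells ↭ f ∷ vs ++ (as ++ bs)
  perm′ = ↭-trans (subst (λ r → cells ↭ vs ++ r) eq perm)
    (↭-trans (Perm.++⁺ˡ vs (Perm.shift f as bs)) (Perm.shift f vs (as ++ bs)))
  f∉vs : f ∉ vs
  f∉vs m with unique-↭ perm′ unique
  ... | ne ∷ _ = All.lookup ne (∈-++⁺ˡ m) refl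
  len′ : length (as ++ bs) ≡ n
  len′ = ℕ.suc-injective (trans (sym (Perm.↭-length (Perm.shift f as bs))) (trans (cong length (sym eq)) len))
  extend : ShareEdge a f → Σ[ cs ∈ List Cell ] Σ[ h ∈ ℕ ] Σ[ v ∈ ℕ ] Grow cs h v × cells ↭ cs ++ []
  extend (inj₁ (same , dist)) = complete unique connected n (as ++ bs) len′ (growY g a∈vs f∉vs (sym same , swap-⊎
    (adjacent _ _ dist))) perm′
  extend (inj₂ (same , dist)) = complete unique connected n (as ++ bs) len′ (growX g a∈vs f∉vs (sym same , swap-⊎
    (adjacent _ _ dist))) perm′

-- Lower bound for the area, and the case of equality up to one half

Σ<-nonNeg : ∀ n {f} → (∀ i → i ℕ.< n → 0ℚ ≤ f i) → 0ℚ ≤ Σ< n f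
Σ<-nonNeg zero    h = ℚ.≤-refl
Σ<-nonNeg (suc n) h = h 0 (ℕ.s≤s ℕ.z≤n) ⊕ Σ<-nonNeg n (λ i i<n → h (suc i) (ℕ.s≤s i<n))

Σ<-term : ∀ n {f} → (∀ i → i ℕ.< n → 0ℚ ≤ f i) → ∀ k → k ℕ.< n → f k ≤ Σ< n f
Σ<-term (suc n) {f} h zero    _ = lin (Σ<-nonNeg n (λ i i<n → h (suc i) (ℕ.s≤s i<n)))
  (solve 2 (λ a b → a :+ b :- a := b) refl (f 0) (Σ< n (f ∘ suc)))
Σ<-term (suc n) {f} h (suc k) (ℕ.s≤s k<n) = ℚ.≤-trans (Σ<-term n (λ i i<n → h (suc i) (ℕ.s≤s i<n)) k k<n)
  (lin (h 0 (ℕ.s≤s ℕ.z≤n)) (solve 2 (λ a b → a :+ b :- b := a) refl (f 0) (Σ< n (f ∘ suc))))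

Σ<-two : ∀ n {f} → (∀ i → i ℕ.< n → 0ℚ ≤ f i) → ∀ j k → j ℕ.< n → k ℕ.< n → j ≢ k → f j + f k ≤ Σ< n f
Σ<-two (suc n) h zero zero _ _ j≢k = contradiction refl j≢k
Σ<-two (suc n) {f} h zero (suc k) _ (ℕ.s≤s k<n) _ =
  ℚ.+-monoʳ-≤ (f 0) (Σ<-term n (λ i i<n → h (suc i) (ℕ.s≤s i<n)) k k<n)
Σ<-two (suc n) {f} h (suc j) zero (ℕ.s≤s j<n) _ _ = subst (_≤ f 0 + Σ< n (f ∘ suc)) (ℚ.+-comm (f 0) (f (suc j)))
  (ℚ.+-monoʳ-≤ (f 0) (Σ<-term n (λ i i<n → h (suc i) (ℕ.s≤s i<n)) j j<n))
Σ<-two (suc n) {f} h (suc j) (suc k) (ℕ.s≤s j<n) (ℕ.s≤s k<n) j≢k =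
  ℚ.≤-trans (Σ<-two n (λ i i<n → h (suc i) (ℕ.s≤s i<n)) j k j<n k<n (j≢k ∘ cong suc))
    (lin (h 0 (ℕ.s≤s ℕ.z≤n)) (solve 2 (λ a b → a :+ b :- b := a) refl (f 0) (Σ< n (f ∘ suc))))

Σ<-zero : ∀ n {f} → (∀ i → i ℕ.< n → f i ≡ 0ℚ) → Σ< n f ≡ 0ℚ
Σ<-zero zero    h = refl
Σ<-zero (suc n) h = cong₂ _+_ (h 0 (ℕ.s≤s ℕ.z≤n)) (Σ<-zero n (λ i i<n → h (suc i) (ℕ.s≤s i<n)))

Σ<-single : ∀ n {f} k → k ℕ.< n → (∀ j → j ℕ.< n → j ≢ k → f j ≡ 0ℚ) → Σ< n f ≡ f k
Σ<-single (suc n) {f} zero _ h = trans (cong (λ u → f 0 + u) (Σ<-zero n (λ i i<n → h (suc i) (ℕ.s≤s i<n) (λ ()))))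
  (ℚ.+-identityʳ (f 0))
Σ<-single (suc n) {f} (suc k) (ℕ.s≤s k<n) h = trans (cong (_+ Σ< n (f ∘ suc)) (h 0 (ℕ.s≤s ℕ.z≤n) (λ ())))
  (trans (ℚ.+-identityˡ (Σ< n (f ∘ suc))) (Σ<-single n k k<n (λ j j<n j≢k → h (suc j) (ℕ.s≤s j<n)
    (j≢k ∘ ℕ.suc-injective))))

pinch : ∀ {p q} → p ≤ q → q - p ≤ 0ℚ → q ≡ p
pinch {p} {q} p≤q h = ℚ.≤-antisym (lin (diff h) (solve 2 (λ p q → p :- q := con 0ℚ :- (q :- p)) refl p q)) p≤q

jump? : ∀ (t : ℕ → ℤ) b → (∀ i → i ℕ.< b → t i ≡ t (suc i)) ⊎ (Σ[ i ∈ ℕ ] i ℕ.< b × t i ≢ t (suc i))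
jump? t zero = inj₁ (λ _ ())
jump? t (suc b) with t b ℤ.≟ t (suc b) | jump? t b
... | no ne  | _                  = inj₂ (b , ℕ.n<1+n b , ne)
... | yes _  | inj₂ (i , i<b , ne) = inj₂ (i , ℕ.m<n⇒m<1+n i<b , ne)
... | yes eq | inj₁ h = inj₁ λ i i<1+b → case ℕ.m≤n⇒m<n∨m≡n (ℕ.s≤s⁻¹ i<1+b) of λ { (inj₁ i<b) → h i i<b ; (inj₂ refl) → eq }

constant : ∀ (t : ℕ → ℤ) {b} → (∀ i → i ℕ.< b → t i ≡ t (suc i)) → ∀ i → i ℕ.≤ b → t i ≡ t 0
constant t h zero    _   = refl
constant t h (suc i) i<b = trans (sym (h i i<b)) (constant t h i (ℕ.<⇒≤ i<b))

-- The value 0 is a default for empty columns; only values on occupied columns enter the arguments.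
topOf : List Cell → ℤ → ℤ
topOf cs x = [ proj₁ , (λ _ → + 0) ]′ (topmost? x cs)

topOf-∈ : ∀ {cs x q} → (x , q) ∈ cs → (x , topOf cs x) ∈ cs
topOf-∈ {cs} {x} m with topmost? x cs
... | inj₁ (_ , m′ , _) = m′
... | inj₂ h            = contradiction m h

topOf-≥ : ∀ {cs x q} → (x , q) ∈ cs → q ℤ.≤ topOf cs x
topOf-≥ {cs} {x} m with topmost? x cs
... | inj₁ (_ , _ , h) = h m
... | inj₂ h           = contradiction m h

Filled : List Cell → ℤ → ℕ → Set
Filled cs x a = ∀ i → i ℕ.< a → Σ[ q ∈ ℤ ] (x ℤ.+ + i , q) ∈ cs

columnTop : List Cell → ℤ → ℕ → ℤ
columnTop cs x i = ℤ.suc (topOf cs (x ℤ.+ + i))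

module Boundary {cs x b z} (S : Span cs x b) (U : Cap cs (ι x) (suc b) z) (filled : Filled cs x (suc b)) where

  open Cap U

  a = suc b

  t : ℕ → ℤ
  t = columnTop cs x

  -- `excess i` is twice the area between the boundary and the top of the highest cell in column
  -- `i`.
  τ leftValue rightValue excess : ℕ → ℚ
  τ i = ι (t i)
  leftValue i = at (line i) (ι x + ιℕ i)
  rightValue i = at (line i) (ι x + ιℕ (suc i))
  excess i = (leftValue i - τ i) + (rightValue i - τ i)

  topCell : ∀ {i} → i ℕ.< a → (x ℤ.+ + i , topOf cs (x ℤ.+ + i)) ∈ cs
  topCell {i} i<a = topOf-∈ (proj₂ (filled i i<a))

  support-left : ∀ {i j} → i ℕ.< a → j ℕ.< a → τ j ≤ at (line i) (ι x + ιℕ j)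
  support-left {i} {j} i<a j<a = subst (λ u → τ j ≤ at (line i) u) (ι-+ x (+ j)) (above i i<a (topLeft (topCell j<a)))

  support-right : ∀ {i j} → i ℕ.< a → j ℕ.< a → τ j ≤ at (line i) (ι x + ιℕ (suc j))
  support-right {i} {j} i<a j<a = subst (λ u → τ j ≤ at (line i) u)
    (trans (cong ι (solveᶻ 2 (λ x j → conᶻ (+ 1) :+ᶻ (x :+ᶻ j) :=ᶻ x :+ᶻ (conᶻ (+ 1) :+ᶻ j)) refl x (+ j)))
      (ι-+ x (+ suc j)))
    (above i i<a (topRight (topCell j<a)))

  0≤excess : ∀ i → i ℕ.< a → 0ℚ ≤ excess i
  0≤excess i i<a = diff (support-left i<a i<a) ⊕ diff (support-right i<a i<a)

  excess-sum : Σ< a excess ≡ ι z - (Σ< a τ + Σ< a τ)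
  excess-sum = begin
    Σ< a excess
      ≡⟨ Σ<-cong a (λ i _ → solve 3 (λ l r t → (l :- t) :+ (r :- t) := (l :+ r) :+ (con (- 1ℚ) :* (t :+ t) :+ con
        0ℚ)) refl (leftValue i) (rightValue i) (τ i)) ⟩
    Σ< a (λ i → (leftValue i + rightValue i) + ((- 1ℚ) * (τ i + τ i) + 0ℚ))
      ≡⟨ Σ<-+ a (λ i → leftValue i + rightValue i) (λ i → (- 1ℚ) * (τ i + τ i) + 0ℚ) ⟩
    Σ< a (λ i → leftValue i + rightValue i) + Σ< a (λ i → (- 1ℚ) * (τ i + τ i) + 0ℚ)
      ≡⟨ cong₂ _+_ total (trans (Σ<-affine a (- 1ℚ) (λ i → τ i + τ i) 0ℚ) (cong (λ u → (- 1ℚ) * u + ιℕ a * 0ℚ)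
        (Σ<-+ a τ τ))) ⟩
    ι z + ((- 1ℚ) * (Σ< a τ + Σ< a τ) + ιℕ a * 0ℚ)
      ≡⟨ solve 3 (λ z s a → z :+ (con (- 1ℚ) :* s :+ a :* con 0ℚ) := z :- s) refl (ι z) (Σ< a τ + Σ< a τ) (ιℕ a) ⟩
    ι z - (Σ< a τ + Σ< a τ) ∎
    where open ≡-Reasoning

  tight : ∀ {i} → i ℕ.< a → excess i ≤ 0ℚ → leftValue i ≡ τ i × rightValue i ≡ τ i
  tight {i} i<a h = pinch (support-left i<a i<a) (ℚ.≤-trans (lin (diff (support-right i<a i<a))
    (solve 3 (λ l r t → (l :- t) :+ (r :- t) :- (l :- t) := r :- t) refl (leftValue i) (rightValue i) (τ i))) h) ,
    pinch (support-right i<a i<a) (ℚ.≤-trans (lin (diff (support-left i<a i<a)) (solve 3 (λ l r t → (l :- t) :+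
      (r :- t) :- (r :- t) := l :- t) refl (leftValue i) (rightValue i) (τ i))) h)

  -- Both columns have a corner on their common vertical, and the line of each column bounds the
  -- corner of the other.
  level : ∀ {i} → i ℕ.< b → rightValue i ≡ τ i → leftValue (suc i) ≡ τ (suc i) → t i ≡ t (suc i)
  level {i} i<b r l = ι-injective (ℚ.≤-antisym
    (subst (τ i ≤_) l (support-right (ℕ.s≤s i<b) (ℕ.m<n⇒m<1+n i<b)))
    (subst (τ (suc i) ≤_) r (support-left (ℕ.m<n⇒m<1+n i<b) (ℕ.s≤s i<b))))

  flat : Σ< a excess ≡ 0ℚ → ∀ i → i ℕ.≤ b → t i ≡ t 0
  flat eq = constant t (λ i i<b → level i<b (proj₂ (zero-excess (ℕ.m<n⇒m<1+n i<b))) (proj₁ (zero-excess (ℕ.s≤s i<b))))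
    where
    zero-excess : ∀ {i} → i ℕ.< a → leftValue i ≡ τ i × rightValue i ≡ τ i
    zero-excess {i} i<a = tight i<a (subst (excess i ≤_) eq (Σ<-term a 0≤excess i i<a))

  -- With all tops equal, the horizontal line through them bounds every corner, so the boundary has
  -- no excess at all.
  not-constant : Σ< a excess ≡ 1ℚ → ¬ (∀ i → i ℕ.≤ b → t i ≡ t 0)
  not-constant eq h = ℚ.<-irrefl refl (ℚ.<-≤-trans 0<1 (subst (_≤ 0ℚ) eq
    (ℚ.≤-trans (Σ<-mono a no-excess) (ℚ.≤-reflexive (Σ<-zero a {λ _ → 0ℚ} (λ _ _ → refl))))))
    where
    roof : Line
    roof = mkLine (τ 0) 0ℚ
    at-roof : ∀ u → at roof u ≡ τ 0
    at-roof u = solve 2 (λ c u → c :+ con 0ℚ :* u := c) refl (τ 0) u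
    column : ∀ {p q} → (p , q) ∈ cs → ι (ℤ.suc q) ≤ τ 0
    column {p} {q} m with column-index S m
    ... | i , r , refl , eq′ = subst (ι (ℤ.suc q) ≤_)
      (cong ι (h i (ℕ.s≤s⁻¹ (subst (suc i ℕ.≤_) (sym eq′) (subst (suc i ℕ.≤_) (sym (ℕ.+-suc i r))
      (ℕ.s≤s (ℕ.m≤m+n i r)))))))
      (ι-≤ (ℤ.suc-mono (topOf-≥ m)))
    above-roof : Above cs roof
    above-roof (topLeft {p} {q} m)  = subst (ι (ℤ.suc q) ≤_) (sym (at-roof (ι p))) (column m)
    above-roof (topRight {p} {q} m) = subst (ι (ℤ.suc q) ≤_) (sym (at-roof (ι (ℤ.suc p)))) (column m)
    no-excess : ∀ i → i ℕ.< a → excess i ≤ 0ℚ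
    no-excess i i<a = lin (diff (under (leftEnd i i<a)) ⊕ diff (under (rightEnd i i<a)))
      (solve 3 (λ l r t → con 0ℚ :- ((l :- t) :+ (r :- t)) := (t :- l) :+ (t :- r)) refl (leftValue i)
        (rightValue i) (τ i))
      where
      under : ∀ {u v} → Attained cs u v → v ≤ τ i
      under {u} {v} att = subst (v ≤_) (trans (at-roof u) (cong ι (sym (h i (ℕ.s≤s⁻¹ i<a))))) (attained-≤ roof att
        above-roof)

  -- For counting cells it only matters that one column is lower by 1, not that it stands at an end.
  -- The condition `1 ≤ b` provides a second column and hence a proper factor.
  Notched : Set
  Notched = Σ[ M ∈ ℤ ] Σ[ k ∈ ℕ ] k ℕ.< a × 1 ℕ.≤ b × M ≡ ℤ.suc (t k) × (∀ j → j ℕ.< a → j ≢ k → t j ≡ M)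

  level-line : ∀ i u v w → at (line i) u ≡ v → at (line i) (u + 1ℚ) ≡ v → at (line i) w ≡ v
  level-line i u v w p q = trans (cong (λ s → c + s * w) σ≡0)
    (trans (solve 3 (λ c w u → c :+ con 0ℚ :* w := c :+ con 0ℚ :* u) refl c w u) (trans (cong (λ s → c + s * u)
      (sym σ≡0)) p))
    where
    c σ : ℚ
    c = intercept (line i)
    σ = slope (line i)
    σ≡0 : σ ≡ 0ℚ
    σ≡0 = trans (solve 3 (λ c σ u → σ := (c :+ σ :* (u :+ con 1ℚ)) :- (c :+ σ :* u)) refl c σ u)
      (trans (cong₂ _-_ q p) (ℚ.+-inverseʳ v))

  next : ∀ j → ι x + ιℕ (suc j) ≡ ι x + ιℕ j + 1ℚ
  next j = trans (cong (λ u → ι x + u) (ιℕ-suc j)) (sym (ℚ.+-assoc (ι x) (ιℕ j) 1ℚ))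

  -- Where two neighbouring tops differ, the line over the lower column must pass above the corner
  -- of the higher one on the common vertical. This uses up the whole excess 1, so the difference is
  -- exactly 1 and every other column is tight.
  bent : Σ< a excess ≡ 1ℚ → Notched
  bent eq with jump? t b
  ... | inj₁ h = contradiction (constant t h) (not-constant eq)
  ... | inj₂ (i , i<b , ne) with ℤ.<-cmp (t i) (t (suc i))
  ...   | tri≈ _ e _ = contradiction e ne
  ...   | tri> _ _ down = M , k , k<a , ℕ.≤-trans (ℕ.s≤s ℕ.z≤n) i<b , M≡ , others
    where
    k = suc i
    M = t i
    k<a : k ℕ.< a
    k<a = ℕ.s≤s i<b
    i<a : i ℕ.< a
    i<a = ℕ.m<n⇒m<1+n i<b
    drop : 1ℚ ≤ leftValue k - τ k
    drop = lin (diff (support-right {k} {i} k<a i<a) ⊕ diff (subst (_≤ τ i) (ι-suc (t k))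
      (ι-≤ (ℤ.i<j⇒suc[i]≤j down))))
      (solve 3 (λ l s m → l :- s :- con 1ℚ := (l :- m) :+ (m :- (s :+ con 1ℚ))) refl (leftValue k) (τ k) (τ i))
    rest : ∀ j → j ℕ.< a → j ≢ k → leftValue j ≡ τ j × rightValue j ≡ τ j
    rest j j<a j≢k = tight j<a (lin (diff (Σ<-two a 0≤excess j k j<a k<a j≢k) ⊕ diff drop ⊕ diff (support-right
      k<a k<a))
      (trans (solve 4 (λ f l r t → con 0ℚ :- f := (con 1ℚ :- (f :+ ((l :- t) :+ (r :- t)))) :+ ((l :- t :- con 1ℚ)
        :+ (r :- t))) refl (excess j) (leftValue k) (rightValue k) (τ k))
        (cong (λ u → (u - (excess j + excess k)) + ((leftValue k - τ k - 1ℚ) + (rightValue k - τ k))) (sym eq))))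
    excess-k : excess k ≤ 1ℚ
    excess-k = subst (excess k ≤_) eq (Σ<-term a 0≤excess k k<a)
    left-k : leftValue k ≤ τ k + 1ℚ
    left-k = lin (diff excess-k ⊕ diff (support-right k<a k<a))
      (solve 3 (λ l r t → t :+ con 1ℚ :- l := (con 1ℚ :- ((l :- t) :+ (r :- t))) :+ (r :- t)) refl (leftValue k)
        (rightValue k) (τ k))
    M≡ : M ≡ ℤ.suc (t k)
    M≡ = ℤ.≤-antisym (ι-≤⁻ (subst (τ i ≤_) (sym (ι-suc (t k))) (ℚ.≤-trans (support-right {k} {i} k<a i<a)
      left-k))) (ℤ.i<j⇒suc[i]≤j down)
    -- A further column would have a horizontal boundary too low for column i.
    last : k ≡ b
    last with ℕ.m≤n⇒m<n∨m≡n i<b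
    ... | inj₂ k≡b = k≡b
    ... | inj₁ k<b = contradiction (ι-≤⁻ (subst (τ i ≤_) (level-line (suc k) (ι x + ιℕ (suc k)) (τ (suc k))
      (ι x + ιℕ k)
              (proj₁ (rest (suc k) (ℕ.s≤s k<b) ℕ.1+n≢n)) (subst (λ u → at (line (suc k)) u ≡ τ (suc k))
                (next (suc k)) (proj₂ (rest (suc k) (ℕ.s≤s k<b) ℕ.1+n≢n))))
              (support-right {suc k} {i} (ℕ.s≤s k<b) i<a)))
            (ℤ.<⇒≱ (ℤ.≤-<-trans below down))
      where
      right-k : rightValue k ≤ τ k
      right-k = lin (diff excess-k ⊕ diff drop)
        (solve 3 (λ l r t → t :- r := (con 1ℚ :- ((l :- t) :+ (r :- t))) :+ (l :- t :- con 1ℚ)) refl (leftValue k)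
          (rightValue k) (τ k))
      below : t (suc k) ℤ.≤ t k
      below = ι-≤⁻ (ℚ.≤-trans (support-left {k} {suc k} k<a (ℕ.s≤s k<b)) right-k)
    steps : ∀ j → j ℕ.< i → t j ≡ t (suc j)
    steps j j<i = level (ℕ.<-trans j<i i<b) (proj₂ (rest j (ℕ.<-trans j<i i<a) (ℕ.<⇒≢ (ℕ.m<n⇒m<1+n j<i))))
      (proj₁ (rest (suc j) (ℕ.s≤s (ℕ.<-trans j<i i<b)) (ℕ.<⇒≢ (ℕ.s≤s j<i))))
    others : ∀ j → j ℕ.< a → j ≢ k → t j ≡ M
    others j j<a j≢k = trans (constant t steps j j≤i) (sym (constant t steps i ℕ.≤-refl))
      where
      j≤i : j ℕ.≤ i
      j≤i = ℕ.s≤s⁻¹ (ℕ.≤∧≢⇒< (ℕ.≤-trans (ℕ.s≤s⁻¹ j<a) (ℕ.≤-reflexive (sym last))) j≢k)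
  ...   | tri< up _ _ = M , i , i<a , ℕ.≤-trans (ℕ.s≤s ℕ.z≤n) i<b , M≡ , others
    where
    M = t (suc i)
    i<a : i ℕ.< a
    i<a = ℕ.m<n⇒m<1+n i<b
    k<a : suc i ℕ.< a
    k<a = ℕ.s≤s i<b
    rise : 1ℚ ≤ rightValue i - τ i
    rise = lin (diff (support-left {i} {suc i} i<a k<a) ⊕ diff (subst (_≤ τ (suc i)) (ι-suc (t i))
      (ι-≤ (ℤ.i<j⇒suc[i]≤j up))))
      (solve 3 (λ l s m → l :- s :- con 1ℚ := (l :- m) :+ (m :- (s :+ con 1ℚ))) refl (rightValue i) (τ i) (τ (suc i)))
    rest : ∀ j → j ℕ.< a → j ≢ i → leftValue j ≡ τ j × rightValue j ≡ τ j
    rest j j<a j≢i = tight j<a (lin (diff (Σ<-two a 0≤excess j i j<a i<a j≢i) ⊕ diff rise ⊕ diff (support-left i<a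
      i<a))
      (trans (solve 4 (λ f l r t → con 0ℚ :- f := (con 1ℚ :- (f :+ ((l :- t) :+ (r :- t)))) :+ ((r :- t :- con 1ℚ)
        :+ (l :- t))) refl (excess j) (leftValue i) (rightValue i) (τ i))
        (cong (λ u → (u - (excess j + excess i)) + ((rightValue i - τ i - 1ℚ) + (leftValue i - τ i))) (sym eq))))
    right-i : rightValue i ≤ τ i + 1ℚ
    right-i = lin (diff (subst (excess i ≤_) eq (Σ<-term a 0≤excess i i<a)) ⊕ diff (support-left i<a i<a))
      (solve 3 (λ l r t → t :+ con 1ℚ :- r := (con 1ℚ :- ((l :- t) :+ (r :- t))) :+ (l :- t)) refl (leftValue i)
        (rightValue i) (τ i))
    M≡ : M ≡ ℤ.suc (t i)
    M≡ = ℤ.≤-antisym (ι-≤⁻ (subst (τ (suc i) ≤_) (sym (ι-suc (t i))) (ℚ.≤-trans (support-left {i} {suc i} i<a k<a)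
      right-i))) (ℤ.i<j⇒suc[i]≤j up)
    first : ∀ i′ → i ≡ suc i′ → ⊥
    first i′ refl = contradiction (ι-≤⁻ (subst (τ (suc i) ≤_) (level-line i′ (ι x + ιℕ i′) (τ i′) (ι x + ιℕ (suc i))
        (proj₁ (rest i′ i′<a i′≢i)) (subst (λ u → at (line i′) u ≡ τ i′) (next i′) (proj₂ (rest i′ i′<a i′≢i))))
        (support-left {i′} {suc i} i′<a k<a)))
      (ℤ.<⇒≱ (ℤ.≤-<-trans below up))
      where
      i′≢i : i′ ≢ suc i′
      i′≢i ()
      i′<a : i′ ℕ.< a
      i′<a = ℕ.<-trans (ℕ.n<1+n i′) i<a
      left-i : leftValue i ≤ τ i
      left-i = lin (diff (subst (excess i ≤_) eq (Σ<-term a 0≤excess i i<a)) ⊕ diff rise)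
        (solve 3 (λ l r t → t :- l := (con 1ℚ :- ((l :- t) :+ (r :- t))) :+ (r :- t :- con 1ℚ)) refl (leftValue i)
          (rightValue i) (τ i))
      below : t i′ ℤ.≤ t i
      below = ι-≤⁻ (ℚ.≤-trans (support-right {i} {i′} i<a i′<a) left-i)
    tail : ∀ j → suc j ℕ.< b → t (suc j) ≡ t (suc (suc j))
    tail j j<b = level j<b (proj₂ (rest (suc j) (ℕ.m<n⇒m<1+n j<b) (λ e → first j (sym e))))
      (proj₁ (rest (suc (suc j)) (ℕ.s≤s j<b) (λ e → first (suc j) (sym e))))
    after : ∀ j → suc j ℕ.≤ b → t (suc j) ≡ t 1
    after zero    _   = refl
    after (suc j) j<b = trans (sym (tail j j<b)) (after j (ℕ.<⇒≤ j<b))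
    others : ∀ j → j ℕ.< a → j ≢ i → t j ≡ M
    others zero    j<a 0≢i = ⊥-elim (impossible i refl)
      where
      impossible : ∀ k → i ≡ k → ⊥
      impossible zero    e = 0≢i (sym e)
      impossible (suc k) e = first k e
    others (suc j) j<a j≢i = trans (after j (ℕ.s≤s⁻¹ j<a)) (sym (after i i<b))

-- Counting the cells of the columns

ι-<suc : ∀ i → ι i < ι (ℤ.suc i)
ι-<suc i = ι-< {i} {ℤ.suc i} (ℤ.suc[i]≤j⇒i<j (ℤ.≤-refl {ℤ.suc i}))

squareBox : Cell → Box
squareBox (p , q) = record
  { left = ι p ; right = ι (ℤ.suc p) ; bottom = ι q ; top = ι (ℤ.suc q)
  ; left<right = ι-<suc p ; bottom<top = ι-<suc q }

squares-disjoint : ∀ {c d} → c ≢ d → NonOverlapping (squareBox c) (squareBox d)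
squares-disjoint {p , q} {p′ , q′} c≢d with ℤ.<-cmp p p′ | ℤ.<-cmp q q′
... | tri< lt _ _ | _ = inj₁ (ι-≤ (ℤ.i<j⇒suc[i]≤j lt))
... | tri> _ _ gt | _ = inj₂ (inj₁ (ι-≤ (ℤ.i<j⇒suc[i]≤j gt)))
... | tri≈ _ _ _ | tri< lt _ _ = inj₂ (inj₂ (inj₁ (ι-≤ (ℤ.i<j⇒suc[i]≤j lt))))
... | tri≈ _ _ _ | tri> _ _ gt = inj₂ (inj₂ (inj₂ (ι-≤ (ℤ.i<j⇒suc[i]≤j gt))))
... | tri≈ _ refl _ | tri≈ _ refl _ = contradiction refl c≢d

squares-area : ∀ cs → totalArea (map squareBox cs) ≡ ιℕ (length cs)
squares-area [] = refl
squares-area ((p , q) ∷ cs) = trans (cong₂ _+_ (cong₂ _*_ (unit p) (unit q)) (squares-area cs))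
  (trans (ℚ.+-comm 1ℚ (ιℕ (length cs))) (sym (ιℕ-suc (length cs))))
  where
  unit : ∀ i → ι (ℤ.suc i) - ι i ≡ 1ℚ
  unit i = trans (cong (_- ι i) (ι-suc i)) (solve 1 (λ i → i :+ con 1ℚ :- i := con 1ℚ) refl (ι i))

Σ<-last : ∀ n f → Σ< (suc n) f ≡ f n + Σ< n f
Σ<-last zero    f = refl
Σ<-last (suc n) f = trans (cong (λ u → f 0 + u) (Σ<-last n (f ∘ suc)))
  (solve 3 (λ a b c → a :+ (b :+ c) := b :+ (a :+ c)) refl (f 0) (f (suc n)) (Σ< n (f ∘ suc)))

module Columns {cs x b z z′} (S : Span cs x b) (filled : Filled cs x (suc b)) (filled′ : Filled (map flip cs) x (suc b))
               (U : Cap cs (ι x) (suc b) z) (L : Cap (map flip cs) (ι x) (suc b) z′) where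

  module Upper = Boundary S U filled
  module Lower = Boundary (span-flip S) L filled′

  private
    a = suc b

  -- `Lower.t i` is minus the bottom of the lowest cell, so the sum is the height of column `i`.
  column-height : ∀ {i} → i ℕ.< a → + 1 ℤ.≤ Upper.t i ℤ.+ Lower.t i
  column-height {i} i<a with filled i i<a
  ... | q , m = linᶻ (diffᶻ (ℤ.suc-mono (topOf-≥ m)) ⊕ᶻ diffᶻ (ℤ.suc-mono (topOf-≥ (∈-map⁺ flip m))))
    (solveᶻ 3 (λ t t′ q → t :+ᶻ t′ :-ᶻ conᶻ (+ 1) :=ᶻ (t :-ᶻ (conᶻ (+ 1) :+ᶻ q)) :+ᶻ
      (t′ :-ᶻ (conᶻ (+ 1) :+ᶻ (:-ᶻ (conᶻ (+ 1) :+ᶻ q))))) refl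
      (Upper.t i) (Lower.t i) q)

  columnBox : ∀ i → i ℕ.< a → Box
  columnBox i i<a = record
    { left = ι (x ℤ.+ + i) ; right = ι (ℤ.suc (x ℤ.+ + i)) ; bottom = - Lower.τ i ; top = Upper.τ i
    ; left<right = ι-<suc (x ℤ.+ + i)
    ; bottom<top = lin< (ℚ.<-≤-trans 0<1 (subst (1ℚ ≤_) (ι-+ (Upper.t i) (Lower.t i)) (ι-≤ (column-height i<a))))
        (solve 2 (λ s t → s :- (:- t) := s :+ t) refl (Upper.τ i) (Lower.τ i)) }

  columnBoxes : ∀ n → n ℕ.≤ a → List Box
  columnBoxes zero    _   = []
  columnBoxes (suc n) n<a = columnBox n n<a ∷ columnBoxes n (ℕ.<⇒≤ n<a)

  columnBoxes-area : ∀ n n≤a → totalArea (columnBoxes n n≤a) ≡ Σ< n (λ i → Upper.τ i + Lower.τ i)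
  columnBoxes-area zero    _   = refl
  columnBoxes-area (suc n) n<a = trans (cong₂ _+_
      (trans (cong (λ w → (w - ι (x ℤ.+ + n)) * (Upper.τ n - (- Lower.τ n))) (ι-suc (x ℤ.+ + n)))
        (solve 3 (λ i s t → (i :+ con 1ℚ :- i) :* (s :- (:- t)) := s :+ t) refl (ι (x ℤ.+ + n)) (Upper.τ n)
          (Lower.τ n)))
      (columnBoxes-area n (ℕ.<⇒≤ n<a)))
    (sym (Σ<-last n (λ i → Upper.τ i + Lower.τ i)))

  pick : ∀ n n≤a {p} i → i ℕ.< n → (∀ i<a → boxRegion (columnBox i i<a) p) → Any (λ b → boxRegion b p)
    (columnBoxes n n≤a)
  pick (suc n) n<a {p} i i<1+n h with ℕ.m≤n⇒m<n∨m≡n (ℕ.s≤s⁻¹ i<1+n)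
  ... | inj₁ i<n  = there (pick n (ℕ.<⇒≤ n<a) {p} i i<n h)
  ... | inj₂ refl = here (h n<a)

  covered : unionOf cs ⊆ (λ p → Any (λ b → boxRegion b p) (columnBoxes a ℕ.≤-refl))
  covered {X , Y} h = locate (find h)
    where
    locate : Σ[ c ∈ Cell ] c ∈ cs × square c (X , Y) → Any (λ b → boxRegion b (X , Y)) (columnBoxes a ℕ.≤-refl)
    locate ((p , q) , m , (l , r , d , u)) = inColumn (column-index S m)
      where
      inColumn : (Σ[ i ∈ ℕ ] Σ[ r ∈ ℕ ] p ≡ x ℤ.+ + i × a ≡ i ℕ.+ suc r) → Any (λ b → boxRegion b (X , Y))
        (columnBoxes a ℕ.≤-refl)
      inColumn (i , k , refl , eq) = pick a ℕ.≤-refl {X , Y} i i<a λ _ → l , r ,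
          ≤-transʳ {fromℚ (- Lower.τ i)} {fromℤ q} {Y} (fromℚ-≤ bottom≤) d ,
          ≤-transʳ {Y} {fromℤ (ℤ.suc q)} {fromℚ (Upper.τ i)} u (fromℚ-≤ (ι-≤ (ℤ.suc-mono (topOf-≥ m))))
        where
        i<a : i ℕ.< a
        i<a = subst (suc i ℕ.≤_) (sym eq) (subst (suc i ℕ.≤_) (sym (ℕ.+-suc i k)) (ℕ.s≤s (ℕ.m≤m+n i k)))
        bottom≤ : - Lower.τ i ≤ ι q
        bottom≤ = subst (- Lower.τ i ≤_) (sym (ι-suc-flip q)) (ℚ.neg-antimono-≤
          (ι-≤ (ℤ.suc-mono (topOf-≥ (∈-map⁺ flip m)))))

  -- Cells are counted by area: their squares do not overlap and are covered by one box per column.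
  count : Unique cs → ιℕ (length cs) ≤ Σ< a Upper.τ + Σ< a Lower.τ
  count unique = subst₂ _≤_ (squares-area cs) (trans (columnBoxes-area a ℕ.≤-refl) (Σ<-+ a Upper.τ Lower.τ))
    (inner≤outer {unionOf cs} (map squareBox cs) (columnBoxes a ℕ.≤-refl)
      (AllPairs.map⁺ (AllPairs.map squares-disjoint unique)) (All.map⁺ (All.tabulate (λ m h → lose m h)))
        (λ {p} → covered {p}))

integer-sum : ∀ n (t : ℕ → ℤ) → Σ[ s ∈ ℤ ] Σ< n (λ i → ι (t i)) ≡ ι s
integer-sum zero    t = + 0 , refl
integer-sum (suc n) t = let s , eq = integer-sum n (t ∘ suc) in
  t 0 ℤ.+ s , trans (cong (λ u → ι (t 0) + u) eq) (sym (ι-+ (t 0) s))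

Σ<-const : ∀ n {f} c → (∀ i → i ℕ.< n → f i ≡ c) → Σ< n f ≡ ιℕ n * c
Σ<-const n {f} c h = trans (Σ<-cong n (λ i i<n → trans (h i i<n) (solve 1 (λ c → c := con 0ℚ :* con 0ℚ :+ c) refl c)))
  (trans (Σ<-affine n 0ℚ (λ _ → 0ℚ) c) (solve 2 (λ s a → con 0ℚ :* s :+ a := a) refl (Σ< n (λ _ → 0ℚ)) (ιℕ n * c)))

-- Raising column `k` by one unit brings all columns to the height `M`.
notched-sum : ∀ n (t : ℕ → ℤ) M k → k ℕ.< n → M ≡ ℤ.suc (t k) → (∀ j → j ℕ.< n → j ≢ k → t j ≡ M) →
  Σ< n (λ i → ι (t i)) + 1ℚ ≡ ιℕ n * ι M
notched-sum n t M k k<n M≡ others = begin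
  Σ< n τ + 1ℚ                                       ≡⟨ cong (λ u → Σ< n τ + u) (sym gap≡1) ⟩
  Σ< n τ + (ι M - τ k)                              ≡⟨ cong (λ u → Σ< n τ + u)
    (sym (Σ<-single n k k<n (λ j j<n j≢k → trans (cong (λ m → ι M - ι m) (others j j<n j≢k)) (ℚ.+-inverseʳ (ι M))))) ⟩
  Σ< n τ + Σ< n (λ j → ι M - τ j)                   ≡⟨ sym (Σ<-+ n τ (λ j → ι M - τ j)) ⟩
  Σ< n (λ j → τ j + (ι M - τ j))                    ≡⟨ Σ<-const n (ι M) (λ j _ → solve 2 (λ t m → t :+ (m :- t) :=
    m) refl (τ j) (ι M)) ⟩
  ιℕ n * ι M                                        ∎
  where
  open ≡-Reasoning
  τ : ℕ → ℚ
  τ i = ι (t i)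
  gap≡1 : ι M - τ k ≡ 1ℚ
  gap≡1 = trans (cong (λ m → ι m - τ k) M≡) (trans (cong (_- τ k) (ι-suc (t k))) (solve 1 (λ t → t :+ con 1ℚ :- t
    := con 1ℚ) refl (τ k)))

Factored : ℕ → Set
Factored m = Σ[ d ∈ ℕ ] Σ[ e ∈ ℕ ] 2 ℕ.≤ d × 2 ℕ.≤ e × m ≡ d ℕ.* e

factored : ∀ n b H → 1 ℕ.≤ b → + 2 ℤ.≤ H → ιℕ n + 1ℚ ≡ ιℕ (suc b) * ι H → Factored (suc n)
factored n b (+ h) 1≤b (ℤ.+≤+ 2≤h) eq = suc b , h , ℕ.s≤s 1≤b , 2≤h ,
  ℤ.+-injective (ι-injective (trans (ιℕ-suc n) (trans eq (trans (sym (ι-* (+ suc b) (+ h)))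
    (cong ι (sym (ℤ.pos-* (suc b) h)))))))

-- The third number enters twice, so the odd total stems from exactly one of the other two.
sum-to-one : ∀ {u l k} → + 0 ℤ.≤ u → + 0 ℤ.≤ l → + 0 ℤ.≤ k → u ℤ.+ l ℤ.+ (k ℤ.+ k) ≡ + 1 →
  (u ≡ + 1 × l ≡ + 0 × k ≡ + 0) ⊎ (u ≡ + 0 × l ≡ + 1 × k ≡ + 0)
sum-to-one {+ 1} {+ 0} {+ 0} _ _ _ _ = inj₁ (refl , refl , refl)
sum-to-one {+ 0} {+ 1} {+ 0} _ _ _ _ = inj₂ (refl , refl , refl)
sum-to-one {+ 0} {+ 0} {+ 0} _ _ _ ()
sum-to-one {+ 0} {+ 0} {+ suc k} _ _ _ eq = contradiction (ℤ.+-injective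
  (trans (cong +_ (sym (ℕ.+-suc (suc k) k))) eq)) λ ()
sum-to-one {+ 0} {+ 1} {+ suc k} _ _ _ eq = contradiction (ℤ.+-injective eq) λ ()
sum-to-one {+ 0} {+ suc (suc l)} {+ k} _ _ _ eq = contradiction (ℤ.+-injective eq) λ ()
sum-to-one {+ 1} {+ 0} {+ suc k} _ _ _ eq = contradiction (ℤ.+-injective eq) λ ()
sum-to-one {+ 1} {+ suc l} {+ k} _ _ _ eq = contradiction (ℤ.+-injective eq) λ ()
sum-to-one {+ suc (suc u)} {+ l} {+ k} _ _ _ eq = contradiction (ℤ.+-injective eq) λ ()

LowerBound : ℕ → ℤ → Set
LowerBound n z = + (2 ℕ.* n) ℤ.≤ z × (z ≡ + suc (2 ℕ.* n) → Factored (suc n))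

-- Twice the area minus 2 n splits into `eU + eL + (k + k)`: the excess of the upper boundary, that
-- of the lower boundary, and twice the number `k` of holes inside the columns.
caps-lower : ∀ {cs x b u l} → Unique cs → Span cs x b → Filled cs x (suc b) → Filled (map flip cs) x (suc b) →
  Cap cs (ι x) (suc b) u → Cap (map flip cs) (ι x) (suc b) l → LowerBound (length cs) (u ℤ.+ l)
caps-lower {cs} {x} {b} {u} {l} unique S filled filled′ U L = 2n≤ , λ eq → [ case₁ , case₂ ]′ (split eq)
  where
  open Columns S filled filled′ U L
  a n : ℕ
  a = suc b
  n = length cs
  s s′ eU eL k : ℤ
  s = proj₁ (integer-sum a Upper.t)
  s′ = proj₁ (integer-sum a Lower.t)
  Σ≡ : Σ< a Upper.τ ≡ ι s
  Σ≡ = proj₂ (integer-sum a Upper.t)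
  Σ≡′ : Σ< a Lower.τ ≡ ι s′
  Σ≡′ = proj₂ (integer-sum a Lower.t)
  eU = u ℤ.- (s ℤ.+ s)
  eL = l ℤ.- (s′ ℤ.+ s′)
  k = s ℤ.+ s′ ℤ.- + n
  minus-twice : ∀ u s {σ} → σ ≡ ι s → ι u - (σ + σ) ≡ ι (u ℤ.- (s ℤ.+ s))
  minus-twice u s refl = sym (trans (ι-minus u (s ℤ.+ s)) (cong (λ v → ι u - v) (ι-+ s s)))
  excessU : Σ< a Upper.excess ≡ ι eU
  excessU = trans Upper.excess-sum (minus-twice u s Σ≡)
  excessL : Σ< a Lower.excess ≡ ι eL
  excessL = trans Lower.excess-sum (minus-twice l s′ Σ≡′)
  0≤eU : + 0 ℤ.≤ eU
  0≤eU = ι-≤⁻ {+ 0} {eU} (subst (0ℚ ≤_) excessU (Σ<-nonNeg a Upper.0≤excess))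
  0≤eL : + 0 ℤ.≤ eL
  0≤eL = ι-≤⁻ {+ 0} {eL} (subst (0ℚ ≤_) excessL (Σ<-nonNeg a Lower.0≤excess))
  0≤k : + 0 ℤ.≤ k
  0≤k = diffᶻ (ι-≤⁻ {+ n} {s ℤ.+ s′} (subst (ιℕ n ≤_) (trans (cong₂ _+_ Σ≡ Σ≡′) (sym (ι-+ s s′))) (count unique)))
  2n≤ : + (2 ℕ.* n) ℤ.≤ u ℤ.+ l
  2n≤ = linᶻ (0≤eU ⊕ᶻ 0≤eL ⊕ᶻ 0≤k ⊕ᶻ 0≤k)
    (trans (cong (λ m → u ℤ.+ l ℤ.- m) (ℤ.pos-* 2 n))
      (solveᶻ 5 (λ u l s s′ n → u :+ᶻ l :-ᶻ conᶻ (+ 2) :*ᶻ n :=ᶻ (u :-ᶻ (s :+ᶻ s)) :+ᶻ ((l :-ᶻ (s′ :+ᶻ s′)) :+ᶻ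
        ((s :+ᶻ s′ :-ᶻ n) :+ᶻ (s :+ᶻ s′ :-ᶻ n)))) refl u l s s′ (+ n)))
  split : u ℤ.+ l ≡ + suc (2 ℕ.* n) → (eU ≡ + 1 × eL ≡ + 0 × k ≡ + 0) ⊎ (eU ≡ + 0 × eL ≡ + 1 × k ≡ + 0)
  split eq = sum-to-one 0≤eU 0≤eL 0≤k (begin
    eU ℤ.+ eL ℤ.+ (k ℤ.+ k)
      ≡⟨ solveᶻ 5 (λ u l s s′ n → u :-ᶻ (s :+ᶻ s) :+ᶻ (l :-ᶻ (s′ :+ᶻ s′)) :+ᶻ ((s :+ᶻ s′ :-ᶻ n) :+ᶻ
        (s :+ᶻ s′ :-ᶻ n)) :=ᶻ u :+ᶻ l :-ᶻ conᶻ (+ 2) :*ᶻ n) refl u l s s′ (+ n) ⟩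
    u ℤ.+ l ℤ.- + 2 ℤ.* + n       ≡⟨ cong (λ v → v ℤ.- + 2 ℤ.* + n) (trans eq (cong (λ m → + 1 ℤ.+ m)
      (ℤ.pos-* 2 n))) ⟩
    + 1 ℤ.+ + 2 ℤ.* + n ℤ.- + 2 ℤ.* + n ≡⟨ solveᶻ 1 (λ m → conᶻ (+ 1) :+ᶻ m :-ᶻ m :=ᶻ conᶻ (+ 1)) refl (+ 2 ℤ.* + n) ⟩
    + 1 ∎)
    where open ≡-Reasoning
  n≡ : k ≡ + 0 → ιℕ n ≡ Σ< a Upper.τ + Σ< a Lower.τ
  n≡ k≡0 = trans (cong ι (trans (solveᶻ 2 (λ s n → n :=ᶻ s :-ᶻ (s :-ᶻ n)) refl (s ℤ.+ s′) (+ n))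
    (trans (cong (λ m → s ℤ.+ s′ ℤ.- m) k≡0) (ℤ.+-identityʳ (s ℤ.+ s′)))))
    (trans (ι-+ s s′) (sym (cong₂ _+_ Σ≡ Σ≡′)))
  assemble : ∀ {f g : ℕ → ℤ} M t → Σ< a (λ i → ι (f i)) + 1ℚ ≡ ιℕ a * ι M → (∀ i → i ℕ.< a → g i ≡ t) →
    ιℕ n ≡ Σ< a (λ i → ι (f i)) + Σ< a (λ i → ι (g i)) → ιℕ n + 1ℚ ≡ ιℕ a * ι (M ℤ.+ t)
  assemble {f} {g} M t notched level eq = begin
    ιℕ n + 1ℚ                                  ≡⟨ cong (_+ 1ℚ) eq ⟩
    Σ< a (λ i → ι (f i)) + Σ< a (λ i → ι (g i)) + 1ℚ
      ≡⟨ solve 2 (λ x y → x :+ y :+ con 1ℚ := (x :+ con 1ℚ) :+ y) refl (Σ< a (λ i → ι (f i))) (Σ< a (λ i → ι (g i))) ⟩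
    (Σ< a (λ i → ι (f i)) + 1ℚ) + Σ< a (λ i → ι (g i))
      ≡⟨ cong₂ _+_ notched (Σ<-const a (ι t) (λ i i<a → cong ι (level i i<a))) ⟩
    ιℕ a * ι M + ιℕ a * ι t                    ≡⟨ sym (ℚ.*-distribˡ-+ (ιℕ a) (ι M) (ι t)) ⟩
    ιℕ a * (ι M + ι t)                         ≡⟨ cong (ιℕ a *_) (sym (ι-+ M t)) ⟩
    ιℕ a * ι (M ℤ.+ t)                         ∎
    where open ≡-Reasoning
  two≤ : ∀ {M t g g₀} → M ≡ ℤ.suc t → g ≡ g₀ → + 1 ℤ.≤ t ℤ.+ g → + 2 ℤ.≤ M ℤ.+ g₀
  two≤ {t = t} {g} refl refl h = linᶻ (diffᶻ h) (solveᶻ 2 (λ t g → conᶻ (+ 1) :+ᶻ t :+ᶻ g :-ᶻ conᶻ (+ 2) :=ᶻ t :+ᶻ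
    g :-ᶻ conᶻ (+ 1)) refl t g)
  case₁ : (eU ≡ + 1 × eL ≡ + 0 × k ≡ + 0) → Factored (suc n)
  case₁ (eU≡ , eL≡ , k≡) = finish (Upper.bent (trans excessU (cong ι eU≡))) (Lower.flat (trans excessL (cong ι eL≡)))
    where
    finish : Upper.Notched → (∀ i → i ℕ.≤ b → Lower.t i ≡ Lower.t 0) → Factored (suc n)
    finish (M , j , j<a , 1≤b , M≡ , others) level = factored n b (M ℤ.+ Lower.t 0) 1≤b
      (two≤ {M} {Upper.t j} {Lower.t j} M≡ (level j (ℕ.s≤s⁻¹ j<a)) (column-height j<a))
      (assemble {Upper.t} {Lower.t} M (Lower.t 0) (notched-sum a Upper.t M j j<a M≡ others) (λ i i<a → level i
        (ℕ.s≤s⁻¹ i<a)) (n≡ k≡))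
  case₂ : (eU ≡ + 0 × eL ≡ + 1 × k ≡ + 0) → Factored (suc n)
  case₂ (eU≡ , eL≡ , k≡) = finish (Lower.bent (trans excessL (cong ι eL≡))) (Upper.flat (trans excessU (cong ι eU≡)))
    where
    finish : Lower.Notched → (∀ i → i ℕ.≤ b → Upper.t i ≡ Upper.t 0) → Factored (suc n)
    finish (M , j , j<a , 1≤b , M≡ , others) level = factored n b (M ℤ.+ Upper.t 0) 1≤b
      (two≤ {M} {Lower.t j} {Upper.t j} M≡ (level j (ℕ.s≤s⁻¹ j<a)) (subst (+ 1 ℤ.≤_) (ℤ.+-comm (Upper.t j)
        (Lower.t j)) (column-height j<a)))
      (assemble {Lower.t} {Upper.t} M (Upper.t 0) (notched-sum a Lower.t M j j<a M≡ others) (λ i i<a → level i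
        (ℕ.s≤s⁻¹ i<a))
        (trans (n≡ k≡) (ℚ.+-comm (Σ< a Upper.τ) (Σ< a Lower.τ))))

grow-unique : ∀ {cs h v} → Grow cs h v → Unique cs
grow-unique (seed c)           = [] ∷ []
grow-unique (growX g _ c∉ _)   = All.tabulate (λ m eq → c∉ (subst (_∈ _) (sym eq) m)) ∷ grow-unique g
grow-unique (growY g _ c∉ _)   = All.tabulate (λ m eq → c∉ (subst (_∈ _) (sym eq) m)) ∷ grow-unique g

suc-cancel-≤ : ∀ {i j} → ℤ.suc i ℤ.≤ ℤ.suc j → i ℤ.≤ j
suc-cancel-≤ {i} {j} h = linᶻ (diffᶻ h) (solveᶻ 2 (λ i j → j :-ᶻ i :=ᶻ conᶻ (+ 1) :+ᶻ j :-ᶻ (conᶻ (+ 1) :+ᶻ i))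
  refl i j)

HasColumn : List Cell → ℤ → Set
HasColumn cs r = Σ[ q ∈ ℤ ] (r , q) ∈ cs

-- The column of the new cell is at distance at most 1 from an occupied one, so the occupied columns
-- still form an interval.
add-column : ∀ {cs c d} → d ∈ cs → proj₁ d ℤ.≤ ℤ.suc (proj₁ c) → proj₁ c ℤ.≤ ℤ.suc (proj₁ d) →
  (∀ {p p′ r} → HasColumn cs p → HasColumn cs p′ → p ℤ.≤ r → r ℤ.≤ p′ → HasColumn cs r) →
  ∀ {p p′ r} → HasColumn (c ∷ cs) p → HasColumn (c ∷ cs) p′ → p ℤ.≤ r → r ℤ.≤ p′ → HasColumn (c ∷ cs) r
add-column {cs} {c} {d} d∈ d≤ c≤ between {p} {p′} {r} hp hp′ p≤r r≤p′ with r ℤ.≟ proj₁ c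
... | yes refl = proj₂ c , here refl
... | no r≢c = let q , m = between-old (from-left hp) (from-right hp′) in q , there m
  where
  from-left : HasColumn (c ∷ cs) p → Σ[ o ∈ ℤ ] HasColumn cs o × o ℤ.≤ r
  from-left (q , here refl) = proj₁ d , (proj₂ d , d∈) , ℤ.≤-trans d≤ (ℤ.i<j⇒suc[i]≤j (ℤ.≤∧≢⇒< p≤r (r≢c ∘ sym)))
  from-left (q , there m)   = p , (q , m) , p≤r
  from-right : HasColumn (c ∷ cs) p′ → Σ[ o ∈ ℤ ] HasColumn cs o × r ℤ.≤ o
  from-right (q , here refl) = proj₁ d , (proj₂ d , d∈) , suc-cancel-≤
    (ℤ.≤-trans (ℤ.i<j⇒suc[i]≤j (ℤ.≤∧≢⇒< r≤p′ r≢c)) c≤)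
  from-right (q , there m)   = p′ , (q , m) , r≤p′
  between-old : Σ[ o ∈ ℤ ] HasColumn cs o × o ℤ.≤ r → Σ[ o ∈ ℤ ] HasColumn cs o × r ℤ.≤ o → HasColumn cs r
  between-old (_ , h , le) (_ , h′ , le′) = between h h′ le le′

columns-between : ∀ {cs h v} → Grow cs h v → ∀ {p p′ r} → HasColumn cs p → HasColumn cs p′ → p ℤ.≤ r → r ℤ.≤ p′ →
  HasColumn cs r
columns-between (seed (x , y)) (_ , here refl) (_ , here refl) x≤r r≤x = y , here (cong (_, y) (ℤ.≤-antisym r≤x x≤r))
columns-between (growY {c = c} g m _ (refl , _)) = add-column {c = c} m (ℤ.i≤suc[i] _) (ℤ.i≤suc[i] _)
  (columns-between g)
columns-between (growX {c = c} g m _ (_ , inj₁ refl)) = add-column {c = c} m (ℤ.≤-trans (ℤ.i≤suc[i] _)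
  (ℤ.i≤suc[i] _)) ℤ.≤-refl (columns-between g)
columns-between (growX {c = c} g m _ (_ , inj₂ refl)) = add-column {c = c} m ℤ.≤-refl (ℤ.≤-trans (ℤ.i≤suc[i] _)
  (ℤ.i≤suc[i] _)) (columns-between g)

grow-filled : ∀ {cs h v x b} → Grow cs h v → Span cs x b → Filled cs x (suc b)
grow-filled {x = x} {b} g S i i<a = let p , q , m , eq = Span.rightmost S in
  columns-between g (Span.leftmost S) (q , m) (subst (ℤ._≤ x ℤ.+ + i) (ℤ.+-identityʳ x) (ℤ.+-monoʳ-≤ x (ℤ.+≤+ ℕ.z≤n)))
    (linᶻ (diffᶻ (ℤ.+≤+ i<a)) (trans (solveᶻ 3 (λ p x i → p :-ᶻ (x :+ᶻ i) :=ᶻ conᶻ (+ 1) :+ᶻ p :-ᶻ x :-ᶻ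
      (conᶻ (+ 1) :+ᶻ i)) refl p x (+ i))
      (trans (cong (λ u → u ℤ.- x ℤ.- + suc i) eq) (solveᶻ 3 (λ x a i → x :+ᶻ a :-ᶻ x :-ᶻ i :=ᶻ a :-ᶻ i) refl x
        (+ suc b) (+ suc i)))))

grow-lower : ∀ {cs h v z} → Grow cs h v → HullArea cs z → LowerBound (length cs) z
grow-lower {cs} {z = z} g area = finish (span-nonempty (proj₂ (grow-nonempty g)))
  where
  finish : Σ[ x ∈ ℤ ] Σ[ b ∈ ℕ ] Span cs x b → LowerBound (length cs) z
  finish (x , b , S) = compare (span⇒cap S) (span⇒cap (span-flip S))
    where
    filled : Filled cs x (suc b)
    filled = grow-filled g S
    compare : Σ[ u ∈ ℤ ] Cap cs (ι x) (suc b) u → Σ[ l ∈ ℤ ] Cap (map flip cs) (ι x) (suc b) l → LowerBound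
      (length cs) z
    compare (u , U) (l , L) = subst (LowerBound (length cs)) (hullArea-unique {cs} {u ℤ.+ l} {z} (caps⇒area S U L)
      area)
      (caps-lower (grow-unique g) S filled (λ i i<a → let q , m = filled i i<a in _ , ∈-map⁺ flip m) U L)

-- Polyominoes with prescribed hull

Grown : List Cell → Set
Grown cs = Σ[ h ∈ ℕ ] Σ[ v ∈ ℕ ] Grow cs h v

grow : ∀ {cs c d} → Grown cs → d ∈ cs → c ∉ cs → StepX c d ⊎ StepY c d → Grown (c ∷ cs)
grow (h , v , g) m new (inj₁ s) = suc h , v , growX g m new s
grow (h , v , g) m new (inj₂ s) = h , suc v , growY g m new s

run : (ℕ → Cell) → ℕ → List Cell → List Cell
run f zero    cs = cs
run f (suc k) cs = f k ∷ run f k cs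

run-∈ : ∀ {f k cs i} → i ℕ.< k → f i ∈ run f k cs
run-∈ {k = suc k} {i = i} i<1+k with ℕ.m≤n⇒m<n∨m≡n (ℕ.s≤s⁻¹ i<1+k)
... | inj₁ i<k  = there (run-∈ i<k)
... | inj₂ refl = here refl

run-old : ∀ {f c cs} k → c ∈ cs → c ∈ run f k cs
run-old zero    m = m
run-old (suc k) m = there (run-old k m)

run-∈⁻ : ∀ {f c cs} k → c ∈ run f k cs → (Σ[ i ∈ ℕ ] i ℕ.< k × c ≡ f i) ⊎ c ∈ cs
run-∈⁻ zero    m           = inj₂ m
run-∈⁻ (suc k) (here refl) = inj₁ (k , ℕ.n<1+n k , refl)
run-∈⁻ (suc k) (there m) with run-∈⁻ k m
... | inj₁ (i , i<k , eq) = inj₁ (i , ℕ.m<n⇒m<1+n i<k , eq)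
... | inj₂ m′             = inj₂ m′

run-length : ∀ f k cs → length (run f k cs) ≡ k ℕ.+ length cs
run-length f zero    cs = refl
run-length f (suc k) cs = cong suc (run-length f k cs)

horizontal vertical : ℕ → ℕ → ℕ → Cell
horizontal x y i = + (x ℕ.+ i) , + y
vertical x y i = + x , + (y ℕ.+ i)

grow-run : ∀ {cs} f → (∀ {i j} → f i ≡ f j → i ≡ j) → (∀ i → StepX (f (suc i)) (f i) ⊎ StepY (f (suc i)) (f i)) →
  ∀ {d} k → Grown cs → d ∈ cs → StepX (f 0) d ⊎ StepY (f 0) d → (∀ i → i ℕ.< k → f i ∉ cs) → Grown (run f k cs)
grow-run f inj next zero    g m s new = g
grow-run {cs} f inj next (suc k) g m s new = attach k (grow-run f inj next k g m s (λ i i<k → new i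
  (ℕ.m<n⇒m<1+n i<k))) fresh
  where
  fresh : f k ∉ run f k cs
  fresh m with run-∈⁻ k m
  ... | inj₁ (i , i<k , eq) = ℕ.<-irrefl (sym (inj eq)) i<k
  ... | inj₂ m′             = new k (ℕ.n<1+n k) m′
  attach : ∀ k → Grown (run f k cs) → f k ∉ run f k cs → Grown (f k ∷ run f k cs)
  attach zero    g new = grow g m new s
  attach (suc k) g new = grow g (here refl) new (next k)

grow-horizontal : ∀ {cs} x y {d} k → Grown cs → d ∈ cs → StepX (horizontal x y 0) d ⊎ StepY (horizontal x y 0) d →
  (∀ i → i ℕ.< k → horizontal x y i ∉ cs) → Grown (run (horizontal x y) k cs)
grow-horizontal x y = grow-run (horizontal x y)
  (λ {i} {j} eq → ℕ.+-cancelˡ-≡ x i j (ℤ.+-injective (cong proj₁ eq)))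
  (λ i → inj₁ (refl , inj₁ (cong +_ (ℕ.+-suc x i))))

grow-vertical : ∀ {cs} x y {d} k → Grown cs → d ∈ cs → StepX (vertical x y 0) d ⊎ StepY (vertical x y 0) d →
  (∀ i → i ℕ.< k → vertical x y i ∉ cs) → Grown (run (vertical x y) k cs)
grow-vertical x y = grow-run (vertical x y)
  (λ {i} {j} eq → ℕ.+-cancelˡ-≡ y i j (ℤ.+-injective (cong proj₂ eq)))
  (λ i → inj₂ (refl , inj₁ (cong +_ (ℕ.+-suc y i))))

∉-run : ∀ {f cs c} k → (∀ i → i ℕ.< k → c ≢ f i) → c ∉ cs → c ∉ run f k cs
∉-run k ne new m with run-∈⁻ k m
... | inj₁ (i , i<k , eq) = ne i i<k eq
... | inj₂ m′             = new m′

-- An `edge` given by its end heights instead of their difference, which keeps the totals of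
-- explicit chains readable as polynomials.
link : ∀ {cs x y y′ a t} d → TopCorner cs (+ x) y → TopCorner cs (+ (x ℕ.+ suc d)) y′ →
  (∀ {p q} → TopCorner cs p q → + suc d ℤ.* (q ℤ.- y) ℤ.≤ (y′ ℤ.- y) ℤ.* (p ℤ.- + x)) →
  Chain cs (+ (x ℕ.+ suc d)) y′ a t → Chain cs (+ x) y (suc d ℕ.+ a) (+ suc d ℤ.* (y ℤ.+ y′) ℤ.+ t)
link {cs} {x} {y} {y′} {a} {t} d from to support chain = go (y′ ℤ.- y) (solveᶻ 2 (λ y y′ → y′ :=ᶻ y :+ᶻ
  (y′ :-ᶻ y)) refl y y′) to support chain
  where
  go : ∀ e {y′} → y′ ≡ y ℤ.+ e → TopCorner cs (+ (x ℕ.+ suc d)) y′ →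
    (∀ {p q} → TopCorner cs p q → + suc d ℤ.* (q ℤ.- y) ℤ.≤ (y′ ℤ.- y) ℤ.* (p ℤ.- + x)) →
    Chain cs (+ (x ℕ.+ suc d)) y′ a t → Chain cs (+ x) y (suc d ℕ.+ a) (+ suc d ℤ.* (y ℤ.+ y′) ℤ.+ t)
  go e refl to support = edge d e from to λ {p} {q} c → subst (λ u → + suc d ℤ.* (q ℤ.- y) ℤ.≤ u ℤ.* (p ℤ.- + x))
    (solveᶻ 2 (λ y e → y :+ᶻ e :-ᶻ y :=ᶻ e) refl y e) (support c)

-- Under a falling edge the right top corner of a cell is critical, under a rising edge the left
-- one. This leaves one inequality per cell.
falling : ∀ {cs} D x y y′ → y′ ℤ.≤ y →
  (∀ {p q} → (p , q) ∈ cs → D ℤ.* (ℤ.suc q ℤ.- y) ℤ.≤ (y′ ℤ.- y) ℤ.* (ℤ.suc p ℤ.- x)) →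
  ∀ {p q} → TopCorner cs p q → D ℤ.* (q ℤ.- y) ℤ.≤ (y′ ℤ.- y) ℤ.* (p ℤ.- x)
falling D x y y′ le h (topLeft {p} m) = ℤ.≤-trans (h m) (linᶻ (diffᶻ le)
  (solveᶻ 4 (λ x y y′ p → (y′ :-ᶻ y) :*ᶻ (p :-ᶻ x) :-ᶻ (y′ :-ᶻ y) :*ᶻ (conᶻ (+ 1) :+ᶻ p :-ᶻ x) :=ᶻ y :-ᶻ y′) refl
    x y y′ p))
falling D x y y′ le h (topRight m) = h m

rising : ∀ {cs} D x y y′ → y ℤ.≤ y′ →
  (∀ {p q} → (p , q) ∈ cs → D ℤ.* (ℤ.suc q ℤ.- y) ℤ.≤ (y′ ℤ.- y) ℤ.* (p ℤ.- x)) →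
  ∀ {p q} → TopCorner cs p q → D ℤ.* (q ℤ.- y) ℤ.≤ (y′ ℤ.- y) ℤ.* (p ℤ.- x)
rising D x y y′ le h (topLeft m) = h m
rising D x y y′ le h (topRight {p} m) = ℤ.≤-trans (h m) (linᶻ (diffᶻ le)
  (solveᶻ 4 (λ x y y′ p → (y′ :-ᶻ y) :*ᶻ (conᶻ (+ 1) :+ᶻ p :-ᶻ x) :-ᶻ (y′ :-ᶻ y) :*ᶻ (p :-ᶻ x) :=ᶻ y′ :-ᶻ y) refl
    x y y′ p))

level : ∀ {cs} D x y → + 0 ℤ.≤ D → (∀ {p q} → (p , q) ∈ cs → ℤ.suc q ℤ.≤ y) →
  ∀ {p q} → TopCorner cs p q → D ℤ.* (q ℤ.- y) ℤ.≤ (y ℤ.- y) ℤ.* (p ℤ.- x)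
level D x y 0≤D h = falling D x y y ℤ.≤-refl λ {p} {q} m → linᶻ (0≤D ⊗ᶻ diffᶻ (h m))
  (solveᶻ 5 (λ D x y p q → (y :-ᶻ y) :*ᶻ (p :-ᶻ x) :-ᶻ D :*ᶻ (q :-ᶻ y) :=ᶻ D :*ᶻ (y :-ᶻ q)) refl D x y (ℤ.suc p)
    (ℤ.suc q))

flip-∈⁻ : ∀ {cs} (P : ℤ → ℤ → Set) → (∀ {p q} → (p , q) ∈ cs → P p (ℤ.- q)) → ∀ {p q} → (p , q) ∈ map flip cs → P
  p (ℤ.suc q)
flip-∈⁻ P h m with ∈-map⁻ flip m
... | (p , q) , m′ , refl = subst (P p) (sym (suc-flip q)) (h m′)

flip-left : ∀ {cs p q} → (p , q) ∈ cs → TopCorner (map flip cs) p (ℤ.- q)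
flip-left {cs} {p} {q} m = subst (TopCorner (map flip cs) p) (suc-flip q) (topLeft (∈-map⁺ flip m))

flip-right : ∀ {cs p q} → (p , q) ∈ cs → TopCorner (map flip cs) (ℤ.suc p) (ℤ.- q)
flip-right {cs} {p} {q} m = subst (TopCorner (map flip cs) (ℤ.suc p)) (suc-flip q) (topRight (∈-map⁺ flip m))

0≤+ : ∀ n → + 0 ℤ.≤ + n
0≤+ n = ℤ.+≤+ ℕ.z≤n

floor-chain : ∀ {cs b} → (∀ {p q} → (p , q) ∈ cs → + 0 ℤ.≤ q) → (+ 0 , + 0) ∈ cs → (+ b , + 0) ∈ cs →
  Chain (map flip cs) (+ 0) (+ 0) (suc b ℕ.+ 0) (+ suc b ℤ.* (+ 0 ℤ.+ + 0) ℤ.+ + 0)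
floor-chain {b = b} nonneg l r = link {x = 0} b (flip-left l) (flip-right r)
  (level (+ suc b) (+ 0) (+ 0) (0≤+ (suc b)) (flip-∈⁻ (λ _ q → q ℤ.≤ + 0) λ m → ℤ.neg-mono-≤ (nonneg m))) stop

-- The floor when the cell at the origin is absent. Its first edge runs from (0, 1) to (1, 0) and
-- takes 1 off twice the area.
notched-floor-chain : ∀ {cs b} → (∀ {p q} → (p , q) ∈ cs → + 0 ℤ.≤ q) → (∀ {p q} → (p , q) ∈ cs → + 1 ℤ.≤ p ℤ.+ q) →
  (+ 0 , + 1) ∈ cs → (+ 1 , + 0) ∈ cs → (+ suc b , + 0) ∈ cs →
  Chain (map flip cs) (+ 0) -[1+ 0 ] (suc (suc b ℕ.+ 0)) (+ 1 ℤ.* (-[1+ 0 ] ℤ.+ + 0) ℤ.+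
    (+ suc b ℤ.* (+ 0 ℤ.+ + 0) ℤ.+ + 0))
notched-floor-chain {b = b} nonneg off l c r = link {x = 0} 0 (flip-left l) (flip-left c)
  (rising (+ 1) (+ 0) -[1+ 0 ] (+ 0) ℤ.-≤+ λ m → flip-∈⁻ (λ p q → + 1 ℤ.* (q ℤ.- -[1+ 0 ]) ℤ.≤ (+ 0 ℤ.- -[1+ 0 ])
    ℤ.* (p ℤ.- + 0)) (λ {p} {q} m → linᶻ (diffᶻ (off m))
    (solveᶻ 2 (λ p q → (conᶻ (+ 0) :-ᶻ conᶻ -[1+ 0 ]) :*ᶻ (p :-ᶻ conᶻ (+ 0)) :-ᶻ conᶻ (+ 1) :*ᶻ ((:-ᶻ q) :-ᶻ conᶻ
      -[1+ 0 ]) :=ᶻ p :+ᶻ q :-ᶻ conᶻ (+ 1)) refl p q)) m)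
  (link {x = 1} b (flip-left c) (flip-right r)
    (level (+ suc b) (+ 1) (+ 0) (0≤+ (suc b)) (flip-∈⁻ (λ _ q → q ℤ.≤ + 0) λ m → ℤ.neg-mono-≤ (nonneg m))) stop)

record InBox (cs : List Cell) (b t : ℕ) : Set where
  field
    left≥0   : ∀ {p q} → (p , q) ∈ cs → + 0 ℤ.≤ p
    bottom≥0 : ∀ {p q} → (p , q) ∈ cs → + 0 ℤ.≤ q
    right≤   : ∀ {p q} → (p , q) ∈ cs → p ℤ.≤ + b
    top≤     : ∀ {p q} → (p , q) ∈ cs → q ℤ.≤ + t

box-span : ∀ {cs b t q q′} → InBox cs b t → (+ 0 , q) ∈ cs → (+ b , q′) ∈ cs → Span cs (+ 0) b
box-span B l r = record
  { lower = InBox.left≥0 B ; upper = λ m → ℤ.suc-mono (InBox.right≤ B m)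
  ; leftmost = _ , l ; rightmost = _ , _ , r , refl }

chains⇒area : ∀ {cs b t q q′ y y′ z z′ a a′} → InBox cs b t → (+ 0 , q) ∈ cs → (+ b , q′) ∈ cs →
  a ≡ suc b → a′ ≡ suc b → Chain cs (+ 0) y a z → Chain (map flip cs) (+ 0) y′ a′ z′ → HullArea cs (z ℤ.+ z′)
chains⇒area B l r refl refl U L = caps⇒area (box-span B l r) (chain⇒cap U) (chain⇒cap L)

rectangle-area : ∀ {cs b t} → InBox cs b t → (+ 0 , + 0) ∈ cs → (+ b , + 0) ∈ cs → (+ 0 , + t) ∈ cs → (+ b , + t)
  ∈ cs →
  HullArea cs (+ (2 ℕ.* (suc b ℕ.* suc t)))
rectangle-area {cs} {b} {t} B o r u ur = subst (HullArea cs) eq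
  (chains⇒area B o r (ℕ.+-identityʳ (suc b)) (ℕ.+-identityʳ (suc b))
    (link {x = 0} b (topLeft u) (topRight ur) (level (+ suc b) (+ 0) (+ suc t) (0≤+ (suc b)) (λ m → ℤ.suc-mono
      (InBox.top≤ B m))) stop)
    (floor-chain (InBox.bottom≥0 B) o r))
  where
  open ≡-Reasoning
  eq : + suc b ℤ.* (+ suc t ℤ.+ + suc t) ℤ.+ + 0 ℤ.+ (+ suc b ℤ.* (+ 0 ℤ.+ + 0) ℤ.+ + 0) ≡ + (2 ℕ.* (suc b ℕ.* suc t))
  eq = begin
    _ ≡⟨ solveᶻ 2 (λ b t → b :*ᶻ (t :+ᶻ t) :+ᶻ conᶻ (+ 0) :+ᶻ (b :*ᶻ (conᶻ (+ 0) :+ᶻ conᶻ (+ 0)) :+ᶻ conᶻ (+ 0))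
      :=ᶻ conᶻ (+ 2) :*ᶻ (b :*ᶻ t)) refl (+ suc b) (+ suc t) ⟩
    + 2 ℤ.* (+ suc b ℤ.* + suc t)    ≡⟨ cong (+ 2 ℤ.*_) (sym (ℤ.pos-* (suc b) (suc t))) ⟩
    + 2 ℤ.* + (suc b ℕ.* suc t)      ≡⟨ sym (ℤ.pos-* 2 (suc b ℕ.* suc t)) ⟩
    + (2 ℕ.* (suc b ℕ.* suc t)) ∎

-- The upper boundary runs through (0, t + 1), (l + 1, t + 1) and
-- (l + d + 2, r + 1), where t = r + e.
cut-chain : ∀ {cs} l d r e → InBox cs (l ℕ.+ suc d) (r ℕ.+ e) →
  (∀ {p q} → (p , q) ∈ cs → + suc d ℤ.* (q ℤ.- + (r ℕ.+ e)) ℤ.+ + e ℤ.* (p ℤ.- + l) ℤ.≤ + 0) →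
  (+ 0 , + (r ℕ.+ e)) ∈ cs → (+ l , + (r ℕ.+ e)) ∈ cs → (+ (l ℕ.+ suc d) , + r) ∈ cs →
  Chain cs (+ 0) (+ suc (r ℕ.+ e)) (suc l ℕ.+ (suc d ℕ.+ 0))
    (+ suc l ℤ.* (+ suc (r ℕ.+ e) ℤ.+ + suc (r ℕ.+ e)) ℤ.+ (+ suc d ℤ.* (+ suc (r ℕ.+ e) ℤ.+ + suc r) ℤ.+ + 0))
cut-chain {cs} l d r e B below u₀ u₁ u₂ =
  link {x = 0} l (topLeft u₀) (topRight u₁) (level (+ suc l) (+ 0) (+ suc (r ℕ.+ e)) (0≤+ (suc l))
    (λ m → ℤ.suc-mono (InBox.top≤ B m)))
  (link {x = suc l} d (topRight u₁) (topRight u₂) (falling (+ suc d) (+ suc l) (+ suc (r ℕ.+ e)) (+ suc r)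
    (ℤ.+≤+ (ℕ.s≤s (ℕ.m≤m+n r e))) λ {p} {q} m → linᶻ (diffᶻ (below m))
    (trans (cong (λ s → (+ suc r ℤ.- (+ 1 ℤ.+ s)) ℤ.* (ℤ.suc p ℤ.- + suc l) ℤ.- + suc d ℤ.*
      (ℤ.suc q ℤ.- (+ 1 ℤ.+ s))) (ℤ.pos-+ r e))
    (trans (solveᶻ 6 (λ p q l d r e → (conᶻ (+ 1) :+ᶻ r :-ᶻ (conᶻ (+ 1) :+ᶻ (r :+ᶻ e))) :*ᶻ (conᶻ (+ 1) :+ᶻ p :-ᶻ
      (conᶻ (+ 1) :+ᶻ l)) :-ᶻ d :*ᶻ (conᶻ (+ 1) :+ᶻ q :-ᶻ (conᶻ (+ 1) :+ᶻ (r :+ᶻ e)))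
        :=ᶻ conᶻ (+ 0) :-ᶻ (d :*ᶻ (q :-ᶻ (r :+ᶻ e)) :+ᶻ e :*ᶻ (p :-ᶻ l))) refl p q (+ l) (+ suc d) (+ r) (+ e))
      (cong (λ s → + 0 ℤ.- (+ suc d ℤ.* (q ℤ.- s) ℤ.+ + e ℤ.* (p ℤ.- + l))) (sym (ℤ.pos-+ r e)))))) stop)

-- Twice the area under the boundary of `cut-chain`: a rectangle of width l + 1 followed by a
-- trapezoid of width d + 1.
cutTotal : (l d r e : ℕ) → ℕ
cutTotal l d r e = suc l ℕ.* (suc (r ℕ.+ e) ℕ.+ suc (r ℕ.+ e)) ℕ.+ suc d ℕ.* (suc (r ℕ.+ e) ℕ.+ suc r)

cutTotal≡ : ∀ l d r e → + suc l ℤ.* (+ suc (r ℕ.+ e) ℤ.+ + suc (r ℕ.+ e)) ℤ.+ (+ suc d ℤ.* (+ suc (r ℕ.+ e) ℤ.+ +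
  suc r) ℤ.+ + 0) ≡ + cutTotal l d r e
cutTotal≡ l d r e = cong₂ ℤ._+_ (sym (ℤ.pos-* (suc l) (suc (r ℕ.+ e) ℕ.+ suc (r ℕ.+ e))))
  (trans (ℤ.+-identityʳ (+ suc d ℤ.* (+ suc (r ℕ.+ e) ℤ.+ + suc r))) (sym (ℤ.pos-* (suc d) (suc (r ℕ.+ e) ℕ.+ suc
    r))))

cut-width : ∀ l d → suc l ℕ.+ (suc d ℕ.+ 0) ≡ suc (l ℕ.+ suc d)
cut-width l d = cong (λ u → suc (l ℕ.+ u)) (ℕ.+-identityʳ (suc d))

flat-floor : ∀ z b → z ℤ.+ (+ suc b ℤ.* (+ 0 ℤ.+ + 0) ℤ.+ + 0) ≡ z
flat-floor z b = solveᶻ 2 (λ z b → z :+ᶻ (b :*ᶻ (conᶻ (+ 0) :+ᶻ conᶻ (+ 0)) :+ᶻ conᶻ (+ 0)) :=ᶻ z) refl z (+ suc b)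

-- As the right top corners are critical, `below` compares the coordinates of a cell with the
-- falling edge shifted by (-1, -1), the line through (l, r + e) and (l + d + 1, r).
cut-area : ∀ {cs} l d r e → InBox cs (l ℕ.+ suc d) (r ℕ.+ e) →
  (∀ {p q} → (p , q) ∈ cs → + suc d ℤ.* (q ℤ.- + (r ℕ.+ e)) ℤ.+ + e ℤ.* (p ℤ.- + l) ℤ.≤ + 0) →
  (+ 0 , + 0) ∈ cs → (+ (l ℕ.+ suc d) , + 0) ∈ cs →
  (+ 0 , + (r ℕ.+ e)) ∈ cs → (+ l , + (r ℕ.+ e)) ∈ cs → (+ (l ℕ.+ suc d) , + r) ∈ cs →
  HullArea cs (+ cutTotal l d r e)
cut-area {cs} l d r e B below o right u₀ u₁ u₂ = subst (HullArea cs)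
  (trans (flat-floor (+ suc l ℤ.* (+ suc (r ℕ.+ e) ℤ.+ + suc (r ℕ.+ e)) ℤ.+ (+ suc d ℤ.* (+ suc (r ℕ.+ e) ℤ.+ +
    suc r) ℤ.+ + 0)) (l ℕ.+ suc d)) (cutTotal≡ l d r e))
  (chains⇒area B o right (cut-width l d) (ℕ.+-identityʳ (suc (l ℕ.+ suc d)))
    (cut-chain l d r e B below u₀ u₁ u₂) (floor-chain (InBox.bottom≥0 B) o right))

-- Opaque, so that case distinctions do not normalise the area.
opaque
  Realizable : (n k : ℕ) → Set
  Realizable n k = Σ[ cs ∈ List Cell ] Grown cs × length cs ≡ n × HullArea cs (+ (2 ℕ.* n ℕ.+ k))

  realize : ∀ {n k z} cs → Grown cs → length cs ≡ n → HullArea cs (+ z) → z ≡ 2 ℕ.* n ℕ.+ k → Realizable n k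
  realize cs g len area eq = cs , g , len , subst (λ z → HullArea cs (+ z)) eq area

  realization : ∀ {n k} → Realizable n k → Σ[ cs ∈ List Cell ] Grown cs × length cs ≡ n × HullArea cs
    (+ (2 ℕ.* n ℕ.+ k))
  realization r = r

run-elim : ∀ {f cs} (P : ℤ → ℤ → Set) k → (∀ i → i ℕ.< k → P (proj₁ (f i)) (proj₂ (f i))) →
  (∀ {p q} → (p , q) ∈ cs → P p q) → ∀ {p q} → (p , q) ∈ run f k cs → P p q
run-elim P k new old m with run-∈⁻ k m
... | inj₁ (i , i<k , refl) = new i i<k
... | inj₂ m′               = old m′

cell-elim : ∀ {a b} (P : ℤ → ℤ → Set) → P a b → ∀ {p q} → (p , q) ∈ (a , b) ∷ [] → P p q
cell-elim P h (here refl) = h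

Inside : (b t : ℕ) → ℤ → ℤ → Set
Inside b t p q = (+ 0 ℤ.≤ p × + 0 ℤ.≤ q) × (p ℤ.≤ + b × q ℤ.≤ + t)

inside : ∀ {b t x y} → x ℕ.≤ b → y ℕ.≤ t → Inside b t (+ x) (+ y)
inside x≤b y≤t = (0≤+ _ , 0≤+ _) , (ℤ.+≤+ x≤b , ℤ.+≤+ y≤t)

inBox : ∀ {cs b t} → (∀ {p q} → (p , q) ∈ cs → Inside b t p q) → InBox cs b t
inBox h = record
  { left≥0 = λ m → proj₁ (proj₁ (h m)) ; bottom≥0 = λ m → proj₂ (proj₁ (h m))
  ; right≤ = λ m → proj₁ (proj₂ (h m)) ; top≤ = λ m → proj₂ (proj₂ (h m)) }

-- Rows and rectangles

single : List Cell
single = (+ 0 , + 0) ∷ []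

grown-cell : ∀ c → Grown (c ∷ [])
grown-cell c = 0 , 0 , seed c

row : ℕ → List Cell
row k = run (horizontal 1 0) k single

row-∈ : ∀ {x k} → x ℕ.≤ k → (+ x , + 0) ∈ row k
row-∈ {zero}  {k} _   = run-old k (here refl)
row-∈ {suc x} x<k = run-∈ x<k

row-elim : ∀ (P : ℤ → ℤ → Set) k → (∀ i → i ℕ.≤ k → P (+ i) (+ 0)) → ∀ {p q} → (p , q) ∈ row k → P p q
row-elim P k h = run-elim P k (λ i i<k → h (suc i) i<k) (cell-elim P (h 0 ℕ.z≤n))

grown-row : ∀ k → Grown (row k)
grown-row k = grow-horizontal 1 0 k (grown-cell (+ 0 , + 0)) (here refl) (inj₁ (refl , inj₁ refl))
  (λ _ _ → λ { (here ()) ; (there ()) })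

row-length : ∀ k → length (row k) ≡ suc k
row-length k = trans (run-length (horizontal 1 0) k single) (ℕ.+-comm k 1)

∉-row : ∀ {p y} k → (p , + suc y) ∉ row k
∉-row {p} {y} k m = row-elim (λ _ q → q ≢ + suc y) k (λ _ _ → λ ()) m refl

realize-row : ∀ n → Realizable (suc n) 0
realize-row n = realize (row n) (grown-row n) (row-length n)
  (rectangle-area {b = n} {t = 0} (inBox (row-elim (Inside n 0) n (λ i i≤n → inside i≤n ℕ.z≤n)))
    (row-∈ ℕ.z≤n) (row-∈ ℕ.≤-refl) (row-∈ ℕ.z≤n) (row-∈ ℕ.≤-refl))
  (arith n)
  where
  arith : ∀ n → 2 ℕ.* (suc n ℕ.* 1) ≡ 2 ℕ.* suc n ℕ.+ 0
  arith = ℕsolve-∀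

-- The lower row has l + d + 2 cells and the upper one l + 1. The hull adds a triangle with legs d +
-- 1 and 1.
realize-two-rows : ∀ l d → Realizable (l ℕ.+ suc d ℕ.+ suc (suc l)) (suc d)
realize-two-rows l d = realize cs
  (grow-horizontal 0 1 (suc l) (grown-row b) (row-∈ ℕ.z≤n) (inj₂ (refl , inj₁ refl)) (λ _ _ → ∉-row b))
  (trans (run-length (horizontal 0 1) (suc l) (row b)) (trans (cong (suc l ℕ.+_) (row-length b)) (arith₁ l b)))
  (cut-area l d 0 1
    (inBox (run-elim (Inside b 1) (suc l) (λ i i<l → inside (ℕ.≤-trans (ℕ.s≤s⁻¹ i<l) (ℕ.m≤m+n l (suc d))) ℕ.≤-refl)
      (row-elim (Inside b 1) b (λ i i≤b → inside i≤b ℕ.z≤n))))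
    (run-elim Below (suc l)
      (λ i i<l → linᶻ (diffᶻ (ℤ.+≤+ (ℕ.s≤s⁻¹ i<l))) (solveᶻ 3 (λ d i l → conᶻ (+ 0) :-ᶻ
        (d :*ᶻ (conᶻ (+ 1) :-ᶻ conᶻ (+ 1)) :+ᶻ conᶻ (+ 1) :*ᶻ (i :-ᶻ l)) :=ᶻ l :-ᶻ i) refl (+ suc d) (+ i) (+ l)))
      (row-elim Below b (λ i i≤b → linᶻ (diffᶻ (ℤ.+≤+ i≤b)) (trans
        (solveᶻ 3 (λ d i l → conᶻ (+ 0) :-ᶻ (d :*ᶻ (conᶻ (+ 0) :-ᶻ conᶻ (+ 1)) :+ᶻ conᶻ (+ 1) :*ᶻ (i :-ᶻ l)) :=ᶻ l
          :+ᶻ d :-ᶻ i) refl (+ suc d) (+ i) (+ l))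
        (cong (ℤ._- + i) (sym (ℤ.pos-+ l (suc d))))))))
    (run-old (suc l) (row-∈ ℕ.z≤n)) (run-old (suc l) (row-∈ ℕ.≤-refl)) (run-∈ {horizontal 0 1} {suc l}
      (ℕ.s≤s ℕ.z≤n)) (run-∈ {horizontal 0 1} {suc l} (ℕ.n<1+n l)) (run-old (suc l) (row-∈ ℕ.≤-refl)))
  (arith₂ l d)
  where
  b = l ℕ.+ suc d
  cs = run (horizontal 0 1) (suc l) (row b)
  Below : ℤ → ℤ → Set
  Below p q = + suc d ℤ.* (q ℤ.- + 1) ℤ.+ + 1 ℤ.* (p ℤ.- + l) ℤ.≤ + 0
  arith₁ : ∀ l b → suc l ℕ.+ suc b ≡ b ℕ.+ suc (suc l)
  arith₁ = ℕsolve-∀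
  arith₂ : ∀ l d → suc l ℕ.* (2 ℕ.+ 2) ℕ.+ suc d ℕ.* (2 ℕ.+ 1) ≡ 2 ℕ.* (l ℕ.+ suc d ℕ.+ suc (suc l)) ℕ.+ suc d
  arith₂ = ℕsolve-∀

-- A hole in the upper of two rows changes the parity of n - k.
module Hollow (l b : ℕ) (l≤b : suc (suc l) ℕ.≤ b) where

  left-tower hollow : List Cell
  left-tower = (+ 0 , + 1) ∷ row b
  hollow = run (horizontal 2 1) (suc l) left-tower

  hollow-grown : Grown hollow
  hollow-grown = grow-horizontal 2 1 {+ 2 , + 0} (suc l)
    (grow (grown-row b) (row-∈ ℕ.z≤n) (∉-row b) (inj₂ (refl , inj₁ refl)))
    (there (row-∈ (ℕ.≤-trans (ℕ.s≤s (ℕ.s≤s ℕ.z≤n)) l≤b))) (inj₂ (refl , inj₁ refl))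
      (λ _ _ → λ { (here ()) ; (there m) → ∉-row b m })

  hollow-length : length hollow ≡ suc l ℕ.+ suc (suc b)
  hollow-length = trans (run-length (horizontal 2 1) (suc l) left-tower) (cong (λ n → suc l ℕ.+ suc n) (row-length b))

  hollow-elim : ∀ (P : ℤ → ℤ → Set) → (∀ i → i ℕ.≤ suc (suc l) → P (+ i) (+ 1)) → (∀ i → i ℕ.≤ b → P (+ i) (+ 0)) →
    ∀ {p q} → (p , q) ∈ hollow → P p q
  hollow-elim P upper lower = run-elim P (suc l) (λ i i<l → upper (suc (suc i)) (ℕ.s≤s i<l))
    λ { (here refl) → upper 0 ℕ.z≤n ; (there m) → row-elim P b lower m }

  hollow-box : InBox hollow b 1
  hollow-box = inBox (hollow-elim (Inside b 1) (λ i i≤ → inside (ℕ.≤-trans i≤ l≤b) ℕ.≤-refl) (λ i i≤b → inside i≤b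
    ℕ.z≤n))

  lower-∈ : ∀ {x} → x ℕ.≤ b → (+ x , + 0) ∈ hollow
  lower-∈ x≤b = run-old (suc l) (there (row-∈ x≤b))

  upper-left : (+ 0 , + 1) ∈ hollow
  upper-left = run-old (suc l) (here refl)

  upper-right : (+ suc (suc l) , + 1) ∈ hollow
  upper-right = run-∈ (ℕ.n<1+n l)

-- The triangle next to the upper row contributes d + 1 and the hole contributes 2.
realize-hollow : ∀ l d → Realizable (suc l ℕ.+ suc (suc (suc (suc l) ℕ.+ suc d))) (suc (suc (suc d)))
realize-hollow l d = realize hollow hollow-grown hollow-length
  (cut-area (suc (suc l)) d 0 1 hollow-box
    (hollow-elim Below
      (λ i i≤ → linᶻ (diffᶻ (ℤ.+≤+ i≤)) (solveᶻ 3 (λ d i l → conᶻ (+ 0) :-ᶻ (d :*ᶻ (conᶻ (+ 1) :-ᶻ conᶻ (+ 1)) :+ᶻ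
        conᶻ (+ 1) :*ᶻ (i :-ᶻ l)) :=ᶻ l :-ᶻ i) refl (+ suc d) (+ i) (+ suc (suc l))))
      (λ i i≤b → linᶻ (diffᶻ (ℤ.+≤+ i≤b)) (trans
        (solveᶻ 3 (λ d i l → conᶻ (+ 0) :-ᶻ (d :*ᶻ (conᶻ (+ 0) :-ᶻ conᶻ (+ 1)) :+ᶻ conᶻ (+ 1) :*ᶻ (i :-ᶻ l)) :=ᶻ l
          :+ᶻ d :-ᶻ i) refl (+ suc d) (+ i) (+ suc (suc l)))
        (cong (ℤ._- + i) (sym (ℤ.pos-+ (suc (suc l)) (suc d)))))))
    (lower-∈ ℕ.z≤n) (lower-∈ ℕ.≤-refl) upper-left upper-right (lower-∈ ℕ.≤-refl))
  (arith l d)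
  where
  open Hollow l (suc (suc l) ℕ.+ suc d) (ℕ.m≤m+n (suc (suc l)) (suc d))
  Below : ℤ → ℤ → Set
  Below p q = + suc d ℤ.* (q ℤ.- + 1) ℤ.+ + 1 ℤ.* (p ℤ.- + suc (suc l)) ℤ.≤ + 0
  arith : ∀ l d → suc (suc (suc l)) ℕ.* (2 ℕ.+ 2) ℕ.+ suc d ℕ.* (2 ℕ.+ 1) ≡
    2 ℕ.* (suc l ℕ.+ suc (suc (suc (suc l) ℕ.+ suc d))) ℕ.+ suc (suc (suc d))
  arith = ℕsolve-∀

-- Both rows end in the same column and the hull is a rectangle, so the hole alone gives m = 2.
realize-cup : ∀ l → Realizable (suc l ℕ.+ suc (suc (suc (suc l)))) 2
realize-cup l = realize hollow hollow-grown hollow-length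
  (rectangle-area hollow-box (lower-∈ ℕ.z≤n) (lower-∈ ℕ.≤-refl) upper-left upper-right) (arith l)
  where
  open Hollow l (suc (suc l)) ℕ.≤-refl
  arith : ∀ l → 2 ℕ.* (suc (suc (suc l)) ℕ.* 2) ≡ 2 ℕ.* (suc l ℕ.+ suc (suc (suc (suc l)))) ℕ.+ 2
  arith = ℕsolve-∀

rows : ℕ → ℕ → List Cell
rows l zero    = row (suc l)
rows l (suc y) = run (horizontal 0 (suc y)) (suc (suc l)) (rows l y)

rows-elim : ∀ (P : ℤ → ℤ → Set) l y → (∀ i j → i ℕ.≤ suc l → j ℕ.≤ y → P (+ i) (+ j)) → ∀ {p q} → (p , q) ∈ rows l
  y → P p q
rows-elim P l zero    h = row-elim P (suc l) (λ i i≤ → h i 0 i≤ ℕ.z≤n)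
rows-elim P l (suc y) h = run-elim P (suc (suc l)) (λ i i< → h i (suc y) (ℕ.s≤s⁻¹ i<) ℕ.≤-refl)
  (rows-elim P l y (λ i j i≤ j≤ → h i j i≤ (ℕ.m≤n⇒m≤1+n j≤)))

rows-last : ∀ {x} l y → x ℕ.≤ suc l → (+ x , + y) ∈ rows l y
rows-last l zero    x≤ = row-∈ x≤
rows-last l (suc y) x≤ = run-∈ (ℕ.s≤s x≤)

rows-origin : ∀ {x} l y → x ℕ.≤ suc l → (+ x , + 0) ∈ rows l y
rows-origin l zero    x≤ = row-∈ x≤
rows-origin l (suc y) x≤ = run-old (suc (suc l)) (rows-origin l y x≤)

above-rows : ∀ l y {x} → (x , + suc y) ∉ rows l y
above-rows l y m = rows-elim (λ _ q → q ≢ + suc y) l y (λ i j _ j≤y eq → ℕ.<-irrefl (ℤ.+-injective eq)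
  (ℕ.s≤s j≤y)) m refl

rows-grown : ∀ l y → Grown (rows l y)
rows-grown l zero    = grown-row (suc l)
rows-grown l (suc y) = grow-horizontal 0 (suc y) (suc (suc l)) (rows-grown l y) (rows-last l y ℕ.z≤n)
  (inj₂ (refl , inj₁ refl))
  (λ _ _ → above-rows l y)

rows-length : ∀ l y → length (rows l y) ≡ suc (suc l) ℕ.* suc y
rows-length l zero    = trans (row-length (suc l)) (sym (ℕ.*-identityʳ (suc (suc l))))
rows-length l (suc y) = trans (run-length (horizontal 0 (suc y)) (suc (suc l)) (rows l y))
  (trans (cong (suc (suc l) ℕ.+_) (rows-length l y)) (sym (ℕ.*-suc (suc (suc l)) (suc y))))

realize-notched : ∀ l r → Realizable (suc l ℕ.+ suc (suc l) ℕ.* suc r) 1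
realize-notched l r = realize cs
  (grow-horizontal 0 (suc r) (suc l) (rows-grown l r) (rows-last l r ℕ.z≤n) (inj₂ (refl , inj₁ refl))
    (λ _ _ → above-rows l r))
  (trans (run-length (horizontal 0 (suc r)) (suc l) (rows l r)) (cong (suc l ℕ.+_) (rows-length l r)))
  -- The missing upper right corner makes a falling edge of width and height 1, whence d = 0 and e =
  -- 1.
  (cut-area l 0 r 1
    (subst₂ (InBox cs) (sym (ℕ.+-comm l 1)) (sym (ℕ.+-comm r 1)) (inBox
      (run-elim (Inside (suc l) (suc r)) (suc l) (λ i i< → inside (ℕ.<⇒≤ i<) ℕ.≤-refl)
        (rows-elim (Inside (suc l) (suc r)) l r (λ i j i≤ j≤ → inside i≤ (ℕ.m≤n⇒m≤1+n j≤))))))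
    (λ {p} {q} m → subst (λ t → + 1 ℤ.* (q ℤ.- + t) ℤ.+ + 1 ℤ.* (p ℤ.- + l) ℤ.≤ + 0) (sym (ℕ.+-comm r 1))
      (run-elim Below (suc l)
        (λ i i< → linᶻ (diffᶻ (ℤ.+≤+ (ℕ.s≤s⁻¹ i<))) (solveᶻ 3 (λ i l r → conᶻ (+ 0) :-ᶻ (conᶻ (+ 1) :*ᶻ (r :-ᶻ r)
          :+ᶻ conᶻ (+ 1) :*ᶻ (i :-ᶻ l)) :=ᶻ l :-ᶻ i) refl (+ i) (+ l) (+ suc r)))
        (rows-elim Below l r (λ i j i≤ j≤ → linᶻ (diffᶻ (ℤ.+≤+ i≤) ⊕ᶻ diffᶻ (ℤ.+≤+ j≤))
          (solveᶻ 4 (λ i j l r → conᶻ (+ 0) :-ᶻ (conᶻ (+ 1) :*ᶻ (j :-ᶻ (conᶻ (+ 1) :+ᶻ r)) :+ᶻ conᶻ (+ 1) :*ᶻ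
            (i :-ᶻ l)) :=ᶻ (conᶻ (+ 1) :+ᶻ l :-ᶻ i) :+ᶻ (r :-ᶻ j)) refl (+ i) (+ j) (+ l) (+ r)))) m))
    (run-old (suc l) (rows-origin l r ℕ.z≤n))
    (subst (λ x → (+ x , + 0) ∈ cs) (sym (ℕ.+-comm l 1)) (run-old (suc l) (rows-origin l r ℕ.≤-refl)))
    (subst (λ y → (+ 0 , + y) ∈ cs) (sym (ℕ.+-comm r 1)) (run-∈ {horizontal 0 (suc r)} {suc l} (ℕ.s≤s ℕ.z≤n)))
    (subst (λ y → (+ l , + y) ∈ cs) (sym (ℕ.+-comm r 1)) (run-∈ {horizontal 0 (suc r)} {suc l} (ℕ.n<1+n l)))
    (subst (λ x → (+ x , + r) ∈ cs) (sym (ℕ.+-comm l 1)) (run-old (suc l) (rows-last l r ℕ.≤-refl))))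
  (arith l r)
  where
  cs = run (horizontal 0 (suc r)) (suc l) (rows l r)
  Below : ℤ → ℤ → Set
  Below p q = + 1 ℤ.* (q ℤ.- + suc r) ℤ.+ + 1 ℤ.* (p ℤ.- + l) ℤ.≤ + 0
  arith : ∀ l r → suc l ℕ.* (suc (r ℕ.+ 1) ℕ.+ suc (r ℕ.+ 1)) ℕ.+ 1 ℕ.* (suc (r ℕ.+ 1) ℕ.+ suc r) ≡
    2 ℕ.* (suc l ℕ.+ suc (suc l) ℕ.* suc r) ℕ.+ 1
  arith = ℕsolve-∀

-- Hooks

*-≤ᶻ : ∀ {a b c d} → a ℕ.* b ℕ.≤ c ℕ.* d → + a ℤ.* + b ℤ.≤ + c ℤ.* + d
*-≤ᶻ {a} {b} {c} {d} h = subst₂ ℤ._≤_ (ℤ.pos-* a b) (ℤ.pos-* c d) (ℤ.+≤+ h)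

filler-fits : ∀ {j w h} → j ℕ.* suc w ℕ.≤ suc h ℕ.* w → j ℕ.≤ suc h
filler-fits {j} {w} {h} fit = ℕ.*-cancelʳ-≤ j (suc h) (suc w) (ℕ.≤-trans fit (ℕ.*-monoʳ-≤ (suc h) (ℕ.n≤1+n w)))

-- (i, 1) lies below the line from (0, w + 1) to (h + 1, 0).
filler-below : ∀ {i j w h} → i ℕ.≤ j → j ℕ.* suc w ℕ.≤ suc h ℕ.* w →
  + suc h ℤ.* (+ 1 ℤ.- + suc w) ℤ.+ + suc w ℤ.* (+ i ℤ.- + 0) ℤ.≤ + 0
filler-below {i} {j} {w} {h} i≤j fit = linᶻ (diffᶻ (*-≤ᶻ {j} {suc w} {suc h} {w} fit) ⊕ᶻ (0≤+ (suc w) ⊗ᶻ diffᶻ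
  (ℤ.+≤+ i≤j)))
  (solveᶻ 4 (λ i j w h → conᶻ (+ 0) :-ᶻ (h :*ᶻ (conᶻ (+ 1) :-ᶻ (conᶻ (+ 1) :+ᶻ w)) :+ᶻ (conᶻ (+ 1) :+ᶻ w) :*ᶻ
    (i :-ᶻ conᶻ (+ 0)))
    :=ᶻ (h :*ᶻ w :-ᶻ j :*ᶻ (conᶻ (+ 1) :+ᶻ w)) :+ᶻ (conᶻ (+ 1) :+ᶻ w) :*ᶻ (j :-ᶻ i)) refl (+ i) (+ j) (+ w) (+ suc h))

row-below : ∀ {i h} V → i ℕ.≤ suc h → + suc h ℤ.* (+ 0 ℤ.- + V) ℤ.+ + V ℤ.* (+ i ℤ.- + 0) ℤ.≤ + 0
row-below {i} {h} V i≤ = linᶻ (0≤+ V ⊗ᶻ diffᶻ (ℤ.+≤+ i≤))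
  (solveᶻ 3 (λ i h V → conᶻ (+ 0) :-ᶻ (h :*ᶻ (conᶻ (+ 0) :-ᶻ V) :+ᶻ V :*ᶻ (i :-ᶻ conᶻ (+ 0))) :=ᶻ V :*ᶻ (h :-ᶻ i))
    refl (+ i) (+ suc h) (+ V))

column-below : ∀ {i h} V → i ℕ.≤ V → + suc h ℤ.* (+ i ℤ.- + V) ℤ.+ + V ℤ.* (+ 0 ℤ.- + 0) ℤ.≤ + 0
column-below {i} {h} V i≤ = linᶻ (0≤+ (suc h) ⊗ᶻ diffᶻ (ℤ.+≤+ i≤))
  (solveᶻ 3 (λ i h V → conᶻ (+ 0) :-ᶻ (h :*ᶻ (i :-ᶻ V) :+ᶻ V :*ᶻ (conᶻ (+ 0) :-ᶻ conᶻ (+ 0))) :=ᶻ h :*ᶻ (V :-ᶻ i))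
    refl (+ i) (+ suc h) (+ V))

-- The `j` cells next to the vertical leg fill the second row from the left; by `fit` the last of
-- them is still under the hypotenuse, so the hull is that of the bare hook.
module Hook (h w j : ℕ) (fit : j ℕ.* suc w ℕ.≤ suc h ℕ.* w) where

  private
    H = suc h
    V = suc w

  column hook cs : List Cell
  column = run (vertical 0 1) V single
  hook = run (horizontal 1 0) H column
  cs = run (horizontal 1 1) j hook

  grown : Grown cs
  grown = grow-horizontal 1 1 {+ 0 , + 1} j
    (grow-horizontal 1 0 {+ 0 , + 0} H
      (grow-vertical 0 1 {+ 0 , + 0} V (grown-cell (+ 0 , + 0)) (here refl) (inj₂ (refl , inj₁ refl))
        (λ _ _ → λ { (here ()) ; (there ()) }))
      (run-old V (here refl)) (inj₁ (refl , inj₁ refl)) (λ _ _ → ∉-run V (λ _ _ ()) (λ { (here ()) ; (there ()) })))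
    (run-old H (run-∈ {vertical 0 1} {V} (ℕ.s≤s ℕ.z≤n))) (inj₁ (refl , inj₁ refl))
    (λ _ _ → ∉-run H (λ _ _ ()) (∉-run V (λ _ _ ()) (λ { (here ()) ; (there ()) })))

  elim : ∀ (P : ℤ → ℤ → Set) → (∀ i → i ℕ.≤ j → P (+ i) (+ 1)) → (∀ i → i ℕ.≤ H → P (+ i) (+ 0)) → (∀ i → i ℕ.≤ V
    → P (+ 0) (+ i)) →
    ∀ {p q} → (p , q) ∈ cs → P p q
  elim P fillers bottom left = run-elim P j (λ i i<j → fillers (suc i) i<j) (run-elim P H (λ i i<H → bottom
    (suc i) i<H)
    (run-elim P V (λ i i<V → left (suc i) i<V) (cell-elim P (left 0 ℕ.z≤n))))

  column-∈ : ∀ {y} → y ℕ.≤ V → (+ 0 , + y) ∈ cs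
  column-∈ {zero}  _   = run-old j (run-old H (run-old V (here refl)))
  column-∈ {suc y} y<V = run-old j (run-old H (run-∈ {vertical 0 1} {V} y<V))

  corner-∈ : (+ H , + 0) ∈ cs
  corner-∈ = run-old j (run-∈ {horizontal 1 0} {H} (ℕ.n<1+n h))

  area : HullArea cs (+ cutTotal 0 h 0 V)
  area = cut-area 0 h 0 V
    (inBox (elim (Inside H V) (λ i i≤j → inside (ℕ.≤-trans i≤j (filler-fits {j} {w} {h} fit)) (ℕ.s≤s ℕ.z≤n))
      (λ i i≤H → inside i≤H ℕ.z≤n) (λ i i≤V → inside ℕ.z≤n i≤V)))
    (elim (λ p q → + H ℤ.* (q ℤ.- + V) ℤ.+ + V ℤ.* (p ℤ.- + 0) ℤ.≤ + 0)
      (λ i i≤j → filler-below {i} {j} {w} {h} i≤j fit) (λ i i≤H → row-below V i≤H) (λ i i≤V → column-below {i} {h}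
        V i≤V))
    (column-∈ ℕ.z≤n) corner-∈ (column-∈ ℕ.≤-refl) (column-∈ ℕ.≤-refl) corner-∈

  cells-length : length cs ≡ j ℕ.+ (H ℕ.+ (V ℕ.+ 1))
  cells-length = trans (run-length (horizontal 1 1) j hook) (cong (j ℕ.+_) (trans (run-length (horizontal 1 0) H
    column)
    (cong (H ℕ.+_) (run-length (vertical 0 1) V single))))

realize-hook : ∀ h w j k → j ℕ.* suc w ℕ.≤ suc h ℕ.* w → k ℕ.+ 2 ℕ.* j ≡ suc h ℕ.* suc w → Realizable
  (j ℕ.+ (suc h ℕ.+ (suc w ℕ.+ 1))) k
realize-hook h w j k fit eq = realize cs grown cells-length area
  (trans (arith₁ h w) (trans (cong (2 ℕ.* (suc h ℕ.+ (suc w ℕ.+ 1)) ℕ.+_) (sym eq))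
    (arith₂ (suc h ℕ.+ (suc w ℕ.+ 1)) j k)))
  where
  open Hook h w j fit
  arith₁ : ∀ h w → 1 ℕ.* (suc (suc w) ℕ.+ suc (suc w)) ℕ.+ suc h ℕ.* (suc (suc w) ℕ.+ 1) ≡ 2 ℕ.*
    (suc h ℕ.+ (suc w ℕ.+ 1)) ℕ.+ suc h ℕ.* suc w
  arith₁ = ℕsolve-∀
  arith₂ : ∀ m j k → 2 ℕ.* m ℕ.+ (k ℕ.+ 2 ℕ.* j) ≡ 2 ℕ.* (j ℕ.+ m) ℕ.+ k
  arith₂ = ℕsolve-∀

-- The hook without its corner cell: this cuts off a triangle of area one half.
module BrokenHook (h w j : ℕ) (fit : suc j ℕ.* suc w ℕ.≤ suc h ℕ.* w) where

  private
    H = suc h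
    V = suc w
    start : List Cell
    start = (+ 0 , + 1) ∷ []

  fillers upright cs : List Cell
  fillers = run (horizontal 1 1) (suc j) start
  upright = run (vertical 0 2) w fillers
  cs = run (horizontal 1 0) H upright

  grown : Grown cs
  grown = grow-horizontal 1 0 {+ 1 , + 1} H
    (grow-vertical 0 2 {+ 0 , + 1} w
      (grow-horizontal 1 1 {+ 0 , + 1} (suc j) (grown-cell (+ 0 , + 1)) (here refl) (inj₁ (refl , inj₁ refl))
        (λ _ _ → λ { (here ()) ; (there ()) }))
      (run-old (suc j) (here refl)) (inj₂ (refl , inj₁ refl)) (λ _ _ → ∉-run (suc j) (λ _ _ ())
        (λ { (here ()) ; (there ()) })))
    (run-old w (run-∈ {horizontal 1 1} {suc j} (ℕ.s≤s ℕ.z≤n))) (inj₂ (refl , inj₂ refl))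
    (λ _ _ → ∉-run w (λ _ _ ()) (∉-run (suc j) (λ _ _ ()) (λ { (here ()) ; (there ()) })))

  elim : ∀ (P : ℤ → ℤ → Set) → (∀ i → i ℕ.≤ suc j → P (+ i) (+ 1)) → (∀ i → i ℕ.< H → P (+ suc i) (+ 0)) →
    (∀ i → i ℕ.< V → P (+ 0) (+ suc i)) →
    ∀ {p q} → (p , q) ∈ cs → P p q
  elim P middle bottom left = run-elim P H bottom (run-elim P w (λ i i<w → left (suc i) (ℕ.s≤s i<w))
    (run-elim P (suc j) (λ i i≤j → middle (suc i) i≤j) (cell-elim P (left 0 (ℕ.s≤s ℕ.z≤n)))))

  column-∈ : ∀ {y} → y ℕ.< V → (+ 0 , + suc y) ∈ cs
  column-∈ {zero}  _         = run-old H (run-old w (run-old (suc j) (here refl)))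
  column-∈ {suc y} (ℕ.s≤s y<w) = run-old H (run-∈ {vertical 0 2} {w} y<w)

  bottom-∈ : ∀ {x} → x ℕ.< H → (+ suc x , + 0) ∈ cs
  bottom-∈ x<H = run-∈ {horizontal 1 0} {H} x<H

  box : InBox cs H V
  box = inBox (elim (Inside H V) (λ i i≤j → inside (ℕ.≤-trans i≤j (filler-fits {suc j} {w} {h} fit))
    (ℕ.s≤s ℕ.z≤n)) (λ i i<H → inside i<H ℕ.z≤n) (λ i i<V → inside ℕ.z≤n i<V))

  area : ∀ {z} → cutTotal 0 h 0 V ≡ suc z → HullArea cs (+ z)
  area {z} eq = subst (HullArea cs) total
    (chains⇒area box (column-∈ (ℕ.s≤s ℕ.z≤n)) (bottom-∈ (ℕ.n<1+n h)) (cut-width 0 h) (cong (suc ∘ suc)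
      (ℕ.+-identityʳ h))
      (cut-chain 0 h 0 V box
        (elim (λ p q → + H ℤ.* (q ℤ.- + V) ℤ.+ + V ℤ.* (p ℤ.- + 0) ℤ.≤ + 0)
          (λ i i≤j → filler-below {i} {suc j} {w} {h} i≤j fit) (λ i i<H → row-below V i<H) (λ i i<V → column-below
            {suc i} {h} V i<V))
        (column-∈ (ℕ.n<1+n w)) (column-∈ (ℕ.n<1+n w)) (bottom-∈ (ℕ.n<1+n h)))
      (notched-floor-chain (InBox.bottom≥0 box)
        (elim (λ p q → + 1 ℤ.≤ p ℤ.+ q) (λ i _ → ℤ.+≤+ (ℕ.m≤n+m 1 i)) (λ i _ → ℤ.+≤+ (ℕ.s≤s ℕ.z≤n)) (λ i _ → ℤ.+≤+
          (ℕ.s≤s ℕ.z≤n)))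
        (column-∈ (ℕ.s≤s ℕ.z≤n)) (bottom-∈ (ℕ.s≤s ℕ.z≤n)) (bottom-∈ (ℕ.n<1+n h))))
    where
    U = + 1 ℤ.* (+ suc V ℤ.+ + suc V) ℤ.+ (+ H ℤ.* (+ suc V ℤ.+ + 1) ℤ.+ + 0)
    total : U ℤ.+ (+ 1 ℤ.* (-[1+ 0 ] ℤ.+ + 0) ℤ.+ (+ H ℤ.* (+ 0 ℤ.+ + 0) ℤ.+ + 0)) ≡ + z
    total = trans (cong₂ ℤ._+_ (trans (cutTotal≡ 0 h 0 V) (cong +_ eq)) (flat-floor -[1+ 0 ] h))
      (solveᶻ 1 (λ z → (conᶻ (+ 1) :+ᶻ z) :+ᶻ conᶻ -[1+ 0 ] :=ᶻ z) refl (+ z))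

  cells-length : length cs ≡ H ℕ.+ (w ℕ.+ (suc j ℕ.+ 1))
  cells-length = trans (run-length (horizontal 1 0) H upright) (cong (H ℕ.+_) (trans (run-length (vertical 0 2) w
    fillers)
    (cong (w ℕ.+_) (run-length (horizontal 1 1) (suc j) start))))

-- Dropping the corner cell lowers both n and twice the area by 1, so m rises by 1, while `suc j`
-- fillers lower it by 2 j + 2. The filler at (1, 1) joins the two legs.
realize-broken-hook : ∀ h w j k → suc j ℕ.* suc w ℕ.≤ suc h ℕ.* w → suc (k ℕ.+ 2 ℕ.* j) ≡ suc h ℕ.* suc w →
  Realizable (suc h ℕ.+ (w ℕ.+ (suc j ℕ.+ 1))) k
realize-broken-hook h w j k fit eq = realize cs grown cells-length
  (area (trans (arith₁ h w) (trans (cong (2 ℕ.* (suc h ℕ.+ (suc w ℕ.+ 1)) ℕ.+_) (sym eq)) (arith₂ h w j k)))) refl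
  where
  open BrokenHook h w j fit
  arith₁ : ∀ h w → 1 ℕ.* (suc (suc w) ℕ.+ suc (suc w)) ℕ.+ suc h ℕ.* (suc (suc w) ℕ.+ 1) ≡ 2 ℕ.*
    (suc h ℕ.+ (suc w ℕ.+ 1)) ℕ.+ suc h ℕ.* suc w
  arith₁ = ℕsolve-∀
  arith₂ : ∀ h w j k → 2 ℕ.* (suc h ℕ.+ (suc w ℕ.+ 1)) ℕ.+ suc (k ℕ.+ 2 ℕ.* j) ≡ suc
    (2 ℕ.* (suc h ℕ.+ (w ℕ.+ (suc j ℕ.+ 1))) ℕ.+ k)
  arith₂ = ℕsolve-∀

-- A hook with a foot at (0, 0) and a bump at (0, i + 1); the bump turns the
-- upper boundary into (0, i + 2), (1, w + 2), (2, w + 2), (g + 3, 1).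
module Bump (g w i j : ℕ) (i≤w : i ℕ.≤ w) (fit : j ℕ.* suc w ℕ.≤ suc g ℕ.* w) where

  private
    G = suc g
    V = suc w

  upright bumped cs : List Cell
  upright = run (vertical 1 1) V (row (suc G))
  bumped = (+ 0 , + suc i) ∷ upright
  cs = run (horizontal 2 1) j bumped

  grown : Grown cs
  grown = grow-horizontal 2 1 {+ 1 , + 1} j
    (grow
      (grow-vertical 1 1 {+ 1 , + 0} V (grown-row (suc G)) (row-∈ (ℕ.s≤s ℕ.z≤n)) (inj₂ (refl , inj₁ refl))
        (λ _ _ → ∉-row (suc G)))
      (run-∈ {vertical 1 1} {V} (ℕ.s≤s i≤w)) (∉-run V (λ _ _ ()) (∉-row (suc G))) (inj₁ (refl , inj₂ refl)))
    (there (run-∈ {vertical 1 1} {V} (ℕ.s≤s ℕ.z≤n))) (inj₁ (refl , inj₁ refl))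
    (λ _ _ → λ { (here ()) ; (there m) → ∉-run V (λ _ _ ()) (∉-row (suc G)) m })

  elim : ∀ (P : ℤ → ℤ → Set) → (∀ t → t ℕ.< j → P (+ suc (suc t)) (+ 1)) → P (+ 0) (+ suc i) → (∀ t → t ℕ.≤ w → P
    (+ 1) (+ suc t)) →
    (∀ t → t ℕ.≤ suc G → P (+ t) (+ 0)) → ∀ {p q} → (p , q) ∈ cs → P p q
  elim P fillers bump middle bottom = run-elim P j fillers λ
    { (here refl) → bump
    ; (there m)   → run-elim P V (λ t t<V → middle t (ℕ.s≤s⁻¹ t<V)) (row-elim P (suc G) bottom) m }

  bottom-∈ : ∀ {x} → x ℕ.≤ suc G → (+ x , + 0) ∈ cs
  bottom-∈ x≤ = run-old j (there (run-old V (row-∈ x≤)))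

  tower-∈ : (+ 1 , + V) ∈ cs
  tower-∈ = run-old j (there (run-∈ {vertical 1 1} {V} (ℕ.n<1+n w)))

  box : InBox cs (suc G) V
  box = inBox (elim (Inside (suc G) V)
    (λ t t<j → inside (ℕ.s≤s (ℕ.≤-trans t<j (filler-fits {j} {w} {g} fit))) (ℕ.s≤s ℕ.z≤n))
    (inside ℕ.z≤n (ℕ.s≤s i≤w)) (λ t t≤w → inside (ℕ.s≤s ℕ.z≤n) (ℕ.s≤s t≤w)) (λ t t≤ → inside t≤ ℕ.z≤n))

  upper : Chain cs (+ 0) (+ suc (suc i)) (1 ℕ.+ (1 ℕ.+ (G ℕ.+ 0)))
    (+ 1 ℤ.* (+ suc (suc i) ℤ.+ + suc V) ℤ.+ (+ 1 ℤ.* (+ suc V ℤ.+ + suc V) ℤ.+ (+ G ℤ.* (+ suc V ℤ.+ + 1) ℤ.+ + 0)))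
  upper =
    link {x = 0} 0 (topLeft (run-old j (here refl))) (topLeft tower-∈) (rising (+ 1) (+ 0) (+ suc (suc i))
      (+ suc V) (ℤ.+≤+ (ℕ.s≤s (ℕ.s≤s i≤w)))
      (elim (λ p q → + 1 ℤ.* (ℤ.suc q ℤ.- + suc (suc i)) ℤ.≤ (+ suc V ℤ.- + suc (suc i)) ℤ.* (p ℤ.- + 0))
        (λ t _ → linᶻ ((0≤w-i ⊗ᶻ 0≤+ (suc (suc t))) ⊕ᶻ 0≤+ i)
          (solveᶻ 3 (λ t i w → (s (s w) :-ᶻ s (s i)) :*ᶻ (s (s t) :-ᶻ conᶻ (+ 0)) :-ᶻ conᶻ (+ 1) :*ᶻ
            (s (conᶻ (+ 1)) :-ᶻ s (s i)) :=ᶻ (w :-ᶻ i) :*ᶻ s (s t) :+ᶻ i) refl (+ t) (+ i) (+ w)))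
        (linᶻ ℤ.≤-refl (solveᶻ 2 (λ i w → (s (s w) :-ᶻ s (s i)) :*ᶻ (conᶻ (+ 0) :-ᶻ conᶻ (+ 0)) :-ᶻ conᶻ (+ 1) :*ᶻ
          (s (s i) :-ᶻ s (s i)) :=ᶻ conᶻ (+ 0)) refl (+ i) (+ w)))
        (λ t t≤w → linᶻ (diffᶻ (ℤ.+≤+ t≤w))
          (solveᶻ 3 (λ t i w → (s (s w) :-ᶻ s (s i)) :*ᶻ (conᶻ (+ 1) :-ᶻ conᶻ (+ 0)) :-ᶻ conᶻ (+ 1) :*ᶻ
            (s (s t) :-ᶻ s (s i)) :=ᶻ w :-ᶻ t) refl (+ t) (+ i) (+ w)))
        (λ t _ → linᶻ ((0≤w-i ⊗ᶻ 0≤+ t) ⊕ᶻ 0≤+ (suc i))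
          (solveᶻ 3 (λ t i w → (s (s w) :-ᶻ s (s i)) :*ᶻ (t :-ᶻ conᶻ (+ 0)) :-ᶻ conᶻ (+ 1) :*ᶻ (s (conᶻ (+ 0)) :-ᶻ
            s (s i)) :=ᶻ (w :-ᶻ i) :*ᶻ t :+ᶻ s i) refl (+ t) (+ i) (+ w)))))
    (link {x = 1} 0 (topLeft tower-∈) (topRight tower-∈) (level (+ 1) (+ 1) (+ suc V) (0≤+ 1) (λ m → ℤ.suc-mono
      (InBox.top≤ box m)))
    (link {x = 2} g (topRight tower-∈) (topRight (bottom-∈ ℕ.≤-refl)) (falling (+ G) (+ 2) (+ suc V) (+ 1)
      (ℤ.+≤+ (ℕ.s≤s ℕ.z≤n))
      (elim (λ p q → + G ℤ.* (ℤ.suc q ℤ.- + suc V) ℤ.≤ (+ 1 ℤ.- + suc V) ℤ.* (ℤ.suc p ℤ.- + 2))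
        (λ t t<j → linᶻ (diffᶻ (*-≤ᶻ {j} {V} {G} {w} fit) ⊕ᶻ (0≤+ V ⊗ᶻ diffᶻ (ℤ.+≤+ t<j)))
          (solveᶻ 4 (λ t j w G → (conᶻ (+ 1) :-ᶻ s (s w)) :*ᶻ (s (s (s t)) :-ᶻ conᶻ (+ 2)) :-ᶻ G :*ᶻ
            (s (conᶻ (+ 1)) :-ᶻ s (s w)) :=ᶻ (G :*ᶻ w :-ᶻ j :*ᶻ s w) :+ᶻ s w :*ᶻ (j :-ᶻ s t)) refl (+ t) (+ j)
            (+ w) (+ G)))
        (linᶻ ((0≤+ G ⊗ᶻ 0≤w-i) ⊕ᶻ 0≤+ V)
          (solveᶻ 3 (λ i w G → (conᶻ (+ 1) :-ᶻ s (s w)) :*ᶻ (s (conᶻ (+ 0)) :-ᶻ conᶻ (+ 2)) :-ᶻ G :*ᶻ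
            (s (s i) :-ᶻ s (s w)) :=ᶻ G :*ᶻ (w :-ᶻ i) :+ᶻ s w) refl (+ i) (+ w) (+ G)))
        (λ t t≤w → linᶻ (0≤+ G ⊗ᶻ diffᶻ (ℤ.+≤+ t≤w))
          (solveᶻ 3 (λ t w G → (conᶻ (+ 1) :-ᶻ s (s w)) :*ᶻ (s (conᶻ (+ 1)) :-ᶻ conᶻ (+ 2)) :-ᶻ G :*ᶻ
            (s (s t) :-ᶻ s (s w)) :=ᶻ G :*ᶻ (w :-ᶻ t)) refl (+ t) (+ w) (+ G)))
        (λ t t≤ → linᶻ (0≤+ V ⊗ᶻ diffᶻ (ℤ.+≤+ t≤))
          (solveᶻ 3 (λ t w G → (conᶻ (+ 1) :-ᶻ s (s w)) :*ᶻ (s t :-ᶻ conᶻ (+ 2)) :-ᶻ G :*ᶻ (s (conᶻ (+ 0)) :-ᶻ s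
            (s w)) :=ᶻ s w :*ᶻ (s G :-ᶻ t)) refl (+ t) (+ w) (+ G)))))
      stop))
    where
    0≤w-i : + 0 ℤ.≤ + w ℤ.- + i
    0≤w-i = diffᶻ (ℤ.+≤+ i≤w)
    s : ∀ {m} → ℤSolver.Polynomial m → ℤSolver.Polynomial m
    s p = conᶻ (+ 1) :+ᶻ p

  total : ℕ
  total = 1 ℕ.* (suc (suc i) ℕ.+ suc V) ℕ.+ cutTotal 0 g 0 V

  area : HullArea cs (+ total)
  area = subst (HullArea cs)
    (trans (flat-floor (+ 1 ℤ.* (+ suc (suc i) ℤ.+ + suc V) ℤ.+ (+ 1 ℤ.* (+ suc V ℤ.+ + suc V) ℤ.+
      (+ G ℤ.* (+ suc V ℤ.+ + 1) ℤ.+ + 0))) (suc G))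
      (cong₂ ℤ._+_ (sym (ℤ.pos-* 1 (suc (suc i) ℕ.+ suc V))) (cutTotal≡ 0 g 0 V)))
    (chains⇒area box (bottom-∈ ℕ.z≤n) (bottom-∈ ℕ.≤-refl) (cong (suc ∘ suc) (ℕ.+-identityʳ G)) (ℕ.+-identityʳ
      (suc (suc G)))
      upper (floor-chain (InBox.bottom≥0 box) (bottom-∈ ℕ.z≤n) (bottom-∈ ℕ.≤-refl)))

  cells-length : length cs ≡ j ℕ.+ suc (V ℕ.+ suc (suc G))
  cells-length = trans (run-length (horizontal 2 1) j bumped) (cong (λ n → j ℕ.+ suc n)
    (trans (run-length (vertical 1 1) V (row (suc G))) (cong (V ℕ.+_) (row-length (suc G)))))

-- The hook with legs g + 1 and w + 1 accounts for their product. Column 0 adds a trapezoid of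
-- doubled area (i + 2) + (w + 2) and two cells, hence i + w to m.
realize-bump : ∀ g w i j k → i ℕ.≤ w → j ℕ.* suc w ℕ.≤ suc g ℕ.* w → k ℕ.+ 2 ℕ.* j ≡ i ℕ.+ w ℕ.+ suc g ℕ.* suc w →
  Realizable (j ℕ.+ suc (suc w ℕ.+ suc (suc (suc g)))) k
realize-bump g w i j k i≤w fit eq = realize cs grown cells-length area
  (trans (arith₁ g w i) (trans (cong (2 ℕ.* (5 ℕ.+ w ℕ.+ g) ℕ.+_) (sym eq)) (arith₂ g w j k)))
  where
  open Bump g w i j i≤w fit
  arith₁ : ∀ g w i → 1 ℕ.* (suc (suc i) ℕ.+ suc (suc w)) ℕ.+ (1 ℕ.* (suc (suc w) ℕ.+ suc (suc w)) ℕ.+ suc g ℕ.*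
    (suc (suc w) ℕ.+ 1)) ≡
    2 ℕ.* (5 ℕ.+ w ℕ.+ g) ℕ.+ (i ℕ.+ w ℕ.+ suc g ℕ.* suc w)
  arith₁ = ℕsolve-∀
  arith₂ : ∀ g w j k → 2 ℕ.* (5 ℕ.+ w ℕ.+ g) ℕ.+ (k ℕ.+ 2 ℕ.* j) ≡ 2 ℕ.* (j ℕ.+ suc (suc w ℕ.+ suc (suc (suc g))))
    ℕ.+ k
  arith₂ = ℕsolve-∀

-- Choosing a polyomino

factored⇒¬prime : ∀ {n} → Factored n → ¬ Prime n
factored⇒¬prime {n} (suc (suc d) , suc (suc e) , _ , _ , refl) p =
  Prime.notComposite p (hasNonTrivialDivisor {divisor = suc (suc d)}
    (ℕ.m<m*n (suc (suc d)) (suc (suc e)) (ℕ.s≤s (ℕ.s≤s ℕ.z≤n))) (divides (suc (suc e)) (ℕ.*-comm (suc (suc d))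
      (suc (suc e)))))
factored⇒¬prime (0 , _ , () , _) _
factored⇒¬prime (1 , _ , ℕ.s≤s () , _) _
factored⇒¬prime (suc (suc _) , 0 , _ , () , _) _
factored⇒¬prime (suc (suc _) , 1 , _ , ℕ.s≤s () , _) _

composite⇒realizable : ∀ {n} → Composite (suc n) → Realizable n 1
composite⇒realizable (hasNonTrivialDivisor {zero} _ (divides q eq)) with () ← trans eq (ℕ.*-zeroʳ q)
composite⇒realizable (hasNonTrivialDivisor {1} {{()}} _ _)
composite⇒realizable (hasNonTrivialDivisor {suc (suc l)} d<n (divides 1 eq)) =
  contradiction (trans eq (ℕ.*-identityˡ (suc (suc l)))) (ℕ.>⇒≢ d<n)
composite⇒realizable {n} (hasNonTrivialDivisor {suc (suc l)} d<n (divides (suc (suc r)) eq)) =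
  subst (λ n → Realizable n 1) (ℕ.suc-injective (trans (arith l r) (sym eq))) (realize-notched l r)
  where
  arith : ∀ l r → suc (suc l ℕ.+ suc (suc l) ℕ.* suc r) ≡ suc (suc r) ℕ.* suc (suc l)
  arith = ℕsolve-∀

half? : ∀ n → (Σ[ m ∈ ℕ ] n ≡ m ℕ.+ m) ⊎ (Σ[ m ∈ ℕ ] n ≡ suc (m ℕ.+ m))
half? zero = inj₁ (0 , refl)
half? (suc n) with half? n
... | inj₁ (m , refl) = inj₂ (m , refl)
... | inj₂ (m , refl) = inj₁ (suc m , cong suc (sym (ℕ.+-suc m m)))

-- Two full rows fix the parity of n - m, here the parity of `r`. The odd case takes a hole, which
-- accounts for 2 by itself, so m = 2 is realised without a triangle.
realize-small : ∀ k r → Realizable (suc (suc k) ℕ.+ suc (suc r)) (suc (suc k))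
realize-small k r with half? r
... | inj₁ (m , refl) = subst (λ n → Realizable n (suc (suc k))) (arith m k) (realize-two-rows m (suc k))
  where
  arith : ∀ m k → m ℕ.+ suc (suc k) ℕ.+ suc (suc m) ≡ suc (suc k) ℕ.+ suc (suc (m ℕ.+ m))
  arith = ℕsolve-∀
realize-small zero r | inj₂ (m , refl) = subst (λ n → Realizable n 2) (arith m) (realize-cup m)
  where
  arith : ∀ m → suc m ℕ.+ suc (suc (suc (suc m))) ≡ 2 ℕ.+ suc (suc (suc (m ℕ.+ m)))
  arith = ℕsolve-∀
realize-small (suc k) r | inj₂ (m , refl) = subst (λ n → Realizable n (suc (suc (suc k)))) (arith m k)
  (realize-hollow m k)
  where
  arith : ∀ m k → suc m ℕ.+ suc (suc (suc (suc m) ℕ.+ suc k)) ≡ suc (suc (suc k)) ℕ.+ suc (suc (suc (m ℕ.+ m)))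
  arith = ℕsolve-∀

-- With v = w + 2 and total deficit s + j (v + 2) below v (v + r), where
-- s < v + 2: a hook, a broken hook or a bump realise the residues s.
realize-large : ∀ w j s r k → s ℕ.< suc (suc (suc (suc w))) →
  k ℕ.+ (s ℕ.+ j ℕ.* suc (suc (suc (suc w)))) ≡ suc (suc w) ℕ.* (suc (suc w) ℕ.+ (s ℕ.+ j ℕ.* suc
    (suc (suc (suc w))) ℕ.+ r)) →
  Realizable (suc (suc (suc w) ℕ.+ suc (suc w) ℕ.+ (s ℕ.+ j ℕ.* suc (suc (suc (suc w))) ℕ.+ r))) k
-- With n fixed, a filler is taken from the horizontal leg. It costs 2 as a filler and v through the
-- shorter leg, hence the modulus v + 2.
realize-large w j zero r k _ eq = subst (λ n → Realizable n k) (arith₁ w j r)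
  (realize-hook h (suc w) j k fit (ℕ.+-cancelʳ-≡ (j ℕ.* V) (k ℕ.+ 2 ℕ.* j) (suc h ℕ.* V)
    (trans (arith₂ k j w) (trans eq (arith₃ w j r)))))
  where
  V h : ℕ
  V = suc (suc w)
  h = suc w ℕ.+ (j ℕ.* suc V ℕ.+ r)
  fit : j ℕ.* V ℕ.≤ suc h ℕ.* suc w
  fit = ℕ.≤-trans (ℕ.≤-trans (ℕ.≤-trans (ℕ.*-monoʳ-≤ j (ℕ.n≤1+n V)) (ℕ.m≤m+n (j ℕ.* suc V) r))
    (ℕ.m≤n+m (j ℕ.* suc V ℕ.+ r) V)) (ℕ.m≤m*n (suc h) (suc w))
  arith₁ : ∀ w j r → j ℕ.+ (suc (suc w ℕ.+ (j ℕ.* suc (suc (suc w)) ℕ.+ r)) ℕ.+ (suc (suc w) ℕ.+ 1)) ≡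
    suc (suc (suc w) ℕ.+ suc (suc w) ℕ.+ (0 ℕ.+ j ℕ.* suc (suc (suc (suc w))) ℕ.+ r))
  arith₁ = ℕsolve-∀
  arith₂ : ∀ k j w → k ℕ.+ 2 ℕ.* j ℕ.+ j ℕ.* suc (suc w) ≡ k ℕ.+ (0 ℕ.+ j ℕ.* suc (suc (suc (suc w))))
  arith₂ = ℕsolve-∀
  arith₃ : ∀ w j r → suc (suc w) ℕ.* (suc (suc w) ℕ.+ (0 ℕ.+ j ℕ.* suc (suc (suc (suc w))) ℕ.+ r)) ≡
    suc (suc w ℕ.+ (j ℕ.* suc (suc (suc w)) ℕ.+ r)) ℕ.* suc (suc w) ℕ.+ j ℕ.* suc (suc w)
  arith₃ = ℕsolve-∀
-- Compared with the hook with `j` fillers, the corner cell has moved to the second row: n and the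
-- legs stay, and twice the area drops by 1.
realize-large w j (suc zero) r k _ eq = subst (λ n → Realizable n k) (arith₁ w j r)
  (realize-broken-hook h (suc w) j k fit (ℕ.+-cancelʳ-≡ (j ℕ.* V) (suc (k ℕ.+ 2 ℕ.* j)) (suc h ℕ.* V)
    (trans (arith₂ k j w) (trans eq (arith₃ w j r)))))
  where
  V h : ℕ
  V = suc (suc w)
  h = suc w ℕ.+ (1 ℕ.+ j ℕ.* suc V ℕ.+ r)
  fit : suc j ℕ.* V ℕ.≤ suc h ℕ.* suc w
  fit = ℕ.≤-trans (ℕ.+-monoʳ-≤ V (ℕ.≤-trans (ℕ.≤-trans (ℕ.*-monoʳ-≤ j (ℕ.n≤1+n V)) (ℕ.n≤1+n (j ℕ.* suc V)))
    (ℕ.m≤m+n (1 ℕ.+ j ℕ.* suc V) r))) (ℕ.m≤m*n (suc h) (suc w))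
  arith₁ : ∀ w j r → suc (suc w ℕ.+ (1 ℕ.+ j ℕ.* suc (suc (suc w)) ℕ.+ r)) ℕ.+ (suc w ℕ.+ (suc j ℕ.+ 1)) ≡
    suc (suc (suc w) ℕ.+ suc (suc w) ℕ.+ (1 ℕ.+ j ℕ.* suc (suc (suc (suc w))) ℕ.+ r))
  arith₁ = ℕsolve-∀
  arith₂ : ∀ k j w → suc (k ℕ.+ 2 ℕ.* j) ℕ.+ j ℕ.* suc (suc w) ≡ k ℕ.+ (1 ℕ.+ j ℕ.* suc (suc (suc (suc w))))
  arith₂ = ℕsolve-∀
  arith₃ : ∀ w j r → suc (suc w) ℕ.* (suc (suc w) ℕ.+ (1 ℕ.+ j ℕ.* suc (suc (suc (suc w))) ℕ.+ r)) ≡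
    suc (suc w ℕ.+ (1 ℕ.+ j ℕ.* suc (suc (suc w)) ℕ.+ r)) ℕ.* suc (suc w) ℕ.+ j ℕ.* suc (suc w)
  arith₃ = ℕsolve-∀
realize-large w j (suc (suc s)) r k (ℕ.s≤s (ℕ.s≤s s<V)) eq with ℕ.m≤n⇒∃[o]m+o≡n (ℕ.s≤s⁻¹ s<V)
-- Lowering the bump by one lowers m by one, so the remaining residues correspond to its positions:
-- here i = w + 1 - s.
... | i , s+i≡ = subst (λ n → Realizable n k) (arith₁ w j r s)
  (realize-bump g (suc w) i j k i≤ fit (ℕ.+-cancelʳ-≡ (suc (suc s) ℕ.+ j ℕ.* V) (k ℕ.+ 2 ℕ.* j) (i ℕ.+ suc w ℕ.+
    suc g ℕ.* V)
    (trans (arith₂ k j w s) (trans eq (trans (arith₃ w j r s) (trans (cong (λ u → (u ℕ.+ suc w ℕ.+ suc g ℕ.* V)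
      ℕ.+ (2 ℕ.+ j ℕ.* V)) (sym s+i≡)) (arith₄ s i (suc w) (suc g ℕ.* V) (j ℕ.* V))))))))
  where
  V g : ℕ
  V = suc (suc w)
  g = suc w ℕ.+ (s ℕ.+ j ℕ.* suc V ℕ.+ r)
  i≤ : i ℕ.≤ suc w
  i≤ = subst (i ℕ.≤_) s+i≡ (ℕ.m≤n+m i s)
  fit : j ℕ.* V ℕ.≤ suc g ℕ.* suc w
  fit = ℕ.≤-trans (ℕ.≤-trans (ℕ.≤-trans (ℕ.≤-trans (ℕ.*-monoʳ-≤ j (ℕ.n≤1+n V)) (ℕ.m≤n+m (j ℕ.* suc V) s))
    (ℕ.m≤m+n (s ℕ.+ j ℕ.* suc V) r))
    (ℕ.m≤n+m (s ℕ.+ j ℕ.* suc V ℕ.+ r) V)) (ℕ.m≤m*n (suc g) (suc w))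
  arith₁ : ∀ w j r s → j ℕ.+ suc (suc (suc w) ℕ.+ suc (suc (suc (suc w ℕ.+ (s ℕ.+ j ℕ.* suc (suc (suc w)) ℕ.+ r))))) ≡
    suc (suc (suc w) ℕ.+ suc (suc w) ℕ.+ (suc (suc s) ℕ.+ j ℕ.* suc (suc (suc (suc w))) ℕ.+ r))
  arith₁ = ℕsolve-∀
  arith₂ : ∀ k j w s → k ℕ.+ 2 ℕ.* j ℕ.+ (suc (suc s) ℕ.+ j ℕ.* suc (suc w)) ≡ k ℕ.+ (suc (suc s) ℕ.+ j ℕ.* suc
    (suc (suc (suc w))))
  arith₂ = ℕsolve-∀
  arith₃ : ∀ w j r s → suc (suc w) ℕ.* (suc (suc w) ℕ.+ (suc (suc s) ℕ.+ j ℕ.* suc (suc (suc (suc w))) ℕ.+ r)) ≡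
    (suc w ℕ.+ suc w ℕ.+ suc (suc w ℕ.+ (s ℕ.+ j ℕ.* suc (suc (suc w)) ℕ.+ r)) ℕ.* suc (suc w)) ℕ.+
      (2 ℕ.+ j ℕ.* suc (suc w))
  arith₃ = ℕsolve-∀
  arith₄ : ∀ s i w x y → (s ℕ.+ i ℕ.+ w ℕ.+ x) ℕ.+ (2 ℕ.+ y) ≡ (i ℕ.+ w ℕ.+ x) ℕ.+ (suc (suc s) ℕ.+ y)
  arith₄ = ℕsolve-∀

-- The maximal value and the height of the vertical leg

maxDefect : ℕ → ℕ
maxDefect n = ((n ∸ 1) / 2) ℕ.* (n / 2)

half-upper : ∀ {x} y → x ℕ.< suc y ℕ.* 2 → x / 2 ℕ.≤ y
half-upper {x} y h = ℕ.s≤s⁻¹ (m<n*o⇒m/o<n {x} {suc y} {2} h)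

maxDefect-upper : ∀ v r → r ℕ.≤ 1 → maxDefect (suc (v ℕ.+ v ℕ.+ r)) ℕ.≤ v ℕ.* (v ℕ.+ r)
maxDefect-upper v zero    _ = ℕ.*-mono-≤ (half-upper v (ℕ.≤-trans (ℕ.≤-reflexive (arith₁ v)) (ℕ.n≤1+n _)))
  (half-upper (v ℕ.+ 0) (ℕ.≤-reflexive (arith₂ v)))
  where
  arith₁ : ∀ v → suc (v ℕ.+ v ℕ.+ 0) ≡ suc (v ℕ.* 2)
  arith₁ = ℕsolve-∀
  arith₂ : ∀ v → suc (suc (v ℕ.+ v ℕ.+ 0)) ≡ suc (v ℕ.+ 0) ℕ.* 2
  arith₂ = ℕsolve-∀
maxDefect-upper v (suc zero) _ = ℕ.*-mono-≤ (half-upper v (ℕ.≤-reflexive (arith₁ v))) (half-upper (v ℕ.+ 1)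
  (ℕ.≤-trans (ℕ.≤-reflexive (arith₂ v)) (ℕ.n≤1+n _)))
  where
  arith₁ : ∀ v → suc (v ℕ.+ v ℕ.+ 1) ≡ suc v ℕ.* 2
  arith₁ = ℕsolve-∀
  arith₂ : ∀ v → suc (suc (v ℕ.+ v ℕ.+ 1)) ≡ suc ((v ℕ.+ 1) ℕ.* 2)
  arith₂ = ℕsolve-∀
maxDefect-upper v (suc (suc r)) (ℕ.s≤s ())

-- The smallest v with k ≤ v (N - v), where N = 2 v + r.
find-height : ∀ w r k → w ℕ.* (suc (suc w) ℕ.+ r) ℕ.< k → k ℕ.≤ maxDefect (suc (suc w ℕ.+ suc w ℕ.+ r)) →
  Σ[ w′ ∈ ℕ ] Σ[ r′ ∈ ℕ ] suc w′ ℕ.+ suc w′ ℕ.+ r′ ≡ suc w ℕ.+ suc w ℕ.+ r ×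
    w ℕ.≤ w′ × w′ ℕ.* (suc (suc w′) ℕ.+ r′) ℕ.< k × k ℕ.≤ suc w′ ℕ.* (suc w′ ℕ.+ r′)
find-height w r k low high with k ℕ.≤? suc w ℕ.* (suc w ℕ.+ r)
... | yes k≤ = w , r , refl , ℕ.≤-refl , low , k≤
find-height w zero k low high | no k≰ = contradiction (ℕ.≤-trans high (maxDefect-upper (suc w) 0 ℕ.z≤n)) k≰
find-height w (suc zero) k low high | no k≰ = contradiction (ℕ.≤-trans high (maxDefect-upper (suc w) 1 ℕ.≤-refl)) k≰
find-height w (suc (suc r)) k low high | no k≰ =
  let w′ , r′ , eq , w≤ , low′ , high′ = find-height (suc w) r k
        (subst (ℕ._< k) (cong (suc w ℕ.*_) (arith₁ w r)) (ℕ.≰⇒> k≰)) (subst (λ m → k ℕ.≤ maxDefect (suc m))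
          (sym (arith₂ w r)) high)
  in w′ , r′ , trans eq (arith₂ w r) , ℕ.≤-trans (ℕ.n≤1+n w) w≤ , low′ , high′
  where
  arith₁ : ∀ w r → suc w ℕ.+ suc (suc r) ≡ suc (suc (suc w)) ℕ.+ r
  arith₁ = ℕsolve-∀
  arith₂ : ∀ w r → suc (suc w) ℕ.+ suc (suc w) ℕ.+ r ≡ suc w ℕ.+ suc w ℕ.+ suc (suc r)
  arith₂ = ℕsolve-∀

-- Here n = r + 5, so k > n - 2. This is the value of v (n - 1 - v) at v = 1, and the search for the
-- height starts at v = 2.
realize-tall : ∀ r k → 4 ℕ.+ r ℕ.≤ k → k ℕ.≤ maxDefect (suc (4 ℕ.+ r)) → Realizable (suc (4 ℕ.+ r)) k
realize-tall r k low high = choose (find-height 1 r k (ℕ.≤-trans (ℕ.≤-reflexive (cong (4 ℕ.+_) (ℕ.+-identityʳ r)))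
  low) high)
  where
  choose : (Σ[ w′ ∈ ℕ ] Σ[ r′ ∈ ℕ ] suc w′ ℕ.+ suc w′ ℕ.+ r′ ≡ 4 ℕ.+ r ×
    1 ℕ.≤ w′ × w′ ℕ.* (suc (suc w′) ℕ.+ r′) ℕ.< k × k ℕ.≤ suc w′ ℕ.* (suc w′ ℕ.+ r′)) → Realizable (suc (4 ℕ.+ r)) k
  choose (suc w , r′ , eq , _ , low′ , high′) with ℕ.m≤n⇒∃[o]m+o≡n high′
  ... | D , k+D≡ with ℕ.m≤n⇒∃[o]m+o≡n D≤r′
    where
    -- Passing from v - 1 to v raises the product v (N - v) by r′ + 1, so minimality of v leaves a
    -- deficit of at most r′. This surplus of the horizontal leg over the vertical one is what
    -- `realize-large` draws on.
    D≤r′ : D ℕ.≤ r′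
    D≤r′ = ℕ.s≤s⁻¹ (ℕ.+-cancelˡ-< (suc w ℕ.* (suc (suc (suc w)) ℕ.+ r′)) D (suc r′)
      (ℕ.<-≤-trans (ℕ.+-monoˡ-< D low′) (ℕ.≤-reflexive (trans k+D≡ (arith w r′)))))
      where
      arith : ∀ w r → suc (suc w) ℕ.* (suc (suc w) ℕ.+ r) ≡ suc w ℕ.* (suc (suc (suc w)) ℕ.+ r) ℕ.+ suc r
      arith = ℕsolve-∀
  ...   | rest , D+rest≡ = subst (λ n → Realizable n k)
      (cong suc (trans (cong (λ u → suc (suc w) ℕ.+ suc (suc w) ℕ.+ u) r≡) eq))
      (realize-large w (D / m) (D % m) rest k (m%n<n D m) (trans (cong (k ℕ.+_) (sym (m≡m%n+[m/n]*n D m)))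
        (trans k+D≡ (cong (λ u → suc (suc w) ℕ.* (suc (suc w) ℕ.+ u)) (sym r≡)))))
    where
    m = suc (suc (suc (suc w)))
    r≡ : D % m ℕ.+ D / m ℕ.* m ℕ.+ rest ≡ r′
    r≡ = trans (cong (ℕ._+ rest) (sym (m≡m%n+[m/n]*n D m))) D+rest≡

realize-notch : ∀ {n} → Dec (Composite (suc n)) → ¬ ¬ Composite (suc n) → Realizable n 1
realize-notch (yes c) _   = composite⇒realizable c
realize-notch (no ¬c) ¬¬c = contradiction ¬c ¬¬c

-- For one to four cells `maxDefect` is 0, 0, 1 and 2, so the two inequalities exclude each other
-- there.
realize-middle : ∀ n k → suc n ℕ.≤ 3 ℕ.+ k → suc (suc k) ℕ.≤ maxDefect (suc n) → Realizable (suc n) (suc (suc k))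
realize-middle 0 k _ ()
realize-middle 1 k _ ()
realize-middle 2 k _ (ℕ.s≤s ())
realize-middle 3 zero (ℕ.s≤s (ℕ.s≤s (ℕ.s≤s ()))) _
realize-middle 3 (suc k) _ (ℕ.s≤s (ℕ.s≤s ()))
realize-middle (suc (suc (suc (suc n)))) k low high = realize-tall n (suc (suc k)) (ℕ.s≤s⁻¹ low) high

realize-by-size : ∀ {n k} → Dec (4 ℕ.+ k ℕ.≤ suc n) → suc (suc k) ℕ.≤ maxDefect (suc n) → Realizable (suc n)
  (suc (suc k))
realize-by-size {n} {k} (no large) high = realize-middle n k (ℕ.s≤s⁻¹ (ℕ.≰⇒> large)) high
realize-by-size {n} {k} (yes small) _ = enlarge (ℕ.m≤n⇒∃[o]m+o≡n small)
  where
  arith : ∀ k r → suc (suc k) ℕ.+ suc (suc r) ≡ 4 ℕ.+ k ℕ.+ r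
  arith = ℕsolve-∀
  enlarge : Σ[ r ∈ ℕ ] 4 ℕ.+ k ℕ.+ r ≡ suc n → Realizable (suc n) (suc (suc k))
  enlarge (r , eq) = subst (λ n → Realizable n (suc (suc k))) (trans (arith k r) eq) (realize-small k r)

realizable : ∀ n k → 1 ℕ.≤ n → k ℕ.≤ maxDefect n → (k ≡ 1 → ¬ Prime (suc n)) → Realizable n k
realizable (suc n) zero          _ _    _      = realize-row n
realizable (suc n) (suc zero)    _ _    ¬prime = realize-notch (composite? (suc (suc n))) (λ ¬c → ¬prime refl
  (prime ¬c))
realizable (suc n) (suc (suc k)) _ high _      = realize-by-size (4 ℕ.+ k ℕ.≤? suc n) high

half-lower : ∀ y {x} → y ℕ.* 2 ℕ.≤ x → y ℕ.≤ x / 2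
half-lower y {x} h = subst (ℕ._≤ x / 2) (m*n/n≡m y 2) (/-monoˡ-≤ 2 h)

-- A product with fixed sum grows as its factors approach each other. Each step of the induction
-- shortens their difference by 2, down to 0 or 1.
maxDefect-lower : ∀ h r → h ℕ.* (h ℕ.+ r) ℕ.≤ maxDefect (suc (h ℕ.+ (h ℕ.+ r)))
maxDefect-lower h zero = ℕ.*-mono-≤ (half-lower h (ℕ.≤-reflexive (arith₁ h))) (half-lower (h ℕ.+ 0)
  (ℕ.≤-trans (ℕ.≤-reflexive (arith₂ h)) (ℕ.n≤1+n _)))
  where
  arith₁ : ∀ h → h ℕ.* 2 ≡ h ℕ.+ (h ℕ.+ 0)
  arith₁ = ℕsolve-∀
  arith₂ : ∀ h → (h ℕ.+ 0) ℕ.* 2 ≡ h ℕ.+ (h ℕ.+ 0)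
  arith₂ = ℕsolve-∀
maxDefect-lower h (suc zero) = ℕ.*-mono-≤ (half-lower h (ℕ.≤-trans (ℕ.n≤1+n _) (ℕ.≤-reflexive (arith₁ h))))
  (half-lower (h ℕ.+ 1) (ℕ.≤-reflexive (arith₂ h)))
  where
  arith₁ : ∀ h → suc (h ℕ.* 2) ≡ h ℕ.+ (h ℕ.+ 1)
  arith₁ = ℕsolve-∀
  arith₂ : ∀ h → (h ℕ.+ 1) ℕ.* 2 ≡ suc (h ℕ.+ (h ℕ.+ 1))
  arith₂ = ℕsolve-∀
maxDefect-lower h (suc (suc r)) = ℕ.≤-trans (subst (h ℕ.* (h ℕ.+ suc (suc r)) ℕ.≤_) (arith₁ h r)
  (ℕ.m≤m+n (h ℕ.* (h ℕ.+ suc (suc r))) (suc r)))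
  (subst (λ m → suc h ℕ.* (suc h ℕ.+ r) ℕ.≤ maxDefect (suc m)) (arith₂ h r) (maxDefect-lower (suc h) r))
  where
  arith₁ : ∀ h r → h ℕ.* (h ℕ.+ suc (suc r)) ℕ.+ suc r ≡ suc h ℕ.* (suc h ℕ.+ r)
  arith₁ = ℕsolve-∀
  arith₂ : ∀ h r → suc h ℕ.+ (suc h ℕ.+ r) ≡ h ℕ.+ (h ℕ.+ suc (suc r))
  arith₂ = ℕsolve-∀

product-bound : ∀ h v → h ℕ.* v ℕ.≤ maxDefect (suc (h ℕ.+ v))
product-bound h v = [ (λ h≤v → ordered h≤v) , (λ v≤h → subst₂ (λ a b → a ℕ.≤ maxDefect (suc b)) (ℕ.*-comm v h)
  (ℕ.+-comm v h) (ordered v≤h)) ]′ (ℕ.≤-total h v)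
  where
  ordered : ∀ {h v} → h ℕ.≤ v → h ℕ.* v ℕ.≤ maxDefect (suc (h ℕ.+ v))
  ordered {h} h≤v = let r , eq = ℕ.m≤n⇒∃[o]m+o≡n h≤v in subst (λ v → h ℕ.* v ℕ.≤ maxDefect (suc (h ℕ.+ v))) eq (maxDefect-lower h r)

-- From polyominoes to growing lists of cells and back

Neighbours : List Cell → Cell → Cell → Set
Neighbours cs e f = e ∈ cs × f ∈ cs × ShareEdge e f

distance-one : ∀ {i j} → i ≡ ℤ.suc j ⊎ j ≡ ℤ.suc i → ℤ.∣ i ℤ.- j ∣ ≡ 1
distance-one {j = j} (inj₁ refl) = cong ℤ.∣_∣ (solveᶻ 1 (λ j → conᶻ (+ 1) :+ᶻ j :-ᶻ j :=ᶻ conᶻ (+ 1)) refl j)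
distance-one {i = i} (inj₂ refl) = cong ℤ.∣_∣ (solveᶻ 1 (λ i → i :-ᶻ (conᶻ (+ 1) :+ᶻ i) :=ᶻ conᶻ -[1+ 0 ]) refl i)

stepX-edge : ∀ {c d} → StepX c d → ShareEdge c d × ShareEdge d c
stepX-edge (same , dir) = inj₂ (same , distance-one dir) , inj₂ (sym same , distance-one (swap-⊎ dir))

stepY-edge : ∀ {c d} → StepY c d → ShareEdge c d × ShareEdge d c
stepY-edge (same , dir) = inj₁ (same , distance-one dir) , inj₁ (sym same , distance-one (swap-⊎ dir))

connect-new : ∀ {cs c d} → (∀ {e f} → e ∈ cs → f ∈ cs → Star (Neighbours cs) e f) → d ∈ cs → ShareEdge c d ×
  ShareEdge d c →
  ∀ {e f} → e ∈ c ∷ cs → f ∈ c ∷ cs → Star (Neighbours (c ∷ cs)) e f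
connect-new {cs} {c} {d} old d∈ (c-d , d-c) = path
  where
  lift : ∀ {e f} → Star (Neighbours cs) e f → Star (Neighbours (c ∷ cs)) e f
  lift = Star.map (λ (e∈ , f∈ , s) → there e∈ , there f∈ , s)
  path : ∀ {e f} → e ∈ c ∷ cs → f ∈ c ∷ cs → Star (Neighbours (c ∷ cs)) e f
  path (here refl) (here refl) = Star.ε
  path (here refl) (there f∈)  = (here refl , there d∈ , c-d) ◅ lift (old d∈ f∈)
  path (there e∈)  (here refl) = lift (old e∈ d∈) ◅◅ ((there d∈ , here refl , d-c) ◅ Star.ε)
  path (there e∈)  (there f∈)  = lift (old e∈ f∈)

grow-connected : ∀ {cs h v} → Grow cs h v → ∀ {e f} → e ∈ cs → f ∈ cs → Star (Neighbours cs) e f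
grow-connected (seed c) (here refl) (here refl) = Star.ε
grow-connected (growX g d∈ _ step)              = connect-new (grow-connected g) d∈ (stepX-edge step)
grow-connected (growY g d∈ _ step)              = connect-new (grow-connected g) d∈ (stepY-edge step)

union-↭ : ∀ {cs ds} → cs ↭ ds → unionOf cs ⊆ unionOf ds
union-↭ p m = Perm.Any-resp-↭ p m

-- Growth lists the cells of a polyomino in a new order, and the union of the squares does not
-- depend on it.
hullArea-↭ : ∀ {cs ds z} → cs ↭ ds → HullArea cs z → HullArea ds z
hullArea-↭ {cs} {ds} {z} p = area-resp {convexHull (unionOf cs)} {convexHull (unionOf ds)} {fromℤ z /2} {fromℤ z /2}
  (λ {q} → hull-subset {cs} {ds} p {q}) (λ {q} → hull-subset {ds} {cs} (↭-sym p) {q}) (≃-refl {fromℤ z /2})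
  where
  hull-subset : ∀ {cs ds} → cs ↭ ds → convexHull (unionOf cs) ⊆ convexHull (unionOf ds)
  hull-subset {cs} {ds} p {q} h = combination (hull-mono {unionOf cs} {unionOf ds} (λ {r} → union-↭ {cs} {ds} p
    {r}) {q} (inHull h))

polyomino⇒grow : ∀ {n} (P : Polyomino n) → 1 ℕ.≤ n → Σ[ cs ∈ List Cell ] Σ[ h ∈ ℕ ] Σ[ v ∈ ℕ ] Grow cs h v × cells
  P ↭ cs × suc (h ℕ.+ v) ≡ n
polyomino⇒grow {n} P 1≤n = start (cells P) (size P) (distinct P) (connected P)
  where
  start : ∀ ds → length ds ≡ n → Unique ds → (∀ {c d} → c ∈ ds → d ∈ ds → Star (Neighbours ds) c d) →
    Σ[ cs ∈ List Cell ] Σ[ h ∈ ℕ ] Σ[ v ∈ ℕ ] Grow cs h v × ds ↭ cs × suc (h ℕ.+ v) ≡ n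
  start []       len _ _ = contradiction (subst (1 ℕ.≤_) (sym len) 1≤n) λ ()
  start (c ∷ ds) len unique connected = finish (complete unique connected (length ds) ds refl (seed c) Perm.refl)
    where
    finish : Σ[ cs ∈ List Cell ] Σ[ h ∈ ℕ ] Σ[ v ∈ ℕ ] Grow cs h v × c ∷ ds ↭ cs ++ [] →
      Σ[ cs ∈ List Cell ] Σ[ h ∈ ℕ ] Σ[ v ∈ ℕ ] Grow cs h v × c ∷ ds ↭ cs × suc (h ℕ.+ v) ≡ n
    finish (cs , h , v , g , p) = cs , h , v , g , p′ , trans (sym (grow-length g))
      (trans (sym (Perm.↭-length p′)) len)
      where
      p′ : c ∷ ds ↭ cs
      p′ = ↭-trans p (Perm.++-identityʳ cs)

grow⇒polyomino : ∀ {cs h v n} → Grow cs h v → length cs ≡ n → Polyomino n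
grow⇒polyomino {cs} g len = record { cells = cs ; size = len ; distinct = grow-unique g ; connected =
  grow-connected g }

-- From doubled areas to the real number m

area-formula : ∀ n k → ½ * ιℕ (2 ℕ.* n ℕ.+ k) ≡ ιℕ n + ½ * ιℕ k
area-formula n k = trans (cong (½ *_) (trans (ιℕ-+ (2 ℕ.* n) k) (cong (_+ ιℕ k)
  (trans (cong ιℕ (cong (n ℕ.+_) (ℕ.+-identityʳ n))) (ιℕ-+ n n)))))
  (solve 2 (λ n k → con ½ :* (n :+ n :+ k) := n :+ con ½ :* k) refl (ιℕ n) (ιℕ k))

defect-≃ : ∀ n k m → fromℕ n +ʳ m /2 ≃ fromℤ (+ (2 ℕ.* n ℕ.+ k)) /2 → m ≃ fromℕ k
defect-≃ n k m h = null-resp (λ l → begin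
    (1ℚ + 1ℚ) * (ιℕ n + ½ * seq m l - ½ * ιℕ (2 ℕ.* n ℕ.+ k))  ≡⟨ cong (λ u → (1ℚ + 1ℚ) * (ιℕ n + ½ * seq m l -
      u)) (area-formula n k) ⟩
    (1ℚ + 1ℚ) * (ιℕ n + ½ * seq m l - (ιℕ n + ½ * ιℕ k))
      ≡⟨ solve 3 (λ n m k → (con 1ℚ :+ con 1ℚ) :* (n :+ con ½ :* m :- (n :+ con ½ :* k)) := m :- k) refl (ιℕ n)
        (seq m l) (ιℕ k) ⟩
    seq m l - ιℕ k                                             ∎)
  (null-scale (1ℚ + 1ℚ) h)
  where open ≡-Reasoning

defect-≃⁻ : ∀ n k m → m ≃ fromℕ k → fromℤ (+ (2 ℕ.* n ℕ.+ k)) /2 ≃ fromℕ n +ʳ m /2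
defect-≃⁻ n k m h = null-resp (λ l → begin
    (- ½) * (seq m l - ιℕ k)
      ≡⟨ solve 3 (λ n m k → (:- con ½) :* (m :- k) := (n :+ con ½ :* k) :- (n :+ con ½ :* m)) refl (ιℕ n)
        (seq m l) (ιℕ k) ⟩
    (ιℕ n + ½ * ιℕ k) - (ιℕ n + ½ * seq m l)         ≡⟨ cong (_- (ιℕ n + ½ * seq m l)) (sym (area-formula n k)) ⟩
    ½ * ιℕ (2 ℕ.* n ℕ.+ k) - (ιℕ n + ½ * seq m l)    ∎)
  (null-scale (- ½) h)
  where open ≡-Reasoning

Condition : (n k : ℕ) → Set
Condition n k = k ℕ.≤ maxDefect n × (k ≡ 1 → ¬ Prime (suc n))

polyomino-defect : ∀ {n} (P : Polyomino n) → 1 ℕ.≤ n → Σ[ k ∈ ℕ ] Condition n k × HullArea (cells P)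
  (+ (2 ℕ.* n ℕ.+ k))
polyomino-defect {n} P 1≤n = measure (polyomino⇒grow P 1≤n)
  where
  measure : Σ[ cs ∈ List Cell ] Σ[ h ∈ ℕ ] Σ[ v ∈ ℕ ] Grow cs h v × cells P ↭ cs × suc (h ℕ.+ v) ≡ n →
    Σ[ k ∈ ℕ ] Condition n k × HullArea (cells P) (+ (2 ℕ.* n ℕ.+ k))
  measure (cs , h , v , g , p , refl) = extract (proj₁ (grow-bound g))
    where
    extract : AreaBound cs h v → Σ[ k ∈ ℕ ] Condition n k × HullArea (cells P) (+ (2 ℕ.* n ℕ.+ k))
    extract (z , area , z≤) = finish (ℤ.0≤i⇒+∣i∣≡i (diffᶻ (proj₁ lower)))
      where
      lower : LowerBound n z
      lower = subst (λ m → LowerBound m z) (grow-length g) (grow-lower {cs} {z = z} g area)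
      k : ℕ
      k = ℤ.∣ z ℤ.- + (2 ℕ.* n) ∣
      finish : + k ≡ z ℤ.- + (2 ℕ.* n) → Σ[ k ∈ ℕ ] Condition n k × HullArea (cells P) (+ (2 ℕ.* n ℕ.+ k))
      finish eq = k , (ℕ.≤-trans k≤ (product-bound h v) , λ k≡1 → factored⇒¬prime
        (proj₂ lower (trans z≡ (cong +_ (trans (cong (2 ℕ.* n ℕ.+_) k≡1) (ℕ.+-comm (2 ℕ.* n) 1)))))) ,
        hullArea-↭ {cs} {cells P} {+ (2 ℕ.* n ℕ.+ k)} (↭-sym p) (subst (HullArea cs) z≡ area)
        where
        z≡ : z ≡ + (2 ℕ.* n ℕ.+ k)
        z≡ = trans (solveᶻ 2 (λ z m → z :=ᶻ m :+ᶻ (z :-ᶻ m)) refl z (+ (2 ℕ.* n))) (cong (λ u → + (2 ℕ.* n) ℤ.+ u)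
          (sym eq))
        k≤ : k ℕ.≤ h ℕ.* v
        k≤ = ℕ.+-cancelˡ-≤ (2 ℕ.* n) k (h ℕ.* v) (ℤ.drop‿+≤+ (subst (ℤ._≤ + (2 ℕ.* n ℕ.+ h ℕ.* v)) z≡ z≤))

realize-polyomino : ∀ {n k} m → m ≃ fromℕ k → Realizable n k → ∃[ P ] HasArea (convexHull (union {n} P))
  (fromℕ n +ʳ m /2)
realize-polyomino {n} {k} m m≃k r = build (realization r)
  where
  build : Σ[ cs ∈ List Cell ] Grown cs × length cs ≡ n × HullArea cs (+ (2 ℕ.* n ℕ.+ k)) →
    ∃[ P ] HasArea (convexHull (union {n} P)) (fromℕ n +ʳ m /2)
  build (cs , (h , v , g) , len , area) = grow⇒polyomino g len ,
    area-resp {convexHull (unionOf cs)} {convexHull (unionOf cs)} {fromℤ (+ (2 ℕ.* n ℕ.+ k)) /2} {fromℕ n +ʳ m /2}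
      id id (defect-≃⁻ n k m m≃k) area

theorem2 : (n : ℕ) → 1 ℕ.≤ n → (m : ℝ) →
    (∃[ P ] HasArea (convexHull (union {n} P)) (fromℕ n +ʳ m /2))
    ⇔
    ((∃[ k ] m ≃ fromℕ k) × 0ℝ ≤ʳ m × m ≤ʳ fromℕ (((n ∸ 1) / 2) ℕ.* (n / 2)) × (Prime (suc n) → ¬ (m ≃ 1ℝ)))
theorem2 n 1≤n m = mk⇔ necessary sufficient
  where
  Admissible : Set
  Admissible = (∃[ k ] m ≃ fromℕ k) × 0ℝ ≤ʳ m × m ≤ʳ fromℕ (maxDefect n) × (Prime (suc n) → ¬ (m ≃ 1ℝ))
  necessary : ∃[ P ] HasArea (convexHull (union {n} P)) (fromℕ n +ʳ m /2) → Admissible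
  necessary (P , area) = admissible (polyomino-defect P 1≤n)
    where
    admissible : Σ[ k ∈ ℕ ] Condition n k × HullArea (cells P) (+ (2 ℕ.* n ℕ.+ k)) → Admissible
    admissible (k , (k≤ , notPrime) , area′) = (k , m≃k) ,
      ≤-transʳ {0ℝ} {fromℕ k} {m} (fromℚ-≤ (0≤ιℕ k)) (≃⇒≤ {fromℕ k} {m} (≃-sym {m} {fromℕ k} m≃k)) ,
      ≤-transʳ {m} {fromℕ k} {fromℕ (maxDefect n)} (≃⇒≤ {m} {fromℕ k} m≃k) (fromℚ-≤ (ι-≤ {+ k} {+ maxDefect n}
        (ℤ.+≤+ k≤))) ,
      λ p m≃1 → notPrime (ℤ.+-injective (ι-injective (fromℚ-≃⁻ {ιℕ k} {1ℚ} (≃-trans {fromℕ k} {m} {1ℝ}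
        (≃-sym {m} {fromℕ k} m≃k) m≃1)))) p
      where
      m≃k : m ≃ fromℕ k
      m≃k = defect-≃ n k m (area-unique {convexHull (union P)} {fromℕ n +ʳ m /2} {fromℤ (+ (2 ℕ.* n ℕ.+ k)) /2}
        area area′)
  sufficient : Admissible → ∃[ P ] HasArea (convexHull (union {n} P)) (fromℕ n +ʳ m /2)
  sufficient ((k , m≃k) , _ , m≤ , notOne) = realize-polyomino {n} {k} m m≃k (realizable n k 1≤n k≤ notPrime)
    where
    k≤ : k ℕ.≤ maxDefect n
    k≤ = ℤ.drop‿+≤+ (ι-≤⁻ {+ k} {+ maxDefect n} (fromℚ-≤⁻ {ιℕ k} {ιℕ (maxDefect n)}
      (≤-transʳ {fromℕ k} {m} {fromℕ (maxDefect n)} (≃⇒≤ {fromℕ k} {m} (≃-sym {m} {fromℕ k} m≃k)) m≤)))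
    notPrime : k ≡ 1 → ¬ Prime (suc n)
    notPrime refl p = notOne p m≃k
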